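{- There is a randomized true-biased Monte-Carlo algorithm which, given integers $r \ge 1$ and $k$ and an $n$-vertex graph $G$ of treewidth $\mathrm{tw}$ together with a tree decomposition of $G$ of width $\mathrm{tw}$, decides in time $O^*\big((2r+2)^{\mathrm{tw}+1}\big)$ whether $G$ has a connected $r$-dominating set of size $k$.
   Context: Graphs are finite, undirected and unweighted. A set $D \subseteq V(G)$ is an $r$-dominating set of $G$ if every vertex of $G$ is at distance (number of edges of a shortest path) at most $r$ from some vertex of $D$; it is a connected $r$-dominating set if moreover the induced subgraph $G[D]$ is connected. "True-biased Monte-Carlo" means: the algorithm never answers "yes" on a no-instance (no false positives), and on a yes-instance it answers "no" with probability at most $1/2$. The notation $O^*$ hides factors polynomial in $n$. Throughout it is assumed that a tree decomposition of $G$ of width $\mathrm{tw}$ (the treewidth of $G$) is given with the input. -}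

module Defs where

open import Data.Bool.Base using (Bool; true; false; if_then_else_; T)
open import Data.Fin.Base using (Fin)
open import Data.Fin.Subset using (Subset; _∈_; ∣_∣)
open import Data.Integer.Base as ℤ using (ℤ; +_; -[1+_])
open import Data.List.Base
  using (List; []; _∷_; _++_; length; map; concatMap; allFin; drop; head)
open import Data.List.Relation.Unary.Unique.Propositional using (Unique)
open import Data.Maybe.Base using (Maybe; just; nothing; fromMaybe)
open import Data.Nat.Base
open import Data.Nat.Properties using (m^n≢0)
open import Data.Product.Base using (∃; _×_)
open import Data.Vec.Base as Vec using (Vec; []; _∷_)
import Data.Vec.Functional as Vector
open import Level using (0ℓ)
open import Relation.Binary.Construct.Closure.ReflexiveTransitive
  using (Star; ε; _◅_)
open import Relation.Binary.Core using (Rel)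
open import Relation.Binary.PropositionalEquality using (_≡_; _≢_)
open import Relation.Nullary using (¬_)
open import Relation.Unary using (Pred)

------------------------------------------------------------------------
-- Graphs

record Graph (n : ℕ) : Set where
  field
    adj    : Fin n → Fin n → Bool
    sym    : ∀ u v → adj u v ≡ adj v u
    irrefl : ∀ u → adj u u ≡ false

  Edge : Rel (Fin n) 0ℓ
  Edge u v = T (adj u v)

open Graph public using (adj; Edge)

module _ {n : ℕ} (G : Graph n) where

  Walk : Rel (Fin n) 0ℓ
  Walk = Star (Edge G)

  vertices : ∀ {u v} → Walk u v → List (Fin n)
  vertices {u} ε       = u ∷ []
  vertices {u} (_ ◅ w) = u ∷ vertices w

  record Path (u v : Fin n) : Set where
    field
      walk   : Walk u v
      simple : Unique (vertices walk)

    edges : ℕ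
    edges = length (vertices walk) ∸ 1

  open Path using (edges)

  IsDistance : Fin n → Fin n → ℕ → Set
  IsDistance u v d =
    (∃ λ (p : Path u v) → edges p ≡ d) × (∀ (p : Path u v) → d ≤ edges p)

  InducedEdge : Pred (Fin n) 0ℓ → Rel (Fin n) 0ℓ
  InducedEdge S u v = S u × S v × Edge G u v

  InducedConnected : Pred (Fin n) 0ℓ → Set
  InducedConnected S = ∀ u v → S u → S v → Star (InducedEdge S) u v

  Connected : Set
  Connected = ∀ u v → Walk u v

  -- A cycle is a path with at least two edges whose ends are adjacent.
  Acyclic : Set
  Acyclic = ∀ u v (p : Path u v) → 2 ≤ edges p → ¬ Edge G v u

  IsTree : Set
  IsTree = 0 < n × Connected × Acyclic

  Dominating : ℕ → Subset n → Set
  Dominating r D =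
    ∀ v → ∃ λ u → u ∈ D × ∃ λ d → IsDistance u v d × d ≤ r

  ConnectedDominating : ℕ → Subset n → Set
  ConnectedDominating r D = Dominating r D × InducedConnected (_∈ D)

  HasConnectedDominatingSet : ℕ → ℤ → Set
  HasConnectedDominatingSet r k =
    ∃ λ (D : Subset n) → ConnectedDominating r D × + ∣ D ∣ ≡ k

------------------------------------------------------------------------
-- Tree decompositions

record TreeDecomposition {n : ℕ} (G : Graph n) : Set where
  field
    nodes        : ℕ
    tree         : Graph nodes
    isTree       : IsTree tree
    bag          : Fin nodes → Subset n
    coversVertex : ∀ v → ∃ λ t → v ∈ bag t
    coversEdge   : ∀ u v → Edge G u v → ∃ λ t → u ∈ bag t × v ∈ bag t
    connected    : ∀ v → InducedConnected tree (λ t → v ∈ bag t)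

  -- Truncated subtraction matters only for the graph without vertices,
  -- which gets width 0.
  width : ℕ
  width = Vector.foldr _⊔_ 0 (λ t → ∣ bag t ∣) ∸ 1

open TreeDecomposition public using (nodes; tree; bag; width)

IsTreewidth : ∀ {n} → Graph n → ℕ → Set
IsTreewidth G tw =
  (∃ λ (𝒯 : TreeDecomposition G) → width 𝒯 ≡ tw) ×
  (∀ (𝒯 : TreeDecomposition G) → tw ≤ width 𝒯)

------------------------------------------------------------------------
-- A randomized word RAM
--
-- Programs are structured: finitely many registers (those mentioned in
-- the program) and an indirectly addressed memory, all holding w-bit
-- words. Every step takes unit time.

Reg : Set
Reg = ℕ

data Op : Set where
  add sub mul quo rem : Op

infix 4 _<ʳ_

data Test : Set where
  _<ʳ_ : Reg → Reg → Test

data Cmd : Set where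
  const  : Reg → ℕ → Cmd
  arith  : Reg → Op → Reg → Reg → Cmd
  load   : (x addr : Reg) → Cmd
  store  : (addr y : Reg) → Cmd
  flip   : Reg → Cmd
  branch : Test → (then else : List Cmd) → Cmd
  while  : Test → List Cmd → Cmd

Program : Set
Program = List Cmd

bit : Bool → ℕ
bit b = if b then 1 else 0

update : (ℕ → ℕ) → ℕ → ℕ → (ℕ → ℕ)
update f x a y = if y ≡ᵇ x then a else f y

record Config : Set where
  constructor ⟨_,_,_⟩
  field
    code : List Cmd
    regs : ℕ → ℕ
    mem  : ℕ → ℕ

module Machine (w : ℕ) where

  wrap : ℕ → ℕ
  wrap a = _%_ a (2 ^ w) {{m^n≢0 2 w}}

  -- sub is truncated at 0; quo and rem by 0 give 0.
  ⟦_⟧ : Op → ℕ → ℕ → ℕ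
  ⟦ add ⟧ a b       = wrap (a + b)
  ⟦ sub ⟧ a b       = a ∸ b
  ⟦ mul ⟧ a b       = wrap (a * b)
  ⟦ quo ⟧ a zero    = 0
  ⟦ quo ⟧ a (suc b) = a / suc b
  ⟦ rem ⟧ a zero    = 0
  ⟦ rem ⟧ a (suc b) = a % suc b

  test : Test → (ℕ → ℕ) → Bool
  test (x <ʳ y) ρ = ρ x <ᵇ ρ y

  -- Each step is supplied with a fresh random bit, which only flip reads.
  step : Bool → Config → Config
  step b ⟨ [] , ρ , m ⟩               = ⟨ [] , ρ , m ⟩
  step b ⟨ const x a ∷ κ , ρ , m ⟩     = ⟨ κ , update ρ x (wrap a) , m ⟩
  step b ⟨ arith x o y z ∷ κ , ρ , m ⟩ = ⟨ κ , update ρ x (⟦ o ⟧ (ρ y) (ρ z)) , m ⟩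
  step b ⟨ load x y ∷ κ , ρ , m ⟩      = ⟨ κ , update ρ x (m (ρ y)) , m ⟩
  step b ⟨ store x y ∷ κ , ρ , m ⟩     = ⟨ κ , ρ , update m (ρ x) (ρ y) ⟩
  step b ⟨ flip x ∷ κ , ρ , m ⟩        = ⟨ κ , update ρ x (wrap (bit b)) , m ⟩
  step b ⟨ branch c p q ∷ κ , ρ , m ⟩  = ⟨ (if test c ρ then p else q) ++ κ , ρ , m ⟩
  step b ⟨ while c p ∷ κ , ρ , m ⟩     =
    ⟨ (if test c ρ then p ++ while c p ∷ κ else κ) , ρ , m ⟩

  steps : ∀ {t} → Vec Bool t → Config → Config
  steps []      σ = σ
  steps (b ∷ ω) σ = steps ω (step b σ)

  -- The input list occupies memory cells 0, 1, 2, …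
  initial : Program → List ℕ → Config
  initial P input = ⟨ P , (λ _ → 0) , (λ a → fromMaybe 0 (head (drop a input))) ⟩

  -- The answer is in register 0 (nonzero for "yes"); nothing: still running.
  answer : Config → Maybe Bool
  answer ⟨ []    , ρ , m ⟩ = just (0 <ᵇ ρ 0)
  answer ⟨ _ ∷ _ , ρ , m ⟩ = nothing

  run : Program → List ℕ → ∀ {t} → Vec Bool t → Maybe Bool
  run P input ω = answer (steps ω (initial P input))

-- Number of sequences of t coin tosses with a given property; divided by
-- 2 ^ t this is the probability of the property.
count : ∀ t → (Vec Bool t → Bool) → ℕ
count zero    p = bit (p [])
count (suc t) p =
  count t (λ ω → p (false ∷ ω)) + count t (λ ω → p (true ∷ ω))

saysNo : Maybe Bool → Bool
saysNo (just false) = true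
saysNo _            = false

-- P, on words of w bits, is a true-biased Monte-Carlo algorithm for the
-- question Q on the given input, with worst-case running time at most t.
record TrueBiasedMonteCarlo
  (P : Program) (w : ℕ) (input : List ℕ) (t : ℕ) (Q : Set) : Set where
  open Machine w
  field
    halts           : ∀ (ω : Vec Bool t) → ∃ λ b → run P input ω ≡ just b
    noFalsePositive : ¬ Q → ∀ (ω : Vec Bool t) → run P input ω ≢ just true
    falseNegative   : Q → 2 * count t (λ ω → saysNo (run P input ω)) ≤ 2 ^ t

------------------------------------------------------------------------
-- Inputs and resource bounds

matrix : ∀ {m n} → (Fin m → Fin n → Bool) → List ℕ
matrix f = concatMap (λ i → map (λ j → bit (f i j)) (allFin _)) (allFin _)

encodeℤ : ℤ → List ℕ
encodeℤ (+ a)    = 0 ∷ a ∷ []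
encodeℤ -[1+ a ] = 1 ∷ suc a ∷ []

encode : ∀ {n} (G : Graph n) → TreeDecomposition G → ℕ → ℤ → List ℕ
encode {n} G 𝒯 r k =
  n ∷ nodes 𝒯 ∷ r ∷ encodeℤ k ++
  matrix (adj G) ++ matrix (adj (tree 𝒯)) ++ matrix (λ t v → Vec.lookup (bag 𝒯 t) v)

-- O*((2r+2)^(tw+1)). Since the decomposition is part of the input and may
-- have arbitrarily many nodes, all of which may have to be read, the hidden
-- factor is polynomial in n + nodes; for decompositions with polynomially
-- many nodes, as is tacitly assumed with this notation, that is polynomial
-- in n.
timeBound : (C n N r tw : ℕ) → ℕ
timeBound C n N r tw = C * (n + N) ^ C * (2 * r + 2) ^ (tw + 1)

-- The usual word-RAM assumption: a word can hold the integer k and numbers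
-- up to the time bound (hence r, n and the addresses of all cells needed).
WordsSuffice : (w t : ℕ) → ℤ → Set
WordsSuffice w t k = t < 2 ^ w × ℤ.∣ k ∣ < 2 ^ w

{-# OPTIONS --safe #-}

-- Cut & Count with distance labels.  Every vertex gets a label at most r, and
-- the vertices of label 0 form the candidate D.  Labels that change by at most
-- 1 along edges, and such that every nonzero label has a neighbour with the
-- label below it, are the distances to D.  The second condition is counted by
-- inclusion and exclusion with one bit per vertex outside D, while a vertex of
-- D has one bit for its side of a cut of G[D] crossed by no edge: 2 (r + 1)
-- states in all.  If G[D] has c components there are 2 ^ c such cuts, so
-- modulo 4 the contribution of D vanishes if and only if c ≥ 2.
--
-- Let v have weight 1 + (n + 1) x v for random x v < 2 ^ m with 2 n ≤ 2 ^ m;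
-- the weight of D then determines |D| modulo n + 1.  Contributions of distinct
-- sets of the same weight might cancel, but for each v at most one value of
-- x v lets the generating function of the sets with v cancel that of the sets
-- without v, so with probability at least 1/2 the count for some weight
-- survives as soon as one set contributes.
--
-- The generating functions are computed by eliminating the vertices along the
-- tree decomposition, with a table indexed by the states of each bag.  The
-- program is compiled from a language in which static exponents a ≤ 100 and
-- p ≤ 1 bound every value and running time by X ^ a * Q ^ p, for
-- X = n + N + 8 and Q the size of a table.  This one analysis yields both the
-- time bound and the absence of overflow.
module Submission where

open import Defs
open import Algebra.Bundles using (CommutativeSemiring)
open import Data.Bool.Base using (Bool; true; false; if_then_else_; T; not; _∧_; _∨_)
open import Data.Bool.Properties using (T-≡; T-∨; ∧-zeroʳ)
open import Data.Empty using (⊥-elim)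
open import Data.Fin.Base as Fin using (Fin; toℕ; fromℕ<)
import Data.Fin.Properties as Fin
open import Data.Fin.Subset using (Subset; _∈_; ∣_∣)
open import Data.Integer.Base as ℤ using (ℤ; -[1+_])
open import Data.List.Base as List using (List; []; _∷_; _++_; length; map; concatMap; allFin; drop; head; tabulate)
import Data.List.Properties as List
open import Data.List.Membership.Propositional using () renaming (_∈_ to _∈ˡ_)
open import Data.List.Relation.Unary.All as All using (All; []; _∷_)
open import Data.List.Relation.Unary.AllPairs using ([]; _∷_)
open import Data.List.Relation.Unary.Any using (here; there)
open import Data.List.Relation.Unary.Unique.Propositional using (Unique)
open import Data.Maybe.Base using (just; fromMaybe)
open import Data.Maybe.Properties using (just-injective)
open import Data.Nat.Base
open import Data.Nat.DivMod
open import Data.Nat.Induction using (<-rec; <-wellFounded)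
open import Data.Nat.Properties
open import Data.Nat.Solver using (module +-*-Solver)
open +-*-Solver using (solve; _:=_; _:+_; _:*_; con)
open import Data.Product.Base using (∃; ∃₂; _×_; _,_; proj₁; proj₂; map₂; Σ-syntax)
open import Data.Sum.Base using (_⊎_; inj₁; inj₂; [_,_]′)
open import Data.Unit.Base using (⊤; tt)
open import Data.Vec.Base as Vec using (Vec; []; _∷_)
import Data.Vec.Properties as VecP
import Data.Vec.Functional as Vector
open import Function.Base using (_∘_; id; case_of_)
open import Function.Bundles using (Equivalence)
open import Induction.WellFounded using (Acc; acc)
open import Level using (0ℓ)
open import Relation.Binary.Construct.Closure.ReflexiveTransitive using (Star; ε; _◅_; _◅◅_)
open import Relation.Binary.PropositionalEquality
open import Relation.Binary.Definitions using (tri<; tri≈; tri>)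
open import Relation.Nullary using (¬_; Dec; yes; no; ¬¬-excluded-middle)
open import Relation.Nullary.Decidable using (¬?; _×-dec_)

module Sums {c ℓ} (R : CommutativeSemiring c ℓ) where
  open CommutativeSemiring R using (_≈_; 0#; 1#; reflexive)
    renaming (Carrier to A; _+_ to infixl 6 _⊕_; _*_ to infixl 7 _⊗_; refl to ≈-refl; sym to ≈-sym; trans to ≈-trans;
              +-cong to ⊕-cong; +-congʳ to ⊕-congʳ; +-comm to ⊕-comm; +-assoc to ⊕-assoc;
              +-identityˡ to ⊕-identityˡ; +-identityʳ to ⊕-identityʳ; *-cong to ⊗-cong; *-congʳ to ⊗-congʳ;
              *-identityˡ to ⊗-identityˡ; *-identityʳ to ⊗-identityʳ; zeroʳ to ⊗-zeroʳ; distribˡ to ⊗-distribˡ)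
  open import Algebra.Properties.CommutativeSemigroup (CommutativeSemiring.+-commutativeSemigroup R)
    using () renaming (interchange to ⊕-interchange)
  open import Algebra.Properties.CommutativeSemigroup (CommutativeSemiring.*-commutativeSemigroup R)
    using () renaming (interchange to ⊗-interchange)

  Sum : ℕ → (ℕ → A) → A
  Sum zero    f = 0#
  Sum (suc n) f = Sum n f ⊕ f n

  Prod : ℕ → (ℕ → A) → A
  Prod zero    f = 1#
  Prod (suc n) f = Prod n f ⊗ f n

  Sum-cong : ∀ n {f g} → (∀ i → i < n → f i ≈ g i) → Sum n f ≈ Sum n g
  Sum-cong zero    h = ≈-refl
  Sum-cong (suc n) h = ⊕-cong (Sum-cong n λ i i<n → h i (m<n⇒m<1+n i<n)) (h n ≤-refl)

  Prod-cong : ∀ n {f g} → (∀ i → i < n → f i ≈ g i) → Prod n f ≈ Prod n g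
  Prod-cong zero    h = ≈-refl
  Prod-cong (suc n) h = ⊗-cong (Prod-cong n λ i i<n → h i (m<n⇒m<1+n i<n)) (h n ≤-refl)

  Sum-0 : ∀ n {f} → (∀ i → i < n → f i ≈ 0#) → Sum n f ≈ 0#
  Sum-0 zero    h = ≈-refl
  Sum-0 (suc n) h = ≈-trans (⊕-cong (Sum-0 n λ i i<n → h i (m<n⇒m<1+n i<n)) (h n ≤-refl)) (⊕-identityˡ 0#)

  Prod-1 : ∀ n {f} → (∀ i → i < n → f i ≈ 1#) → Prod n f ≈ 1#
  Prod-1 zero    h = ≈-refl
  Prod-1 (suc n) h = ≈-trans (⊗-cong (Prod-1 n λ i i<n → h i (m<n⇒m<1+n i<n)) (h n ≤-refl)) (⊗-identityˡ 1#)

  Sum-+ : ∀ n f g → Sum n (λ i → f i ⊕ g i) ≈ Sum n f ⊕ Sum n g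
  Sum-+ zero    f g = ≈-sym (⊕-identityˡ 0#)
  Sum-+ (suc n) f g = ≈-trans (⊕-congʳ (Sum-+ n f g)) (⊕-interchange _ _ _ _)

  Sum-*ˡ : ∀ n x f → Sum n (λ i → x ⊗ f i) ≈ x ⊗ Sum n f
  Sum-*ˡ zero    x f = ≈-sym (⊗-zeroʳ x)
  Sum-*ˡ (suc n) x f = ≈-trans (⊕-congʳ (Sum-*ˡ n x f)) (≈-sym (⊗-distribˡ x _ _))

  Sum-swap : ∀ m n (f : ℕ → ℕ → A) →
    Sum m (λ i → Sum n (f i)) ≈ Sum n (λ j → Sum m (λ i → f i j))
  Sum-swap zero    n f = ≈-sym (Sum-0 n λ _ _ → ≈-refl)
  Sum-swap (suc m) n f = ≈-trans (⊕-congʳ (Sum-swap m n f)) (≈-sym (Sum-+ n _ (f m)))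

  Sum-shift : ∀ n f → Sum (suc n) f ≈ f 0 ⊕ Sum n (f ∘ suc)
  Sum-shift zero    f = ⊕-comm 0# (f 0)
  Sum-shift (suc n) f = ≈-trans (⊕-congʳ (Sum-shift n f)) (⊕-assoc _ _ _)

  Sum-single : ∀ n {f} k → k < n → (∀ i → i < n → i ≢ k → f i ≈ 0#) → Sum n f ≈ f k
  Sum-single (suc n) {f} k k<n h with k ≟ n
  ... | yes refl = ≈-trans (⊕-congʳ (Sum-0 n λ i i<n → h i (m<n⇒m<1+n i<n) (<⇒≢ i<n))) (⊕-identityˡ _)
  ... | no  k≢n  = ≈-trans (⊕-cong (Sum-single n k (≤∧≢⇒< (s≤s⁻¹ k<n) k≢n) λ i i<n → h i (m<n⇒m<1+n i<n))
                                   (h n ≤-refl (k≢n ∘ sym))) (⊕-identityʳ _)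

  Prod-* : ∀ n f g → Prod n (λ i → f i ⊗ g i) ≈ Prod n f ⊗ Prod n g
  Prod-* zero    f g = ≈-sym (⊗-identityˡ 1#)
  Prod-* (suc n) f g = ≈-trans (⊗-congʳ (Prod-* n f g)) (⊗-interchange _ _ _ _)

  Prod-single : ∀ n {f} k → k < n → (∀ i → i < n → i ≢ k → f i ≈ 1#) → Prod n f ≈ f k
  Prod-single (suc n) {f} k k<n h with k ≟ n
  ... | yes refl = ≈-trans (⊗-congʳ (Prod-1 n λ i i<n → h i (m<n⇒m<1+n i<n) (<⇒≢ i<n))) (⊗-identityˡ _)
  ... | no  k≢n  = ≈-trans (⊗-cong (Prod-single n k (≤∧≢⇒< (s≤s⁻¹ k<n) k≢n) λ i i<n → h i (m<n⇒m<1+n i<n))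
                                   (h n ≤-refl (k≢n ∘ sym))) (⊗-identityʳ _)

  only : ℕ → A → ℕ → A
  only k x i = if i ≡ᵇ k then x else 1#

  without : ℕ → (ℕ → A) → ℕ → A
  without k f i = if i ≡ᵇ k then 1# else f i

  Prod-extract : ∀ n f k → k < n → Prod n f ≈ f k ⊗ Prod n (without k f)
  Prod-extract n f k k<n = ≈-trans (Prod-cong n split) (≈-trans (Prod-* n _ _) (⊗-congʳ one))
    where
    split : ∀ i → i < n → f i ≈ only k (f k) i ⊗ without k f i
    split i _ with i ≡ᵇ k in eq
    ... | true  = ≈-trans (reflexive (cong f (≡ᵇ⇒≡ i k (subst T (sym eq) tt)))) (≈-sym (⊗-identityʳ _))
    ... | false = ≈-sym (⊗-identityˡ _)
    one : Prod n (only k (f k)) ≈ f k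
    one = ≈-trans (Prod-single n k k<n other) (reflexive (self (f k)))
      where
      self : ∀ x → only k x k ≡ x
      self x with k ≡ᵇ k in eq
      ... | true  = refl
      ... | false = ⊥-elim (subst T eq (≡⇒≡ᵇ k k refl))
      other : ∀ i → i < n → i ≢ k → only k (f k) i ≈ 1#
      other i _ i≢k with i ≡ᵇ k in eq
      ... | true  = ⊥-elim (i≢k (≡ᵇ⇒≡ i k (subst T (sym eq) tt)))
      ... | false = ≈-refl

open module Sumℕ = Sums +-*-commutativeSemiring public

update-same : ∀ f x a → update f x a x ≡ a
update-same f x a with x ≡ᵇ x in eq
... | true  = refl
... | false = ⊥-elim (subst T eq (≡⇒≡ᵇ x x refl))

update-other : ∀ f {x} a {y} → y ≢ x → update f x a y ≡ f y
update-other f {x} a {y} y≢x with y ≡ᵇ x in eq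
... | true  = ⊥-elim (y≢x (≡ᵇ⇒≡ y x (subst T (sym eq) tt)))
... | false = refl

opaque
  rV rT : ℕ → Reg
  rV x = suc (x + x)
  rT k = k + k

  rT≢rV : ∀ k x → rT k ≢ rV x
  rT≢rV (suc k) zero    eq = case trans (sym (+-suc k k)) (suc-injective eq) of λ ()
  rT≢rV (suc k) (suc x) eq =
    rT≢rV k x (suc-injective (trans (sym (+-suc k k)) (trans (suc-injective eq) (cong suc (+-suc x x)))))

  rT-inj : ∀ {j k} → rT j ≡ rT k → j ≡ k
  rT-inj {j} {k} eq = *-cancelˡ-≡ j k 2 (trans (cong (j +_) (+-identityʳ j)) (trans eq (cong (k +_) (sym (+-identityʳ k)))))

  rT0 : rT 0 ≡ 0
  rT0 = refl

  rV-inj : ∀ {x y} → rV x ≡ rV y → x ≡ y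
  rV-inj eq = rT-inj (suc-injective eq)

apart : ∀ a b {k} → a ≢ b → rT (a + k) ≢ rT (b + k)
apart a b {k} a≢b eq = a≢b (+-cancelʳ-≡ k a b (rT-inj eq))

below : ∀ a {j k} → j < k → rT j ≢ rT (a + k)
below a {j} {k} j<k eq = <⇒≢ (<-≤-trans j<k (m≤n+m k a)) (rT-inj eq)

data Expr : Set where
  var : ℕ → Expr
  lit : ℕ → Expr
  inp : Expr → Expr
  rd  : ℕ → Expr → Expr
  op  : Op → Expr → Expr → Expr
  lt  : Expr → Expr → Expr
  sum : ℕ → Expr → Expr → Expr

data Com : Set where
  store : ℕ → Expr → Expr → Com
  for   : ℕ → Expr → Com → Com
  _⨾_   : Com → Com → Com
infixr 4 _⨾_

infixl 7 _/₀_ _%₀_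
_/₀_ _%₀_ : ℕ → ℕ → ℕ
a /₀ zero  = 0
a /₀ suc b = a / suc b
a %₀ zero  = 0
a %₀ suc b = a % suc b

opv : Op → ℕ → ℕ → ℕ
opv add = _+_
opv sub = _∸_
opv mul = _*_
opv quo = _/₀_
opv rem = _%₀_

Env Arrays : Set
Env    = ℕ → ℕ
Arrays = ℕ → ℕ → ℕ

set : Arrays → ℕ → ℕ → ℕ → Arrays
set 𝓐 A i v B = if B ≡ᵇ A then update (𝓐 A) i v else 𝓐 B

iter : ∀ {a} {S : Set a} → ℕ → (ℕ → S → S) → S → S
iter zero    f s = s
iter (suc n) f s = f n (iter n f s)

module Semantics (input : ℕ → ℕ) where

  ev : Expr → Env → Arrays → ℕ
  ev (var x)     σ 𝓐 = σ x
  ev (lit c)     σ 𝓐 = c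
  ev (inp e)     σ 𝓐 = input (ev e σ 𝓐)
  ev (rd A e)    σ 𝓐 = 𝓐 A (ev e σ 𝓐)
  ev (op o a b)  σ 𝓐 = opv o (ev a σ 𝓐) (ev b σ 𝓐)
  ev (lt a b)    σ 𝓐 = bit (ev a σ 𝓐 <ᵇ ev b σ 𝓐)
  ev (sum x b e) σ 𝓐 = Sum (ev b σ 𝓐) (λ i → ev e (update σ x i) 𝓐)

  exec : Com → Env → Arrays → Arrays
  exec (store A i e) σ 𝓐 = set 𝓐 A (ev i σ 𝓐) (ev e σ 𝓐)
  exec (for x b c)   σ 𝓐 = iter (ev b σ 𝓐) (λ i → exec c (update σ x i)) 𝓐
  exec (c ⨾ d)       σ 𝓐 = exec d σ (exec c σ 𝓐)

-- Variables 0, 1, 2, 3 hold the size parameter, the input length, 0 and 1;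
-- the arrays are interleaved behind the input.

arrays : ℕ
arrays = 8

cell : ℕ → ℕ → ℕ → ℕ
cell L A i = L + (arrays * i + A)

Code : Set
Code = ℕ → List Cmd

codeOp : Op → Code → Code → Code
codeOp o c d k = c k ++ d (suc k) ++ arith (rT k) o (rT k) (rT (suc k)) ∷ []

codeVar codeLit : ℕ → Code
codeVar x k = arith (rT k) add (rV x) (rV 2) ∷ []
codeLit c k = const (rT k) c ∷ []

codeCell : ℕ → Code → Code
codeCell A c = codeOp add (codeVar 1) (codeOp add (codeOp mul (codeLit arrays) c) (codeLit A))

codeLoop : ℕ → ℕ → List Cmd → List Cmd
codeLoop x k body =
  arith (rT (1 + k)) add (rV 2) (rV 2) ∷
  arith (rT (2 + k)) add (rV x) (rV 2) ∷
  while (rT (1 + k) <ʳ rT k)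
    (arith (rV x) add (rT (1 + k)) (rV 2) ∷ body ++
     arith (rT (1 + k)) add (rT (1 + k)) (rV 3) ∷ []) ∷
  arith (rV x) add (rT (2 + k)) (rV 2) ∷ []

setBit : Bool → Code
setBit b k = arith (rT k) add (rV (if b then 3 else 2)) (rV 2) ∷ []

comparison : Code
comparison k = branch (rT k <ʳ rT (suc k)) (setBit true k) (setBit false k) ∷ []

fetch : Code
fetch k = branch (rT k <ʳ rV 1)
  (load (rT k) (rT k) ∷ arith (rT (1 + k)) sub (rT k) (rV 0) ∷ arith (rT k) sub (rT k) (rT (1 + k)) ∷ [])
  (const (rT k) 0 ∷ []) ∷ []

code : Expr → Code
code (var x)     k = codeVar x k
code (lit c)     k = codeLit c k
code (inp e)     k = code e k ++ fetch k
code (rd A e)    k = codeCell A (code e) k ++ load (rT k) (rT k) ∷ []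
code (op o a b)  k = codeOp o (code a) (code b) k
code (lt a b)    k = code a k ++ code b (suc k) ++ comparison k
code (sum x b e) k = code b k ++ arith (rT (3 + k)) add (rV 2) (rV 2) ∷
  codeLoop x k (code e (4 + k) ++ arith (rT (3 + k)) add (rT (3 + k)) (rT (4 + k)) ∷ []) ++
  arith (rT k) add (rT (3 + k)) (rV 2) ∷ []

codeC : Com → Code
codeC (store A i e) k = codeCell A (code i) k ++ code e (suc k) ++ store (rT k) (rT (suc k)) ∷ []
codeC (for x b c)   k = code b k ++ codeLoop x k (codeC c (3 + k))
codeC (c ⨾ d)       k = codeC c k ++ codeC d k

-- Static bounds

Deg : Set
Deg = ℕ × ℕ

infixl 6 _⊞_
infixl 7 _⊠_
_⊞_ _⊠_ : Deg → Deg → Deg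
(a , p) ⊞ (b , r) = suc (a ⊔ b) , p ⊔ r
(a , p) ⊠ (b , r) = a + b , p + r

litD : ℕ → Deg
litD c = c , 0

opD : Op → Deg → Deg → Deg
opD add d e = d ⊞ e
opD sub d e = d
opD mul d e = d ⊠ e
opD quo d e = d
opD rem d e = e

updateD : (ℕ → Deg) → ℕ → Deg → ℕ → Deg
updateD Δ x d y = if y ≡ᵇ x then d else Δ y

-- Bounds X^a Q^p on the values of an expression, on the contents of the
-- arrays, and on running times, represented by their exponents (a , p).
module Degrees (Γ : ℕ → Deg) (D : ℕ) where

  deg : (ℕ → Deg) → Expr → Deg
  deg Δ (var x)     = Δ x
  deg Δ (lit c)     = litD c
  deg Δ (inp e)     = 1 , 0
  deg Δ (rd A e)    = Γ A
  deg Δ (op o a b)  = opD o (deg Δ a) (deg Δ b)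
  deg Δ (lt a b)    = 0 , 0
  deg Δ (sum x b e) = deg Δ b ⊠ deg (updateD Δ x (deg Δ b)) e

  fits : Deg → Bool
  fits (a , p) = (a ≤ᵇ D) ∧ (p ≤ᵇ 1)

  cellD : ℕ → Deg → Deg
  cellD A d = (3 , 0) ⊞ (litD arrays ⊠ d ⊞ litD A)

  ok : (ℕ → Deg) → Expr → Bool
  ok Δ (var x)     = true
  ok Δ (lit c)     = fits (litD c)
  ok Δ (inp e)     = ok Δ e
  ok Δ (rd A e)    = ok Δ e ∧ fits (cellD A (deg Δ e)) ∧ (A <ᵇ arrays)
  ok Δ (op o a b)  = ok Δ a ∧ ok Δ b ∧ fits (opD o (deg Δ a) (deg Δ b))
  ok Δ (lt a b)    = ok Δ a ∧ ok Δ b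
  ok Δ (sum x b e) = ok Δ b ∧ ok (updateD Δ x (deg Δ b)) e ∧ (3 <ᵇ x) ∧
    fits (deg Δ b) ∧ fits (deg Δ b ⊠ deg (updateD Δ x (deg Δ b)) e)

  okC : (ℕ → Deg) → Com → Bool
  okC Δ (store A i e) = ok Δ i ∧ ok Δ e ∧ fits (cellD A (deg Δ i)) ∧ (A <ᵇ arrays)
  okC Δ (for x b c)   = ok Δ b ∧ okC (updateD Δ x (deg Δ b)) c ∧ (3 <ᵇ x) ∧ fits (deg Δ b)
  okC Δ (c ⨾ d)       = okC Δ c ∧ okC Δ d

  loopD : Deg → Deg → Deg
  loopD b c = litD 4 ⊞ b ⊠ (c ⊞ litD 3)

  cost : (ℕ → Deg) → Expr → Deg
  cost Δ (var x)     = litD 1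
  cost Δ (lit c)     = litD 1
  cost Δ (inp e)     = cost Δ e ⊞ litD 4
  cost Δ (rd A e)    = litD 8 ⊞ cost Δ e
  cost Δ (op o a b)  = cost Δ a ⊞ (cost Δ b ⊞ litD 1)
  cost Δ (lt a b)    = cost Δ a ⊞ (cost Δ b ⊞ litD 2)
  cost Δ (sum x b e) = cost Δ b ⊞ (litD 2 ⊞ loopD (deg Δ b) (cost (updateD Δ x (deg Δ b)) e ⊞ litD 1))

  costC : (ℕ → Deg) → Com → Deg
  costC Δ (store A i e) = litD 8 ⊞ (cost Δ i ⊞ cost Δ e)
  costC Δ (for x b c)   = cost Δ b ⊞ loopD (deg Δ b) (costC (updateD Δ x (deg Δ b)) c)
  costC Δ (c ⨾ d)       = costC Δ c ⊞ costC Δ d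

∧-T : ∀ a {b} → T (a ∧ b) → T a × T b
∧-T true h = tt , h

∧-T₃ : ∀ a b {c} → T (a ∧ b ∧ c) → T a × T b × T c
∧-T₃ true b h = tt , ∧-T b h

∧-T₄ : ∀ a b c {d} → T (a ∧ b ∧ c ∧ d) → T a × T b × T c × T d
∧-T₄ true b c h = tt , ∧-T₃ b c h

∧-T₅ : ∀ a b c d {e} → T (a ∧ b ∧ c ∧ d ∧ e) → T a × T b × T c × T d × T e
∧-T₅ true b c d h = tt , ∧-T₄ b c d h

bit≤1 : ∀ b → bit b ≤ 1
bit≤1 false = z≤n
bit≤1 true  = ≤-refl

n≤2^n : ∀ n → n ≤ 2 ^ n
n≤2^n zero    = z≤n
n≤2^n (suc n) = ≤-trans (+-mono-≤ (m^n>0 2 n) (n≤2^n n)) (+-monoʳ-≤ (2 ^ n) (≤-reflexive (sym (+-identityʳ _))))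

module Bounds (X Q : ℕ) (2≤X : 2 ≤ X) (1≤Q : 1 ≤ Q) where

  private instance
    X≢0 : NonZero X
    X≢0 = >-nonZero (<-trans z<s 2≤X)
    Q≢0 : NonZero Q
    Q≢0 = >-nonZero 1≤Q

  𝔹 : Deg → ℕ
  𝔹 (a , p) = X ^ a * Q ^ p

  𝔹-mono : ∀ {a b p r} → a ≤ b → p ≤ r → 𝔹 (a , p) ≤ 𝔹 (b , r)
  𝔹-mono a≤b p≤r = *-mono-≤ (^-monoʳ-≤ X a≤b) (^-monoʳ-≤ Q p≤r)

  𝔹-⊞ : ∀ {x y} d e → x ≤ 𝔹 d → y ≤ 𝔹 e → x + y ≤ 𝔹 (d ⊞ e)
  𝔹-⊞ {x} {y} (a , p) (b , r) x≤ y≤ = begin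
    x + y                       ≤⟨ +-mono-≤ (≤-trans x≤ (𝔹-mono (m≤m⊔n a b) (m≤m⊔n p r)))
                                            (≤-trans y≤ (𝔹-mono (m≤n⊔m a b) (m≤n⊔m p r))) ⟩
    M + M                       ≡⟨ cong (M +_) (+-identityʳ M) ⟨
    2 * M                       ≤⟨ *-monoˡ-≤ M 2≤X ⟩
    X * M                       ≡⟨ *-assoc X _ _ ⟨
    𝔹 (suc (a ⊔ b) , p ⊔ r)     ∎
    where open ≤-Reasoning ; M = 𝔹 (a ⊔ b , p ⊔ r)

  𝔹-⊠ : ∀ {x y} d e → x ≤ 𝔹 d → y ≤ 𝔹 e → x * y ≤ 𝔹 (d ⊠ e)
  𝔹-⊠ {x} {y} (a , p) (b , r) x≤ y≤ = begin
    x * y                               ≤⟨ *-mono-≤ x≤ y≤ ⟩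
    X ^ a * Q ^ p * (X ^ b * Q ^ r)     ≡⟨ [m*n]*[o*p]≡[m*o]*[n*p] (X ^ a) _ _ _ ⟩
    X ^ a * X ^ b * (Q ^ p * Q ^ r)     ≡⟨ cong₂ _*_ (^-distribˡ-+-* X a b) (^-distribˡ-+-* Q p r) ⟨
    𝔹 (a + b , p + r)                   ∎
    where open ≤-Reasoning

  𝔹-lit : ∀ c → c ≤ 𝔹 (litD c)
  𝔹-lit c = ≤-trans (≤-trans (n≤2^n c) (^-monoˡ-≤ c 2≤X)) (≤-reflexive (sym (*-identityʳ _)))

  Sum-bound : ∀ n {f M} → (∀ i → i < n → f i ≤ M) → Sum n f ≤ n * M
  Sum-bound zero        h = z≤n
  Sum-bound (suc n) {f} {M} h = ≤-trans (+-mono-≤ (Sum-bound n λ i i<n → h i (m<n⇒m<1+n i<n)) (h n ≤-refl))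
                                  (≤-reflexive (+-comm (n * M) M))

  /₀-≤ : ∀ a b → a /₀ b ≤ a
  /₀-≤ a zero    = z≤n
  /₀-≤ a (suc b) = m/n≤m a (suc b)

  %₀-≤ : ∀ a b → a %₀ b ≤ b
  %₀-≤ a zero    = z≤n
  %₀-≤ a (suc b) = <⇒≤ (m%n<n a (suc b))

  opv-bound : ∀ o {x y} d e → x ≤ 𝔹 d → y ≤ 𝔹 e → opv o x y ≤ 𝔹 (opD o d e)
  opv-bound add d e p q = 𝔹-⊞ d e p q
  opv-bound sub {x} {y} d e p q = ≤-trans (m∸n≤m x y) p
  opv-bound mul d e p q = 𝔹-⊠ d e p q
  opv-bound quo {x} {y} d e p q = ≤-trans (/₀-≤ x y) p
  opv-bound rem {x} {y} d e p q = ≤-trans (%₀-≤ x y) q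

  Bounded : (ℕ → Deg) → Env → Set
  Bounded Δ σ = ∀ x → σ x ≤ 𝔹 (Δ x)

  Bounded-update : ∀ {Δ σ} x {i d} → Bounded Δ σ → i ≤ 𝔹 d → Bounded (updateD Δ x d) (update σ x i)
  Bounded-update x h i≤ y with y ≡ᵇ x
  ... | true  = i≤
  ... | false = h y

  module _ (Γ : ℕ → Deg) (D : ℕ) (input : ℕ → ℕ) (input≤X : ∀ i → input i ≤ X) where
    open Degrees Γ D
    open Semantics input

    BoundedA : Arrays → Set
    BoundedA 𝓐 = ∀ A i → 𝓐 A i ≤ 𝔹 (Γ A)

    ev-bound : ∀ e {Δ σ 𝓐} → Bounded Δ σ → BoundedA 𝓐 → ev e σ 𝓐 ≤ 𝔹 (deg Δ e)
    ev-bound (var x)     hσ h𝓐 = hσ x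
    ev-bound (lit c)     hσ h𝓐 = 𝔹-lit c
    ev-bound (inp e)     hσ h𝓐 = ≤-trans (input≤X _) (≤-reflexive (sym (trans (*-identityʳ _) (*-identityʳ X))))
    ev-bound (rd A e)    hσ h𝓐 = h𝓐 A _
    ev-bound (op o a b)  {Δ} hσ h𝓐 = opv-bound o (deg Δ a) (deg Δ b) (ev-bound a hσ h𝓐) (ev-bound b hσ h𝓐)
    ev-bound (lt a b) {Δ} {σ} {𝓐} hσ h𝓐 = bit≤1 (ev a σ 𝓐 <ᵇ ev b σ 𝓐)
    ev-bound (sum x b e) {Δ} hσ h𝓐 = ≤-trans
      (Sum-bound _ λ i i< → ev-bound e (Bounded-update x hσ (≤-trans (<⇒≤ i<) (ev-bound b hσ h𝓐))) h𝓐)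
      (𝔹-⊠ (deg Δ b) (deg _ e) (ev-bound b hσ h𝓐) ≤-refl)

    Valid : Com → Env → Arrays → Set
    Valid (store A i e) σ 𝓐 = ev e σ 𝓐 ≤ 𝔹 (Γ A)
    Valid (for x b c)   σ 𝓐 = ∀ i → i < ev b σ 𝓐 → Valid c (update σ x i) (iter i (λ i → exec c (update σ x i)) 𝓐)
    Valid (c ⨾ d)       σ 𝓐 = Valid c σ 𝓐 × Valid d σ (exec c σ 𝓐)

    set-bound : ∀ {𝓐} A i v → BoundedA 𝓐 → v ≤ 𝔹 (Γ A) → BoundedA (set 𝓐 A i v)
    set-bound A i v h v≤ B j with B ≡ᵇ A in eq
    ... | false = h B j
    ... | true with j ≡ᵇ i
    ...   | true  = subst (λ B → v ≤ 𝔹 (Γ B)) (sym (≡ᵇ⇒≡ B A (subst T (sym eq) tt))) v≤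
    ...   | false = subst (λ C → _ ≤ 𝔹 (Γ C)) (sym (≡ᵇ⇒≡ B A (subst T (sym eq) tt))) (h A j)

    exec-bound : ∀ c {σ 𝓐} → Valid c σ 𝓐 → BoundedA 𝓐 → BoundedA (exec c σ 𝓐)
    exec-bound (store A i e) v h = set-bound A _ _ h v
    exec-bound (for x b c) {σ} {𝓐} v h = go _ v
      where
      go : ∀ n → (∀ i → i < n → Valid c (update σ x i) (iter i (λ i → exec c (update σ x i)) 𝓐)) →
           BoundedA (iter n (λ i → exec c (update σ x i)) 𝓐)
      go zero    v = h
      go (suc n) v = exec-bound c (v n ≤-refl) (go n λ i i<n → v i (m<n⇒m<1+n i<n))
    exec-bound (c ⨾ d) (v , v′) h = exec-bound d v′ (exec-bound c v h)

    -- Valid computes to a huge type on a large command; the record is compared by its indices instead.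
    record Admissible (c : Com) (σ : Env) (𝓐 : Arrays) : Set where
      constructor admissible
      field valid : Valid c σ 𝓐

    admissible-⨾ : ∀ {c d σ 𝓐} → Admissible c σ 𝓐 → Admissible d σ (exec c σ 𝓐) → Admissible (c ⨾ d) σ 𝓐
    admissible-⨾ (admissible v) (admissible v′) = admissible (v , v′)

module Runs (w : ℕ) where
  open Machine w

  data _⟶[_]_ : Config → ℕ → Config → Set where
    done   : ∀ {σ} → σ ⟶[ 0 ] σ
    _then_ : ∀ {σ σ₁ σ₂ s} → (∀ b → step b σ ≡ σ₁) → σ₁ ⟶[ s ] σ₂ → σ ⟶[ suc s ] σ₂
  infixr 5 _then_

  infixr 5 _++ʳ_
  _++ʳ_ : ∀ {σ σ₁ σ₂ s t} → σ ⟶[ s ] σ₁ → σ₁ ⟶[ t ] σ₂ → σ ⟶[ s + t ] σ₂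
  done       ++ʳ r = r
  (e then q) ++ʳ r = e then (q ++ʳ r)

  reassoc : ∀ (a b : List Cmd) {κ ρ m s τ} → ⟨ a ++ (b ++ κ) , ρ , m ⟩ ⟶[ s ] τ → ⟨ (a ++ b) ++ κ , ρ , m ⟩ ⟶[ s ] τ
  reassoc a b {κ} {ρ} {m} {s} {τ} = subst (λ c → ⟨ c , ρ , m ⟩ ⟶[ s ] τ) (sym (List.++-assoc a b κ))

  wrap-small : ∀ {a} → a < 2 ^ w → wrap a ≡ a
  wrap-small a< = m<n⇒m%n≡m {{m^n≢0 2 w}} a<

  ⟦⟧-small : ∀ o a b → opv o a b < 2 ^ w → ⟦ o ⟧ a b ≡ opv o a b
  ⟦⟧-small add a b h = wrap-small h
  ⟦⟧-small sub a b h = refl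
  ⟦⟧-small mul a b h = wrap-small h
  ⟦⟧-small quo a zero    h = refl
  ⟦⟧-small quo a (suc b) h = refl
  ⟦⟧-small rem a zero    h = refl
  ⟦⟧-small rem a (suc b) h = refl

-- The input is read truncated to X, since the radius and the size may be
-- arbitrarily large; distances and sizes of sets never exceed X.
capped : ℕ → ℕ → (ℕ → ℕ) → ℕ → ℕ
capped X L I i = if i <ᵇ L then I i ∸ (I i ∸ X) else 0

capped≤ : ∀ X L I i → capped X L I i ≤ X
capped≤ X L I i with i <ᵇ L
... | false = z≤n
... | true  with ≤-total (I i) X
...   | inj₁ h = ≤-trans (m∸n≤m (I i) (I i ∸ X)) h
...   | inj₂ h = ≤-reflexive (m∸[m∸n]≡n h)

capped-small : ∀ X L I i → i < L → I i ≤ X → capped X L I i ≡ I i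
capped-small X L I i i<L h = trans (cong (λ b → if b then I i ∸ (I i ∸ X) else 0) (Equivalence.to T-≡ (<⇒<ᵇ i<L))) (cong (I i ∸_) (m≤n⇒m∸n≡0 h))

capped≤I : ∀ X L I i → capped X L I i ≤ I i
capped≤I X L I i with i <ᵇ L
... | false = z≤n
... | true  = m∸n≤m (I i) (I i ∸ X)

capped-out : ∀ X L I i → L ≤ i → capped X L I i ≡ 0
capped-out X L I i L≤i with i <ᵇ L in eq
... | false = refl
... | true  = ⊥-elim (≤⇒≯ L≤i (<ᵇ⇒< i L (subst T (sym eq) tt)))

capped-≥ : ∀ X L I i {d} → i < L → d ≤ X → d ≤ I i → d ≤ capped X L I i
capped-≥ X L I i {d} i<L d≤X d≤I with ≤-total (I i) X
... | inj₁ h = subst (d ≤_) (sym (capped-small X L I i i<L h)) d≤I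
... | inj₂ h = subst (d ≤_) (sym (trans (cong (λ b → if b then I i ∸ (I i ∸ X) else 0) (Equivalence.to T-≡ (<⇒<ᵇ i<L))) (m∸[m∸n]≡n h))) d≤X

module Compiler (w X Q L : ℕ) (I : ℕ → ℕ) (2≤X : 2 ≤ X) (1≤Q : 1 ≤ Q) (arrays<W : arrays < 2 ^ w) where
  open Machine w using (⟦_⟧; wrap; step)
  open Runs w
  open Bounds X Q 2≤X 1≤Q

  W : ℕ
  W = 2 ^ w

  input : ℕ → ℕ
  input = capped X L I

  input≤X : ∀ i → input i ≤ X
  input≤X = capped≤ X L I

  open Semantics input

  Vars : (ℕ → ℕ) → Env → Set
  Vars ρ σ = ∀ x → ρ (rV x) ≡ σ x

  record Good (σ : Env) : Set where
    field
      isX   : σ 0 ≡ X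
      isL   : σ 1 ≡ L
      is0   : σ 2 ≡ 0
      is1   : σ 3 ≡ 1
      small : ∀ x → σ x < W

  Good-update : ∀ {σ x i} → Good σ → 3 < x → i < W → Good (update σ x i)
  Good-update {σ} {x} {i} g 3<x i<W = record
    { isX = other 0 z≤n isX ; isL = other 1 (s≤s z≤n) isL
    ; is0 = other 2 (s≤s (s≤s z≤n)) is0 ; is1 = other 3 ≤-refl is1 ; small = small′ }
    where
    open Good g
    other : ∀ y {v} → y ≤ 3 → σ y ≡ v → update σ x i y ≡ v
    other y y≤3 e = trans (update-other σ i (<⇒≢ (≤-<-trans y≤3 3<x))) e
    small′ : ∀ y → update σ x i y < W
    small′ y with y ≡ᵇ x
    ... | true  = i<W
    ... | false = small y

  Vars-T : ∀ ρ {σ k v} → Vars ρ σ → Vars (update ρ (rT k) v) σ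
  Vars-T ρ {k = k} {v} h x = trans (update-other ρ v (rT≢rV k x ∘ sym)) (h x)

  keepT : ∀ ρ {v} a {j k} → j < k → update ρ (rT (a + k)) v (rT j) ≡ ρ (rT j)
  keepT ρ {v} a j<k = update-other ρ v (below a j<k)

  keepV : ∀ ρ {v x} j → update ρ (rV x) v (rT j) ≡ ρ (rT j)
  keepV ρ {v} {x} j = update-other ρ v (rT≢rV j x)

  record Result (c : List Cmd) (κ : List Cmd) (ρ m : ℕ → ℕ) (k : ℕ) (σ : Env) (P : (ℕ → ℕ) → (ℕ → ℕ) → Set) (T : ℕ) : Set where
    constructor result
    field
      {ρ′ m′} : ℕ → ℕ
      {time}  : ℕ
      time≤   : time ≤ T
      run     : ⟨ c ++ κ , ρ , m ⟩ ⟶[ time ] ⟨ κ , ρ′ , m′ ⟩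
      vars    : Vars ρ′ σ
      keeps   : ∀ j → j < k → ρ′ (rT j) ≡ ρ (rT j)
      post    : P ρ′ m′

  Computes : Code → (ℕ → ℕ) → Env → ℕ → ℕ → Set
  Computes c m σ v T = ∀ k ρ κ → Vars ρ σ → Result (c k) κ ρ m k σ (λ ρ′ m′ → ρ′ (rT k) ≡ v × m′ ≡ m) T

  Computes-mono : ∀ {c m σ v S T} → S ≤ T → Computes c m σ v S → Computes c m σ v T
  Computes-mono S≤T h k ρ κ vs with result t≤ r vs′ ks p ← h k ρ κ vs = result (≤-trans t≤ S≤T) r vs′ ks p

  module _ {σ : Env} (g : Good σ) {m : ℕ → ℕ} where
    open Good g

    move : ∀ {ρ} y → Vars ρ σ → ρ y < W → ⟦ add ⟧ (ρ y) (ρ (rV 2)) ≡ ρ y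
    move {ρ} y vs y<W = trans (cong (λ z → wrap (ρ y + z)) (trans (vs 2) is0))
                        (trans (cong wrap (+-identityʳ (ρ y))) (wrap-small y<W))

    moveV : ∀ {ρ} x → Vars ρ σ → ⟦ add ⟧ (ρ (rV x)) (ρ (rV 2)) ≡ σ x
    moveV {ρ} x vs = trans (move {ρ} (rV x) vs (subst (_< W) (sym (vs x)) (small x))) (vs x)

    computesVar : ∀ x → Computes (codeVar x) m σ (σ x) 1
    computesVar x k ρ κ vs = result ≤-refl ((λ _ → refl) then done) (Vars-T ρ vs)
      (λ j j<k → keepT ρ 0 j<k) (trans (update-same ρ (rT k) _) (moveV {ρ} x vs) , refl)

    computesLit : ∀ c → c < W → Computes (codeLit c) m σ c 1
    computesLit c c<W k ρ κ vs = result ≤-refl ((λ _ → refl) then done) (Vars-T ρ vs)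
      (λ j j<k → keepT ρ 0 j<k) (trans (update-same ρ (rT k) _) (wrap-small c<W) , refl)

    computesOp : ∀ o {c d u v S T} → Computes c m σ u S → Computes d m σ v T → opv o u v < W →
      Computes (codeOp o c d) m σ (opv o u v) (S + (T + 1))
    computesOp o {c} {d} {u} {v} hc hd small k ρ κ vs
      with result t≤ r vs₁ ks₁ (e₁ , refl) ← hc k ρ ((d (suc k) ++ arith (rT k) o (rT k) (rT (suc k)) ∷ []) ++ κ) vs
      with result {ρ₂} u≤ q vs₂ ks₂ (e₂ , refl) ← hd (suc k) _ (arith (rT k) o (rT k) (rT (suc k)) ∷ κ) vs₁
      = result (+-mono-≤ t≤ (+-mono-≤ u≤ (≤-refl {1})))
          (reassoc (c k) _ (r ++ʳ reassoc (d (suc k)) _ (q ++ʳ (λ _ → refl) then done)))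
          (Vars-T ρ₂ vs₂)
          (λ j j<k → trans (keepT ρ₂ 0 j<k) (trans (ks₂ j (m<n⇒m<1+n j<k)) (ks₁ j j<k)))
          (trans (update-same ρ₂ (rT k) _)
             (trans (cong₂ ⟦ o ⟧ (trans (ks₂ k ≤-refl) e₁) e₂) (⟦⟧-small o u v small)) , refl)

    computesCell : ∀ A {c i T} → Computes c m σ i T → cell L A i < W →
      Computes (codeCell A c) m σ (cell L A i) (1 + (((1 + (T + 1)) + (1 + 1)) + 1))
    computesCell A {i = i} h small = subst (λ l → Computes _ m σ (l + (arrays * i + A)) _) isL
      (computesOp add (computesVar 1)
        (computesOp add (computesOp mul (computesLit arrays arrays<W) h (≤-<-trans i≤ small′))
          (computesLit A (≤-<-trans A≤ small′)) small′)
        (subst (λ l → l + (arrays * i + A) < W) (sym isL) small))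
      where
      small′ : arrays * i + A < W
      small′ = ≤-<-trans (m≤n+m _ L) small
      i≤ : arrays * i ≤ arrays * i + A
      i≤ = m≤m+n _ A
      A≤ : A ≤ arrays * i + A
      A≤ = m≤n+m A _

  -- The loop keeps its bound, its counter and the caller's value of x in
  -- temporaries, so that code for the body is free to reuse x.
  module Loop {σ : Env} (g : Good σ) (x k : ℕ) (3<x : 3 < x) (body : List Cmd) (b S : ℕ) (b<W : b < W)
    (Held : ℕ → ℕ → Set) (Mem : ℕ → (ℕ → ℕ) → Set)
    (iteration : ∀ i → i < b → ∀ ρ m κ → Vars ρ (update σ x i) → Held i (ρ (rT (3 + k))) → Mem i m →
       Result body κ ρ m (3 + k) (update σ x i) (λ ρ′ m′ → Held (suc i) (ρ′ (rT (3 + k))) × Mem (suc i) m′) S) where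
    open Good g

    full : List Cmd
    full = arith (rV x) add (rT (1 + k)) (rV 2) ∷ body ++ arith (rT (1 + k)) add (rT (1 + k)) (rV 3) ∷ []

    record At (i : ℕ) (ρ₀ ρ m : ℕ → ℕ) : Set where
      field
        others  : ∀ y → y ≢ x → ρ (rV y) ≡ σ y
        bound   : ρ (rT k) ≡ b
        counter : ρ (rT (1 + k)) ≡ i
        saved   : ρ (rT (2 + k)) ≡ σ x
        held    : Held i (ρ (rT (3 + k)))
        mem     : Mem i m
        keeps   : ∀ j → j < k → ρ (rT j) ≡ ρ₀ (rT j)

    round : ∀ i → i < b → ∀ ρ₀ ρ m κ → At i ρ₀ ρ m → Σ[ ρ′ ∈ (ℕ → ℕ) ] Σ[ m′ ∈ (ℕ → ℕ) ] Σ[ s ∈ ℕ ]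
      s ≤ S + 3 × (⟨ while (rT (1 + k) <ʳ rT k) full ∷ κ , ρ , m ⟩ ⟶[ s ] ⟨ while (rT (1 + k) <ʳ rT k) full ∷ κ , ρ′ , m′ ⟩)
      × At (suc i) ρ₀ ρ′ m′
    round i i<b ρ₀ ρ m κ at = finish (iteration i i<b ρ₁ m κ₁ vs₁ (subst (Held i) (sym (keepV ρ (3 + k))) held) mem)
      where
      open At at hiding (keeps)
      ρ₁ : ℕ → ℕ
      ρ₁ = update ρ (rV x) (⟦ add ⟧ (ρ (rT (1 + k))) (ρ (rV 2)))
      κ₁ : List Cmd
      κ₁ = arith (rT (1 + k)) add (rT (1 + k)) (rV 3) ∷ while (rT (1 + k) <ʳ rT k) full ∷ κ
      set-x : ⟦ add ⟧ (ρ (rT (1 + k))) (ρ (rV 2)) ≡ i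
      set-x = trans (cong₂ (λ c z → wrap (c + z)) counter (trans (others 2 (<⇒≢ (<-trans (n<1+n 2) 3<x))) is0))
              (trans (cong wrap (+-identityʳ i)) (wrap-small (<-trans i<b b<W)))
      vs₁ : Vars ρ₁ (update σ x i)
      vs₁ y with y ≟ x
      ... | yes refl = trans (update-same ρ (rV x) _) (trans set-x (sym (update-same σ x i)))
      ... | no y≢x   = trans (update-other ρ _ (y≢x ∘ rV-inj)) (trans (others y y≢x) (sym (update-other σ i y≢x)))
      enter : (bt : Bool) → step bt ⟨ while (rT (1 + k) <ʳ rT k) full ∷ κ , ρ , m ⟩ ≡
              ⟨ full ++ while (rT (1 + k) <ʳ rT k) full ∷ κ , ρ , m ⟩
      enter _ = cong (λ c → ⟨ (if c then full ++ while (rT (1 + k) <ʳ rT k) full ∷ κ else κ) , ρ , m ⟩)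
        (trans (cong₂ _<ᵇ_ counter bound) (Equivalence.to T-≡ (<⇒<ᵇ i<b)))
      bound≤ : ∀ {s} → s ≤ S → suc (suc (s + 1)) ≤ S + 3
      bound≤ {s} s≤ = ≤-trans (s≤s (s≤s (+-monoˡ-≤ 1 s≤))) (≤-reflexive (trans (cong (suc ∘ suc) (+-comm S 1)) (+-comm 3 S)))
      finish : Result body κ₁ ρ₁ m (3 + k) (update σ x i) (λ ρ′ m′ → Held (suc i) (ρ′ (rT (3 + k))) × Mem (suc i) m′) S → _
      finish (result {ρ₂} {m₂} {s} s≤ r vs ks (a , mm)) = ρ₃ , m₂ , suc (suc (s + 1)) , bound≤ s≤
          , enter then (λ _ → refl) then reassoc body _ (r ++ʳ (λ _ → refl) then done)
          , record
            { others  = λ y y≢x → trans (Vars-T ρ₂ vs y) (update-other σ i y≢x)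
            ; bound   = trans (update-other ρ₂ _ (apart 0 1 λ ())) (trans (ks k (m<n+m k z<s)) (trans (keepV ρ k) bound))
            ; counter = trans (update-same ρ₂ (rT (1 + k)) _) increment
            ; saved   = trans (update-other ρ₂ _ (apart 2 1 λ ())) (trans (ks (2 + k) ≤-refl) (trans (keepV ρ (2 + k)) saved))
            ; held    = subst (Held (suc i)) (sym (update-other ρ₂ _ (apart 3 1 λ ()))) a
            ; mem     = mm
            ; keeps   = λ j j<k → trans (keepT ρ₂ 1 j<k) (trans (ks j (<-trans j<k (m<n+m k z<s))) (trans (keepV ρ j) (At.keeps at j j<k)))
            }
        where
        ρ₃ : ℕ → ℕ
        ρ₃ = update ρ₂ (rT (1 + k)) (⟦ add ⟧ (ρ₂ (rT (1 + k))) (ρ₂ (rV 3)))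
        increment : ⟦ add ⟧ (ρ₂ (rT (1 + k))) (ρ₂ (rV 3)) ≡ suc i
        increment = trans (cong₂ (λ c o → wrap (c + o)) (trans (ks (1 + k) (m<n⇒m<1+n (n<1+n _))) (trans (keepV ρ (1 + k)) counter))
                      (trans (vs 3) (trans (update-other σ i (<⇒≢ 3<x)) is1)))
                    (trans (cong wrap (+-comm i 1)) (wrap-small (≤-<-trans i<b b<W)))

    rounds : ∀ r i → r + i ≡ b → ∀ ρ₀ ρ m κ → At i ρ₀ ρ m → Σ[ ρ′ ∈ (ℕ → ℕ) ] Σ[ m′ ∈ (ℕ → ℕ) ] Σ[ s ∈ ℕ ]
      s ≤ r * (S + 3) + 1 × (⟨ while (rT (1 + k) <ʳ rT k) full ∷ κ , ρ , m ⟩ ⟶[ s ] ⟨ κ , ρ′ , m′ ⟩)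
      × At b ρ₀ ρ′ m′
    rounds zero    i refl ρ₀ ρ m κ at = ρ , m , 1 , ≤-refl , leave then done , at
      where
      open At at
      leave : (bt : Bool) → step bt ⟨ while (rT (1 + k) <ʳ rT k) full ∷ κ , ρ , m ⟩ ≡ ⟨ κ , ρ , m ⟩
      leave _ = cong (λ c → ⟨ (if c then full ++ while (rT (1 + k) <ʳ rT k) full ∷ κ else κ) , ρ , m ⟩) (trans (cong₂ _<ᵇ_ counter bound) (n≮ᵇn i))
        where
        n≮ᵇn : ∀ n → (n <ᵇ n) ≡ false
        n≮ᵇn zero    = refl
        n≮ᵇn (suc n) = n≮ᵇn n
    rounds (suc r) i r+i≡b ρ₀ ρ m κ at
      with ρ₁ , m₁ , s , s≤ , run₁ , at₁ ← round i (subst (i <_) r+i≡b (s≤s (m≤n+m i r))) ρ₀ ρ m κ at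
      with ρ₂ , m₂ , t , t≤ , run₂ , at₂ ← rounds r (suc i) (trans (+-suc r i) r+i≡b) ρ₀ ρ₁ m₁ κ at₁
      = ρ₂ , m₂ , s + t , ≤-trans (+-mono-≤ s≤ t≤) (≤-reflexive (sym (+-assoc (S + 3) (r * (S + 3)) 1))) , run₁ ++ʳ run₂ , at₂

    loop : ∀ ρ m κ → Vars ρ σ → ρ (rT k) ≡ b → Held 0 (ρ (rT (3 + k))) → Mem 0 m →
      Result (codeLoop x k body) κ ρ m k σ (λ ρ′ m′ → Held b (ρ′ (rT (3 + k))) × Mem b m′) (4 + b * (S + 3))
    loop ρ m κ vs bnd a mm = finish (rounds b 0 (+-identityʳ b) ρ₂ ρ₂ m (arith (rV x) add (rT (2 + k)) (rV 2) ∷ κ) start)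
      where
      ρ₁ ρ₂ : ℕ → ℕ
      ρ₁ = update ρ (rT (1 + k)) (⟦ add ⟧ (ρ (rV 2)) (ρ (rV 2)))
      ρ₂ = update ρ₁ (rT (2 + k)) (⟦ add ⟧ (ρ₁ (rV x)) (ρ₁ (rV 2)))
      start : At 0 ρ₂ ρ₂ m
      start = record
          { others  = λ y _ → Vars-T ρ₁ (Vars-T ρ vs) y
          ; bound   = trans (update-other ρ₁ _ (apart 0 2 λ ())) (trans (update-other ρ _ (apart 0 1 λ ())) bnd)
          ; counter = trans (update-other ρ₁ _ (apart 1 2 λ ())) (trans (update-same ρ (rT (1 + k)) _)
                      (trans (cong₂ (λ c d → wrap (c + d)) (trans (vs 2) is0) (trans (vs 2) is0)) (wrap-small (≤-<-trans z≤n b<W))))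
          ; saved   = trans (update-same ρ₁ (rT (2 + k)) _) (moveV g {m} {ρ₁} x (Vars-T ρ vs))
          ; held    = subst (Held 0) (sym (trans (update-other ρ₁ _ (apart 3 2 λ ())) (update-other ρ _ (apart 3 1 λ ())))) a
          ; mem     = mm
          ; keeps   = λ _ _ → refl
          }
      restored : ∀ ρ₃ → (∀ y → y ≢ x → ρ₃ (rV y) ≡ σ y) → ρ₃ (rT (2 + k)) ≡ σ x →
        Vars (update ρ₃ (rV x) (⟦ add ⟧ (ρ₃ (rT (2 + k))) (ρ₃ (rV 2)))) σ
      restored ρ₃ oth sv y with y ≟ x
      ... | no y≢x   = trans (update-other ρ₃ _ (y≢x ∘ rV-inj)) (oth y y≢x)
      ... | yes refl = trans (update-same ρ₃ (rV x) _)
        (trans (cong₂ (λ c z → wrap (c + z)) sv (trans (oth 2 (<⇒≢ (<-trans (n<1+n 2) 3<x))) is0))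
        (trans (cong wrap (+-identityʳ _)) (wrap-small (small x))))
      finish : Σ[ ρ′ ∈ (ℕ → ℕ) ] Σ[ m′ ∈ (ℕ → ℕ) ] Σ[ s ∈ ℕ ] s ≤ b * (S + 3) + 1 ×
        (⟨ while (rT (1 + k) <ʳ rT k) full ∷ arith (rV x) add (rT (2 + k)) (rV 2) ∷ κ , ρ₂ , m ⟩ ⟶[ s ]
         ⟨ arith (rV x) add (rT (2 + k)) (rV 2) ∷ κ , ρ′ , m′ ⟩) × At b ρ₂ ρ′ m′ →
        Result (codeLoop x k body) κ ρ m k σ (λ ρ′ m′ → Held b (ρ′ (rT (3 + k))) × Mem b m′) (4 + b * (S + 3))
      finish (ρ₃ , m₃ , s , s≤ , r , at) = result
              (≤-trans (+-monoʳ-≤ 2 (≤-trans (+-monoˡ-≤ 1 s≤) (≤-reflexive (+-assoc (b * (S + 3)) 1 1))))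
                       (≤-reflexive (trans (cong (2 +_) (+-comm _ 2)) refl)))
              ((λ _ → refl) then (λ _ → refl) then (r ++ʳ (λ _ → refl) then done))
              (restored ρ₃ (At.others at) (At.saved at))
              (λ j j<k → trans (keepV ρ₃ j) (trans (At.keeps at j j<k) (trans (keepT ρ₁ 2 j<k) (keepT ρ 1 j<k))))
              (subst (Held b) (sym (keepV ρ₃ (3 + k))) (At.held at) , At.mem at)

  record Rep (m : ℕ → ℕ) (𝓐 : Arrays) : Set where
    field
      cells  : ∀ A i → A < arrays → m (cell L A i) ≡ 𝓐 A i
      inputs : ∀ i → i < L → m i ≡ I i

  cell-inj : ∀ {A B i j} → A < arrays → B < arrays → cell L A i ≡ cell L B j → A ≡ B × i ≡ j
  cell-inj {A} {B} {i} {j} A< B< eq = A≡B , *-cancelˡ-≡ i j arrays (+-cancelʳ-≡ A _ _ (trans eq′ (cong (arrays * j +_) (sym A≡B))))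
    where
    eq′ : arrays * i + A ≡ arrays * j + B
    eq′ = +-cancelˡ-≡ L _ _ eq
    mod : ∀ {A i} → A < arrays → (arrays * i + A) % arrays ≡ A
    mod {A} {i} A< = trans (cong (_% arrays) (trans (+-comm (arrays * i) A) (cong (A +_) (*-comm arrays i))))
                     (trans ([m+kn]%n≡m%n A i arrays) (m<n⇒m%n≡m A<))
    A≡B : A ≡ B
    A≡B = trans (sym (mod {i = i} A<)) (trans (cong (_% arrays) eq′) (mod {i = j} B<))

  Rep-store : ∀ {m 𝓐} A i v → A < arrays → Rep m 𝓐 → Rep (update m (cell L A i) v) (set 𝓐 A i v)
  Rep-store {m} {𝓐} A i v A< rep = record { cells = cells′ ; inputs = inputs′ }
    where
    open Rep rep
    inputs′ : ∀ j → j < L → update m (cell L A i) v j ≡ I j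
    inputs′ j j<L = trans (update-other m v (<⇒≢ (<-≤-trans j<L (m≤m+n L _)))) (inputs j j<L)
    cells′ : ∀ B j → B < arrays → update m (cell L A i) v (cell L B j) ≡ set 𝓐 A i v B j
    cells′ B j B< with B ≡ᵇ A in B≟A
    ... | false = trans (update-other m v λ eq → subst T B≟A (≡⇒≡ᵇ B A (proj₁ (cell-inj {B} {A} {j} {i} B< A< eq)))) (cells B j B<)
    ... | true rewrite ≡ᵇ⇒≡ B A (subst T (sym B≟A) tt) with j ≡ᵇ i in j≟i
    ...   | true  rewrite ≡ᵇ⇒≡ j i (subst T (sym j≟i) tt) = update-same m (cell L A i) v
    ...   | false = trans (update-other m v λ eq → subst T j≟i (≡⇒≡ᵇ j i (proj₂ (cell-inj {A} {A} {j} {i} A< A< eq)))) (cells A j A<)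

  module Correct (Γ : ℕ → Deg) (D : ℕ) (D-fits : X ^ D * Q < 2 ^ w) where
    open Degrees Γ D

    fits-< : ∀ {v} d → T (fits d) → v ≤ 𝔹 d → v < W
    fits-< (a , p) h v≤ = ≤-<-trans v≤ (≤-<-trans
      (𝔹-mono (≤ᵇ⇒≤ a D (proj₁ (∧-T (a ≤ᵇ D) h))) (≤ᵇ⇒≤ p 1 (proj₂ (∧-T (a ≤ᵇ D) h))))
      (subst (λ q → X ^ D * q < W) (sym (*-identityʳ Q)) D-fits))

    cell-fits : ∀ A {i σ} d → Good σ → σ 1 ≤ 𝔹 (3 , 0) → T (fits (cellD A d)) → i ≤ 𝔹 d → cell L A i < W
    cell-fits A d g L≤ h i≤ = fits-< (cellD A d) h
      (𝔹-⊞ (3 , 0) (litD arrays ⊠ d ⊞ litD A) (subst (_≤ 𝔹 (3 , 0)) (Good.isL g) L≤)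
        (𝔹-⊞ (litD arrays ⊠ d) (litD A) (𝔹-⊠ (litD arrays) d (𝔹-lit arrays) i≤) (𝔹-lit A)))

    record Fit (Δ : ℕ → Deg) (σ : Env) : Set where
      field
        good : Good σ
        bnd  : Bounded Δ σ
        L≤   : σ 1 ≤ 𝔹 (3 , 0)

    Fit-update : ∀ {Δ σ x i} d → 3 < x → i < W → i ≤ 𝔹 d → Fit Δ σ → Fit (updateD Δ x d) (update σ x i)
    Fit-update {σ = σ} {x} {i} d 3<x i<W i≤ f = record
      { good = Good-update good 3<x i<W
      ; bnd  = Bounded-update x bnd i≤
      ; L≤   = subst (_≤ 𝔹 (3 , 0)) (sym (update-other σ i (<⇒≢ (<-trans (s≤s (s≤s z≤n)) 3<x)))) L≤ }
      where open Fit f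

    loop≤ : ∀ {b s} d e → b ≤ 𝔹 d → s ≤ 𝔹 e → 4 + b * (s + 3) ≤ 𝔹 (loopD d e)
    loop≤ d e b≤ s≤ = 𝔹-⊞ (litD 4) (d ⊠ (e ⊞ litD 3)) (𝔹-lit 4) (𝔹-⊠ d (e ⊞ litD 3) b≤ (𝔹-⊞ e (litD 3) s≤ (𝔹-lit 3)))

    code-correct : ∀ e {Δ σ 𝓐 m} → T (ok Δ e) → Fit Δ σ → BoundedA Γ D input input≤X 𝓐 → Rep m 𝓐 →
      Computes (code e) m σ (ev e σ 𝓐) (𝔹 (cost Δ e))
    code-correct (var x) h f b𝓐 rep = Computes-mono (𝔹-lit 1) (computesVar (Fit.good f) x)
    code-correct (lit c) h f b𝓐 rep = Computes-mono (𝔹-lit 1) (computesLit (Fit.good f) c (fits-< (litD c) h (𝔹-lit c)))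
    code-correct (op o a b) {Δ} h f b𝓐 rep with ha , hb , ho ← ∧-T₃ (ok Δ a) (ok Δ b) h =
      Computes-mono (𝔹-⊞ (cost Δ a) (cost Δ b ⊞ litD 1) ≤-refl (𝔹-⊞ (cost Δ b) (litD 1) ≤-refl (𝔹-lit 1)))
        (computesOp (Fit.good f) o (code-correct a ha f b𝓐 rep) (code-correct b hb f b𝓐 rep)
          (fits-< (opD o (deg Δ a) (deg Δ b)) ho
            (opv-bound o (deg Δ a) (deg Δ b) (ev-bound Γ D input input≤X a (Fit.bnd f) b𝓐)
                                             (ev-bound Γ D input input≤X b (Fit.bnd f) b𝓐))))
    code-correct (rd A e) {Δ} {σ} {𝓐} {m} h f b𝓐 rep k ρ κ vs with he , hc , hA ← ∧-T₃ (ok Δ e) (fits (cellD A (deg Δ e))) h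
      with result {ρ₁} {m₁} t≤ r vs₁ ks (e₁ , refl) ← computesCell (Fit.good f) A (code-correct e he f b𝓐 rep)
             (cell-fits A (deg Δ e) (Fit.good f) (Fit.L≤ f) hc (ev-bound Γ D input input≤X e (Fit.bnd f) b𝓐))
             k ρ (load (rT k) (rT k) ∷ κ) vs
      = result (≤-trans (+-monoˡ-≤ 1 t≤) (≤-trans (≤-reflexive arith≡) (𝔹-⊞ (litD 8) (cost Δ e) (≤-trans (n≤1+n 7) (𝔹-lit 8)) ≤-refl)))
          (reassoc (codeCell A (code e) k) _ (r ++ʳ (λ _ → refl) then done)) (Vars-T ρ₁ vs₁)
          (λ j j<k → trans (keepT ρ₁ 0 j<k) (ks j j<k))
          (trans (update-same ρ₁ (rT k) _) (trans (cong m e₁) (Rep.cells rep A _ (<ᵇ⇒< A arrays hA))) , refl)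
      where
      c = 𝔹 (cost Δ e)
      arith≡ : 1 + (((1 + (c + 1)) + (1 + 1)) + 1) + 1 ≡ 7 + c
      arith≡ = solve 1 (λ c → con 1 :+ (((con 1 :+ (c :+ con 1)) :+ (con 1 :+ con 1)) :+ con 1) :+ con 1 := con 7 :+ c) refl c
    code-correct (inp e) {Δ} {σ} {𝓐} {m} h f b𝓐 rep k ρ κ vs = finish (code-correct e h f b𝓐 rep k ρ (fetch k ++ κ) vs)
      where
      open Good (Fit.good f)
      thn els : List Cmd
      thn  = load (rT k) (rT k) ∷ arith (rT (1 + k)) sub (rT k) (rV 0) ∷ arith (rT k) sub (rT k) (rT (1 + k)) ∷ []
      els  = const (rT k) 0 ∷ []
      finish : Result (code e k) (fetch k ++ κ) ρ m k σ (λ ρ′ m′ → ρ′ (rT k) ≡ ev e σ 𝓐 × m′ ≡ m) (𝔹 (cost Δ e)) →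
        Result (code (inp e) k) κ ρ m k σ (λ ρ′ m′ → ρ′ (rT k) ≡ input (ev e σ 𝓐) × m′ ≡ m) (𝔹 (cost Δ e ⊞ litD 4))
      finish (result {ρ₁} {m₁} {t} t≤ r vs₁ ks (e₁ , refl)) with ev e σ 𝓐 in i≡
      ... | i with i <ᵇ L in i<L
      ...   | false = result (𝔹-⊞ (cost Δ e) (litD 4) t≤ (≤-trans (s≤s (s≤s z≤n)) (𝔹-lit 4)))
                (reassoc (code e k) _ (r ++ʳ (λ _ → cong (λ c → ⟨ (if c then thn else els) ++ κ , ρ₁ , m ⟩) (trans (cong₂ _<ᵇ_ e₁ (trans (vs₁ 1) isL)) i<L))
                   then (λ _ → refl) then done))
                (Vars-T ρ₁ vs₁) (λ j j<k → trans (keepT ρ₁ 0 j<k) (ks j j<k))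
                (trans (update-same ρ₁ (rT k) _) (wrap-small (m^n>0 2 w)) , refl)
      ...   | true  = result (𝔹-⊞ (cost Δ e) (litD 4) t≤ (𝔹-lit 4))
                (reassoc (code e k) _ (r ++ʳ (λ _ → cong (λ c → ⟨ (if c then thn else els) ++ κ , ρ₁ , m ⟩) (trans (cong₂ _<ᵇ_ e₁ (trans (vs₁ 1) isL)) i<L))
                   then (λ _ → refl) then (λ _ → refl) then (λ _ → refl) then done))
                (Vars-T ρ₃ (Vars-T ρ₂ (Vars-T ρ₁ vs₁)))
                (λ j j<k → trans (keepT ρ₃ 0 j<k) (trans (keepT ρ₂ 1 j<k) (trans (keepT ρ₁ 0 j<k) (ks j j<k))))
                (trans (update-same ρ₃ (rT k) _) (cong₂ _∸_ k₃ (trans (update-same ρ₂ (rT (1 + k)) _) (cong₂ _∸_ k₂ (trans (Vars-T ρ₁ {k = k} vs₁ 0) isX)))) , refl)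
        where
        ρ₂ ρ₃ : ℕ → ℕ
        ρ₂ = update ρ₁ (rT k) (m (ρ₁ (rT k)))
        ρ₃ = update ρ₂ (rT (1 + k)) (ρ₂ (rT k) ∸ ρ₂ (rV 0))
        k₂ : ρ₂ (rT k) ≡ I i
        k₂ = trans (update-same ρ₁ (rT k) _) (trans (cong m e₁) (Rep.inputs rep i (<ᵇ⇒< i L (subst T (sym i<L) tt))))
        k₃ : ρ₃ (rT k) ≡ I i
        k₃ = trans (update-other ρ₂ _ (apart 0 1 λ ())) k₂
    code-correct (lt a b) {Δ} {σ} {𝓐} {m} h f b𝓐 rep k ρ κ vs
      with result {ρ₁} s≤ r vs₁ ks₁ (e₁ , refl) ← code-correct a (proj₁ (∧-T (ok Δ a) h)) f b𝓐 rep k ρ ((code b (suc k) ++ comparison k) ++ κ) vs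
      with result {ρ₂} t≤ q vs₂ ks₂ (e₂ , refl) ← code-correct b (proj₂ (∧-T (ok Δ a) h)) f b𝓐 rep (suc k) ρ₁ (comparison k ++ κ) vs₁
      with ev a σ 𝓐 <ᵇ ev b σ 𝓐 in a<b
    ... | c = result (𝔹-⊞ (cost Δ a) (cost Δ b ⊞ litD 2) s≤ (𝔹-⊞ (cost Δ b) (litD 2) t≤ (𝔹-lit 2)))
        (reassoc (code a k) _ (r ++ʳ reassoc (code b (suc k)) _ (q ++ʳ
          (λ _ → cong (λ c → ⟨ (if c then setBit true k else setBit false k) ++ κ , ρ₂ , m ⟩)
            (trans (cong₂ _<ᵇ_ (trans (ks₂ k ≤-refl) e₁) e₂) a<b)) then assign c {ρ₂} vs₂)))
        (Vars-T ρ₂ vs₂) (λ j j<k → trans (keepT ρ₂ 0 j<k) (trans (ks₂ j (m<n⇒m<1+n j<k)) (ks₁ j j<k)))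
        (update-same ρ₂ (rT k) _ , refl)
      where
      open Good (Fit.good f)
      assign : ∀ c {ρ₂} → Vars ρ₂ σ → ⟨ (if c then setBit true k else setBit false k) ++ κ , ρ₂ , m ⟩ ⟶[ 1 ] ⟨ κ , update ρ₂ (rT k) (bit c) , m ⟩
      assign true  {ρ₂} vs₂ = (λ _ → cong (λ v → ⟨ κ , update ρ₂ (rT k) v , m ⟩) (trans (moveV (Fit.good f) {m} {ρ₂} 3 vs₂) is1)) then done
      assign false {ρ₂} vs₂ = (λ _ → cong (λ v → ⟨ κ , update ρ₂ (rT k) v , m ⟩) (trans (moveV (Fit.good f) {m} {ρ₂} 2 vs₂) is0)) then done
    code-correct (sum x b e) {Δ} {σ} {𝓐} {m} h f b𝓐 rep k ρ κ vs =
        finish (code-correct b (proj₁ (∧-T₅ (ok Δ b) (ok (updateD Δ x (deg Δ b)) e) (3 <ᵇ x) (fits (deg Δ b)) h)) f b𝓐 rep k ρ (rest ++ κ) vs)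
      where
      open Good (Fit.good f)
      d = deg Δ b
      ce = cost (updateD Δ x (deg Δ b)) e ⊞ litD 1
      B = ev b σ 𝓐
      val : ℕ → ℕ
      val i = ev e (update σ x i) 𝓐
      parts : T (ok Δ b) × T (ok (updateD Δ x d) e) × T (3 <ᵇ x) × T (fits d) × T (fits (d ⊠ deg (updateD Δ x d) e))
      parts = ∧-T₅ (ok Δ b) (ok (updateD Δ x (deg Δ b)) e) (3 <ᵇ x) (fits (deg Δ b)) h
      body rest : List Cmd
      body = code e (4 + k) ++ arith (rT (3 + k)) add (rT (3 + k)) (rT (4 + k)) ∷ []
      rest = arith (rT (3 + k)) add (rV 2) (rV 2) ∷ codeLoop x k body ++ arith (rT k) add (rT (3 + k)) (rV 2) ∷ []
      B≤ : B ≤ 𝔹 d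
      B≤ = ev-bound Γ D input input≤X b (Fit.bnd f) b𝓐
      B<W : B < W
      B<W = fits-< d (proj₁ (proj₂ (proj₂ (proj₂ parts)))) B≤
      fit-i : ∀ {i} → i < B → Fit (updateD Δ x d) (update σ x i)
      fit-i i<B = Fit-update d (<ᵇ⇒< 3 x (proj₁ (proj₂ (proj₂ parts)))) (<-trans i<B B<W) (≤-trans (<⇒≤ i<B) B≤) f
      Sum-mono : ∀ {i j} → i ≤ j → Sum i val ≤ Sum j val
      Sum-mono {i} {j} i≤j with k , refl ← m≤n⇒∃[o]m+o≡n i≤j = go k
        where
        go : ∀ k → Sum i val ≤ Sum (i + k) val
        go zero    = ≤-reflexive (cong (λ j → Sum j val) (sym (+-identityʳ i)))
        go (suc k) = subst (λ j → Sum i val ≤ Sum j val) (sym (+-suc i k)) (≤-trans (go k) (m≤m+n _ _))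
      Sum<W : ∀ {i} → i ≤ B → Sum i val < W
      Sum<W i≤B = ≤-<-trans (Sum-mono i≤B) (fits-< (d ⊠ deg (updateD Δ x d) e) (proj₂ (proj₂ (proj₂ (proj₂ parts))))
        (ev-bound Γ D input input≤X (sum x b e) {Δ} (Fit.bnd f) b𝓐))
      iteration : ∀ i → i < B → ∀ ρ m′ κ → Vars ρ (update σ x i) → ρ (rT (3 + k)) ≡ Sum i val → m′ ≡ m →
        Result body κ ρ m′ (3 + k) (update σ x i) (λ ρ′ m″ → ρ′ (rT (3 + k)) ≡ Sum (suc i) val × m″ ≡ m) (𝔹 (cost (updateD Δ x d) e ⊞ litD 1))
      iteration i i<B ρ m′ κ vs held refl
        with result {ρ₁} t≤ r vs₁ ks (e₁ , refl) ← code-correct e (proj₁ (proj₂ parts)) (fit-i i<B) b𝓐 rep (4 + k) ρ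
               (arith (rT (3 + k)) add (rT (3 + k)) (rT (4 + k)) ∷ κ) vs
        = result (𝔹-⊞ (cost (updateD Δ x d) e) (litD 1) t≤ (𝔹-lit 1))
            (reassoc (code e (4 + k)) _ (r ++ʳ (λ _ → refl) then done))
            (Vars-T ρ₁ vs₁) (λ j j<k → trans (keepT ρ₁ 0 j<k) (ks j (m<n⇒m<1+n j<k)))
            (trans (update-same ρ₁ (rT (3 + k)) _) (trans (cong₂ (λ u v → wrap (u + v)) (trans (ks (3 + k) ≤-refl) held) e₁) (wrap-small (Sum<W i<B))) , refl)
      finish : Result (code b k) (rest ++ κ) ρ m k σ (λ ρ′ m′ → ρ′ (rT k) ≡ B × m′ ≡ m) (𝔹 (cost Δ b)) →
        Result (code (sum x b e) k) κ ρ m k σ (λ ρ′ m′ → ρ′ (rT k) ≡ Sum B val × m′ ≡ m) (𝔹 (cost Δ (sum x b e)))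
      finish (result {ρ₁} t≤ r vs₁ ks (e₁ , refl)) = finish′
        (Loop.loop (Fit.good f) x k (<ᵇ⇒< 3 x (proj₁ (proj₂ (proj₂ parts)))) body B _ B<W
          (λ i a → a ≡ Sum i val) (λ _ m′ → m′ ≡ m) iteration ρ₂ m (arith (rT k) add (rT (3 + k)) (rV 2) ∷ κ)
          (Vars-T ρ₁ vs₁) (trans (update-other ρ₁ _ (apart 0 3 λ ())) e₁)
          (trans (update-same ρ₁ (rT (3 + k)) _) (trans (moveV (Fit.good f) {m} {ρ₁} 2 vs₁) is0)) refl)
        where
        ρ₂ : ℕ → ℕ
        ρ₂ = update ρ₁ (rT (3 + k)) (⟦ add ⟧ (ρ₁ (rV 2)) (ρ₁ (rV 2)))
        finish′ : Result (codeLoop x k body) (arith (rT k) add (rT (3 + k)) (rV 2) ∷ κ) ρ₂ m k σ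
            (λ ρ′ m′ → ρ′ (rT (3 + k)) ≡ Sum B val × m′ ≡ m) (4 + B * (𝔹 (cost (updateD Δ x d) e ⊞ litD 1) + 3)) →
          Result (code (sum x b e) k) κ ρ m k σ (λ ρ′ m′ → ρ′ (rT k) ≡ Sum B val × m′ ≡ m) (𝔹 (cost Δ (sum x b e)))
        finish′ (result {ρ₃} {m₃} {u} u≤ q vs₃ ks₃ (e₃ , refl)) = result
          (𝔹-⊞ (cost Δ b) (litD 2 ⊞ loopD d ce) t≤ (≤-trans (≤-reflexive (cong suc (+-comm u 1)))
            (𝔹-⊞ (litD 2) (loopD d ce) (𝔹-lit 2) (≤-trans u≤ (loop≤ d ce B≤ ≤-refl)))))
          (reassoc (code b k) _ (r ++ʳ (λ _ → refl) then reassoc (codeLoop x k body) (arith (rT k) add (rT (3 + k)) (rV 2) ∷ []) (q ++ʳ (λ _ → refl) then done)))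
          (Vars-T ρ₃ vs₃)
          (λ j j<k → trans (keepT ρ₃ 0 j<k) (trans (ks₃ j j<k) (trans (keepT ρ₁ 3 j<k) (ks j j<k))))
          (trans (update-same ρ₃ (rT k) _) (trans (move (Fit.good f) {m₃} {ρ₃} (rT (3 + k)) vs₃ (subst (_< W) (sym e₃) (Sum<W ≤-refl))) e₃) , refl)

    codeC-correct : ∀ c {Δ σ 𝓐 m} → T (okC Δ c) → Fit Δ σ → BoundedA Γ D input input≤X 𝓐 → Valid Γ D input input≤X c σ 𝓐 →
      ∀ k ρ κ → Rep m 𝓐 → Vars ρ σ →
      Result (codeC c k) κ ρ m k σ (λ ρ′ m′ → Rep m′ (exec c σ 𝓐)) (𝔹 (costC Δ c))
    codeC-correct (c ⨾ d) {Δ} h f b𝓐 (v , v′) k ρ κ rep vs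
      with result s≤ r vs₁ ks₁ rep₁ ← codeC-correct c (proj₁ (∧-T (okC Δ c) h)) f b𝓐 v k ρ (codeC d k ++ κ) rep vs
      with result t≤ q vs₂ ks₂ rep₂ ← codeC-correct d (proj₂ (∧-T (okC Δ c) h)) f (exec-bound Γ D input input≤X c v b𝓐) v′ k _ κ rep₁ vs₁
      = result (𝔹-⊞ (costC Δ c) (costC Δ d) s≤ t≤) (reassoc (codeC c k) _ (r ++ʳ q)) vs₂
          (λ j j<k → trans (ks₂ j j<k) (ks₁ j j<k)) rep₂
    codeC-correct (store A i e) {Δ} {σ} {𝓐} {m} h f b𝓐 v k ρ κ rep vs
      with hi , he , hc , hA ← ∧-T₄ (ok Δ i) (ok Δ e) (fits (cellD A (deg Δ i))) h
      with result {ρ₁} s≤ r vs₁ ks₁ (e₁ , refl) ← computesCell (Fit.good f) A (code-correct i hi f b𝓐 rep)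
             (cell-fits A (deg Δ i) (Fit.good f) (Fit.L≤ f) hc (ev-bound Γ D input input≤X i (Fit.bnd f) b𝓐))
             k ρ ((code e (suc k) ++ store (rT k) (rT (suc k)) ∷ []) ++ κ) vs
      with result {ρ₂} t≤ q vs₂ ks₂ (e₂ , refl) ← code-correct e he f b𝓐 rep (suc k) ρ₁ (store (rT k) (rT (suc k)) ∷ κ) vs₁
      = result {m′ = update m (ρ₂ (rT k)) (ρ₂ (rT (suc k)))}
          (≤-trans (+-mono-≤ s≤ (+-monoˡ-≤ 1 t≤)) (≤-trans (≤-reflexive arith≡)
            (𝔹-⊞ (litD 8) (cost Δ i ⊞ cost Δ e) (≤-trans (n≤1+n 7) (𝔹-lit 8)) (𝔹-⊞ (cost Δ i) (cost Δ e) ≤-refl ≤-refl))))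
          (reassoc (codeCell A (code i) k) _ (r ++ʳ reassoc (code e (suc k)) _ (q ++ʳ (λ _ → refl) then done)))
          vs₂ (λ j j<k → trans (ks₂ j (m<n⇒m<1+n j<k)) (ks₁ j j<k))
          (subst₂ (λ a v → Rep (update m a v) (set 𝓐 A (ev i σ 𝓐) (ev e σ 𝓐))) (sym (trans (ks₂ k ≤-refl) e₁)) (sym e₂)
            (Rep-store A _ _ (<ᵇ⇒< A arrays hA) rep))
      where
      arith≡ : 1 + (((1 + (𝔹 (cost Δ i) + 1)) + (1 + 1)) + 1) + (𝔹 (cost Δ e) + 1) ≡ 7 + (𝔹 (cost Δ i) + 𝔹 (cost Δ e))
      arith≡ = solve 2 (λ c d → con 1 :+ (((con 1 :+ (c :+ con 1)) :+ (con 1 :+ con 1)) :+ con 1) :+ (d :+ con 1) := con 7 :+ (c :+ d))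
                 refl (𝔹 (cost Δ i)) (𝔹 (cost Δ e))
    codeC-correct (for x b c) {Δ} {σ} {𝓐} {m} h f b𝓐 v k ρ κ rep vs = finish (code-correct b (proj₁ (∧-T₄ (ok Δ b) (okC (updateD Δ x (deg Δ b)) c) (3 <ᵇ x) h)) f b𝓐 rep k ρ (codeLoop x k (codeC c (3 + k)) ++ κ) vs)
      where
      d = deg Δ b
      B = ev b σ 𝓐
      parts : T (ok Δ b) × T (okC (updateD Δ x d) c) × T (3 <ᵇ x) × T (fits d)
      parts = ∧-T₄ (ok Δ b) (okC (updateD Δ x (deg Δ b)) c) (3 <ᵇ x) h
      3<x = <ᵇ⇒< 3 x (proj₁ (proj₂ (proj₂ parts)))
      B≤ : B ≤ 𝔹 d
      B≤ = ev-bound Γ D input input≤X b (Fit.bnd f) b𝓐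
      B<W : B < W
      B<W = fits-< d (proj₂ (proj₂ (proj₂ parts))) B≤
      state : ℕ → Arrays
      state i = iter i (λ i → exec c (update σ x i)) 𝓐
      bounded : ∀ i → i ≤ B → BoundedA Γ D input input≤X (state i)
      bounded zero    _   = b𝓐
      bounded (suc i) i<B = exec-bound Γ D input input≤X c (v i i<B) (bounded i (<⇒≤ i<B))
      iteration : ∀ i → i < B → ∀ ρ m κ → Vars ρ (update σ x i) → ⊤ → Rep m (state i) →
        Result (codeC c (3 + k)) κ ρ m (3 + k) (update σ x i) (λ _ m′ → ⊤ × Rep m′ (state (suc i))) (𝔹 (costC (updateD Δ x d) c))
      iteration i i<B ρ m κ vs _ rep
        with result t≤ r vs₁ ks rep₁ ← codeC-correct c (proj₁ (proj₂ parts)) (Fit-update d 3<x (<-trans i<B B<W) (≤-trans (<⇒≤ i<B) B≤) f)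
               (bounded i (<⇒≤ i<B)) (v i i<B) (3 + k) ρ κ rep vs
        = result t≤ r vs₁ ks (tt , rep₁)
      finish : Result (code b k) (codeLoop x k (codeC c (3 + k)) ++ κ) ρ m k σ (λ ρ′ m′ → ρ′ (rT k) ≡ B × m′ ≡ m) (𝔹 (cost Δ b)) →
        Result (codeC (for x b c) k) κ ρ m k σ (λ _ m′ → Rep m′ (state B)) (𝔹 (costC Δ (for x b c)))
      finish (result {ρ₁} t≤ r vs₁ ks (e₁ , refl))
        with result u≤ q vs₂ ks₂ (_ , rep₂) ← Loop.loop (Fit.good f) x k 3<x (codeC c (3 + k)) B _ B<W
               (λ _ _ → ⊤) (λ i m′ → Rep m′ (state i)) iteration ρ₁ m κ vs₁ e₁ tt rep
        = result (𝔹-⊞ (cost Δ b) (loopD d (costC (updateD Δ x d) c)) t≤ (≤-trans u≤ (loop≤ d (costC (updateD Δ x d) c) B≤ ≤-refl)))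
            (reassoc (code b k) _ (r ++ʳ q)) vs₂ (λ j j<k → trans (ks₂ j j<k) (ks j j<k)) rep₂

-- Sums over assignments, and elimination

at : ∀ {n} → Vec ℕ n → ℕ → ℕ
at []      v       = 0
at (d ∷ g) zero    = d
at (d ∷ g) (suc v) = at g v

setAt : ∀ {n} → Vec ℕ n → ℕ → ℕ → Vec ℕ n
setAt []      v       d = []
setAt (_ ∷ g) zero    d = d ∷ g
setAt (c ∷ g) (suc v) d = c ∷ setAt g v d

at-same : ∀ {n} (g : Vec ℕ n) v d → v < n → at (setAt g v d) v ≡ d
at-same (_ ∷ g) zero    d _       = refl
at-same (_ ∷ g) (suc v) d (s≤s h) = at-same g v d h

at-other : ∀ {n} (g : Vec ℕ n) v d u → u ≢ v → at (setAt g v d) u ≡ at g u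
at-other []      v       d u       u≢v = refl
at-other (_ ∷ g) zero    d zero    u≢v = ⊥-elim (u≢v refl)
at-other (_ ∷ g) zero    d (suc u) u≢v = refl
at-other (_ ∷ g) (suc v) d zero    u≢v = refl
at-other (_ ∷ g) (suc v) d (suc u) u≢v = at-other g v d u (u≢v ∘ cong suc)

at-ext : ∀ {n} (g h : Vec ℕ n) → (∀ v → v < n → at g v ≡ at h v) → g ≡ h
at-ext []      []      eq = refl
at-ext (c ∷ g) (d ∷ h) eq = cong₂ _∷_ (eq 0 z<s) (at-ext g h λ v v< → eq (suc v) (s<s v<))

vec : ∀ n → (ℕ → ℕ) → Vec ℕ n
vec zero    f = []
vec (suc n) f = f 0 ∷ vec n (f ∘ suc)

at-vec : ∀ n f v → v < n → at (vec n f) v ≡ f v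
at-vec (suc n) f zero    _       = refl
at-vec (suc n) f (suc v) (s≤s h) = at-vec n (f ∘ suc) v h

Digits : ∀ {n} → ℕ → Vec ℕ n → Set
Digits {n} q g = ∀ v → v < n → at g v < q

Digits-∷ : ∀ {n q d} {g : Vec ℕ n} → d < q → Digits q g → Digits q (d ∷ g)
Digits-∷ d<q h zero    _       = d<q
Digits-∷ d<q h (suc v) (s≤s p) = h v p

module VectorSums {c ℓ} (R : CommutativeSemiring c ℓ) where
  open CommutativeSemiring R using (_≈_; 0#; 1#; reflexive)
    renaming (Carrier to A; _+_ to infixl 6 _⊕_; _*_ to infixl 7 _⊗_; refl to ≈-refl; sym to ≈-sym; trans to ≈-trans;
              *-cong to ⊗-cong; *-congʳ to ⊗-congʳ; *-congˡ to ⊗-congˡ; *-comm to ⊗-comm; *-assoc to ⊗-assoc;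
              *-identityˡ to ⊗-identityˡ; zeroˡ to ⊗-zeroˡ)
  open import Algebra.Properties.CommutativeSemigroup (CommutativeSemiring.*-commutativeSemigroup R)
    using () renaming (interchange to ⊗-interchange)
  open Sums R renaming (Sum to SumR; Sum-cong to SumR-cong; Sum-0 to SumR-0; Sum-+ to SumR-+; Sum-*ˡ to SumR-*ˡ;
    Sum-swap to SumR-swap; Sum-single to SumR-single; Prod to ProdR; Prod-cong to ProdR-cong; Prod-extract to ProdR-extract; without to withoutR) using ()
  open import Relation.Binary.Reasoning.Setoid (CommutativeSemiring.setoid R)

  sumV : ℕ → ∀ n → (Vec ℕ n → A) → A
  sumV q zero    F = F []
  sumV q (suc n) F = SumR q (λ d → sumV q n (λ g → F (d ∷ g)))

  sumV-cong : ∀ q n {F G} → (∀ g → Digits q g → F g ≈ G g) → sumV q n F ≈ sumV q n G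
  sumV-cong q zero    h = h [] λ _ ()
  sumV-cong q (suc n) h = SumR-cong q λ d d<q → sumV-cong q n λ g hg → h (d ∷ g) (Digits-∷ d<q hg)

  sumV-0 : ∀ q n {F} → (∀ g → Digits q g → F g ≈ 0#) → sumV q n F ≈ 0#
  sumV-0 q zero    h = h [] λ _ ()
  sumV-0 q (suc n) h = SumR-0 q λ d d<q → sumV-0 q n λ g hg → h (d ∷ g) (Digits-∷ d<q hg)

  sumV-+ : ∀ q n F G → sumV q n (λ g → F g ⊕ G g) ≈ sumV q n F ⊕ sumV q n G
  sumV-+ q zero    F G = ≈-refl
  sumV-+ q (suc n) F G = ≈-trans (SumR-cong q λ d _ → sumV-+ q n _ _) (SumR-+ q _ _)

  sumV-*ˡ : ∀ q n x F → sumV q n (λ g → x ⊗ F g) ≈ x ⊗ sumV q n F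
  sumV-*ˡ q zero    x F = ≈-refl
  sumV-*ˡ q (suc n) x F = ≈-trans (SumR-cong q λ d _ → sumV-*ˡ q n x _) (SumR-*ˡ q x _)

  sumV-Sum : ∀ q n m (F : ℕ → Vec ℕ n → A) →
    SumR m (λ i → sumV q n (F i)) ≈ sumV q n (λ g → SumR m (λ i → F i g))
  sumV-Sum q zero    m F = ≈-refl
  sumV-Sum q (suc n) m F = ≈-trans (SumR-swap m q _) (SumR-cong q λ d _ → sumV-Sum q n m _)

  sumV-single : ∀ q n {F} (c : Vec ℕ n) → Digits q c → (∀ g → Digits q g → g ≢ c → F g ≈ 0#) → sumV q n F ≈ F c
  sumV-single q zero    []      hc h = ≈-refl
  sumV-single q (suc n) (d ∷ c) hc h = ≈-trans
    (SumR-single q d (hc 0 z<s) λ e e<q e≢d → sumV-0 q n λ g hg → h (e ∷ g) (Digits-∷ e<q hg) λ { refl → e≢d refl })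
    (sumV-single q n c (λ v v< → hc (suc v) (s<s v<)) λ g hg g≢c → h (d ∷ g) (Digits-∷ (hc 0 z<s) hg) λ { refl → g≢c refl })

  δ : ℕ → A
  δ zero    = 1#
  δ (suc _) = 0#

  sumV-forget : ∀ q n F v → v < n → 0 < q → sumV q n F ≈ sumV q n (λ g → δ (at g v) ⊗ SumR q (λ d → F (setAt g v d)))
  sumV-forget q (suc n) F zero    _       0<q = ≈-sym (begin
    SumR q (λ c → sumV q n (λ g → δ c ⊗ SumR q (λ d → F (d ∷ g))))   ≈⟨ SumR-single q 0 0<q vanish ⟩
    sumV q n (λ g → 1# ⊗ SumR q (λ d → F (d ∷ g)))                   ≈⟨ sumV-cong q n (λ g _ → ⊗-identityˡ _) ⟩
    sumV q n (λ g → SumR q (λ d → F (d ∷ g)))                        ≈⟨ sumV-Sum q n q _ ⟨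
    SumR q (λ d → sumV q n (λ g → F (d ∷ g)))                        ∎)
    where
    vanish : ∀ c → c < q → c ≢ 0 → sumV q n (λ g → δ c ⊗ SumR q (λ d → F (d ∷ g))) ≈ 0#
    vanish zero    _ c≢0 = ⊥-elim (c≢0 refl)
    vanish (suc c) _ _   = sumV-0 q n λ g _ → ⊗-zeroˡ _
  sumV-forget q (suc n) F (suc v) (s≤s h) 0<q = SumR-cong q λ d _ → sumV-forget q n (λ g → F (d ∷ g)) v h 0<q

  -- Eliminating the vertices of a tree of tables: every table τ s is a factor
  -- that sees the assignment g only through its index enc s g.
  module Elimination (q n : ℕ) (0<q : 0 < q) (enc : ℕ → Vec ℕ n → ℕ) (nd : ℕ → ℕ) where

    total : (ℕ → ℕ → A) → (ℕ → ℕ → A) → ℕ → A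
    total φ τ i = sumV q n (λ g → ProdR n (λ v → φ v (at g v)) ⊗ ProdR (suc i) (λ j → τ (nd j) (enc (nd j) g)))

    forget : ∀ φ φ′ τ τ′ i v → v < n →
      (∀ j → j < i → ∀ g d → enc (nd j) (setAt g v d) ≡ enc (nd j) g) →
      (∀ u d → u ≢ v → φ′ u d ≡ φ u d) → (∀ d → φ′ v d ≡ δ d) →
      (∀ j → j < i → ∀ g → Digits q g → τ′ (nd j) (enc (nd j) g) ≈ τ (nd j) (enc (nd j) g)) →
      (∀ g → Digits q g → τ′ (nd i) (enc (nd i) g) ≈ SumR q (λ d → φ v d ⊗ τ (nd i) (enc (nd i) (setAt g v d)))) →
      total φ τ i ≈ total φ′ τ′ i
    forget φ φ′ τ τ′ i v v<n indep φ-other φ-same τ-other τ-same = ≈-trans (sumV-forget q n _ v v<n 0<q) (sumV-cong q n pointwise)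
      where
      pointwise : ∀ g → Digits q g → _ ≈ _
      pointwise g hg = begin
        δ (at g v) ⊗ SumR q (λ d → ProdR n (λ u → φ u (at (setAt g v d) u)) ⊗
                                   (ProdR i (λ j → τ (nd j) (enc (nd j) (setAt g v d))) ⊗ τ (nd i) (enc (nd i) (setAt g v d))))
          ≈⟨ ⊗-congˡ (SumR-cong q λ d _ → ≈-trans (⊗-cong (vertex d) (⊗-congʳ (tables d))) (rearrange d)) ⟩
        δ (at g v) ⊗ SumR q (λ d → (P ⊗ Tb) ⊗ (φ v d ⊗ τ (nd i) (enc (nd i) (setAt g v d))))
          ≈⟨ ⊗-congˡ (≈-trans (SumR-*ˡ q (P ⊗ Tb) _) (⊗-congˡ (≈-sym (τ-same g hg)))) ⟩
        δ (at g v) ⊗ ((P ⊗ Tb) ⊗ τ′ (nd i) (enc (nd i) g))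
          ≈⟨ ⊗-congˡ (⊗-assoc P Tb _) ⟩
        δ (at g v) ⊗ (P ⊗ (Tb ⊗ τ′ (nd i) (enc (nd i) g)))
          ≈⟨ ⊗-assoc _ _ _ ⟨
        (δ (at g v) ⊗ P) ⊗ (Tb ⊗ τ′ (nd i) (enc (nd i) g))
          ≈⟨ ⊗-cong vertex′ (⊗-congʳ (ProdR-cong i λ j j<i → τ-other j j<i g hg)) ⟨
        ProdR n (λ u → φ′ u (at g u)) ⊗ (ProdR i (λ j → τ′ (nd j) (enc (nd j) g)) ⊗ τ′ (nd i) (enc (nd i) g)) ∎
        where
        P Tb : A
        P = ProdR n (withoutR v (λ u → φ u (at g u)))
        Tb = ProdR i (λ j → τ (nd j) (enc (nd j) g))
        without-cong : ∀ (f f′ : ℕ → A) → (∀ u → u ≢ v → f u ≡ f′ u) → ProdR n (withoutR v f) ≈ ProdR n (withoutR v f′)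
        without-cong f f′ h = ProdR-cong n go
          where
          go : ∀ u → u < n → withoutR v f u ≈ withoutR v f′ u
          go u _ with u ≡ᵇ v in u≟v
          ... | true  = ≈-refl
          ... | false = reflexive (h u λ u≡v → subst T u≟v (≡⇒≡ᵇ u v u≡v))
        vertex : ∀ d → ProdR n (λ u → φ u (at (setAt g v d) u)) ≈ φ v d ⊗ P
        vertex d = ≈-trans (ProdR-extract n _ v v<n)
          (⊗-cong (reflexive (cong (φ v) (at-same g v d v<n)))
                  (without-cong _ _ λ u u≢v → cong (φ u) (at-other g v d u u≢v)))
        vertex′ : ProdR n (λ u → φ′ u (at g u)) ≈ δ (at g v) ⊗ P
        vertex′ = ≈-trans (ProdR-extract n _ v v<n)
          (⊗-cong (reflexive (φ-same _)) (without-cong _ _ λ u u≢v → φ-other u _ u≢v))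
        tables : ∀ d → ProdR i (λ j → τ (nd j) (enc (nd j) (setAt g v d))) ≈ Tb
        tables d = ProdR-cong i λ j j<i → reflexive (cong (τ (nd j)) (indep j j<i g d))
        rearrange : ∀ d → (φ v d ⊗ P) ⊗ (Tb ⊗ τ (nd i) (enc (nd i) (setAt g v d))) ≈
                          (P ⊗ Tb) ⊗ (φ v d ⊗ τ (nd i) (enc (nd i) (setAt g v d)))
        rearrange d = ≈-trans (⊗-congʳ (⊗-comm (φ v d) P)) (⊗-interchange P (φ v d) Tb _)

    merge : ∀ φ τ τ′ i j₀ → j₀ < suc i →
      (∀ j → j < suc i → j ≢ j₀ → ∀ g → Digits q g → τ′ (nd j) (enc (nd j) g) ≈ τ (nd j) (enc (nd j) g)) →
      (∀ g → Digits q g → (∃ λ v → v < n × φ v (at g v) ≈ 0#) ⊎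
         (τ′ (nd j₀) (enc (nd j₀) g) ≈ τ (nd j₀) (enc (nd j₀) g) ⊗ τ (nd (suc i)) (enc (nd (suc i)) g))) →
      total φ τ (suc i) ≈ total φ τ′ i
    merge φ τ τ′ i j₀ j₀< other here′ = sumV-cong q n pointwise
      where
      pointwise : ∀ g → Digits q g → _ ≈ _
      pointwise g hg with here′ g hg
      ... | inj₁ (v , v<n , zro) = ≈-trans (vanish _) (≈-sym (vanish _))
        where
        vanish : ∀ y → ProdR n (λ v → φ v (at g v)) ⊗ y ≈ 0#
        vanish y = ≈-trans (⊗-congʳ (≈-trans (ProdR-extract n _ v v<n) (≈-trans (⊗-congʳ zro) (⊗-zeroˡ _)))) (⊗-zeroˡ _)
      ... | inj₂ eq = ⊗-congˡ (begin
        ProdR (suc i) f ⊗ x                          ≈⟨ ⊗-congʳ (ProdR-extract (suc i) f j₀ j₀<) ⟩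
        (f j₀ ⊗ ProdR (suc i) (withoutR j₀ f)) ⊗ x   ≈⟨ ⊗-comm _ x ⟩
        x ⊗ (f j₀ ⊗ ProdR (suc i) (withoutR j₀ f))   ≈⟨ ⊗-assoc x _ _ ⟨
        (x ⊗ f j₀) ⊗ ProdR (suc i) (withoutR j₀ f)   ≈⟨ ⊗-cong (≈-trans (⊗-comm x _) (≈-sym eq)) (ProdR-cong (suc i) rest) ⟩
        f′ j₀ ⊗ ProdR (suc i) (withoutR j₀ f′)       ≈⟨ ProdR-extract (suc i) f′ j₀ j₀< ⟨
        ProdR (suc i) f′                             ∎)
        where
        f f′ : ℕ → A
        f  j = τ (nd j) (enc (nd j) g)
        f′ j = τ′ (nd j) (enc (nd j) g)
        x : A
        x = f (suc i)
        rest : ∀ j → j < suc i → withoutR j₀ f j ≈ withoutR j₀ f′ j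
        rest j j< with j ≡ᵇ j₀ in j≟
        ... | true  = ≈-refl
        ... | false = ≈-sym (other j j< (λ j≡ → subst T j≟ (≡⇒≡ᵇ j j₀ j≡)) g hg)

    total-end : ∀ φ τ (z : Vec ℕ n) → (∀ v → v < n → at z v ≡ 0) → (∀ v d → v < n → φ v d ≡ δ d) → total φ τ 0 ≈ τ (nd 0) (enc (nd 0) z)
    total-end φ τ z z≡0 φ≡δ = ≈-trans (sumV-single q n z (λ v v< → subst (_< q) (sym (z≡0 v v<)) 0<q) vanish)
      (≈-trans (⊗-cong (ProdR-ones n λ v v< → reflexive (trans (φ≡δ v _ v<) (cong δ (z≡0 v v<)))) (⊗-identityˡ _)) (⊗-identityˡ _))
      where
      ProdR-ones : ∀ n {f} → (∀ i → i < n → f i ≈ 1#) → ProdR n f ≈ 1#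
      ProdR-ones = Sums.Prod-1 R
      vanish : ∀ g → Digits q g → g ≢ z → _ ≈ 0#
      vanish g hg g≢z = search n (λ v v< → v<) λ all → g≢z (at-ext g z λ v v< → trans (all v v<) (sym (z≡0 v v<)))
        where
        search : ∀ m → (∀ v → v < m → v < n) → ¬ (∀ v → v < m → at g v ≡ 0) →
          ProdR n (λ v → φ v (at g v)) ⊗ _ ≈ 0#
        search zero    _   none = ⊥-elim (none λ _ ())
        search (suc m) inside none with at g m in eq
        ... | suc d = ≈-trans (⊗-congʳ (≈-trans (ProdR-extract n _ m (inside m ≤-refl))
                (≈-trans (⊗-congʳ (reflexive (trans (φ≡δ m _ (inside m ≤-refl)) (cong δ eq)))) (⊗-zeroˡ _)))) (⊗-zeroˡ _)
        ... | zero  = search m (λ v v< → inside v (m<n⇒m<1+n v<)) λ all → none λ v v< → case m≤n⇒m<n∨m≡n (s≤s⁻¹ v<) of λ where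
                (inj₁ v<m)  → all v v<m
                (inj₂ refl) → eq

infix 4 _≡₄_
_≡₄_ : ℕ → ℕ → Set
a ≡₄ b = a % 4 ≡ b % 4

+₄ : ∀ {a b c d} → a ≡₄ b → c ≡₄ d → a + c ≡₄ b + d
+₄ {a} {b} {c} {d} p q = trans (%-distribˡ-+ a c 4) (trans (cong₂ (λ x y → (x + y) % 4) p q) (sym (%-distribˡ-+ b d 4)))

*₄ : ∀ {a b c d} → a ≡₄ b → c ≡₄ d → a * c ≡₄ b * d
*₄ {a} {b} {c} {d} p q = trans (%-distribˡ-* a c 4) (trans (cong₂ (λ x y → (x * y) % 4) p q) (sym (%-distribˡ-* b d 4)))

Sum₄ : ∀ n {f g} → (∀ i → i < n → f i ≡₄ g i) → Sum n f ≡₄ Sum n g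
Sum₄ zero    h = refl
Sum₄ (suc n) {f} {g} h = +₄ {Sum n f} {Sum n g} (Sum₄ n λ i i<n → h i (m<n⇒m<1+n i<n)) (h n ≤-refl)

cancel₄ : ∀ a {b c} → a + b ≡₄ a + c → b ≡₄ c
cancel₄ a {b} {c} h = trans (sym (back b)) (trans (+₄ {a + b} {a + c} {3 * a} h refl) (back c))
  where
  back : ∀ x → a + x + 3 * a ≡₄ x
  back x = trans (cong (_% 4) (solve 2 (λ a x → a :+ x :+ con 3 :* a := x :+ a :* con 4) refl a x)) ([m+kn]%n≡m%n x a 4)

Series : Set
Series = ℕ → ℕ

conv : Series → Series → Series
conv f g zero    = f 0 * g 0
conv f g (suc e) = f 0 * g (suc e) + conv (f ∘ suc) g e

conv-cong₄ : ∀ e {f f′ g g′} → (∀ i → i ≤ e → f i ≡₄ f′ i) → (∀ i → i ≤ e → g i ≡₄ g′ i) → conv f g e ≡₄ conv f′ g′ e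
conv-cong₄ zero    {f} {f′} p q = *₄ {f 0} {f′ 0} (p 0 z≤n) (q 0 z≤n)
conv-cong₄ (suc e) {f} {f′} {g} {g′} p q = +₄ {f 0 * g (suc e)} {f′ 0 * g′ (suc e)}
  (*₄ {f 0} {f′ 0} (p 0 z≤n) (q (suc e) ≤-refl))
  (conv-cong₄ e (λ i i≤e → p (suc i) (s≤s i≤e)) (λ i i≤e → q i (m≤n⇒m≤1+n i≤e)))

conv-Sum : ∀ e f g → conv f g e ≡ Sum (e + 1) (λ i → f i * g (e ∸ i))
conv-Sum e f g = trans (go e f) (cong (λ n → Sum n (λ i → f i * g (e ∸ i))) (+-comm 1 e))
  where
  go : ∀ e f → conv f g e ≡ Sum (suc e) (λ i → f i * g (e ∸ i))
  go zero    f = refl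
  go (suc e) f = trans (cong (f 0 * g (suc e) +_) (go e (f ∘ suc))) (sym (Sum-shift (suc e) (λ i → f i * g (suc e ∸ i))))

conv-+ : ∀ e f f′ g → conv (λ i → f i + f′ i) g e ≡ conv f g e + conv f′ g e
conv-+ zero    f f′ g = *-distribʳ-+ (g 0) (f 0) (f′ 0)
conv-+ (suc e) f f′ g = trans (cong₂ _+_ (*-distribʳ-+ (g (suc e)) (f 0) (f′ 0)) (conv-+ e (f ∘ suc) (f′ ∘ suc) g))
  (solve 4 (λ a b c d → a :+ b :+ (c :+ d) := a :+ c :+ (b :+ d)) refl (f 0 * g (suc e)) (f′ 0 * g (suc e)) _ _)

conv-* : ∀ e c f g → conv (λ i → c * f i) g e ≡ c * conv f g e
conv-* zero    c f g = *-assoc c (f 0) (g 0)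
conv-* (suc e) c f g = trans (cong₂ _+_ (*-assoc c (f 0) _) (conv-* e c (f ∘ suc) g)) (sym (*-distribˡ-+ c _ _))

conv-last : ∀ e f g → conv f g (suc e) ≡ g 0 * f (suc e) + conv f (g ∘ suc) e
conv-last zero    f g = solve 4 (λ a b c d → a :* b :+ c :* d := d :* c :+ a :* b) refl (f 0) (g 1) (f 1) (g 0)
conv-last (suc e) f g = trans (cong (f 0 * g (2 + e) +_) (conv-last e (f ∘ suc) g))
  (solve 3 (λ a b c → a :+ (b :+ c) := b :+ (a :+ c)) refl (f 0 * g (2 + e)) (g 0 * f (2 + e)) _)

conv-comm : ∀ e f g → conv f g e ≡ conv g f e
conv-comm zero    f g = *-comm (f 0) (g 0)
conv-comm (suc e) f g = trans (conv-last e f g) (cong (g 0 * f (suc e) +_) (conv-comm e f (g ∘ suc)))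

conv-assoc : ∀ e f g h → conv (conv f g) h e ≡ conv f (conv g h) e
conv-assoc zero    f g h = *-assoc (f 0) (g 0) (h 0)
conv-assoc (suc e) f g h = begin
  f 0 * g 0 * h (suc e) + conv (λ i → f 0 * g (suc i) + conv (f ∘ suc) g i) h e
    ≡⟨ cong₂ _+_ (*-assoc (f 0) (g 0) _) (conv-+ e (λ i → f 0 * g (suc i)) _ h) ⟩
  f 0 * (g 0 * h (suc e)) + (conv (λ i → f 0 * g (suc i)) h e + conv (conv (f ∘ suc) g) h e)
    ≡⟨ cong (f 0 * (g 0 * h (suc e)) +_) (cong₂ _+_ (conv-* e (f 0) (g ∘ suc) h) (conv-assoc e (f ∘ suc) g h)) ⟩
  f 0 * (g 0 * h (suc e)) + (f 0 * conv (g ∘ suc) h e + conv (f ∘ suc) (conv g h) e)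
    ≡⟨ solve 4 (λ a b c d → a :* b :+ (a :* c :+ d) := a :* (b :+ c) :+ d) refl (f 0) (g 0 * h (suc e)) _ _ ⟩
  f 0 * (g 0 * h (suc e) + conv (g ∘ suc) h e) + conv (f ∘ suc) (conv g h) e ∎
  where open ≡-Reasoning

mono : ℕ → ℕ → Series
mono c x e = if e ≡ᵇ x then c else 0

conv-zero : ∀ e g → conv (λ _ → 0) g e ≡ 0
conv-zero zero    g = refl
conv-zero (suc e) g = conv-zero e g

conv-mono : ∀ e c x f → conv (mono c x) f e ≡ c * (bit (x <ᵇ e + 1) * f (e ∸ x))
conv-mono zero    c zero    f = cong (c *_) (sym (+-identityʳ (f 0)))
conv-mono zero    c (suc x) f = sym (*-zeroʳ c)
conv-mono (suc e) c zero    f = trans (cong (c * f (suc e) +_) (conv-zero e f))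
  (trans (+-identityʳ _) (cong (c *_) (sym (+-identityʳ (f (suc e))))))
conv-mono (suc e) c (suc x) f = conv-mono e c x f

mono-mono : ∀ e c x d y → conv (mono c x) (mono d y) e ≡ mono (c * d) (x + y) e
mono-mono zero    c zero    d zero    = refl
mono-mono zero    c zero    d (suc y) = *-zeroʳ c
mono-mono zero    c (suc x) d y       = refl
mono-mono (suc e) c zero    d y       = trans (cong (c * mono d y (suc e) +_) (conv-zero e (mono d y)))
  (trans (+-identityʳ _) (scale (suc e ≡ᵇ y)))
  where
  scale : ∀ b → c * (if b then d else 0) ≡ (if b then c * d else 0)
  scale true  = refl
  scale false = *-zeroʳ c
mono-mono (suc e) c (suc x) d y       = mono-mono e c x d y

module Truncated (E : ℕ) where

  infix 4 _≈_
  record _≈_ (f g : Series) : Set where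
    constructor coeffs
    field coeff : ∀ e → e < E → f e ≡₄ g e
  open _≈_ public

  exactly : ∀ {f g} → (∀ e → f e ≡ g e) → f ≈ g
  exactly h = coeffs λ e _ → cong (_% 4) (h e)

  open import Algebra.Structures _≈_ using () renaming (IsCommutativeMonoid to IsCommMonoid)
  open import Algebra.Structures.Biased _≈_ using (isCommutativeSemiringˡ)

  private
    commutativeMonoid : ∀ {_∙_ : Series → Series → Series} {ι : Series} →
      (∀ {f f′ g g′} → f ≈ f′ → g ≈ g′ → (f ∙ g) ≈ (f′ ∙ g′)) →
      (∀ f g h → ((f ∙ g) ∙ h) ≈ (f ∙ (g ∙ h))) → (∀ f → (ι ∙ f) ≈ f) →
      (∀ f g → (f ∙ g) ≈ (g ∙ f)) → IsCommMonoid _∙_ ι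
    commutativeMonoid {_∙_} cng asc idˡ com = record
      { isMonoid = record
        { isSemigroup = record
          { isMagma = record
            { isEquivalence = record { refl = coeffs λ e _ → refl ; sym = λ h → coeffs λ e e< → sym (coeff h e e<) ; trans = λ h k → coeffs λ e e< → trans (coeff h e e<) (coeff k e e<) }
            ; ∙-cong = cng }
          ; assoc = asc }
        ; identity = idˡ , λ f → coeffs λ e e< → trans (coeff (com f _) e e<) (coeff (idˡ f) e e<) }
      ; comm = com }

  series : CommutativeSemiring 0ℓ 0ℓ
  series = record
    { Carrier = Series
    ; _≈_ = _≈_
    ; _+_ = λ f g e → f e + g e
    ; _*_ = conv
    ; 0#  = λ _ → 0
    ; 1#  = mono 1 0
    ; isCommutativeSemiring = isCommutativeSemiringˡ record
      { +-isCommutativeMonoid = commutativeMonoid (λ {f} {f′} p q → coeffs λ e e< → +₄ {f e} {f′ e} (coeff p e e<) (coeff q e e<))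
          (λ f g h → exactly λ e → +-assoc (f e) (g e) (h e)) (λ f → exactly λ e → refl) (λ f g → exactly λ e → +-comm (f e) (g e))
      ; *-isCommutativeMonoid = commutativeMonoid
          (λ p q → coeffs λ e e< → conv-cong₄ e (λ i i≤ → coeff p i (≤-<-trans i≤ e<)) (λ i i≤ → coeff q i (≤-<-trans i≤ e<)))
          (λ f g h → exactly λ e → conv-assoc e f g h)
          (λ f → exactly λ e → trans (conv-mono e 1 0 f) (trans (+-identityʳ _)
             (trans (cong (λ k → bit (0 <ᵇ k) * f e) (+-comm e 1)) (+-identityʳ (f e)))))
          (λ f g → exactly λ e → conv-comm e f g)
      ; distribʳ = λ f g h → exactly λ e → conv-+ e g h f
      ; zeroˡ    = λ f → exactly λ e → conv-zero e f
      }
    }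

-- Counting labellings modulo 4

Sum-term : ∀ n f i → i < n → f i ≤ Sum n f
Sum-term (suc n) f i i<n with m≤n⇒m<n∨m≡n (s≤s⁻¹ i<n)
... | inj₁ i<n′ = ≤-trans (Sum-term n f i i<n′) (m≤m+n _ _)
... | inj₂ refl = m≤n+m (f n) _

eqN : ℕ → ℕ → ℕ
eqN a b = 1 ∸ (bit (a <ᵇ b) + bit (b <ᵇ a))

bit-< : ∀ {a b} → a < b → bit (a <ᵇ b) ≡ 1
bit-< {a} {b} a<b = cong bit (Equivalence.to T-≡ (<⇒<ᵇ a<b))

bit-≥ : ∀ {a b} → b ≤ a → bit (a <ᵇ b) ≡ 0
bit-≥ {a} {b} b≤a with a <ᵇ b in eq
... | false = refl
... | true  = ⊥-elim (≤⇒≯ b≤a (<ᵇ⇒< a b (subst T (sym eq) tt)))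

eqN-refl : ∀ a → eqN a a ≡ 1
eqN-refl a = cong (λ x → 1 ∸ (x + x)) (bit-≥ (≤-refl {a}))

eqN-≢ : ∀ {a b} → a ≢ b → eqN a b ≡ 0
eqN-≢ {a} {b} a≢b with <-cmp a b
... | tri< a<b _ _ = trans (cong (λ x → 1 ∸ (x + bit (b <ᵇ a))) (bit-< a<b)) (0∸n≡0 (bit (b <ᵇ a)))
... | tri≈ _ a≡b _ = ⊥-elim (a≢b a≡b)
... | tri> _ _ b<a = trans (cong (λ x → 1 ∸ (bit (a <ᵇ b) + x)) (bit-< b<a)) (trans (cong (1 ∸_) (+-comm (bit (a <ᵇ b)) 1)) (0∸n≡0 (bit (a <ᵇ b))))

open VectorSums +-*-commutativeSemiring public using (sumV-Sum) renaming
  (sumV to sumN; sumV-cong to sumN-cong; sumV-0 to sumN-0; sumV-+ to sumN-+; sumV-*ˡ to sumN-*ˡ; sumV-single to sumN-single; sumV-forget to sumN-forget; δ to δN)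

flipV : ∀ {n} → (ℕ → Bool) → Vec ℕ n → Vec ℕ n
flipV m []      = []
flipV m (c ∷ b) = (if m 0 then 1 ∸ c else c) ∷ flipV (m ∘ suc) b

at-flip : ∀ {n} m (b : Vec ℕ n) v → v < n → at (flipV m b) v ≡ (if m v then 1 ∸ at b v else at b v)
at-flip m (c ∷ b) zero    _       = refl
at-flip m (c ∷ b) (suc v) (s≤s h) = at-flip (m ∘ suc) b v h

sumN-flip : ∀ n m F → sumN 2 n (F ∘ flipV m) ≡ sumN 2 n F
sumN-flip zero    m F = refl
sumN-flip (suc n) m F = trans (cong₂ (λ x y → 0 + x + y) (sumN-flip n (m ∘ suc) _) (sumN-flip n (m ∘ suc) _)) (swapped (m 0))
  where
  G : ℕ → ℕ
  G c = sumN 2 n (λ b → F (c ∷ b))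
  swapped : ∀ s → G (if s then 1 else 0) + G (if s then 0 else 1) ≡ G 0 + G 1
  swapped true  = +-comm (G 1) (G 0)
  swapped false = refl

flip-half : ∀ n m F x → x < n → T (m x) → (∀ b → Digits 2 b → F (flipV m b) ≡ F b) →
  sumN 2 n F ≡ 2 * sumN 2 n (λ b → δN (at b x) * F b)
flip-half n m F x x<n mx inv = begin
  sumN 2 n F                                         ≡⟨ sumN-cong 2 n (λ b hb → split b (hb x x<n)) ⟩
  sumN 2 n (λ b → H b + K b)                         ≡⟨ sumN-+ 2 n H K ⟩
  sumN 2 n H + sumN 2 n K                            ≡⟨ cong (sumN 2 n H +_) (sumN-flip n m K) ⟨
  sumN 2 n H + sumN 2 n (K ∘ flipV m)                ≡⟨ cong (sumN 2 n H +_) (sumN-cong 2 n λ b hb → cross b hb) ⟩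
  sumN 2 n H + sumN 2 n H                            ≡⟨ cong (sumN 2 n H +_) (+-identityʳ _) ⟨
  2 * sumN 2 n H                                     ∎
  where
  open ≡-Reasoning
  H K : Vec ℕ n → ℕ
  H b = δN (at b x) * F b
  K b = δN (1 ∸ at b x) * F b
  split : ∀ b → at b x < 2 → F b ≡ H b + K b
  split b h with at b x
  ... | 0 = sym (trans (+-identityʳ _) (+-identityʳ _))
  ... | 1 = sym (+-identityʳ _)
  split b (s≤s (s≤s ())) | suc (suc _)
  cross : ∀ b → Digits 2 b → K (flipV m b) ≡ H b
  cross b hb = cong₂ _*_ (cong δN (trans (cong (1 ∸_) (trans (at-flip m b x x<n) (cong (if_then 1 ∸ at b x else at b x) (Equivalence.to T-≡ mx))))
                 (m∸[m∸n]≡n (s≤s⁻¹ (hb x x<n))))) (inv b hb)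

module Labelled (n : ℕ) (adjN : ℕ → ℕ → ℕ) (adj-sym : ∀ u v → u < n → v < n → adjN u v ≡ adjN v u) where

  -- For the label l = 0 the bit b is a side of the cut.  For l > 0, b = 1
  -- requires that no neighbour has the label l ∸ 1; its coefficient 3 is −1
  -- modulo 4.
  coefL : ℕ → ℕ → ℕ
  coefL l b = 1 + 2 * (b * bit (0 <ᵇ l))

  badL : ℕ → ℕ → ℕ → ℕ → ℕ
  badL lu bu lv bv = bit (lu + 1 <ᵇ lv) + (eqN (lu + 1) lv * bv + bit (lu + lv <ᵇ 1) * (bit (bu <ᵇ bv) + bit (bv <ᵇ bu)))

  violL : (l b : ℕ → ℕ) → ℕ
  violL l b = Sum n (λ u → Sum n (λ v → adjN u v * badL (l u) (b u) (l v) (b v)))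

  F : (l b : ℕ → ℕ) → ℕ
  F l b = Prod n (λ v → coefL (l v) (b v)) * bit (violL l b <ᵇ 1)

  F-cong : ∀ l {b b′} → (∀ v → v < n → b v ≡ b′ v) → F l b ≡ F l b′
  F-cong l h = cong₂ _*_ (Prod-cong n λ v v< → cong (coefL (l v)) (h v v<))
    (cong (λ x → bit (x <ᵇ 1)) (Sum-cong n λ u u< → Sum-cong n λ v v< → cong₂ (λ x y → adjN u v * badL (l u) x (l v) y) (h u u<) (h v v<)))

  A : (ℕ → ℕ) → ℕ
  A l = sumN 2 n (λ b → F l (at b))

  Adj : ℕ → ℕ → Set
  Adj u v = u < n × v < n × adjN u v ≢ 0

  Adj-sym : ∀ {u v} → Adj u v → Adj v u
  Adj-sym (u< , v< , a) = v< , u< , λ z → a (trans (adj-sym _ _ u< v<) z)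

  Link : (ℕ → ℕ) → ℕ → ℕ → Set
  Link l u v = l u ≡ 0 × l v ≡ 0 × Adj u v

  Lipschitz Lowered Linked : (ℕ → ℕ) → Set
  Lipschitz l = ∀ u v → Adj u v → l v ≤ l u + 1
  Lowered l   = ∀ v → v < n → l v ≢ 0 → ∃ λ u → Adj u v × l u + 1 ≡ l v
  Linked l    = ∀ x y → x < n → y < n → l x ≡ 0 → l y ≡ 0 → Star (Link l) x y

  violated : ∀ l b {u v} → Adj u v → badL (l u) (b u) (l v) (b v) ≢ 0 → F l b ≡ 0
  violated l b {u} {v} (u< , v< , a) bad = trans (cong (λ x → Prod n (λ v → coefL (l v) (b v)) * x) (bit-≥ pos)) (*-zeroʳ (Prod n (λ v → coefL (l v) (b v))))
    where
    pos : 1 ≤ violL l b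
    pos = ≤-trans (n≢0⇒n>0 (a ∘ m*n≡0⇒m≡0′))
          (≤-trans (Sum-term n (λ v → adjN u v * badL (l u) (b u) (l v) (b v)) v v<) (Sum-term n _ u u<))
      where
      m*n≡0⇒m≡0′ : adjN u v * badL (l u) (b u) (l v) (b v) ≡ 0 → adjN u v ≡ 0
      m*n≡0⇒m≡0′ z with m*n≡0⇒m≡0∨n≡0 (adjN u v) z
      ... | inj₁ z′ = z′
      ... | inj₂ z′ = ⊥-elim (bad z′)

  A≢0⇒Lipschitz : ∀ l → ¬ (A l ≡₄ 0) → Lipschitz l
  A≢0⇒Lipschitz l A≢0 u v uv with l v ≤? l u + 1
  ... | yes h = h
  ... | no ¬h = ⊥-elim (A≢0 (cong (_% 4) (sumN-0 2 n λ b _ → violated l (at b) uv λ z →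
    case trans (sym (bit-< (≰⇒> ¬h))) (m+n≡0⇒m≡0 _ z) of λ ())))

  A≢0⇒Lowered : ∀ l → ¬ (A l ≡₄ 0) → Lowered l
  A≢0⇒Lowered l A≢0 v v<n lv≢0 with anyUpTo? (λ u → (adjN u v ≢0?) ×-dec (l u + 1 ≟ l v)) n
    where
    _≢0? : ∀ x → Dec (x ≢ 0)
    x ≢0? = ¬? (x ≟ 0)
  ... | yes (u , u< , a , e) = u , (u< , v<n , a) , e
  ... | no none = ⊥-elim (A≢0 (trans (cong (_% 4) total) (m*n%n≡0 H 4)))
    where
    H : ℕ
    H = sumN 2 n (λ b → δN (at b v) * F l (at (setAt b v 0)))
    irrelevant : ∀ b u w → u < n → w < n → adjN u w * badL (l u) (at (setAt b v 1) u) (l w) (at (setAt b v 1) w)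
                                          ≡ adjN u w * badL (l u) (at (setAt b v 0) u) (l w) (at (setAt b v 0) w)
    irrelevant b u w u< w< with adjN u w in au | u ≟ v | w ≟ v
    ... | zero  | _ | _ = refl
    ... | suc a | no u≢v | no w≢v = cong (suc a *_) (cong₂ (λ x y → badL (l u) x (l w) y)
      (trans (at-other b v 1 u u≢v) (sym (at-other b v 0 u u≢v))) (trans (at-other b v 1 w w≢v) (sym (at-other b v 0 w w≢v))))
    ... | suc a | yes refl | _ = cong (suc a *_) (cong (bit (l u + 1 <ᵇ l w) +_) (cong₂ _+_ low (trans (dead _) (sym (dead _)))))
      where
      dead : ∀ z → bit (l u + l w <ᵇ 1) * z ≡ 0
      dead z = cong (_* z) (bit-≥ (≤-trans (n≢0⇒n>0 lv≢0) (m≤m+n (l u) (l w))))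
      low : eqN (l u + 1) (l w) * at (setAt b v 1) w ≡ eqN (l u + 1) (l w) * at (setAt b v 0) w
      low with w ≟ v
      ... | no w≢v = cong (eqN (l u + 1) (l w) *_) (trans (at-other b v 1 w w≢v) (sym (at-other b v 0 w w≢v)))
      ... | yes refl = trans (cong (_* at (setAt b v 1) v) ne) (sym (cong (_* at (setAt b v 0) v) ne))
        where
        ne : eqN (l u + 1) (l u) ≡ 0
        ne = eqN-≢ λ e → m+1+n≢m (l u) e
    ... | suc a | no u≢v | yes refl = cong (suc a *_) (cong (bit (l u + 1 <ᵇ l w) +_)
      (cong₂ _+_ (trans (low _) (sym (low _))) (trans (dead _) (sym (dead _)))))
      where
      low : ∀ z → eqN (l u + 1) (l w) * z ≡ 0
      low z = cong (_* z) (eqN-≢ λ e → none (u , u< , (λ z → case trans (sym au) z of λ ()) , e))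
      dead : ∀ z → bit (l u + l w <ᵇ 1) * z ≡ 0
      dead z = cong (_* z) (bit-≥ (≤-trans (n≢0⇒n>0 lv≢0) (m≤n+m (l w) (l u))))
    triple : ∀ b → F l (at (setAt b v 1)) ≡ 3 * F l (at (setAt b v 0))
    triple b = trans (cong₂ _*_ prod (cong (λ x → bit (x <ᵇ 1)) (Sum-cong n λ u u< → Sum-cong n λ w w< → irrelevant b u w u< w<)))
                     (*-assoc 3 (Prod n (λ u → coefL (l u) (at (setAt b v 0) u))) _)
      where
      lit1 : bit (0 <ᵇ l v) ≡ 1
      lit1 = bit-< (n≢0⇒n>0 lv≢0)
      rest : ∀ d → Prod n (without v (λ u → coefL (l u) (at (setAt b v d) u))) ≡ Prod n (without v (λ u → coefL (l u) (at b u)))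
      rest d = Prod-cong n go
        where
        go : ∀ u → u < n → without v (λ u → coefL (l u) (at (setAt b v d) u)) u ≡ without v (λ u → coefL (l u) (at b u)) u
        go u _ with u ≡ᵇ v in u≟v
        ... | true  = refl
        ... | false = cong (coefL (l u)) (at-other b v d u λ u≡v → subst T u≟v (≡⇒≡ᵇ u v u≡v))
      value : ∀ d → Prod n (λ u → coefL (l u) (at (setAt b v d) u)) ≡ (1 + 2 * (d * 1)) * Prod n (without v (λ u → coefL (l u) (at b u)))
      value d = trans (Prod-extract n _ v v<n) (cong₂ _*_ (cong₂ (λ x y → 1 + 2 * (x * y)) (at-same b v d v<n) lit1) (rest d))
      prod : Prod n (λ u → coefL (l u) (at (setAt b v 1) u)) ≡ 3 * Prod n (λ u → coefL (l u) (at (setAt b v 0) u))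
      prod = trans (value 1) (cong (3 *_) (sym (trans (value 0) (+-identityʳ _))))
    total : A l ≡ H * 4
    total = begin
      A l                                                    ≡⟨ sumN-forget 2 n _ v v<n (s≤s z≤n) ⟩
      sumN 2 n (λ b → δN (at b v) * (0 + F l (at (setAt b v 0)) + F l (at (setAt b v 1))))
        ≡⟨ sumN-cong 2 n (λ b _ → trans (cong (λ x → δN (at b v) * (F l (at (setAt b v 0)) + x)) (triple b))
             (solve 2 (λ d f → d :* (f :+ con 3 :* f) := con 4 :* (d :* f)) refl (δN (at b v)) (F l (at (setAt b v 0))))) ⟩
      sumN 2 n (λ b → 4 * (δN (at b v) * F l (at (setAt b v 0))))   ≡⟨ sumN-*ˡ 2 n 4 _ ⟩
      4 * H                                                  ≡⟨ *-comm 4 H ⟩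
      H * 4                                                  ∎
      where open ≡-Reasoning

  -- Exchanging the two sides on a union of components of the solution.
  F-flip : ∀ l (m : ℕ → Bool) → (∀ v → v < n → T (m v) → l v ≡ 0) → (∀ u v → Link l u v → m u ≡ m v) →
    ∀ b → Digits 2 b → F l (at (flipV m b)) ≡ F l (at b)
  F-flip l m zeros closed b hb = trans (F-cong l (at-flip m b)) (cong₂ _*_ (Prod-cong n coefs)
    (cong (λ x → bit (x <ᵇ 1)) (Sum-cong n λ u u< → Sum-cong n λ v v< → term u v u< v<)))
    where
    f : ℕ → ℕ
    f v = if m v then 1 ∸ at b v else at b v
    fixed : ∀ v → v < n → l v ≢ 0 → f v ≡ at b v
    fixed v v< lv≢0 with m v in mv
    ... | false = refl
    ... | true  = ⊥-elim (lv≢0 (zeros v v< (subst T (sym mv) tt)))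
    coefs : ∀ v → v < n → coefL (l v) (f v) ≡ coefL (l v) (at b v)
    coefs v v< with l v ≟ 0
    ... | yes z rewrite z = cong (λ x → 1 + 2 * x) (trans (*-zeroʳ (f v)) (sym (*-zeroʳ (at b v))))
    ... | no nz = cong (coefL (l v)) (fixed v v< nz)
    differ : ℕ → ℕ → ℕ
    differ x y = bit (x <ᵇ y) + bit (y <ᵇ x)
    differ-flip : ∀ x y → x < 2 → y < 2 → ∀ c → differ (if c then 1 ∸ x else x) (if c then 1 ∸ y else y) ≡ differ x y
    differ-flip x y _ _ false = refl
    differ-flip 0 0 _ _ true = refl
    differ-flip 0 1 _ _ true = refl
    differ-flip 1 0 _ _ true = refl
    differ-flip 1 1 _ _ true = refl
    differ-flip (suc (suc _)) _ (s≤s (s≤s ())) _ true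
    differ-flip _ (suc (suc _)) _ (s≤s (s≤s ())) true
    term : ∀ u v → u < n → v < n → adjN u v * badL (l u) (f u) (l v) (f v) ≡ adjN u v * badL (l u) (at b u) (l v) (at b v)
    term u v u< v< with adjN u v in auv
    ... | zero  = refl
    ... | suc a = cong (suc a *_) (cong (bit (l u + 1 <ᵇ l v) +_) (cong₂ _+_ low side))
      where
      low : eqN (l u + 1) (l v) * f v ≡ eqN (l u + 1) (l v) * at b v
      low with l v ≟ 0
      ... | no nz = cong (eqN (l u + 1) (l v) *_) (fixed v v< nz)
      ... | yes z = trans (cong (_* f v) ne) (sym (cong (_* at b v) ne))
        where
        ne : eqN (l u + 1) (l v) ≡ 0
        ne = eqN-≢ λ e → case trans (sym (+-comm (l u) 1)) (trans e z) of λ ()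
      side : bit (l u + l v <ᵇ 1) * differ (f u) (f v) ≡ bit (l u + l v <ᵇ 1) * differ (at b u) (at b v)
      side with l u + l v in s
      ... | suc _ = refl
      ... | zero  = cong (1 *_) (trans (cong (λ c → differ (f u) (if c then 1 ∸ at b v else at b v))
          (sym (closed u v (m+n≡0⇒m≡0 (l u) s , m+n≡0⇒n≡0 (l u) s , u< , v< , λ z → case trans (sym auv) z of λ ()))))
        (differ-flip (at b u) (at b v) (hb u u<) (hb v v<) (m u)))

  A≢0⇒Linked : ∀ l → ¬ (A l ≡₄ 0) → ∀ x y → x < n → y < n → l x ≡ 0 → l y ≡ 0 → ¬ ¬ Star (Link l) x y
  A≢0⇒Linked l A≢0 x y x< y< lx ly unlinked = decide n λ dec → A≢0 (trans (cong (_% 4) (total dec)) (m*n%n≡0 (sumN 2 n (λ b → δN (at b y) * G dec b)) 4))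
    where
    Reach : ℕ → Set
    Reach = Star (Link l) x
    decide : ∀ k → ¬ ¬ (∀ v → v < k → Dec (Reach v))
    decide zero    c = c λ _ ()
    decide (suc k) c = decide k λ below → ¬¬-excluded-middle λ d → c λ v v< → case m≤n⇒m<n∨m≡n (s≤s⁻¹ v<) of λ where
      (inj₁ v<k)  → below v v<k
      (inj₂ refl) → d
    module _ (dec : ∀ v → v < n → Dec (Reach v)) where
      open import Relation.Nullary.Decidable using (does)
      mx my : ℕ → Bool
      mx v with v <? n
      ... | yes v< = does (dec v v<)
      ... | no _   = false
      my v = not (mx v) ∧ (l v ≡ᵇ 0)
      mx-sound : ∀ v → T (mx v) → Reach v
      mx-sound v h with v <? n
      ... | yes v< with dec v v<
      ...   | yes r = r
      mx-complete : ∀ v → v < n → Reach v → T (mx v)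
      mx-complete v v< r with v <? n
      ... | no v≮ = v≮ v<
      ... | yes v<′ with dec v v<′
      ...   | yes _ = tt
      ...   | no ¬r = ¬r r
      reach-zero : ∀ v → Reach v → l v ≡ 0
      reach-zero v r = go lx r
        where
        go : ∀ {u} → l u ≡ 0 → Star (Link l) u v → l v ≡ 0
        go z ε = z
        go z ((_ , z′ , _) ◅ r) = go z′ r
      T-ext : ∀ a b → (T a → T b) → (T b → T a) → a ≡ b
      T-ext true  true  _ _ = refl
      T-ext false false _ _ = refl
      T-ext true  false f _ = ⊥-elim (f tt)
      T-ext false true  _ g = ⊥-elim (g tt)
      mx-closed : ∀ u v → Link l u v → mx u ≡ mx v
      mx-closed u v e@(zu , zv , uv@(u< , v< , _)) = T-ext (mx u) (mx v)
        (λ h → mx-complete v v< (mx-sound u h ◅◅ (e ◅ ε)))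
        (λ h → mx-complete u u< (mx-sound v h ◅◅ ((zv , zu , Adj-sym uv) ◅ ε)))
      my-closed : ∀ u v → Link l u v → my u ≡ my v
      my-closed u v e@(zu , zv , _) = cong₂ (λ a b → not a ∧ (b ≡ᵇ 0)) (mx-closed u v e) (trans zu (sym zv))
      not-mx-y : mx y ≡ false
      not-mx-y with mx y in eq
      ... | true  = ⊥-elim (unlinked (mx-sound y (subst T (sym eq) tt)))
      ... | false = refl
      my-y : T (my y)
      my-y = subst₂ (λ a b → T (not a ∧ (b ≡ᵇ 0))) (sym not-mx-y) (sym ly) tt
      my-zero : ∀ v → T (my v) → l v ≡ 0
      my-zero v h = ≡ᵇ⇒≡ (l v) 0 (proj₂ (∧-T (not (mx v)) h))
      mx-x : mx x ≡ true
      mx-x = Equivalence.to T-≡ (mx-complete x x< ε)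
      G : Vec ℕ n → ℕ
      G b = δN (at b x) * F l (at b)
      total : A l ≡ sumN 2 n (λ b → δN (at b y) * G b) * 4
      total = begin
        A l             ≡⟨ flip-half n mx (λ b → F l (at b)) x x< (subst T (sym mx-x) tt)
                             (F-flip l mx (λ v _ h → reach-zero v (mx-sound v h)) mx-closed) ⟩
        2 * sumN 2 n G  ≡⟨ cong (2 *_) (flip-half n my G y y< my-y λ b hb → cong₂ _*_
                             (cong δN (trans (at-flip my b x x<) (cong (λ c → if not c ∧ (l x ≡ᵇ 0) then 1 ∸ at b x else at b x) mx-x)))
                             (F-flip l my (λ v _ → my-zero v) my-closed b hb)) ⟩
        2 * (2 * sumN 2 n (λ b → δN (at b y) * G b)) ≡⟨ *-assoc 2 2 (sumN 2 n (λ b → δN (at b y) * G b)) ⟨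
        4 * sumN 2 n (λ b → δN (at b y) * G b)       ≡⟨ *-comm 4 (sumN 2 n (λ b → δN (at b y) * G b)) ⟩
        sumN 2 n (λ b → δN (at b y) * G b) * 4       ∎
        where open ≡-Reasoning

  zeroV : Vec ℕ n
  zeroV = vec n (λ _ → 0)

  F-zero : ∀ l → Lipschitz l → F l (at zeroV) ≡ 1
  F-zero l lip = trans (F-cong l (at-vec n (λ _ → 0))) (trans (cong (λ x → Prod n (λ v → coefL (l v) 0) * bit (x <ᵇ 1)) none)
    (trans (*-identityʳ _) (Prod-1 n λ _ _ → refl)))
    where
    none : violL l (λ _ → 0) ≡ 0
    none = Sum-0 n λ u u< → Sum-0 n λ v v< → term u v u< v<
      where
      term : ∀ u v → u < n → v < n → adjN u v * badL (l u) 0 (l v) 0 ≡ 0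
      term u v u< v< with adjN u v in auv
      ... | zero  = refl
      ... | suc a = trans (cong (suc a *_) (cong₂ _+_ (bit-≥ (lip u v (u< , v< , λ z → case trans (sym auv) z of λ ())))
        (cong₂ _+_ (*-zeroʳ (eqN (l u + 1) (l v))) (*-zeroʳ (bit (l u + l v <ᵇ 1)))))) (*-zeroʳ (suc a))

  F-nonzero : ∀ l → Lowered l → ∀ b → (∀ v → v < n → l v ≡ 0 → at b v ≡ 0) → b ≢ zeroV → F l (at b) ≡ 0
  F-nonzero l low b bz b≢0 with anyUpTo? (λ v → ¬? (at b v ≟ 0)) n
  ... | no none = ⊥-elim (b≢0 (at-ext b zeroV λ v v< → trans (zero-at v v<) (sym (at-vec n (λ _ → 0) v v<))))
    where
    zero-at : ∀ v → v < n → at b v ≡ 0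
    zero-at v v< with at b v ≟ 0
    ... | yes z = z
    ... | no nz = ⊥-elim (none (v , v< , nz))
  ... | yes (v , v< , nz) with u , uv , e ← low v v< (nz ∘ bz v v<) = violated l (at b) uv λ z →
    nz (trans (sym (trans (cong (_* at b v) (trans (cong (λ x → eqN x (l v)) e) (eqN-refl (l v)))) (+-identityʳ (at b v))))
       (m+n≡0⇒m≡0 (eqN (l u + 1) (l v) * at b v) (m+n≡0⇒n≡0 (bit (l u + 1 <ᵇ l v)) z)))

  A-good : ∀ l → Lipschitz l → Lowered l → Linked l → ¬ (A l ≡₄ 0)
  A-good l lip low link with anyUpTo? (λ x → l x ≟ 0) n
  ... | no none = λ z → case trans (sym (cong (_% 4) one)) z of λ ()
    where
    one : A l ≡ 1
    one = trans (sumN-single 2 n zeroV (λ v v< → subst (_< 2) (sym (at-vec n _ v v<)) (s≤s z≤n))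
      (λ b hb b≢0 → F-nonzero l low b (λ v v< lv → ⊥-elim (none (v , v< , lv))) b≢0)) (F-zero l lip)
  ... | yes (x , x< , lx) = λ z → case trans (sym (cong (_% 4) two)) z of λ ()
    where
    m : ℕ → Bool
    m v = l v ≡ᵇ 0
    vanish : ∀ b → Digits 2 b → b ≢ zeroV → δN (at b x) * F l (at b) ≡ 0
    vanish b hb b≢0 with at b x in bx
    ... | suc _ = refl
    ... | zero with F l (at b) ≟ 0
    ...   | yes z  = cong (1 *_) z
    ...   | no F≢0 = cong (1 *_) (F-nonzero l low b (λ v v< lv → along bx (link x v x< v< lx lv)) b≢0)
      where
      same : ∀ {u v} → Link l u v → at b u ≡ at b v
      same {u} {v} (zu , zv , uv) with at b u ≟ at b v
      ... | yes e = e
      ... | no ne = ⊥-elim (F≢0 (violated l (at b) uv λ z → diff (m+n≡0⇒n≡0 (eqN (l u + 1) (l v) * at b v) (m+n≡0⇒n≡0 (bit (l u + 1 <ᵇ l v)) z))))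
        where
        diff : bit (l u + l v <ᵇ 1) * (bit (at b u <ᵇ at b v) + bit (at b v <ᵇ at b u)) ≢ 0
        diff z with <-cmp (at b u) (at b v) | trans (cong (λ s → bit (s <ᵇ 1) * (bit (at b u <ᵇ at b v) + bit (at b v <ᵇ at b u))) (sym (cong₂ _+_ zu zv))) z
        ... | tri< ul _ _ | z′ = case trans (sym (bit-< ul)) (m+n≡0⇒m≡0 _ (m+n≡0⇒m≡0 _ z′)) of λ ()
        ... | tri≈ _ e _  | _  = ne e
        ... | tri> _ _ gt | z′ = case trans (sym (bit-< gt)) (m+n≡0⇒n≡0 (bit (at b u <ᵇ at b v)) (m+n≡0⇒m≡0 _ z′)) of λ ()
      along : ∀ {u v} → at b u ≡ 0 → Star (Link l) u v → at b v ≡ 0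
      along z ε       = z
      along z (e ◅ r) = along (trans (sym (same e)) z) r
    two : A l ≡ 2
    two = trans (flip-half n m (λ b → F l (at b)) x x< (≡⇒≡ᵇ (l x) 0 lx)
            (F-flip l m (λ v _ → ≡ᵇ⇒≡ (l v) 0) (λ u v (zu , zv , _) → cong (_≡ᵇ 0) (trans zu (sym zv)))))
          (cong (2 *_) (trans (sumN-single 2 n zeroV (λ v v< → subst (_< 2) (sym (at-vec n _ v v<)) (s≤s z≤n)) vanish)
            (cong₂ _*_ (cong δN (at-vec n (λ _ → 0) x x<)) (F-zero l lip))))

  labels-≤ : ∀ l l′ → Lipschitz l → Lowered l′ → (∀ v → v < n → l′ v ≡ 0 → l v ≡ 0) → ∀ k v → v < n → l′ v ≡ k → l v ≤ k
  labels-≤ l l′ lip low zeros zero    v v< e = ≤-reflexive (zeros v v< e)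
  labels-≤ l l′ lip low zeros (suc k) v v< e
    with u , uv , e′ ← low v v< (λ z → case trans (sym e) z of λ ())
    = ≤-trans (lip u v uv) (≤-trans (+-monoˡ-≤ 1 (labels-≤ l l′ lip low zeros k u (proj₁ uv)
        (suc-injective (trans (+-comm 1 (l′ u)) (trans e′ e))))) (≤-reflexive (+-comm k 1)))

  labels-unique : ∀ l l′ → Lipschitz l → Lipschitz l′ → Lowered l → Lowered l′ →
    (∀ v → v < n → l v ≡ 0 → l′ v ≡ 0) → (∀ v → v < n → l′ v ≡ 0 → l v ≡ 0) → ∀ v → v < n → l v ≡ l′ v
  labels-unique l l′ lip lip′ low low′ z z′ v v< =
    ≤-antisym (labels-≤ l l′ lip low′ z′ _ v v< refl) (labels-≤ l′ l lip′ low z _ v v< refl)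

-- Isolation

sumB : ∀ t → (Vec Bool t → ℕ) → ℕ
sumB zero    f = f []
sumB (suc t) f = sumB t (λ β → f (false ∷ β)) + sumB t (λ β → f (true ∷ β))

count-sumB : ∀ t p → count t p ≡ sumB t (bit ∘ p)
count-sumB zero    p = refl
count-sumB (suc t) p = cong₂ _+_ (count-sumB t _) (count-sumB t _)

sumB-mono : ∀ t {f g} → (∀ β → f β ≤ g β) → sumB t f ≤ sumB t g
sumB-mono zero    h = h []
sumB-mono (suc t) h = +-mono-≤ (sumB-mono t λ β → h _) (sumB-mono t λ β → h _)

sumB-+ : ∀ t f g → sumB t (λ β → f β + g β) ≡ sumB t f + sumB t g
sumB-+ zero    f g = refl
sumB-+ (suc t) f g = trans (cong₂ _+_ (sumB-+ t _ _) (sumB-+ t _ _))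
  (solve 4 (λ a b c d → a :+ b :+ (c :+ d) := a :+ c :+ (b :+ d)) refl
    (sumB t (λ β → f (false ∷ β))) (sumB t (λ β → g (false ∷ β))) (sumB t (λ β → f (true ∷ β))) (sumB t (λ β → g (true ∷ β))))

sumB-* : ∀ t c f → sumB t (λ β → c * f β) ≡ c * sumB t f
sumB-* zero    c f = refl
sumB-* (suc t) c f = trans (cong₂ _+_ (sumB-* t c _) (sumB-* t c _)) (sym (*-distribˡ-+ c _ _))

sumB-1 : ∀ t → sumB t (λ _ → 1) ≡ 2 ^ t
sumB-1 zero    = refl
sumB-1 (suc t) = cong₂ _+_ (sumB-1 t) (trans (sumB-1 t) (sym (+-identityʳ _)))

sumB-swap : ∀ s t (f : Vec Bool s → Vec Bool t → ℕ) → sumB s (λ α → sumB t (f α)) ≡ sumB t (λ β → sumB s (λ α → f α β))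
sumB-swap zero    t f = refl
sumB-swap (suc s) t f = trans (cong₂ _+_ (sumB-swap s t _) (sumB-swap s t _)) (sym (sumB-+ t _ _))

sumB-++ : ∀ s t (f : Vec Bool (s + t) → ℕ) → sumB (s + t) f ≡ sumB s (λ α → sumB t (λ β → f (α Vec.++ β)))
sumB-++ zero    t f = refl
sumB-++ (suc s) t f = cong₂ _+_ (sumB-++ s t _) (sumB-++ s t _)

sumB-bit≤ : ∀ t (p : Vec Bool t → Bool) → sumB t (bit ∘ p) ≤ 2 ^ t
sumB-bit≤ t p = ≤-trans (sumB-mono t λ β → bit≤1 (p β)) (≤-reflexive (sumB-1 t))

someB : ∀ t (p : Vec Bool t → Bool) → 0 < sumB t (bit ∘ p) → ∃ λ β → T (p β)
someB zero p h with p [] in eq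
... | true = [] , subst T (sym eq) tt
someB (suc t) p h with sumB t (λ β → bit (p (false ∷ β))) in eq
... | zero  with β , pβ ← someB t (λ β → p (true ∷ β)) h = true ∷ β , pβ
... | suc _ with β , pβ ← someB t (λ β → p (false ∷ β)) (subst (0 <_) (sym eq) z<s) = false ∷ β , pβ

twoB : ∀ t (p : Vec Bool t → Bool) → 1 < sumB t (bit ∘ p) → ∃₂ λ α β → α ≢ β × T (p α) × T (p β)
twoB zero p h with p []
twoB zero p (s≤s ()) | true
twoB (suc t) p h with sumB t (λ β → bit (p (false ∷ β))) in ef
... | zero  with α , β , α≢β , pα , pβ ← twoB t (λ β → p (true ∷ β)) h = true ∷ α , true ∷ β , (λ { refl → α≢β refl }) , pα , pβ
... | suc zero with α , pα ← someB t (λ β → p (false ∷ β)) (subst (0 <_) (sym ef) z<s)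
               with β , pβ ← someB t (λ β → p (true ∷ β)) (s≤s⁻¹ h) = false ∷ α , true ∷ β , (λ ()) , pα , pβ
... | suc (suc _) with α , β , α≢β , pα , pβ ← twoB t (λ β → p (false ∷ β)) (subst (1 <_) (sym ef) (s≤s z<s)) =
  false ∷ α , false ∷ β , (λ { refl → α≢β refl }) , pα , pβ

shift : ℕ → Series → Series
shift x f e = bit (x <ᵇ e + 1) * f (e ∸ x)

shift-at : ∀ x f e → shift x f (x + e) ≡ f e
shift-at x f e = trans (cong₂ (λ b k → b * f k) (bit-< {x} {x + e + 1} (<-≤-trans (s≤s (m≤m+n x e)) (≤-reflexive (+-comm 1 (x + e))))) (m+n∸m≡n x e)) (+-identityʳ (f e))

-- A series with a nonzero coefficient can be shifted in at most one way to
-- cancel a given one: compare the lowest coefficients.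
shift-cancel : ∀ {x y} → x < y → ∀ (f g : Series) → (∀ e → shift x f e + g e ≡₄ 0) → (∀ e → shift y f e + g e ≡₄ 0) → ∀ e → f e ≡₄ 0
shift-cancel {x} {y} x<y f g hx hy e = go e (<-wellFounded e)
  where
  agree : ∀ e → shift x f e ≡₄ shift y f e
  agree e = cancel₄ (g e) {shift x f e} {shift y f e} (trans (cong (_% 4) (+-comm (g e) (shift x f e)))
    (trans (hx e) (sym (trans (cong (_% 4) (+-comm (g e) (shift y f e))) (hy e)))))
  go : ∀ e → Acc _<_ e → f e ≡₄ 0
  go e (acc rec) = trans (cong (_% 4) (sym (shift-at x f e))) (trans (agree (x + e)) late)
    where
    late : shift y f (x + e) ≡₄ 0
    late with y ≤? x + e
    ... | no y≰ = cong (λ b → (b * f (x + e ∸ y)) % 4) (bit-≥ (subst (_≤ y) (+-comm 1 (x + e)) (≰⇒> y≰)))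
    ... | yes y≤ = trans (*₄ {bit (y <ᵇ x + e + 1)} {bit (y <ᵇ x + e + 1)} {f (x + e ∸ y)} {0} refl (go _ (rec smaller)))
                         (cong (_% 4) (*-zeroʳ (bit (y <ᵇ x + e + 1))))
      where
      smaller : x + e ∸ y < e
      smaller = +-cancelˡ-< y _ _ (subst (_< y + e) (sym (m+[n∸m]≡n y≤)) (+-monoˡ-< e x<y))

module Polynomials (r : ℕ) where

  rest : ∀ {n} → (Vec ℕ (suc n) → ℕ) → Vec ℕ n → ℕ
  rest F l = Sum r (λ d → F (suc d ∷ l))

  poly : ∀ n → (Vec ℕ n → ℕ) → Vec ℕ n → Series
  poly zero    F []       e = mono (F []) 0 e
  poly (suc n) F (x ∷ xs) e = shift x (poly n (λ l → F (0 ∷ l)) xs) e + poly n (rest F) xs e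

  coefficient : ∀ n → (Vec ℕ n → ℕ) → Vec Bool n → ℕ
  coefficient zero    F []          = F []
  coefficient (suc n) F (true  ∷ S) = coefficient n (λ l → F (0 ∷ l)) S
  coefficient (suc n) F (false ∷ S) = coefficient n (rest F) S

  dichotomy : ∀ n F → (∀ S → coefficient n F S ≡₄ 0) ⊎ (∃ λ S → ¬ (coefficient n F S ≡₄ 0))
  dichotomy zero F with F [] % 4 ≟ 0
  ... | yes z = inj₁ λ { [] → z }
  ... | no nz = inj₂ ([] , nz)
  dichotomy (suc n) F with dichotomy n (λ l → F (0 ∷ l)) | dichotomy n (rest F)
  ... | inj₂ (S , nz) | _             = inj₂ (true ∷ S , nz)
  ... | inj₁ _        | inj₂ (S , nz) = inj₂ (false ∷ S , nz)
  ... | inj₁ z        | inj₁ z′       = inj₁ λ { (true ∷ S) → z S ; (false ∷ S) → z′ S }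

  poly-0 : ∀ n F → (∀ S → coefficient n F S ≡₄ 0) → ∀ xs e → poly n F xs e ≡₄ 0
  poly-0 zero    F h []       zero    = h []
  poly-0 zero    F h []       (suc e) = refl
  poly-0 (suc n) F h (x ∷ xs) e = +₄ {shift x f e} {0} {poly n (rest F) xs e} {0}
    (trans (*₄ {b} {b} {f (e ∸ x)} {0} refl (poly-0 n _ (λ S → h (true ∷ S)) xs (e ∸ x))) (cong (_% 4) (*-zeroʳ b)))
    (poly-0 n _ (λ S → h (false ∷ S)) xs e)
    where
    b = bit (x <ᵇ e + 1)
    f = poly n (λ l → F (0 ∷ l)) xs

  exponent : ∀ {n} → Vec ℕ n → Vec ℕ n → ℕ
  exponent []       []      = 0
  exponent (x ∷ xs) (c ∷ l) = bit (c <ᵇ 1) * x + exponent xs l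

  poly-sum : ∀ n F xs e → poly n F xs e ≡ sumN (suc r) n (λ l → bit (e ≡ᵇ exponent xs l) * F l)
  poly-sum zero F [] e = pick (e ≡ᵇ 0)
    where
    pick : ∀ b → (if b then F [] else 0) ≡ bit b * F []
    pick true  = sym (+-identityʳ _)
    pick false = refl
  poly-sum (suc n) F (x ∷ xs) e = sym (begin
    Sum (suc r) G                      ≡⟨ Sum-shift r G ⟩
    G 0 + Sum r (G ∘ suc)              ≡⟨ cong₂ _+_ first others ⟩
    poly (suc n) F (x ∷ xs) e          ∎)
    where
    open ≡-Reasoning
    G : ℕ → ℕ
    G c = sumN (suc r) n (λ l → bit (e ≡ᵇ bit (c <ᵇ 1) * x + exponent xs l) * F (c ∷ l))
    split : ∀ x e y → bit (e ≡ᵇ x + y) ≡ bit (x <ᵇ e + 1) * bit (e ∸ x ≡ᵇ y)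
    split zero    e       y = sym (trans (cong (λ k → bit (0 <ᵇ k) * bit (e ≡ᵇ y)) (+-comm e 1)) (+-identityʳ _))
    split (suc x) zero    y = refl
    split (suc x) (suc e) y = split x e y
    first : G 0 ≡ shift x (poly n (λ l → F (0 ∷ l)) xs) e
    first = trans (sumN-cong (suc r) n λ l _ → trans (cong (λ k → bit (e ≡ᵇ k + exponent xs l) * F (0 ∷ l)) (+-identityʳ x))
              (trans (cong (_* F (0 ∷ l)) (split x e (exponent xs l))) (*-assoc (bit (x <ᵇ e + 1)) _ _)))
            (trans (sumN-*ˡ (suc r) n (bit (x <ᵇ e + 1)) _) (cong (bit (x <ᵇ e + 1) *_) (sym (poly-sum n _ xs (e ∸ x)))))
    others : Sum r (G ∘ suc) ≡ poly n (rest F) xs e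
    others = trans (sumV-Sum (suc r) n r _) (trans (sumN-cong (suc r) n λ l _ → Sum-*ˡ r (bit (e ≡ᵇ exponent xs l)) (λ d → F (suc d ∷ l))) (sym (poly-sum n (rest F) xs e)))

  matches : ∀ {n} → Vec Bool n → Vec ℕ n → Bool
  matches []          []      = true
  matches (true  ∷ S) (c ∷ l) = (c <ᵇ 1) ∧ matches S l
  matches (false ∷ S) (c ∷ l) = (0 <ᵇ c) ∧ matches S l

  coefficient-sum : ∀ n F S → coefficient n F S ≡ sumN (suc r) n (λ l → bit (matches S l) * F l)
  coefficient-sum zero    F []          = sym (+-identityʳ _)
  coefficient-sum (suc n) F (true  ∷ S) = sym (trans (Sum-shift r _)
    (trans (cong₂ _+_ (sym (coefficient-sum n _ S)) (Sum-0 r λ i _ → sumN-0 (suc r) n λ _ _ → refl)) (+-identityʳ _)))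
  coefficient-sum (suc n) F (false ∷ S) = sym (trans (Sum-shift r _)
    (trans (cong₂ _+_ (sumN-0 (suc r) n λ _ _ → refl) (sumV-Sum (suc r) n r _))
      (trans (sumN-cong (suc r) n λ l _ → Sum-*ˡ r (bit (matches S l)) (λ d → F (suc d ∷ l))) (sym (coefficient-sum n (rest F) S)))))

  sumN₄ : ∀ q n {F G} → (∀ l → Digits q l → F l ≡₄ G l) → sumN q n F ≡₄ sumN q n G
  sumN₄ q zero    h = h [] λ _ ()
  sumN₄ q (suc n) h = Sum₄ q λ d d<q → sumN₄ q n λ l hl → h (d ∷ l) (Digits-∷ d<q hl)

  coefficient-single : ∀ n F S l → Digits (suc r) l → T (matches S l) →
    (∀ l′ → Digits (suc r) l′ → T (matches S l′) → l′ ≢ l → F l′ ≡₄ 0) → coefficient n F S ≡₄ F l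
  coefficient-single n F S l hl ml other = trans (cong (_% 4) (coefficient-sum n F S))
    (trans (sumN₄ (suc r) n {G = λ l → (bit (matches S l) * F l) % 4} λ l _ → sym (m%n%n≡m%n (bit (matches S l) * F l) 4))
    (trans (cong (_% 4) (sumN-single (suc r) n l hl vanish)) (trans (m%n%n≡m%n (bit (matches S l) * F l) 4) (cong (_% 4) (trans (cong (λ b → bit b * F l) (Equivalence.to T-≡ ml)) (+-identityʳ (F l)))))))
    where
    vanish : ∀ l′ → Digits (suc r) l′ → l′ ≢ l → (bit (matches S l′) * F l′) % 4 ≡ 0
    vanish l′ hl′ ne with matches S l′ in eq
    ... | false = refl
    ... | true  = trans (cong (_% 4) (+-identityʳ (F l′))) (other l′ hl′ (subst T (sym eq) tt) ne)

bitAt : ∀ {t} → Vec Bool t → ℕ → ℕ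
bitAt []      i       = 0
bitAt (b ∷ β) zero    = bit b
bitAt (b ∷ β) (suc i) = bitAt β i

bitAt-++ˡ : ∀ {s t} (α : Vec Bool s) (β : Vec Bool t) i → i < s → bitAt (α Vec.++ β) i ≡ bitAt α i
bitAt-++ˡ (a ∷ α) β zero    _       = refl
bitAt-++ˡ (a ∷ α) β (suc i) (s≤s h) = bitAt-++ˡ α β i h

bitAt-++ʳ : ∀ {s t} (α : Vec Bool s) (β : Vec Bool t) i → bitAt (α Vec.++ β) (s + i) ≡ bitAt β i
bitAt-++ʳ []      β i = refl
bitAt-++ʳ (a ∷ α) β i = bitAt-++ʳ α β i

vec-cong : ∀ n {f g} → (∀ v → v < n → f v ≡ g v) → vec n f ≡ vec n g
vec-cong zero    h = refl
vec-cong (suc n) h = cong₂ _∷_ (h 0 z<s) (vec-cong n λ v v< → h (suc v) (s<s v<))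

binary : ℕ → (ℕ → ℕ) → ℕ
binary m f = Sum m (λ j → f j * 2 ^ j)

binary-suc : ∀ m f → binary (suc m) f ≡ f 0 + 2 * binary m (f ∘ suc)
binary-suc m f = trans (Sum-shift m _) (cong₂ _+_ (*-identityʳ (f 0))
  (trans (Sum-cong m λ j _ → solve 2 (λ a b → a :* (con 2 :* b) := con 2 :* (a :* b)) refl (f (suc j)) (2 ^ j)) (Sum-*ˡ m 2 _)))

binary-inj : ∀ {m} (α β : Vec Bool m) → binary m (bitAt α) ≡ binary m (bitAt β) → α ≡ β
binary-inj []      []      eq = refl
binary-inj {suc m} (a ∷ α) (b ∷ β) eq = cong₂ _∷_ (bit-inj a b heads)
  (binary-inj α β (*-cancelˡ-≡ _ _ 2 (+-cancelˡ-≡ (bit a) _ _ (trans eq′ (cong (λ c → c + 2 * binary m (bitAt β)) (sym heads))))))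
  where
  eq′ : bit a + 2 * binary m (bitAt α) ≡ bit b + 2 * binary m (bitAt β)
  eq′ = trans (sym (binary-suc m (bitAt (a ∷ α)))) (trans eq (binary-suc m (bitAt (b ∷ β))))
  low-bit : ∀ c k → (bit c + 2 * k) % 2 ≡ bit c
  low-bit c k = trans (cong (λ k → (bit c + k) % 2) (*-comm 2 k)) (trans ([m+kn]%n≡m%n (bit c) k 2) (small c))
    where
    small : ∀ c → bit c % 2 ≡ bit c
    small true  = refl
    small false = refl
  heads : bit a ≡ bit b
  heads = trans (sym (low-bit a (binary m (bitAt α)))) (trans (cong (_% 2) eq′) (low-bit b (binary m (bitAt β))))
  bit-inj : ∀ a b → bit a ≡ bit b → a ≡ b
  bit-inj true  true  _ = refl
  bit-inj false false _ = refl

module Isolation (r m s : ℕ) where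
  open Polynomials r

  weight : (ℕ → ℕ) → ℕ
  weight f = 1 + suc s * binary m f

  weight-inj : (α β : Vec Bool m) → weight (bitAt α) ≡ weight (bitAt β) → α ≡ β
  weight-inj α β eq = binary-inj α β (*-cancelˡ-≡ _ _ (suc s) (suc-injective eq))

  weights : ∀ n → (ℕ → ℕ) → Vec ℕ n
  weights n f = vec n (λ v → weight (λ j → f (v * m + j)))

  weights-++ : ∀ n (α : Vec Bool m) (β : Vec Bool (n * m)) →
    weights (suc n) (bitAt (α Vec.++ β)) ≡ weight (bitAt α) ∷ weights n (bitAt β)
  weights-++ n α β = cong₂ _∷_
    (cong (λ k → 1 + suc s * k) (Sum-cong m λ j j<m → cong (_* 2 ^ j) (bitAt-++ˡ α β j j<m)))
    (vec-cong n λ v _ → cong (λ k → 1 + suc s * k) (Sum-cong m λ j _ → cong (_* 2 ^ j)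
      (trans (cong (bitAt (α Vec.++ β)) (+-assoc m (v * m) j)) (bitAt-++ʳ α β (v * m + j)))))

  isolation : ∀ n F S → ¬ (coefficient n F S ≡₄ 0) → ∀ (p : Vec Bool (n * m) → Bool) →
    (∀ β → T (p β) → ∀ e → poly n F (weights n (bitAt β)) e ≡₄ 0) →
    sumB (n * m) (bit ∘ p) * 2 ^ m ≤ n * 2 ^ (n * m)
  isolation zero F [] nz p h with p [] in eq
  ... | false = z≤n
  ... | true  = ⊥-elim (nz (h [] (subst T (sym eq) tt) 0))
  isolation (suc n) F S nz p h = by-head S nz
    where
    N = n * m
    c : Vec Bool N → ℕ
    c β = sumB m (λ α → bit (p (α Vec.++ β)))
    by-columns : sumB (suc n * m) (bit ∘ p) ≡ sumB N c
    by-columns = trans (sumB-++ m N _) (sumB-swap m N _)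
    zero-at : ∀ α β → T (p (α Vec.++ β)) → ∀ e →
      shift (weight (bitAt α)) (poly n (λ l → F (0 ∷ l)) (weights n (bitAt β))) e + poly n (rest F) (weights n (bitAt β)) e ≡₄ 0
    zero-at α β pβ e = subst (λ xs → poly (suc n) F xs e ≡₄ 0) (weights-++ n α β) (h (α Vec.++ β) pβ e)
    first : ∀ S → ¬ (coefficient n (λ l → F (0 ∷ l)) S ≡₄ 0) → sumB (suc n * m) (bit ∘ p) * 2 ^ m ≤ suc n * 2 ^ (suc n * m)
    first S nz = begin
      sumB (suc n * m) (bit ∘ p) * 2 ^ m             ≡⟨ cong (_* 2 ^ m) by-columns ⟩
      sumB N c * 2 ^ m                               ≤⟨ *-monoˡ-≤ (2 ^ m) (sumB-mono N column) ⟩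
      sumB N (λ β → 1 + 2 ^ m * bit (p′ β)) * 2 ^ m  ≡⟨ cong (_* 2 ^ m) (trans (sumB-+ N _ _) (cong₂ _+_ (sumB-1 N) (sumB-* N (2 ^ m) _))) ⟩
      (2 ^ N + 2 ^ m * sumB N (bit ∘ p′)) * 2 ^ m    ≡⟨ solve 3 (λ a b c → (a :+ b :* c) :* b := b :* a :+ b :* (c :* b)) refl (2 ^ N) (2 ^ m) (sumB N (bit ∘ p′)) ⟩
      2 ^ m * 2 ^ N + 2 ^ m * (sumB N (bit ∘ p′) * 2 ^ m) ≤⟨ +-monoʳ-≤ (2 ^ m * 2 ^ N) (*-monoʳ-≤ (2 ^ m) (isolation n _ S nz p′ vanish)) ⟩
      2 ^ m * 2 ^ N + 2 ^ m * (n * 2 ^ N)            ≡⟨ solve 3 (λ a b n → b :* a :+ b :* (n :* a) := (con 1 :+ n) :* (b :* a)) refl (2 ^ N) (2 ^ m) n ⟩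
      suc n * (2 ^ m * 2 ^ N)                        ≡⟨ cong (suc n *_) (^-distribˡ-+-* 2 m N) ⟨
      suc n * 2 ^ (m + N)                            ∎
      where
      open ≤-Reasoning
      p′ : Vec Bool N → Bool
      p′ β = 1 <ᵇ c β
      column : ∀ β → c β ≤ 1 + 2 ^ m * bit (p′ β)
      column β with 1 <ᵇ c β in eq
      ... | true  = ≤-trans (sumB-bit≤ m _) (≤-trans (≤-reflexive (sym (*-identityʳ (2 ^ m)))) (n≤1+n _))
      ... | false = ≤-trans (≮⇒≥ λ 1<c → subst T eq (<⇒<ᵇ 1<c)) (m≤m+n 1 _)
      vanish : ∀ β → T (p′ β) → ∀ e → poly n (λ l → F (0 ∷ l)) (weights n (bitAt β)) e ≡₄ 0
      vanish β pβ with α , α′ , α≢α′ , pα , pα′ ← twoB m (λ α → p (α Vec.++ β)) (<ᵇ⇒< 1 (c β) pβ)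
        with <-cmp (weight (bitAt α)) (weight (bitAt α′))
      ... | tri< l _ _ = shift-cancel l (poly n (λ l → F (0 ∷ l)) (weights n (bitAt β))) (poly n (rest F) (weights n (bitAt β))) (zero-at α β pα) (zero-at α′ β pα′)
      ... | tri≈ _ e _ = ⊥-elim (α≢α′ (weight-inj α α′ e))
      ... | tri> _ _ g = shift-cancel g (poly n (λ l → F (0 ∷ l)) (weights n (bitAt β))) (poly n (rest F) (weights n (bitAt β))) (zero-at α′ β pα′) (zero-at α β pα)
    by-head : ∀ S → ¬ (coefficient (suc n) F S ≡₄ 0) → sumB (suc n * m) (bit ∘ p) * 2 ^ m ≤ suc n * 2 ^ (suc n * m)
    by-head (true ∷ S)  nz = first S nz
    by-head (false ∷ S) nz with dichotomy n (λ l → F (0 ∷ l))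
    ... | inj₂ (S′ , nz′) = first S′ nz′
    ... | inj₁ zeros = begin
      sumB (suc n * m) (bit ∘ p) * 2 ^ m             ≡⟨ cong (_* 2 ^ m) by-columns ⟩
      sumB N c * 2 ^ m                               ≤⟨ *-monoˡ-≤ (2 ^ m) (sumB-mono N column) ⟩
      sumB N (λ β → 2 ^ m * bit (p′ β)) * 2 ^ m      ≡⟨ cong (_* 2 ^ m) (sumB-* N (2 ^ m) _) ⟩
      2 ^ m * sumB N (bit ∘ p′) * 2 ^ m              ≡⟨ *-assoc (2 ^ m) _ _ ⟩
      2 ^ m * (sumB N (bit ∘ p′) * 2 ^ m)            ≤⟨ *-monoʳ-≤ (2 ^ m) (isolation n _ S nz p′ vanish) ⟩
      2 ^ m * (n * 2 ^ N)                            ≤⟨ m≤n+m _ (2 ^ m * 2 ^ N) ⟩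
      2 ^ m * 2 ^ N + 2 ^ m * (n * 2 ^ N)            ≡⟨ solve 3 (λ a b n → b :* a :+ b :* (n :* a) := (con 1 :+ n) :* (b :* a)) refl (2 ^ N) (2 ^ m) n ⟩
      suc n * (2 ^ m * 2 ^ N)                        ≡⟨ cong (suc n *_) (^-distribˡ-+-* 2 m N) ⟨
      suc n * 2 ^ (m + N)                            ∎
      where
      open ≤-Reasoning
      p′ : Vec Bool N → Bool
      p′ β = 0 <ᵇ c β
      column : ∀ β → c β ≤ 2 ^ m * bit (p′ β)
      column β with 0 <ᵇ c β in eq
      ... | true  = ≤-trans (sumB-bit≤ m _) (≤-reflexive (sym (*-identityʳ (2 ^ m))))
      ... | false = ≤-trans (≮⇒≥ λ 0<c → subst T eq (<⇒<ᵇ 0<c)) z≤n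
      vanish : ∀ β → T (p′ β) → ∀ e → poly n (rest F) (weights n (bitAt β)) e ≡₄ 0
      vanish β pβ e with α , pα ← someB m (λ α → p (α Vec.++ β)) (<ᵇ⇒< 0 (c β) pβ) =
        trans (sym (+₄ {b * f} {0} {g} {g} (trans (*₄ {b} {b} {f} {0} refl (poly-0 n _ zeros (weights n (bitAt β)) (e ∸ x))) (cong (_% 4) (*-zeroʳ b))) refl))
              (zero-at α β pα e)
        where
        x = weight (bitAt α)
        b = bit (x <ᵇ e + 1)
        f = poly n (λ l → F (0 ∷ l)) (weights n (bitAt β)) (e ∸ x)
        g = poly n (rest F) (weights n (bitAt β)) e

  isolation-half : ∀ n F S → ¬ (coefficient n F S ≡₄ 0) → n * 2 ≤ 2 ^ m → ∀ (p : Vec Bool (n * m) → Bool) →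
    (∀ β → T (p β) → ∀ e → poly n F (weights n (bitAt β)) e ≡₄ 0) → 2 * count (n * m) p ≤ 2 ^ (n * m)
  isolation-half zero F S nz n≤ p h = subst (λ k → 2 * k ≤ 1) (sym none) z≤n
    where
    none : count 0 p ≡ 0
    none with m*n≡0⇒m≡0∨n≡0 (count 0 p) (n≤0⇒n≡0 (isolation zero F S nz p h))
    ... | inj₁ z = z
    ... | inj₂ z = ⊥-elim (<⇒≢ (m^n>0 2 m) (sym z))
  isolation-half (suc k) F S nz n≤ p h = *-cancelˡ-≤ (suc k) (begin
    suc k * (2 * count N p)      ≡⟨ solve 2 (λ a c → a :* (con 2 :* c) := c :* (a :* con 2)) refl (suc k) (count N p) ⟩
    count N p * (suc k * 2)      ≤⟨ *-monoʳ-≤ (count N p) n≤ ⟩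
    count N p * 2 ^ m            ≡⟨ cong (_* 2 ^ m) (count-sumB N p) ⟩
    sumB N (bit ∘ p) * 2 ^ m     ≤⟨ isolation (suc k) F S nz p h ⟩
    suc k * 2 ^ N                ∎)
    where
    N = suc k * m
    open ≤-Reasoning

-- Labels and connected dominating sets

¬¬-All : ∀ {n} {P : Fin n → Set} → (∀ i → ¬ ¬ P i) → ¬ ¬ (∀ i → P i)
¬¬-All {zero}  h c = c λ ()
¬¬-All {suc n} h c = h Fin.zero λ p → ¬¬-All (h ∘ Fin.suc) λ q → c λ { Fin.zero → p ; (Fin.suc i) → q i }

¬¬-least : (P : ℕ → Set) → ∀ k → P k → ¬ ¬ (∃ λ d → d ≤ k × P d × (∀ j → P j → d ≤ j))
¬¬-least P = <-rec (λ k → P k → ¬ ¬ (∃ λ d → d ≤ k × P d × (∀ j → P j → d ≤ j))) step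
  where
  step : ∀ k → (∀ {j} → j < k → P j → ¬ ¬ (∃ λ d → d ≤ j × P d × (∀ j → P j → d ≤ j))) → P k → ¬ ¬ (∃ λ d → d ≤ k × P d × (∀ j → P j → d ≤ j))
  step k rec pk c = ¬¬-excluded-middle {A = ∃ λ j → j < k × P j} λ where
    (yes (j , j<k , pj)) → rec j<k pj λ (d , d≤j , rest) → c (d , ≤-trans d≤j (<⇒≤ j<k) , rest)
    (no none)            → c (k , ≤-refl , pk , λ j pj → ≮⇒≥ λ j<k → none (j , j<k , pj))

module Walks {n : ℕ} (G : Graph n) where

  len : ∀ {u v} → Walk G u v → ℕ
  len ε       = 0
  len (_ ◅ w) = suc (len w)

  length-vertices : ∀ {u v} (w : Walk G u v) → length (vertices G w) ≡ suc (len w)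
  length-vertices ε       = refl
  length-vertices (_ ◅ w) = cong suc (length-vertices w)

  edges≡len : ∀ {u v} (p : Path G u v) → Path.edges p ≡ len (Path.walk p)
  edges≡len p = cong (_∸ 1) (length-vertices (Path.walk p))

  record Erased {u v} (w : Walk G u v) : Set where
    field
      path    : Path G u v
      shorter : len (Path.walk path) ≤ len w
      within  : ∀ {x} → x ∈ˡ vertices G (Path.walk path) → x ∈ˡ vertices G w

  suffix : ∀ {u v x} (w : Walk G u v) → Unique (vertices G w) → x ∈ˡ vertices G w →
    Σ[ p ∈ Path G x v ] len (Path.walk p) ≤ len w × (∀ {y} → y ∈ˡ vertices G (Path.walk p) → y ∈ˡ vertices G w)
  suffix w@ε       uniq (here refl) = record { walk = w ; simple = uniq } , ≤-refl , id
  suffix w@(_ ◅ _) uniq (here refl) = record { walk = w ; simple = uniq } , ≤-refl , id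
  suffix (e ◅ w) (_ ∷ uniq) (there x∈) with p , p≤ , inc ← suffix w uniq x∈ = p , m≤n⇒m≤1+n p≤ , there ∘ inc

  erase : ∀ {u v} (w : Walk G u v) → Erased w
  erase ε = record { path = record { walk = ε ; simple = [] ∷ [] } ; shorter = z≤n ; within = id }
  erase {u} (e ◅ w) with erase w
  ... | record { path = p ; shorter = p≤ ; within = inc } with u ∈? vertices G (Path.walk p)
    where open import Data.List.Membership.DecPropositional (Fin._≟_ {n}) using (_∈?_)
  ...   | yes u∈ with q , q≤ , inc′ ← suffix (Path.walk p) (Path.simple p) u∈ = record
          { path = q ; shorter = m≤n⇒m≤1+n (≤-trans q≤ p≤) ; within = there ∘ inc ∘ inc′ }
  ...   | no u∉ = record
          { path = record { walk = e ◅ Path.walk p ; simple = All.tabulate (λ x∈ u≡x → u∉ (subst (_∈ˡ _) (sym u≡x) x∈)) ∷ Path.simple p }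
          ; shorter = s≤s p≤ ; within = λ { (here refl) → here refl ; (there x∈) → there (inc x∈) } }

  path-short : ∀ {u v} (p : Path G u v) → Path.edges p < n
  path-short p = subst (_≤ n) (trans (length-vertices (Path.walk p)) (cong suc (sym (edges≡len p))))
    (Fin.injective⇒≤ (λ {i} {j} → lookup-inj (Path.simple p) i j))
    where
    lookup∈ : ∀ (xs : List (Fin n)) i → List.lookup xs i ∈ˡ xs
    lookup∈ (x ∷ xs) Fin.zero    = here refl
    lookup∈ (x ∷ xs) (Fin.suc i) = there (lookup∈ xs i)
    lookup-inj : ∀ {xs : List (Fin n)} → Unique xs → ∀ i j → List.lookup xs i ≡ List.lookup xs j → i ≡ j
    lookup-inj (x≢ ∷ u) Fin.zero    Fin.zero    e = refl
    lookup-inj (x≢ ∷ u) Fin.zero    (Fin.suc j) e = ⊥-elim (All.lookup x≢ (lookup∈ _ j) e)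
    lookup-inj (x≢ ∷ u) (Fin.suc i) Fin.zero    e = ⊥-elim (All.lookup x≢ (lookup∈ _ i) (sym e))
    lookup-inj (x≢ ∷ u) (Fin.suc i) (Fin.suc j) e = cong Fin.suc (lookup-inj u i j e)

  ¬¬-distance : ∀ {u v} (w : Walk G u v) → ¬ ¬ (∃ λ d → IsDistance G u v d × d ≤ len w)
  ¬¬-distance w c = ¬¬-least (λ k → ∃ λ (p : Path G _ _) → Path.edges p ≡ k) _ (path , refl)
    λ (d , d≤ , attained , least) → c (d , (attained , λ p → least _ (p , refl)) , ≤-trans d≤ (subst (_≤ len w) (sym (edges≡len path)) shorter))
    where open Erased (erase w)

leastB : (ℕ → Bool) → ℕ → ℕ
leastB p zero    = 0
leastB p (suc b) = if p 0 then 0 else suc (leastB (p ∘ suc) b)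

leastB-≤ : ∀ (p : ℕ → Bool) b → leastB p b ≤ b
leastB-≤ p zero    = z≤n
leastB-≤ p (suc b) with p 0
... | true  = z≤n
... | false = s≤s (leastB-≤ (p ∘ suc) b)

leastB-holds : ∀ (p : ℕ → Bool) b → T (p b) → T (p (leastB p b))
leastB-holds p zero    h = h
leastB-holds p (suc b) h with p 0 in eq
... | true  = subst T (sym eq) tt
... | false = leastB-holds (p ∘ suc) b h

leastB-least : ∀ (p : ℕ → Bool) b j → T (p j) → leastB p b ≤ j
leastB-least p zero    j       h = z≤n
leastB-least p (suc b) j       h with p 0 in eq
leastB-least p (suc b) j       h | true  = z≤n
leastB-least p (suc b) zero    h | false = ⊥-elim (subst T eq h)
leastB-least p (suc b) (suc j) h | false = s≤s (leastB-least (p ∘ suc) b j h)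

module Domination {n : ℕ} (G : Graph n) (adjN : ℕ → ℕ → ℕ)
  (adjN-adj : ∀ u v → adjN (toℕ u) (toℕ v) ≡ bit (adj G u v)) where
  open Walks G

  adjN-sym : ∀ u v → u < n → v < n → adjN u v ≡ adjN v u
  adjN-sym u v u< v< = subst₂ (λ a b → adjN a b ≡ adjN b a) (Fin.toℕ-fromℕ< u<) (Fin.toℕ-fromℕ< v<)
    (trans (adjN-adj _ _) (trans (cong bit (Graph.sym G _ _)) (sym (adjN-adj _ _))))

  open Labelled n adjN adjN-sym public

  edge⇒Adj : ∀ {u v} → Edge G u v → Adj (toℕ u) (toℕ v)
  edge⇒Adj {u} {v} e = Fin.toℕ<n u , Fin.toℕ<n v , λ z → case trans (sym (trans (adjN-adj u v) (cong bit (Equivalence.to T-≡ e)))) z of λ ()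

  Adj⇒edge : ∀ {u v} → Adj (toℕ u) (toℕ v) → Edge G u v
  Adj⇒edge {u} {v} (_ , _ , a) with adj G u v | adjN-adj u v
  ... | true  | _ = tt
  ... | false | z = ⊥-elim (a z)

  Fin-Adj : ∀ {x} {v : Fin n} → Adj x (toℕ v) → ∃ λ u → toℕ u ≡ x × Edge G u v
  Fin-Adj {v = v} a@(x< , _) = fromℕ< x< , Fin.toℕ-fromℕ< x< , Adj⇒edge (subst (λ x → Adj x (toℕ v)) (sym (Fin.toℕ-fromℕ< x<)) a)

  zeroSet : (ℕ → ℕ) → Subset n
  zeroSet l = Vec.tabulate (λ v → l (toℕ v) <ᵇ 1)

  ∈zeroSet : ∀ l v → l (toℕ v) ≡ 0 → v ∈ zeroSet l
  ∈zeroSet l v z = VecP.lookup⇒[]= v (zeroSet l) (trans (VecP.lookup∘tabulate _ v) (cong (_<ᵇ 1) z))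

  zeroSet∈ : ∀ l v → v ∈ zeroSet l → l (toℕ v) ≡ 0
  zeroSet∈ l v v∈ = n<1⇒n≡0 (<ᵇ⇒< _ 1 (Equivalence.from T-≡ (trans (sym (VecP.lookup∘tabulate _ v)) (VecP.[]=⇒lookup v∈))))

  ∣zeroSet∣ : ∀ l → ∣ zeroSet l ∣ ≡ Sum n (λ v → bit (l v <ᵇ 1))
  ∣zeroSet∣ l = go n l
    where
    go : ∀ n (l : ℕ → ℕ) → ∣ Vec.tabulate {n = n} (λ v → l (toℕ v) <ᵇ 1) ∣ ≡ Sum n (λ v → bit (l v <ᵇ 1))
    go zero    l = refl
    go (suc n) l with l 0 <ᵇ 1 | Sum-shift n (λ v → bit (l v <ᵇ 1))
    ... | true  | s = trans (cong suc (go n (l ∘ suc))) (sym s)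
    ... | false | s = trans (go n (l ∘ suc)) (sym s)

  labels-sound : ∀ l r → Lipschitz l → Lowered l → (∀ x y → x < n → y < n → l x ≡ 0 → l y ≡ 0 → ¬ ¬ Star (Link l) x y) →
    (∀ v → v < n → l v ≤ r) → ¬ ¬ ConnectedDominating G r (zeroSet l)
  labels-sound l r lip low link l≤ c = ¬¬-All dominates λ dom → ¬¬-All (λ u → ¬¬-All (connects u)) λ con → c (dom , con)
    where
    descend : ∀ k v → l (toℕ v) ≡ k → ∃ λ u → l (toℕ u) ≡ 0 × Σ[ w ∈ Walk G v u ] len w ≤ k
    descend zero    v e = v , e , ε , z≤n
    descend (suc k) v e
      with x , xv , e′ ← low (toℕ v) (Fin.toℕ<n v) (λ z → case trans (sym e) z of λ ())
      with u , refl , uv ← Fin-Adj {v = v} xv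
      with t , tz , w , w≤ ← descend k u (suc-injective (trans (+-comm 1 (l (toℕ u))) (trans e′ e)))
      = t , tz , subst T (Graph.sym G u v) uv ◅ w , s≤s w≤
    reverse : ∀ {u v} (w : Walk G u v) → Σ[ w′ ∈ Walk G v u ] len w′ ≡ len w
    reverse w = map₂ (λ eq → trans eq (+-identityʳ (len w))) (go w ε)
      where
      go : ∀ {u v x} (w : Walk G u v) (a : Walk G u x) → Σ[ w′ ∈ Walk G v x ] len w′ ≡ len w + len a
      go ε       a = a , refl
      go (e ◅ w) a with w′ , eq ← go w (subst T (Graph.sym G _ _) e ◅ a) = w′ , trans eq (+-suc (len w) (len a))
    dominates : ∀ v → ¬ ¬ (∃ λ u → u ∈ zeroSet l × ∃ λ d → IsDistance G u v d × d ≤ r)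
    dominates v c with u , uz , w , w≤ ← descend _ v refl with w′ , eq ← reverse w =
      ¬¬-distance w′ λ (d , dist , d≤) → c (u , ∈zeroSet l u uz , d , dist ,
        ≤-trans d≤ (≤-trans (≤-reflexive eq) (≤-trans w≤ (l≤ _ (Fin.toℕ<n v)))))
    connects : ∀ u v → ¬ ¬ (u ∈ zeroSet l → v ∈ zeroSet l → Star (InducedEdge G (_∈ zeroSet l)) u v)
    connects u v c = ¬¬-excluded-middle {A = u ∈ zeroSet l × v ∈ zeroSet l} λ where
        (yes (u∈ , v∈)) → link _ _ (Fin.toℕ<n u) (Fin.toℕ<n v) (zeroSet∈ l u u∈) (zeroSet∈ l v v∈) λ s → c λ _ _ → convert s refl refl
        (no no-pair)    → c λ u∈ v∈ → ⊥-elim (no-pair (u∈ , v∈))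
      where
      convert : ∀ {x y u v} → Star (Link l) x y → x ≡ toℕ u → y ≡ toℕ v → Star (InducedEdge G (_∈ zeroSet l)) u v
      convert ε refl e with refl ← Fin.toℕ-injective e = ε
      convert {u = u} ((zx , zt , xt@(_ , t< , _)) ◅ s) refl ey =
        (∈zeroSet l u zx , ∈zeroSet l t (trans (cong l t≡) zt) , Adj⇒edge (subst (Adj (toℕ u)) (sym t≡) xt)) ◅ convert s (sym t≡) ey
        where
        t : Fin n
        t = fromℕ< t<
        t≡ : toℕ t ≡ _
        t≡ = Fin.toℕ-fromℕ< t<

  module Distances (D : Subset n) where

    inD : ℕ → Bool
    inD v with v <? n
    ... | yes v< = Vec.lookup D (fromℕ< v<)
    ... | no _   = false

    inD-∈ : ∀ v → v ∈ D → T (inD (toℕ v))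
    inD-∈ v v∈ with toℕ v <? n
    ... | no ≮   = ≮ (Fin.toℕ<n v)
    ... | yes v< = Equivalence.from T-≡ (trans (cong (Vec.lookup D) (Fin.fromℕ<-toℕ v v<)) (VecP.[]=⇒lookup v∈))

    ∈-inD : ∀ v → T (inD (toℕ v)) → v ∈ D
    ∈-inD v h with toℕ v <? n
    ... | yes v< = VecP.lookup⇒[]= v D (trans (cong (Vec.lookup D) (sym (Fin.fromℕ<-toℕ v v<))) (Equivalence.to T-≡ h))

    near : ℕ → ℕ → Bool
    near zero    v = inD v
    near (suc j) v = near j v ∨ (0 <ᵇ Sum n (λ u → adjN u v * bit (near j u)))

    near-mono : ∀ {j k v} → j ≤ k → T (near j v) → T (near k v)
    near-mono {j} {k} {v} j≤k h with m≤n⇒∃[o]m+o≡n j≤k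
    ... | o , refl = go o
      where
      go : ∀ o → T (near (j + o) v)
      go zero    = subst (λ k → T (near k v)) (sym (+-identityʳ j)) h
      go (suc o) = subst (λ k → T (near k v)) (sym (+-suc j o)) (Equivalence.from (T-∨ {near (j + o) v}) (inj₁ (go o)))

    near-step : ∀ {j u v} → Adj u v → T (near j u) → T (near (suc j) v)
    near-step {j} {u} {v} (u< , v< , a) h = Equivalence.from (T-∨ {near j v}) (inj₂ (<⇒<ᵇ (≤-trans (n≢0⇒n>0 nz) (Sum-term n _ u u<))))
      where
      nz : adjN u v * bit (near j u) ≢ 0
      nz z = a (trans (sym (*-identityʳ _)) (trans (cong (λ b → adjN u v * bit b) (sym (Equivalence.to T-≡ h))) z))

    near-back : ∀ {j v} → v < n → T (near (suc j) v) → ¬ T (near j v) → ∃ λ u → Adj u v × T (near j u)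
    near-back {j} {v} v< h ¬h with Equivalence.to (T-∨ {near j v}) h
    ... | inj₁ h′ = ⊥-elim (¬h h′)
    ... | inj₂ h′ with anyUpTo? (λ u → ¬? (adjN u v * bit (near j u) ≟ 0)) n
    ...   | no none = ⊥-elim (<⇒≢ (<ᵇ⇒< 0 _ h′) (sym (Sum-0 n λ u u< → all-zero u u<)))
      where
      all-zero : ∀ u → u < n → adjN u v * bit (near j u) ≡ 0
      all-zero u u< with adjN u v * bit (near j u) ≟ 0
      ... | yes z = z
      ... | no nz = ⊥-elim (none (u , u< , nz))
    ...   | yes (u , u< , nz) with near j u in eq
    ...     | true  = u , (u< , v< , λ z → nz (cong (_* 1) z)) , subst T (sym eq) tt
    ...     | false = ⊥-elim (nz (*-zeroʳ (adjN u v)))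

    module _ (r R : ℕ) (R≡ : ∀ d → d ≤ r → d < n → d ≤ R) (cd : ConnectedDominating G r D) where

      near-walk : ∀ {u v} j (w : Walk G u v) → T (near j (toℕ u)) → T (near (j + len w) (toℕ v))
      near-walk {u} j ε       h = subst (λ k → T (near k (toℕ u))) (sym (+-identityʳ j)) h
      near-walk {v = v} j (e ◅ w) h = subst (λ k → T (near k (toℕ v))) (sym (+-suc j (len w))) (near-walk (suc j) w (near-step {j} (edge⇒Adj e) h))

      near-R : ∀ v → v < n → T (near R v)
      near-R v v< with u , u∈ , d , ((p , p≡) , _) , d≤r ← proj₁ cd (fromℕ< v<) =
        subst (λ v → T (near R v)) (Fin.toℕ-fromℕ< v<) (near-mono {Walks.len G (Path.walk p)} {R}
          (R≡ _ (subst (_≤ r) (trans (sym p≡) (edges≡len p)) d≤r) (subst (_< n) (edges≡len p) (path-short p)))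
          (near-walk 0 (Path.walk p) (inD-∈ u u∈)))

      label : ℕ → ℕ
      label v = leastB (λ j → near j v) R

      label-near : ∀ v → v < n → T (near (label v) v)
      label-near v v< = leastB-holds (λ j → near j v) R (near-R v v<)

      label≤ : ∀ v → label v ≤ R
      label≤ v = leastB-≤ (λ j → near j v) R

      label-least : ∀ v j → T (near j v) → label v ≤ j
      label-least v = leastB-least (λ j → near j v) R

      label-Lipschitz : Lipschitz label
      label-Lipschitz u v uv@(u< , _) = label-least v _ (subst (λ k → T (near k v)) (+-comm 1 (label u)) (near-step {label u} uv (label-near u u<)))

      label-Lowered : Lowered label
      label-Lowered v v< nz with label v in eq
      ... | zero  = ⊥-elim (nz refl)
      ... | suc j with u , uv , h ← near-back {j} v< (subst (λ k → T (near k v)) eq (label-near v v<))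
                         (λ h → 1+n≰n (≤-trans (≤-reflexive (sym eq)) (label-least v j h)))
        = u , uv , trans (+-comm (label u) 1) (cong suc (≤-antisym (label-least u j h)
            (s≤s⁻¹ (≤-trans (≤-reflexive (sym eq)) (≤-trans (label-Lipschitz u v uv) (≤-reflexive (+-comm (label u) 1)))))))

      label-zero : ∀ v → v < n → label v ≡ 0 → T (inD v)
      label-zero v v< e = subst (λ k → T (near k v)) e (label-near v v<)

      zero-label : ∀ v → T (inD v) → label v ≡ 0
      zero-label v h = n≤0⇒n≡0 (label-least v 0 h)

      label-Linked : Linked label
      label-Linked x y x< y< zx zy = subst₂ (Star (Link label)) (Fin.toℕ-fromℕ< x<) (Fin.toℕ-fromℕ< y<)
        (convert (proj₂ cd _ _ (member x< zx) (member y< zy)))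
        where
        member : ∀ {x} (x< : x < n) → label x ≡ 0 → fromℕ< x< ∈ D
        member {x} x< z = ∈-inD _ (subst (T ∘ inD) (sym (Fin.toℕ-fromℕ< x<)) (label-zero x x< z))
        convert : ∀ {u v} → Star (InducedEdge G (_∈ D)) u v → Star (Link label) (toℕ u) (toℕ v)
        convert ε = ε
        convert ((u∈ , v∈ , e) ◅ s) = (zero-label _ (inD-∈ _ u∈) , zero-label _ (inD-∈ _ v∈) , edge⇒Adj e) ◅ convert s

-- Tree decompositions

module TreeOrder {n N : ℕ} (G : Graph n) (Tr : Graph N) (isTree : IsTree Tr) (bagT : Fin N → Subset n)
  (coversVertex : ∀ v → ∃ λ t → v ∈ bagT t) (coversEdge : ∀ u v → Edge G u v → ∃ λ t → u ∈ bagT t × v ∈ bagT t)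
  (connected : ∀ v → InducedConnected Tr (λ t → v ∈ bagT t)) (tadjN bagN : ℕ → ℕ → ℕ)
  (tadjN-adj : ∀ s t → tadjN (toℕ s) (toℕ t) ≡ bit (adj Tr s t))
  (bagN-bag : ∀ t v → bagN (toℕ t) (toℕ v) ≡ bit (Vec.lookup (bagT t) v))
  (bagN-N : ∀ v → v < n → bagN N v ≡ 0) where

  open Walks Tr

  Tedge : Fin N → Fin N → Set
  Tedge = Edge Tr

  Tedge-sym : ∀ {s t} → Tedge s t → Tedge t s
  Tedge-sym {s} {t} = subst T (Graph.sym Tr s t)

  tadj⇒edge : ∀ {s t} → tadjN (toℕ s) (toℕ t) ≢ 0 → Tedge s t
  tadj⇒edge {s} {t} a with adj Tr s t | tadjN-adj s t
  ... | true  | _ = tt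
  ... | false | z = ⊥-elim (a z)

  edge⇒tadj : ∀ {s t} → Tedge s t → tadjN (toℕ s) (toℕ t) ≢ 0
  edge⇒tadj {s} {t} e z = case trans (sym (trans (tadjN-adj s t) (cong bit (Equivalence.to T-≡ e)))) z of λ ()

  bagN⇒∈ : ∀ {t v} → bagN (toℕ t) (toℕ v) ≢ 0 → v ∈ bagT t
  bagN⇒∈ {t} {v} h with Vec.lookup (bagT t) v in eq | bagN-bag t v
  ... | true  | _ = VecP.lookup⇒[]= v (bagT t) eq
  ... | false | z = ⊥-elim (h z)

  ∈⇒bagN : ∀ {t v} → v ∈ bagT t → bagN (toℕ t) (toℕ v) ≢ 0
  ∈⇒bagN {t} {v} v∈ z = case trans (sym (trans (bagN-bag t v) (cong bit (VecP.[]=⇒lookup v∈)))) z of λ ()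

  Avoiding : Fin N → Fin N → Fin N → Set
  Avoiding t = Star (λ x y → x ≢ t × y ≢ t × Tedge x y)

  avoiding-walk : ∀ {t x y} → x ≢ t → Avoiding t x y → Σ[ w ∈ Walk Tr x y ] ¬ (t ∈ˡ vertices Tr w)
  avoiding-walk x≢t ε = ε , λ { (here t≡x) → x≢t (sym t≡x) }
  avoiding-walk x≢t ((_ , y≢t , e) ◅ s) with w , t∉ ← avoiding-walk y≢t s =
    (e ◅ w) , λ { (here t≡x) → x≢t (sym t≡x) ; (there t∈) → t∉ t∈ }

  avoiding-reverse : ∀ {t x y} → Avoiding t x y → Avoiding t y x
  avoiding-reverse s = go s ε
    where
    go : ∀ {t x y z} → Avoiding t x y → Avoiding t x z → Avoiding t y z
    go ε                   a = a
    go ((nx , ny , e) ◅ s) a = go s ((ny , nx , Tedge-sym e) ◅ a)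

  no-cycle : ∀ {t p q} → Tedge t p → Tedge t q → (w : Walk Tr p q) → Unique (vertices Tr w) →
    ¬ (t ∈ˡ vertices Tr w) → p ≡ q
  no-cycle tp tq ε _ _ = refl
  no-cycle {t} {p} {q} tp tq w@(_ ◅ w′) uniq t∉ = ⊥-elim (proj₂ (proj₂ isTree) t q
    (record { walk = tp ◅ w ; simple = All.tabulate (λ x∈ t≡x → t∉ (subst (_∈ˡ vertices Tr w) (sym t≡x) x∈)) ∷ uniq })
    (s≤s (subst (1 ≤_) (sym (length-vertices w′)) (s≤s z≤n))) (Tedge-sym tq))

  same-branch : ∀ {t p q} → Tedge t p → Tedge t q → p ≢ t → Avoiding t p q → p ≡ q
  same-branch tp tq p≢t s with w , t∉ ← avoiding-walk p≢t s =
    no-cycle tp tq (Path.walk path) (Path.simple path) (t∉ ∘ within)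
    where open Erased (erase w)

  leave : ∀ {S : Fin N → Set} {t x j} → j ≢ t → Star (InducedEdge Tr S) x j →
    (x ≢ t × Avoiding t x j) ⊎ (∃ λ q → S q × Tedge t q × q ≢ t × Avoiding t q j)
  leave j≢t ε = inj₁ (j≢t , ε)
  leave {t = t} {x} j≢t ((_ , sy , e) ◅ s) with leave j≢t s
  ... | inj₂ found = inj₂ found
  ... | inj₁ (y≢t , a) with x Fin.≟ t
  ...   | yes refl = inj₂ (_ , sy , e , y≢t , a)
  ...   | no x≢t   = inj₁ (x≢t , (x≢t , y≢t , e) ◅ a)

  shared : ∀ {t p j v} → Tedge t p → p ≢ t → j ≢ t → Avoiding t p j → v ∈ bagT t → v ∈ bagT j → v ∈ bagT p
  shared {t} {p} {j} {v} tp p≢t j≢t pj v∈t v∈j with leave j≢t (connected v t j v∈t v∈j)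
  ... | inj₁ (t≢t , _) = ⊥-elim (t≢t refl)
  ... | inj₂ (q , v∈q , tq , q≢t , qj) = subst (λ x → v ∈ bagT x) (sym (same-branch tp tq p≢t (pj ◅◅ avoiding-reverse qj))) v∈q

  record Step (nd pa : ℕ → ℕ) (i : ℕ) : Set where
    field
      node<   : nd i < N
      parent  : ∃ λ j → 1 ≤ j × j < i × pa i ≡ nd j
      new     : ∀ j → 1 ≤ j → j < i → nd j ≢ nd i
      attached : tadjN (pa i) (nd i) ≢ 0

  -- The nodes nd 1, nd 2, …, each with a parent among its predecessors;
  -- nd 0 is an additional root with an empty bag.
  record Order (nd pa : ℕ → ℕ) (k : ℕ) : Set where
    field
      root  : nd 0 ≡ N
      first : nd 1 ≡ 0
      top   : pa 1 ≡ N
      steps : ∀ i → 2 ≤ i → i ≤ k → Step nd pa i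

  Step-cong : ∀ {nd nd′ pa pa′ i} → 2 ≤ i → (∀ j → j ≤ i → nd′ j ≡ nd j) → pa′ i ≡ pa i → Step nd pa i → Step nd′ pa′ i
  Step-cong {i = i} 2≤i nd≡ pa≡ s = record
    { node<    = subst (_< N) (sym (nd≡ i ≤-refl)) node<
    ; parent   = let j , 1≤j , j<i , e = parent in j , 1≤j , j<i , trans pa≡ (trans e (sym (nd≡ j (<⇒≤ j<i))))
    ; new      = λ j 1≤j j<i e → new j 1≤j j<i (trans (sym (nd≡ j (<⇒≤ j<i))) (trans e (nd≡ i ≤-refl)))
    ; attached = λ z → attached (trans (cong₂ tadjN (sym pa≡) (sym (nd≡ i ≤-refl))) z) }
    where open Step s

  Order-extend : ∀ {nd nd′ pa pa′ k} → 1 ≤ k → (∀ j → j ≤ k → nd′ j ≡ nd j) → (∀ j → j ≤ k → pa′ j ≡ pa j) →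
    Order nd pa k → Step nd′ pa′ (suc k) → Order nd′ pa′ (suc k)
  Order-extend {nd} {nd′} {pa} {pa′} {k} 1≤k nd≡ pa≡ o s = record
    { root = trans (nd≡ 0 z≤n) root ; first = trans (nd≡ 1 1≤k) first ; top = trans (pa≡ 1 1≤k) top ; steps = steps′ }
    where
    open Order o
    steps′ : ∀ i → 2 ≤ i → i ≤ suc k → Step nd′ pa′ i
    steps′ i 2≤i i≤ with m≤n⇒m<n∨m≡n i≤
    ... | inj₂ refl = s
    ... | inj₁ i<   = Step-cong 2≤i (λ j j≤i → nd≡ j (≤-trans j≤i (s≤s⁻¹ i<))) (pa≡ i (s≤s⁻¹ i<)) (steps i 2≤i (s≤s⁻¹ i<))

  0<N : 0 < N
  0<N = proj₁ isTree

  module Ordered {nd pa : ℕ → ℕ} {k : ℕ} (ordered : Order nd pa k) where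
    open Order ordered

    nd< : ∀ i → 1 ≤ i → i ≤ k → nd i < N
    nd< (suc zero)    _ _   = subst (_< N) (sym first) 0<N
    nd< (suc (suc i)) _ i≤k = Step.node< (steps (2 + i) (s≤s (s≤s z≤n)) i≤k)

    nd-distinct : ∀ i j → 1 ≤ j → j < i → i ≤ k → nd j ≢ nd i
    nd-distinct (suc zero)    (suc j) _ (s≤s ()) _
    nd-distinct (suc (suc i)) j 1≤j j<i i≤k = Step.new (steps (2 + i) (s≤s (s≤s z≤n)) i≤k) j 1≤j j<i

    nd-injective : ∀ i j → 1 ≤ i → i ≤ k → 1 ≤ j → j ≤ k → nd i ≡ nd j → i ≡ j
    nd-injective i j 1≤i i≤k 1≤j j≤k e with <-cmp i j
    ... | tri< i<j _ _ = ⊥-elim (nd-distinct j i 1≤i i<j j≤k e)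
    ... | tri≈ _ i≡j _ = i≡j
    ... | tri> _ _ j<i = ⊥-elim (nd-distinct i j 1≤j j<i i≤k (sym e))

    missing⇒k<N : ∀ u → u < N → (∀ i → 1 ≤ i → i ≤ k → nd i ≢ u) → k < N
    missing⇒k<N u u<N missing = Fin.injective⇒≤ {f = f} f-inj
      where
      f : Fin (suc k) → Fin N
      f Fin.zero    = fromℕ< u<N
      f (Fin.suc i) = fromℕ< (nd< (suc (toℕ i)) (s≤s z≤n) (Fin.toℕ<n i))
      value : ∀ i → toℕ (f (Fin.suc i)) ≡ nd (suc (toℕ i))
      value i = Fin.toℕ-fromℕ< _
      f-inj : ∀ {i j} → f i ≡ f j → i ≡ j
      f-inj {Fin.zero}  {Fin.zero}  e = refl
      f-inj {Fin.zero}  {Fin.suc j} e = ⊥-elim (missing _ (s≤s z≤n) (Fin.toℕ<n j) (trans (sym (value j)) (trans (cong toℕ (sym e)) (Fin.toℕ-fromℕ< u<N))))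
      f-inj {Fin.suc i} {Fin.zero}  e = ⊥-elim (missing _ (s≤s z≤n) (Fin.toℕ<n i) (trans (sym (value i)) (trans (cong toℕ e) (Fin.toℕ-fromℕ< u<N))))
      f-inj {Fin.suc i} {Fin.suc j} e = cong Fin.suc (Fin.toℕ-injective (suc-injective (nd-injective _ _ (s≤s z≤n) (Fin.toℕ<n i) (s≤s z≤n) (Fin.toℕ<n j)
        (trans (sym (value i)) (trans (cong toℕ e) (value j))))))

    Listed : ℕ → Set
    Listed u = ∃ λ i → i < suc k × 1 ≤ i × nd i ≡ u

    listed? : ∀ u → Dec (Listed u)
    listed? u = anyUpTo? (λ i → (1 ≤? i) ×-dec (nd i ≟ u)) (suc k)

    all-listed : N ≤ k → ∀ u → u < N → Listed u
    all-listed N≤k u u<N with listed? u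
    ... | yes l = l
    ... | no ¬l = ⊥-elim (<⇒≱ (missing⇒k<N u u<N λ i 1≤i i≤k e → ¬l (i , s≤s i≤k , 1≤i , e)) N≤k)

    some-unlisted : 1 ≤ k → k < N → ∃ λ u → u < N × ¬ Listed u
    some-unlisted 1≤k k<N with anyUpTo? (λ u → ¬? (listed? u)) N
    ... | yes found = found
    ... | no none = ⊥-elim (<⇒≱ k<N (Fin.injective⇒≤ {f = f} f-inj))
      where
      place : ∀ (u : Fin N) → Listed (toℕ u)
      place u with listed? (toℕ u)
      ... | yes l = l
      ... | no ¬l = ⊥-elim (none (toℕ u , Fin.toℕ<n u , ¬l))
      pred< : ∀ {i} → 1 ≤ i → i < suc k → pred i < k
      pred< {suc i} _ (s≤s h) = h
      f : Fin N → Fin k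
      f u = fromℕ< (pred< (proj₁ (proj₂ (proj₂ (place u)))) (proj₁ (proj₂ (place u))))
      back : ∀ u → nd (suc (toℕ (f u))) ≡ toℕ u
      back u with place u
      ... | suc i , i< , 1≤i , e = trans (cong (nd ∘ suc) (Fin.toℕ-fromℕ< _)) e
      f-inj : ∀ {u v} → f u ≡ f v → u ≡ v
      f-inj {u} {v} e = Fin.toℕ-injective (trans (sym (back u)) (trans (cong (nd ∘ suc ∘ toℕ) e) (back v)))

    crossing : 1 ≤ k → k < N → ∃₂ λ x y → x < N × y < N × Listed x × ¬ Listed y × tadjN x y ≢ 0
    crossing 1≤k k<N with u , u<N , ¬l ← some-unlisted 1≤k k<N =
      go (proj₁ (proj₂ isTree) (fromℕ< 0<N) (fromℕ< u<N))
         (1 , s≤s 1≤k , ≤-refl , trans first (sym (Fin.toℕ-fromℕ< 0<N))) (λ l → ¬l (subst Listed (Fin.toℕ-fromℕ< u<N) l))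
      where
      go : ∀ {s t} → Walk Tr s t → Listed (toℕ s) → ¬ Listed (toℕ t) → ∃₂ λ x y → x < N × y < N × Listed x × ¬ Listed y × tadjN x y ≢ 0
      go ε ls ¬lt = ⊥-elim (¬lt ls)
      go {s} (_◅_ {j = y} e w) ls ¬lt with listed? (toℕ y)
      ... | yes ly = go w ly ¬lt
      ... | no ¬ly = toℕ s , toℕ y , Fin.toℕ<n s , Fin.toℕ<n y , ls , ¬ly , edge⇒tadj e

    running-intersection : ∀ i → 1 ≤ i → i ≤ k → ∀ j → j < i → ∀ v → v < n → bagN (nd i) v ≢ 0 → bagN (nd j) v ≢ 0 → bagN (pa i) v ≢ 0
    running-intersection i 1≤i i≤k zero j<i v v<n bi bj = ⊥-elim (bj (trans (cong (λ x → bagN x v) root) (bagN-N v v<n)))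
    running-intersection (suc zero) 1≤i i≤k (suc j) (s≤s ()) v v<n bi bj
    running-intersection i@(suc (suc _)) 1≤i i≤k j@(suc _) j<i v v<n bi bj
      with Step.parent (steps i (s≤s (s≤s z≤n)) i≤k)
    ... | p , 1≤p , p<i , pa≡ = λ bp → ∈⇒bagN inside (trans (cong₂ bagN (trans (toℕ-F p (1≤p , m<n⇒m<1+n p<i)) (sym pa≡)) (Fin.toℕ-fromℕ< v<n)) bp)
      where
      F : ∀ m → 1 ≤ m × m < suc i → Fin N
      F m (1≤m , m<) = fromℕ< (nd< m 1≤m (≤-trans (s≤s⁻¹ m<) i≤k))
      toℕ-F : ∀ m h → toℕ (F m h) ≡ nd m
      toℕ-F m h = Fin.toℕ-fromℕ< _
      hi : 1 ≤ i × i < suc i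
      hi = 1≤i , ≤-refl
      t : Fin N
      t = F i hi
      V : Fin n
      V = fromℕ< v<n
      earlier≢t : ∀ m (1≤m : 1 ≤ m) (m<i : m < i) → F m (1≤m , m<n⇒m<1+n m<i) ≢ t
      earlier≢t m 1≤m m<i e = nd-distinct i m 1≤m m<i i≤k (trans (sym (toℕ-F m (1≤m , m<n⇒m<1+n m<i))) (trans (cong toℕ e) (toℕ-F i hi)))
      from-first : ∀ m (h : 1 ≤ m) (m<i : m < i) → Avoiding t (F 1 (≤-refl , s≤s 1≤i)) (F m (h , m<n⇒m<1+n m<i))
      from-first m h m<i = go m (<-wellFounded m) h m<i
        where
        go : ∀ m → Acc _<_ m → (h : 1 ≤ m) (m<i : m < i) → Avoiding t (F 1 (≤-refl , s≤s 1≤i)) (F m (h , m<n⇒m<1+n m<i))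
        go (suc zero) _ h m<i = subst (Avoiding t (F 1 (≤-refl , s≤s 1≤i))) (Fin.toℕ-injective (trans (toℕ-F 1 (≤-refl , s≤s 1≤i)) (sym (toℕ-F 1 (h , m<n⇒m<1+n m<i))))) ε
        go m@(suc (suc _)) (acc rec) h m<i with Step.parent (steps m (s≤s (s≤s z≤n)) (≤-trans (<⇒≤ m<i) i≤k))
        ... | p , 1≤p , p<m , pa≡ = go p (rec p<m) 1≤p (<-trans p<m m<i) ◅◅
          ((earlier≢t p 1≤p (<-trans p<m m<i) , earlier≢t m h m<i , tadj⇒edge (λ z → Step.attached (steps m (s≤s (s≤s z≤n)) (≤-trans (<⇒≤ m<i) i≤k))
             (trans (cong₂ tadjN (trans pa≡ (sym (toℕ-F p (1≤p , m<n⇒m<1+n (<-trans p<m m<i))))) (sym (toℕ-F m (h , m<n⇒m<1+n m<i)))) z))) ◅ ε)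
      inside : V ∈ bagT (F p (1≤p , m<n⇒m<1+n p<i))
      inside = shared {t} {F p (1≤p , m<n⇒m<1+n p<i)} {F j (s≤s z≤n , m<n⇒m<1+n j<i)} {V}
        (Tedge-sym (tadj⇒edge (λ z → Step.attached (steps i (s≤s (s≤s z≤n)) i≤k)
          (trans (cong₂ tadjN (trans pa≡ (sym (toℕ-F p (1≤p , m<n⇒m<1+n p<i)))) (sym (toℕ-F i hi))) z))))
        (earlier≢t p 1≤p p<i) (earlier≢t j (s≤s z≤n) j<i)
        (avoiding-reverse (from-first p 1≤p p<i) ◅◅ from-first j (s≤s z≤n) j<i)
        (bagN⇒∈ (λ z → bi (trans (cong₂ bagN (sym (toℕ-F i hi)) (sym (Fin.toℕ-fromℕ< v<n))) z)))
        (bagN⇒∈ (λ z → bj (trans (cong₂ bagN (sym (toℕ-F j (s≤s z≤n , m<n⇒m<1+n j<i))) (sym (Fin.toℕ-fromℕ< v<n))) z)))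

    covered : N ≤ k → ∀ v → v < n → ∃ λ i → 1 ≤ i × i ≤ k × bagN (nd i) v ≢ 0
    covered N≤k v v<n with t , v∈ ← coversVertex (fromℕ< v<n) with i , i< , 1≤i , e ← all-listed N≤k (toℕ t) (Fin.toℕ<n t) =
      i , 1≤i , s≤s⁻¹ i< , λ z → ∈⇒bagN v∈ (trans (cong₂ bagN (sym e) (Fin.toℕ-fromℕ< v<n)) z)

    edge-covered : N ≤ k → ∀ {u v} → Edge G u v → ∃ λ i → 1 ≤ i × i ≤ k × bagN (nd i) (toℕ u) ≢ 0 × bagN (nd i) (toℕ v) ≢ 0
    edge-covered N≤k {u} {v} uv with t , u∈ , v∈ ← coversEdge u v uv with i , i< , 1≤i , e ← all-listed N≤k (toℕ t) (Fin.toℕ<n t) =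
      i , 1≤i , s≤s⁻¹ i< , (λ z → ∈⇒bagN u∈ (trans (cong (λ x → bagN x _) (sym e)) z)) , (λ z → ∈⇒bagN v∈ (trans (cong (λ x → bagN x _) (sym e)) z))

Sum-change : ∀ n f f′ v → v < n → (∀ u → u < n → u ≢ v → f′ u ≡ f u) → Sum n f′ + f v ≡ Sum n f + f′ v
Sum-change (suc n) f f′ v v< same with v ≟ n
... | yes refl = trans (cong (λ s → s + f′ n + f n) (Sum-cong n λ u u< → same u (m<n⇒m<1+n u<) (<⇒≢ u<)))
  (solve 3 (λ a b c → a :+ b :+ c := a :+ c :+ b) refl (Sum n f) (f′ n) (f n))
... | no v≢n = trans (solve 3 (λ a b c → a :+ b :+ c := a :+ c :+ b) refl (Sum n f′) (f′ n) (f v))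
  (trans (cong₂ _+_ (Sum-change n f f′ v (≤∧≢⇒< (s≤s⁻¹ v<) v≢n) λ u u< → same u (m<n⇒m<1+n u<)) (same n ≤-refl (v≢n ∘ sym)))
  (solve 3 (λ a b c → a :+ c :+ b := a :+ b :+ c) refl (Sum n f) (f n) (f′ v)))

/₀-unique : ∀ {a e} E → e < E → (a * E + e) /₀ E ≡ a
/₀-unique {a} {e} (suc E) e<E = trans (+-distrib-/ (a * suc E) e
    (subst (λ x → x + e % suc E < suc E) (sym (m*n%n≡0 a (suc E))) (subst (_< suc E) (sym (m<n⇒m%n≡m e<E)) e<E)))
  (trans (cong₂ _+_ (m*n/n≡m a (suc E)) (m<n⇒m/n≡0 e<E)) (+-identityʳ a))

%₀-unique : ∀ {a e} E → e < E → (a * E + e) %₀ E ≡ e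
%₀-unique {a} {e} (suc E) e<E = trans (cong (_% suc E) (+-comm (a * suc E) e)) (trans ([m+kn]%n≡m%n e a (suc E)) (m<n⇒m%n≡m e<E))

%₀-< : ∀ a {E} → 0 < E → a %₀ E < E
%₀-< a {suc E} _ = m%n<n a (suc E)

/₀-< : ∀ {j b E} → j < b * E → j /₀ E < b
/₀-< {j} {b} {zero}  j< = ⊥-elim (n≮0 (subst (j <_) (*-zeroʳ b) j<))
/₀-< {j} {b} {suc E} j< = *-cancelʳ-< (suc E) (j / suc E) b (≤-<-trans (m/n*n≤m j (suc E)) j<)

/₀-%₀ : ∀ j {E} → 0 < E → j ≡ j /₀ E * E + j %₀ E
/₀-%₀ j {suc E} _ = trans (m≡m%n+[m/n]*n j (suc E)) (+-comm (j % suc E) _)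

radix-< : ∀ {a e b} E → a < b → e < E → a * E + e < b * E
radix-< {a} {e} {b} E a<b e<E = <-≤-trans (+-monoʳ-< (a * E) e<E) (≤-trans (≤-reflexive (+-comm (a * E) E)) (*-monoˡ-≤ E a<b))

module Encoding (n q : ℕ) (0<q : 0 < q) (bagN : ℕ → ℕ → ℕ) (bagN≤1 : ∀ t v → bagN t v ≤ 1) where

  rank : ℕ → ℕ → ℕ
  rank t v = Sum v (bagN t)

  enc : ∀ {m} → ℕ → Vec ℕ m → ℕ
  enc t g = Sum n (λ v → bagN t v * (at g v * q ^ rank t v))

  rank-mono : ∀ t {u v} → u ≤ v → ∃ λ k → rank t v ≡ rank t u + k
  rank-mono t {u} u≤v with m≤n⇒∃[o]m+o≡n u≤v
  ... | o , refl = go o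
    where
    go : ∀ o → ∃ λ k → rank t (u + o) ≡ rank t u + k
    go zero    = 0 , trans (cong (rank t) (+-identityʳ u)) (sym (+-identityʳ _))
    go (suc o) with go o
    ... | k , eq = k + bagN t (u + o) , trans (cong (rank t) (+-suc u o)) (trans (cong (_+ bagN t (u + o)) eq) (+-assoc (rank t u) k _))

  rank-≤ : ∀ t {u v} → u ≤ v → rank t u ≤ rank t v
  rank-≤ t {u} u≤v with rank-mono t u≤v
  ... | k , eq = subst (rank t u ≤_) (sym eq) (m≤m+n _ k)

  bagN-1 : ∀ t v → bagN t v ≢ 0 → bagN t v ≡ 1
  bagN-1 t v nz = ≤-antisym (bagN≤1 t v) (n≢0⇒n>0 nz)

  prefix< : ∀ {m} t (g : Vec ℕ m) k → (∀ v → v < k → at g v < q) → Sum k (λ v → bagN t v * (at g v * q ^ rank t v)) < q ^ rank t k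
  prefix< t g zero    h = s≤s z≤n
  prefix< t g (suc k) h with bagN t k | bagN≤1 t k | prefix< t g k (λ v v< → h v (m<n⇒m<1+n v<))
  ... | zero  | _ | ih = subst₂ _<_ (sym (+-identityʳ _)) (cong (q ^_) (sym (+-identityʳ (rank t k)))) ih
  ... | suc (suc _) | s≤s () | _
  ... | suc zero | _ | ih = subst₂ _<_ (cong (s +_) (sym (+-identityʳ _))) (cong (q ^_) (+-comm 1 (rank t k)))
      (<-≤-trans (+-monoˡ-< (at g k * q ^ rank t k) ih) (*-monoˡ-≤ (q ^ rank t k) (h k ≤-refl)))
    where
    s = Sum k (λ v → bagN t v * (at g v * q ^ rank t v))

  enc< : ∀ t (g : Vec ℕ n) → Digits q g → ∀ {B} → rank t n ≤ B → enc t g < q ^ B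
  enc< t g hg r≤B = <-≤-trans (prefix< t g n hg) (^-monoʳ-≤ q {{>-nonZero 0<q}} r≤B)

  digit-enc : ∀ t (g : Vec ℕ n) → Digits q g → ∀ v → v < n → bagN t v ≢ 0 → (enc t g /₀ (q ^ rank t v)) %₀ q ≡ at g v
  digit-enc t g hg v v<n inside with split n v<n
    where
    f : ℕ → ℕ
    f u = bagN t u * (at g u * q ^ rank t u)
    P = q ^ rank t v
    split : ∀ k → v < k → ∃ λ H → Sum k f ≡ (H * q + at g v) * P + Sum v f
    split (suc k) v<1+k with v ≟ k
    ... | yes refl = 0 , trans (cong (λ b → Sum v f + b * (at g v * P)) (bagN-1 t v inside)) (trans (cong (Sum v f +_) (+-identityʳ _)) (+-comm (Sum v f) _))
    ... | no v≢k with split k (≤∧≢⇒< (s≤s⁻¹ v<1+k) v≢k) | rank-mono t (≤∧≢⇒< (s≤s⁻¹ v<1+k) v≢k)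
    ...   | H , eq | o , r≡ = H + bagN t k * (at g k * q ^ o) , (begin
            Sum k f + f k                             ≡⟨ cong₂ _+_ eq (cong (λ p → bagN t k * (at g k * p)) power) ⟩
            (H * q + at g v) * P + Sum v f + bagN t k * (at g k * (P * q * q ^ o))
              ≡⟨ solve 8 (λ h q d p s b gk qo → (h :* q :+ d) :* p :+ s :+ b :* (gk :* (p :* q :* qo)) := ((h :+ b :* (gk :* qo)) :* q :+ d) :* p :+ s)
                   refl H q (at g v) P (Sum v f) (bagN t k) (at g k) (q ^ o) ⟩
            ((H + bagN t k * (at g k * q ^ o)) * q + at g v) * P + Sum v f ∎)
      where
      open ≡-Reasoning
      power : q ^ rank t k ≡ P * q * q ^ o
      power = trans (cong (q ^_) (trans r≡ (cong (_+ o) (trans (cong (rank t v +_) (bagN-1 t v inside)) refl))))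
        (trans (^-distribˡ-+-* q (rank t v + 1) o) (cong (_* q ^ o) (trans (^-distribˡ-+-* q (rank t v) 1) (cong (P *_) (*-identityʳ q)))))
  ... | H , eq = trans (cong (λ a → (a /₀ (q ^ rank t v)) %₀ q) eq)
    (trans (cong (_%₀ q) (/₀-unique {H * q + at g v} (q ^ rank t v) (prefix< t g v λ u u< → hg u (<-trans u< v<n)))) (%₀-unique {H} q (hg v v<n)))

  enc-set-outside : ∀ t (g : Vec ℕ n) v d → bagN t v ≡ 0 → enc t (setAt g v d) ≡ enc t g
  enc-set-outside t g v d out = Sum-cong n λ u _ → go u
    where
    go : ∀ u → bagN t u * (at (setAt g v d) u * q ^ rank t u) ≡ bagN t u * (at g u * q ^ rank t u)
    go u with u ≟ v
    ... | yes refl = trans (cong (_* (at (setAt g v d) v * q ^ rank t v)) out) (sym (cong (_* (at g v * q ^ rank t v)) out))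
    ... | no u≢v   = cong (λ x → bagN t u * (x * q ^ rank t u)) (at-other g v d u u≢v)

  enc-set : ∀ t (g : Vec ℕ n) v d → v < n → bagN t v ≢ 0 →
    enc t g + d * q ^ rank t v ∸ at g v * q ^ rank t v ≡ enc t (setAt g v d)
  enc-set t g v d v<n inside = trans (cong (_∸ at g v * P) (sym changed)) (m+n∸n≡m _ (at g v * P))
    where
    P = q ^ rank t v
    single : ∀ x → bagN t v * x ≡ x
    single x = trans (cong (_* x) (bagN-1 t v inside)) (+-identityʳ x)
    changed : enc t (setAt g v d) + at g v * P ≡ enc t g + d * P
    changed = trans (cong (enc t (setAt g v d) +_) (sym (single (at g v * P))))
      (trans (Sum-change n (λ u → bagN t u * (at g u * q ^ rank t u)) (λ u → bagN t u * (at (setAt g v d) u * q ^ rank t u)) v v<n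
         λ u _ u≢v → cong (λ x → bagN t u * (x * q ^ rank t u)) (at-other g v d u u≢v))
      (cong (enc t g +_) (trans (single _) (cong (_* P) (at-same g v d v<n)))))

  enc-embed : ∀ t p (g : Vec ℕ n) → Digits q g → (∀ v → v < n → bagN t v ≢ 0 → bagN p v ≡ 0 → at g v ≡ 0) →
    Sum n (λ v → bagN t v * bagN p v * ((enc p g /₀ (q ^ rank p v)) %₀ q * q ^ rank t v)) ≡ enc t g
  enc-embed t p g hg outside = Sum-cong n term
    where
    term : ∀ v → v < n → bagN t v * bagN p v * ((enc p g /₀ (q ^ rank p v)) %₀ q * q ^ rank t v) ≡ bagN t v * (at g v * q ^ rank t v)
    term v v<n with bagN t v ≟ 0 | bagN p v ≟ 0
    ... | yes z | _ = trans (cong (λ b → b * bagN p v * ((enc p g /₀ (q ^ rank p v)) %₀ q * q ^ rank t v)) z) (sym (cong (_* (at g v * q ^ rank t v)) z))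
    ... | no _  | no pv = trans (cong₂ (λ b d → bagN t v * b * (d * q ^ rank t v)) (bagN-1 p v pv) (digit-enc p g hg v v<n pv))
                           (cong (_* (at g v * q ^ rank t v)) (*-identityʳ (bagN t v)))
    ... | no tv | yes pz = trans (cong (λ b → bagN t v * b * ((enc p g /₀ (q ^ rank p v)) %₀ q * q ^ rank t v)) pz)
        (trans (cong (_* ((enc p g /₀ (q ^ rank p v)) %₀ q * q ^ rank t v)) (*-zeroʳ (bagN t v)))
        (sym (trans (cong (λ x → bagN t v * (x * q ^ rank t v)) (outside v v<n tv pz)) (*-zeroʳ (bagN t v)))))

-- The program

pattern POW = 0
pattern P2 = 1
pattern RND = 2
pattern ND = 3
pattern PA = 4
pattern TBL = 5
pattern TMP = 6

infixl 6 _⊹_ _⊖_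
infixl 7 _⊛_ _÷_ _%%_
_⊹_ _⊖_ _⊛_ _÷_ _%%_ : Expr → Expr → Expr
_⊹_ = op add
_⊖_ = op sub
_⊛_ = op mul
_÷_ = op quo
_%%_ = op rem

isEq : Expr → Expr → Expr
isEq a b = lit 1 ⊖ (lt a b ⊹ lt b a)

nE NE qE mE BE QE EE kE signE : Expr
nE    = inp (lit 0)
NE    = inp (lit 1)
qE    = lit 2 ⊛ (inp (lit 2) ⊹ lit 1)
signE = inp (lit 3)
kE    = inp (lit 4)
EE    = var 0 ⊛ var 0 ⊛ (var 0 ⊛ var 0)

adjE tadjE bagE : Expr → Expr → Expr
adjE  u v = inp (lit 5 ⊹ (u ⊛ nE ⊹ v))
tadjE s t = inp (lit 5 ⊹ (nE ⊛ nE ⊹ (s ⊛ NE ⊹ t)))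
bagE  t v = inp (lit 5 ⊹ (nE ⊛ nE ⊹ (NE ⊛ NE ⊹ (t ⊛ nE ⊹ v))))

BE = sum 23 nE (lt (lit 0) (sum 24 NE (lt (var 23) (sum 25 nE (bagE (var 24) (var 25))))))
QE = rd POW BE
mE = sum 22 (lit 2 ⊛ nE) (lt (rd P2 (var 22)) (lit 2 ⊛ nE))

weightE : Expr → Expr
weightE v = lit 1 ⊹ (nE ⊹ lit 1) ⊛ sum 21 mE (rd RND (v ⊛ mE ⊹ var 21) ⊛ rd P2 (var 21))

rankE : Expr → Expr → Expr
rankE t v = sum 16 v (bagE t (var 16))

digE : Expr → Expr → Expr → Expr
digE a t v = a ÷ rd POW (rankE t v) %% qE

-- A state is 2 l + b for a label l and a bit b.
labelE sideE coefE : Expr → Expr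
labelE s = s ÷ lit 2
sideE  s = s %% lit 2
coefE  s = lit 1 ⊹ lit 2 ⊛ (sideE s ⊛ lt (lit 0) (labelE s))

shiftE : Expr → Expr → Expr
shiftE s v = lt (labelE s) (lit 1) ⊛ weightE v

badE : Expr → Expr → Expr
badE s t = lt (labelE s ⊹ lit 1) (labelE t) ⊹
  (isEq (labelE s ⊹ lit 1) (labelE t) ⊛ sideE t ⊹
   lt (labelE s ⊹ labelE t) (lit 1) ⊛ (lt (sideE s) (sideE t) ⊹ lt (sideE t) (sideE s)))

cellE : Expr → Expr → Expr → Expr
cellE a t e = (a ⊛ (NE ⊹ lit 1) ⊹ t) ⊛ EE ⊹ e

listedE : Expr → Expr
listedE x = lt (lit 0) (sum 20 (var 10 ⊹ lit 1) (isEq (rd ND (var 20 ⊹ lit 1)) x))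

crossE : Expr → Expr
crossE c = listedE (c ÷ NE) ⊛ ((lit 1 ⊖ listedE (c %% NE)) ⊛ tadjE (c ÷ NE) (c %% NE))

searchE : Expr
searchE = sum 18 (NE ⊛ NE) (lt (sum 19 (var 18 ⊹ lit 1) (crossE (var 19))) (lit 1))

violE : Expr → Expr → Expr
violE a t = sum 14 nE (sum 15 nE (bagE t (var 14) ⊛ bagE t (var 15) ⊛
  (adjE (var 14) (var 15) ⊛ badE (digE a t (var 14)) (digE a t (var 15)))))

replaceE : Expr → Expr → Expr → Expr → Expr
replaceE a t v d = a ⊹ d ⊛ rd POW (rankE t v) ⊖ digE a t v ⊛ rd POW (rankE t v)

forgetE : Expr → Expr → Expr → Expr → Expr
forgetE a t v e = sum 14 qE (coefE (var 14) ⊛ (lt (shiftE (var 14) v) (e ⊹ lit 1) ⊛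
  rd TBL (cellE (replaceE a t v (var 14)) t (e ⊖ shiftE (var 14) v))))

embedE : Expr → Expr → Expr → Expr
embedE a t p = sum 15 nE (bagE t (var 15) ⊛ bagE p (var 15) ⊛ (digE a p (var 15) ⊛ rd POW (rankE t (var 15))))

joinE : Expr → Expr → Expr → Expr → Expr
joinE a t p e = sum 14 (e ⊹ lit 1) (rd TBL (cellE a p (var 14)) ⊛ rd TBL (cellE (embedE a t p) t (e ⊖ var 14)))

childE parentE rowE colE : Expr
childE  = rd ND (NE ⊖ var 10)
parentE = rd PA (NE ⊖ var 10)
rowE    = var 13 ÷ EE
colE    = var 13 %% EE

powersOf2 powers order tables solve-all : Com
powersOf2 = store P2 (lit 0) (lit 1) ⨾
  for 10 (lit 2 ⊛ nE) (store P2 (var 10 ⊹ lit 1) (rd P2 (var 10) ⊛ (lit 1 ⊹ lt (rd P2 (var 10)) (lit 2 ⊛ nE))))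
powers = store POW (lit 0) (lit 1) ⨾ for 10 BE (store POW (var 10 ⊹ lit 1) (rd POW (var 10) ⊛ qE))
order = store ND (lit 0) NE ⨾ store ND (lit 1) (lit 0) ⨾ store PA (lit 1) NE ⨾
  for 10 (NE ⊖ lit 1) (store PA (var 10 ⊹ lit 2) (searchE ÷ NE) ⨾ store ND (var 10 ⊹ lit 2) (searchE %% NE))
tables = for 10 (QE ⊛ ((NE ⊹ lit 1) ⊛ EE)) (store TBL (var 10)
  (lt (violE (var 10 ÷ EE ÷ (NE ⊹ lit 1)) (var 10 ÷ EE %% (NE ⊹ lit 1))) (lit 1) ⊛ lt (var 10 %% EE) (lit 1)))

-- The new table is computed in TMP before it replaces the old one.
replaceTable : Expr → Expr → Com
replaceTable s e = for 13 (QE ⊛ EE) (store TMP (var 13) (e %% lit 4)) ⨾ for 13 (QE ⊛ EE) (store TBL (cellE rowE s colE) (rd TMP (var 13)))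

forgetC joinC : Com
forgetC = for 11 nE (for 12 (bagE childE (var 11) ⊛ (lit 1 ⊖ bagE parentE (var 11)))
  (replaceTable childE (forgetE rowE childE (var 11) colE)))
joinC = replaceTable parentE (joinE rowE childE parentE colE)

solve-all = for 10 NE (forgetC ⨾ joinC)

main : Com
main = powers ⨾ order ⨾ tables ⨾ solve-all

answerE : Expr
answerE = (lit 1 ⊖ signE) ⊛ lt (lit 0) (sum 10 EE (isEq (var 10 %% (nE ⊹ lit 1)) kE ⊛ (rd TBL (cellE (lit 0) NE (var 10)) %% lit 4)))

Γ : ℕ → Deg
Γ POW = 0 , 1
Γ P2  = 2 , 0
Γ RND = 0 , 0
Γ _   = 1 , 0

Δ₀ : ℕ → Deg
Δ₀ 0 = 1 , 0
Δ₀ 1 = 3 , 0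
Δ₀ _ = 0 , 0

degreeBound : ℕ
degreeBound = 100

module _ where
  open Degrees Γ degreeBound

  ok-powersOf2 : T (okC Δ₀ powersOf2)
  ok-powersOf2 = tt
  ok-bits : T (ok Δ₀ (nE ⊛ mE))
  ok-bits = tt
  fits-bits : T (fits (deg Δ₀ (nE ⊛ mE)))
  fits-bits = tt
  fits-RND : T (fits (cellD RND (deg Δ₀ (nE ⊛ mE))))
  fits-RND = tt
  ok-main : T (okC Δ₀ main)
  ok-main = tt
  ok-answer : T (ok Δ₀ answerE)
  ok-answer = tt

reads : ℕ → Expr → Bool
reads B (var x)     = false
reads B (lit c)     = false
reads B (inp e)     = reads B e
reads B (rd A e)    = (B ≡ᵇ A) ∨ reads B e
reads B (op o a b)  = reads B a ∨ reads B b
reads B (lt a b)    = reads B a ∨ reads B b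
reads B (sum x b e) = reads B b ∨ reads B e

writes : ℕ → Com → Bool
writes B (store A i e) = B ≡ᵇ A
writes B (for x b c)   = writes B c
writes B (c ⨾ d)       = writes B c ∨ writes B d

∨-F : ∀ a {b} → T (not (a ∨ b)) → T (not a) × T (not b)
∨-F false h = tt , h

≢⇒≡ᵇ : ∀ {a b} → a ≢ b → (a ≡ᵇ b) ≡ false
≢⇒≡ᵇ {a} {b} a≢b with a ≡ᵇ b in eq
... | true  = ⊥-elim (a≢b (≡ᵇ⇒≡ a b (subst T (sym eq) tt)))
... | false = refl

≡ᵇ-refl : ∀ a → (a ≡ᵇ a) ≡ true
≡ᵇ-refl a = Equivalence.to T-≡ (≡⇒≡ᵇ a a refl)

set-other : ∀ 𝓐 A i v {B} → B ≢ A → set 𝓐 A i v B ≡ 𝓐 B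
set-other 𝓐 A i v {B} B≢A = cong (λ c → if c then update (𝓐 A) i v else 𝓐 B) (≢⇒≡ᵇ B≢A)

set-same : ∀ 𝓐 A i v → set 𝓐 A i v A ≡ update (𝓐 A) i v
set-same 𝓐 A i v = cong (λ c → if c then update (𝓐 A) i v else 𝓐 A) (≡ᵇ-refl A)

module Frames (input : ℕ → ℕ) where
  open Semantics input

  ev-frame : ∀ A e {σ 𝓐 𝓑} → (∀ B → B ≢ A → 𝓑 B ≡ 𝓐 B) → T (not (reads A e)) → ev e σ 𝓑 ≡ ev e σ 𝓐
  ev-frame A (var x)     h nr = refl
  ev-frame A (lit c)     h nr = refl
  ev-frame A (inp e)     h nr = cong input (ev-frame A e h nr)
  ev-frame A (rd B e)    {σ} {𝓐} h nr = cong₂ (λ f i → f i)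
    (h B λ { refl → subst (T ∘ not) (≡ᵇ-refl B) (proj₁ (∨-F (A ≡ᵇ B) nr)) }) (ev-frame A e h (proj₂ (∨-F (A ≡ᵇ B) nr)))
  ev-frame A (op o a b)  h nr = cong₂ (opv o) (ev-frame A a h (proj₁ (∨-F (reads A a) nr))) (ev-frame A b h (proj₂ (∨-F (reads A a) nr)))
  ev-frame A (lt a b)    h nr = cong₂ (λ x y → bit (x <ᵇ y)) (ev-frame A a h (proj₁ (∨-F (reads A a) nr))) (ev-frame A b h (proj₂ (∨-F (reads A a) nr)))
  ev-frame A (sum x b e) {σ} {𝓐} h nr = trans (cong (λ k → Sum k _) (ev-frame A b h (proj₁ (∨-F (reads A b) nr))))
    (Sum-cong (ev b σ 𝓐) λ i _ → ev-frame A e h (proj₂ (∨-F (reads A b) nr)))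

  frame : ∀ B c {σ 𝓐} → T (not (writes B c)) → exec c σ 𝓐 B ≡ 𝓐 B
  frame B (store A i e) {σ} {𝓐} h = set-other 𝓐 A (ev i σ 𝓐) (ev e σ 𝓐) λ { refl → subst (T ∘ not) (≡ᵇ-refl B) h }
  frame B (c ⨾ d) h = trans (frame B d (proj₂ (∨-F (writes B c) h))) (frame B c (proj₁ (∨-F (writes B c) h)))
  frame B (for x b c) {σ} {𝓐} h = go (ev b σ 𝓐)
    where
    go : ∀ k → iter k (λ i → exec c (update σ x i)) 𝓐 B ≡ 𝓐 B
    go zero    = refl
    go (suc k) = trans (frame B c h) (go k)

  module Fill (x A : ℕ) (idx val : Expr) (no-idx : T (not (reads A idx))) (no-val : T (not (reads A val))) (σ : Env) (𝓐 : Arrays) where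

    place value : ℕ → ℕ
    place j = ev idx (update σ x j) 𝓐
    value j = ev val (update σ x j) 𝓐

    state : ℕ → Arrays
    state j = iter j (λ i → exec (store A idx val) (update σ x i)) 𝓐

    others : ∀ j B → B ≢ A → state j B ≡ 𝓐 B
    others zero    B B≢A = refl
    others (suc j) B B≢A = trans (set-other _ A _ _ B≢A) (others j B B≢A)

    value-at : ∀ j → ev val (update σ x j) (state j) ≡ value j
    value-at j = ev-frame A val (others j) no-val

    step : ∀ j → state (suc j) A ≡ update (state j A) (place j) (value j)
    step j = trans (set-same (state j) A _ _) (cong₂ (update (state j A)) (ev-frame A idx (others j) no-idx) (value-at j))

    miss : ∀ j y → (∀ k → k < j → place k ≢ y) → state j A y ≡ 𝓐 A y
    miss zero    y h = refl
    miss (suc j) y h = trans (cong-app (step j) y) (trans (update-other (state j A) (value j) (h j ≤-refl ∘ sym)) (miss j y λ k k< → h k (m<n⇒m<1+n k<)))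

    hit : ∀ j → (∀ i k → i < j → k < j → place i ≡ place k → i ≡ k) → ∀ k → k < j → state j A (place k) ≡ value k
    hit (suc j) inj k k< with k ≟ j
    ... | yes refl = trans (cong-app (step j) (place j)) (update-same (state j A) (place j) (value j))
    ... | no k≢j   = trans (cong-app (step j) (place k)) (trans (update-other (state j A) (value j) (λ e → k≢j (inj k j k< ≤-refl e)))
        (hit j (λ i k i< k< → inj i k (m<n⇒m<1+n i<) (m<n⇒m<1+n k<)) k (≤∧≢⇒< (s≤s⁻¹ k<) k≢j)))

  module Recurrence (x A : ℕ) (val : Expr) (σ : Env) (𝓐 : Arrays) (p : ℕ → ℕ) (start : 𝓐 A 0 ≡ p 0) (b : ℕ)
    (next : ∀ j 𝓑 → j < b → (∀ B → B ≢ A → 𝓑 B ≡ 𝓐 B) → 𝓑 A j ≡ p j → ev val (update σ x j) 𝓑 ≡ p (suc j)) where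

    state : ℕ → Arrays
    state j = iter j (λ i → exec (store A (var x ⊹ lit 1) val) (update σ x i)) 𝓐

    others : ∀ j B → B ≢ A → state j B ≡ 𝓐 B
    others zero    B B≢A = refl
    others (suc j) B B≢A = trans (set-other _ A _ _ B≢A) (others j B B≢A)

    index : ∀ j → update σ x j x + 1 ≡ suc j
    index j = trans (cong (_+ 1) (update-same σ x j)) (+-comm j 1)

    values : ∀ j → j ≤ b → ∀ i → i ≤ j → state j A i ≡ p i
    next-value : ∀ j → j < b → ev val (update σ x j) (state j) ≡ p (suc j)
    next-value j j<b = next j (state j) j<b (others j) (values j (<⇒≤ j<b) j ≤-refl)
    values zero    _   zero z≤n = start
    values (suc j) j<b i i≤ with i ≟ suc j
    ... | yes refl = trans (cong-app (set-same (state j) A _ _) (suc j)) (trans (cong (λ k → update (state j A) k (ev val (update σ x j) (state j)) (suc j)) (index j))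
        (trans (update-same (state j A) (suc j) (ev val (update σ x j) (state j))) (next-value j j<b)))
    ... | no i≢    = trans (cong-app (set-same (state j) A _ _) i) (trans (update-other (state j A) _ (λ e → i≢ (trans e (index j))))
        (values j (<⇒≤ j<b) i (s≤s⁻¹ (≤∧≢⇒< i≤ i≢))))

doubling : ℕ → ℕ → ℕ
doubling K zero    = 1
doubling K (suc j) = doubling K j * (1 + bit (doubling K j <ᵇ K))

doubling-≤ : ∀ K j → doubling K j ≤ 1 + 2 * K
doubling-≤ K zero    = s≤s z≤n
doubling-≤ K (suc j) with doubling K j <ᵇ K in eq
... | true  = ≤-trans (≤-trans (≤-reflexive (*-comm (doubling K j) 2)) (*-monoʳ-≤ 2 (<⇒≤ (<ᵇ⇒< (doubling K j) K (subst T (sym eq) tt))))) (n≤1+n (2 * K))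
... | false = ≤-trans (≤-reflexive (*-identityʳ (doubling K j))) (doubling-≤ K j)

log : ℕ → ℕ
log K = leastB (λ j → not (2 ^ j <ᵇ K)) K

log-upper : ∀ K → K ≤ 2 ^ log K
log-upper K with leastB-holds (λ j → not (2 ^ j <ᵇ K)) K (big (2 ^ K <ᵇ K) λ h → ≤⇒≯ (n≤2^n K) (<ᵇ⇒< _ K h))
  where
  big : ∀ b → ¬ T b → T (not b)
  big true  h = ⊥-elim (h tt)
  big false h = tt
... | h with 2 ^ log K <ᵇ K in eq
...   | false = ≮⇒≥ λ l → subst T eq (<⇒<ᵇ l)

log-lower : ∀ K j → j < log K → 2 ^ j < K
log-lower K j j< with 2 ^ j <ᵇ K in eq
... | true  = <ᵇ⇒< _ K (subst T (sym eq) tt)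
... | false = ⊥-elim (<⇒≱ j< (leastB-least (λ j → not (2 ^ j <ᵇ K)) K j (subst (T ∘ not) (sym eq) tt)))

doubling-2^ : ∀ K j → j ≤ log K → doubling K j ≡ 2 ^ j
doubling-2^ K zero    _  = refl
doubling-2^ K (suc j) j< = trans (cong (λ d → d * (1 + bit (d <ᵇ K))) (doubling-2^ K j (<⇒≤ j<)))
  (trans (cong (λ b → 2 ^ j * (1 + b)) (bit-< (log-lower K j j<))) (*-comm (2 ^ j) 2))

doubling-stays : ∀ K o → doubling K (log K + o) ≡ 2 ^ log K
doubling-stays K zero    = trans (cong (doubling K) (+-identityʳ (log K))) (doubling-2^ K (log K) ≤-refl)
doubling-stays K (suc o) = trans (cong (doubling K) (+-suc (log K) o)) (trans (cong (λ d → d * (1 + bit (d <ᵇ K))) (doubling-stays K o))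
  (trans (cong (λ b → 2 ^ log K * (1 + b)) (bit-≥ (log-upper K))) (*-identityʳ _)))

Sum-below : ∀ k m → m ≤ k → Sum k (λ j → bit (j <ᵇ m)) ≡ m
Sum-below zero    zero    _  = refl
Sum-below (suc k) m m≤ with m≤n⇒m<n∨m≡n m≤
... | inj₁ m<1+k = trans (cong₂ _+_ (Sum-below k m (s≤s⁻¹ m<1+k)) (bit-≥ (s≤s⁻¹ m<1+k))) (+-identityʳ m)
... | inj₂ refl  = trans (cong₂ _+_ (trans (Sum-cong k λ j j<k → trans (bit-< (m<n⇒m<1+n j<k)) (sym (bit-< j<k))) (Sum-below k k ≤-refl)) (bit-< (n<1+n k))) (+-comm k 1)

log-Sum : ∀ K → Sum K (λ j → bit (doubling K j <ᵇ K)) ≡ log K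
log-Sum K = trans (Sum-cong K term) (Sum-below K (log K) (leastB-≤ _ K))
  where
  term : ∀ j → j < K → bit (doubling K j <ᵇ K) ≡ bit (j <ᵇ log K)
  term j _ with <-≤-connex j (log K)
  ... | inj₁ j< = trans (cong (λ d → bit (d <ᵇ K)) (doubling-2^ K j (<⇒≤ j<))) (trans (bit-< (log-lower K j j<)) (sym (bit-< j<)))
  ... | inj₂ j≥ with m≤n⇒∃[o]m+o≡n j≥
  ...   | o , refl = trans (cong (λ d → bit (d <ᵇ K)) (doubling-stays K o)) (trans (bit-≥ (log-upper K)) (sym (bit-≥ j≥)))

-- The least index with f ≢ 0, as a sum
search : ℕ → (ℕ → ℕ) → ℕ
search b f = Sum b (λ c → bit (Sum (c + 1) f <ᵇ 1))

search-found : ∀ b f → (∃ λ c → c < b × f c ≢ 0) → search b f < b × f (search b f) ≢ 0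
search-found (suc b) f (c , c< , fc) with anyUpTo? (λ c → ¬? (f c ≟ 0)) b
... | yes found@(d , d< , fd) with search-found b f found
...   | s< , fs = subst (λ k → k < suc b × f k ≢ 0) (sym last) (m<n⇒m<1+n s< , fs)
  where
  last : search (suc b) f ≡ search b f
  last = trans (cong (search b f +_) (bit-≥ (≤-trans (n≢0⇒n>0 fd) (Sum-term (b + 1) f d (subst (d <_) (+-comm 1 b) (m<n⇒m<1+n d<)))))) (+-identityʳ _)
search-found (suc b) f (c , c< , fc) | no none = subst (λ k → k < suc b × f k ≢ 0) (sym last) (≤-refl , fb)
  where
  zeros : ∀ d → d < b → f d ≡ 0
  zeros d d< with f d ≟ 0
  ... | yes z = z
  ... | no nz = ⊥-elim (none (d , d< , nz))
  fb : f b ≢ 0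
  fb with m≤n⇒m<n∨m≡n (s≤s⁻¹ c<)
  ... | inj₁ c<b  = ⊥-elim (fc (zeros c c<b))
  ... | inj₂ refl = fc
  last : search (suc b) f ≡ b
  last = trans (cong₂ _+_ (trans (Sum-cong b λ d d< → trans (cong (λ s → bit (s <ᵇ 1)) (Sum-0 (d + 1) λ i i< → zeros i (<-≤-trans i< (subst (_≤ b) (+-comm 1 d) d<)))) (sym (bit-< d<)))
                 (Sum-below b b ≤-refl))
               (bit-≥ (≤-trans (n≢0⇒n>0 fb) (Sum-term (b + 1) f b (≤-reflexive (+-comm 1 b)))))) (+-identityʳ b)

module Preparation (X Q : ℕ) (2≤X : 2 ≤ X) (1≤Q : 1 ≤ Q) (input : ℕ → ℕ) (input≤X : ∀ i → input i ≤ X)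
  (big : input 0 + input 1 + 8 ≤ X) (σ₀ : Env) where
  open Bounds X Q 2≤X 1≤Q
  open Semantics input
  open Frames input

  n N q K : ℕ
  n = input 0
  N = input 1
  q = 2 * (input 2 + 1)
  K = 2 * n

  adjN tadjN bagN : ℕ → ℕ → ℕ
  adjN  u v = input (5 + (u * n + v))
  tadjN s t = input (5 + (n * n + (s * N + t)))
  bagN  t v = input (5 + (n * n + (N * N + (t * n + v))))

  maxBag : ℕ
  maxBag = Sum n (λ j → bit (0 <ᵇ Sum N (λ t → bit (j <ᵇ Sum n (bagN t)))))

  ValidC : Com → Env → Arrays → Set
  ValidC = Valid Γ degreeBound input input≤X

  AdmissibleC : Com → Env → Arrays → Set
  AdmissibleC = Admissible Γ degreeBound input input≤X

  n+8≤X : n + 8 ≤ X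
  n+8≤X = ≤-trans (+-monoˡ-≤ 8 (m≤m+n n N)) big

  N+8≤X : N + 8 ≤ X
  N+8≤X = ≤-trans (+-monoˡ-≤ 8 (m≤n+m N n)) big

  X≤𝔹 : ∀ {k} → k ≤ X → k ≤ 𝔹 (1 , 0)
  X≤𝔹 k≤ = ≤-trans k≤ (≤-reflexive (sym (trans (*-identityʳ _) (*-identityʳ X))))

  module Powers2 (𝓐 : Arrays) where
    val : Expr
    val = rd P2 (var 10) ⊛ (lit 1 ⊹ lt (rd P2 (var 10)) (lit 2 ⊛ nE))

    open Recurrence 10 P2 val σ₀ (set 𝓐 P2 0 1) (doubling K) refl K
      (λ j 𝓑 _ _ e → cong (λ d → d * (1 + bit (d <ᵇ K))) e) public

    after : Arrays
    after = exec powersOf2 σ₀ 𝓐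

    after-P2 : ∀ i → i ≤ K → after P2 i ≡ doubling K i
    after-P2 = values K ≤-refl

    doubling-fits : ∀ j → doubling K j ≤ 𝔹 (2 , 0)
    doubling-fits j = ≤-trans (doubling-≤ K j) (≤-trans bound (≤-reflexive (sym (trans (*-identityʳ _) (cong (X *_) (*-identityʳ X))))))
      where
      bound : 1 + 2 * K ≤ X * X
      bound = ≤-trans (≤-trans (m≤m+n (1 + 2 * K) (4 * n + 63)) (≤-reflexive
                (solve 1 (λ n → con 1 :+ con 2 :* (con 2 :* n) :+ (con 4 :* n :+ con 63) := con 8 :* (n :+ con 8)) refl n)))
              (*-mono-≤ (≤-trans (m≤n+m 8 n) n+8≤X) n+8≤X)

    valid : ValidC powersOf2 σ₀ 𝓐
    valid = doubling-fits 0 , λ j j< → subst (_≤ 𝔹 (2 , 0)) (sym (next-value j j<)) (doubling-fits (suc j))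

  module Powers (𝓐 : Arrays) (Q≡ : Q ≡ q ^ maxBag) (0<q : 0 < q) where
    open Recurrence 10 POW (rd POW (var 10) ⊛ qE) σ₀ (set 𝓐 POW 0 1) (q ^_) refl maxBag
      (λ j 𝓑 _ _ e → trans (cong (_* q) e) (*-comm (q ^ j) q)) public

    after : Arrays
    after = exec powers σ₀ 𝓐

    after-POW : ∀ i → i ≤ maxBag → after POW i ≡ q ^ i
    after-POW = values maxBag ≤-refl

    fits-power : ∀ j → j ≤ maxBag → q ^ j ≤ 𝔹 (0 , 1)
    fits-power j j≤ = ≤-trans (^-monoʳ-≤ q {{>-nonZero 0<q}} j≤) (≤-reflexive (trans (sym Q≡) (sym (trans (*-identityˡ _) (*-identityʳ Q)))))

    valid : AdmissibleC powers σ₀ 𝓐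
    valid = admissible (fits-power 0 z≤n , λ j j< → subst (_≤ 𝔹 (0 , 1)) (sym (next-value j j<)) (fits-power (suc j) j<))

  module Traversal (G : Graph n) (Tr : Graph N) (isTree : IsTree Tr) (bagT : Fin N → Subset n)
    (coversVertex : ∀ v → ∃ λ t → v ∈ bagT t) (coversEdge : ∀ u v → Edge G u v → ∃ λ t → u ∈ bagT t × v ∈ bagT t)
    (connected : ∀ v → InducedConnected Tr (λ t → v ∈ bagT t))
    (tadjN-adj : ∀ s t → tadjN (toℕ s) (toℕ t) ≡ bit (adj Tr s t))
    (bagN-bag : ∀ t v → bagN (toℕ t) (toℕ v) ≡ bit (Vec.lookup (bagT t) v))
    (bagN-N : ∀ v → v < n → bagN N v ≡ 0) (𝓐 : Arrays) where
    open TreeOrder G Tr isTree bagT coversVertex coversEdge connected tadjN bagN tadjN-adj bagN-bag bagN-N public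

    after : Arrays
    after = exec order σ₀ 𝓐

    body : Com
    body = store PA (var 10 ⊹ lit 2) (searchE ÷ NE) ⨾ store ND (var 10 ⊹ lit 2) (searchE %% NE)

    base : Arrays
    base = set (set (set 𝓐 ND 0 N) ND 1 0) PA 1 N

    state : ℕ → Arrays
    state k = iter k (λ i → exec body (update σ₀ 10 i)) base

    cross : ℕ → (ℕ → ℕ) → ℕ → ℕ
    cross k nd c = listed (c /₀ N) * ((1 ∸ listed (c %₀ N)) * tadjN (c /₀ N) (c %₀ N))
      where
      listed : ℕ → ℕ
      listed x = bit (0 <ᵇ Sum (k + 1) (λ j → eqN (nd (j + 1)) x))

    found : ℕ → ℕ
    found k = search (N * N) (cross k (state k ND))

    module _ (k : ℕ) (ordered : Order (state k ND) (state k PA) (suc k)) (k<N : suc k < N) where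
      open Ordered ordered

      nd : ℕ → ℕ
      nd = state k ND

      listedN : ℕ → ℕ
      listedN x = bit (0 <ᵇ Sum (k + 1) (λ j → eqN (nd (j + 1)) x))

      listed-complete : ∀ x → Listed x → listedN x ≡ 1
      listed-complete x (suc i , i< , _ , e) = bit-< (≤-trans (≤-reflexive (trans (sym (eqN-refl x)) (cong (λ y → eqN y x) (trans (sym e) (cong nd (+-comm 1 i))))))
        (Sum-term (k + 1) (λ j → eqN (nd (j + 1)) x) i (subst (i <_) (+-comm 1 k) (s≤s⁻¹ i<))))

      listed-sound : ∀ x → listedN x ≢ 0 → Listed x
      listed-sound x nz with anyUpTo? (λ j → nd (j + 1) ≟ x) (k + 1)
      ... | yes (j , j< , e) = suc j , s≤s (subst (j <_) (+-comm k 1) j<) , s≤s z≤n , trans (cong nd (+-comm 1 j)) e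
      ... | no none = ⊥-elim (nz (trans (cong (λ s → bit (0 <ᵇ s)) (Sum-0 (k + 1) λ j j< → eqN-≢ λ e → none (j , j< , e))) refl))

      0<N′ : 0 < N
      0<N′ = ≤-<-trans z≤n k<N

      found-spec : found k < N * N × cross k nd (found k) ≢ 0
      found-spec with x , y , x<N , y<N , lx , ¬ly , a ← crossing (s≤s z≤n) k<N =
        search-found (N * N) (cross k nd) (x * N + y , radix-< N x<N y<N , λ z → a (trans (sym (value x y y<N lx ¬ly)) z))
        where
        value : ∀ x y → y < N → Listed x → ¬ Listed y → cross k nd (x * N + y) ≡ tadjN x y
        value x y y<N lx ¬ly = trans (cong₂ (λ x y → listedN x * ((1 ∸ listedN y) * tadjN x y)) (/₀-unique {x} N y<N) (%₀-unique {x} N y<N))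
          (trans (cong₂ (λ a b → a * ((1 ∸ b) * tadjN x y)) (listed-complete x lx) not-listed)
          (trans (+-identityʳ _) (+-identityʳ _)))
          where
          not-listed : listedN y ≡ 0
          not-listed with listedN y ≟ 0
          ... | yes z = z
          ... | no nz = ⊥-elim (¬ly (listed-sound y nz))

      x y : ℕ
      x = found k /₀ N
      y = found k %₀ N

      y<N : y < N
      y<N = %₀-< (found k) 0<N′

      x<N : x < N
      x<N = /₀-< {found k} {N} {N} (proj₁ found-spec)

      lx : Listed x
      lx = listed-sound x λ z → proj₂ found-spec (cong (_* ((1 ∸ listedN y) * tadjN x y)) z)

      ¬ly : ¬ Listed y
      ¬ly ly = proj₂ found-spec (trans (cong (λ b → listedN x * ((1 ∸ b) * tadjN x y)) (listed-complete y ly)) (*-zeroʳ (listedN x)))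

      xy : tadjN x y ≢ 0
      xy z = proj₂ found-spec (trans (cong (λ b → listedN x * ((1 ∸ listedN y) * b)) z) (trans (cong (listedN x *_) (*-zeroʳ (1 ∸ listedN y))) (*-zeroʳ (listedN x))))

      middle : Arrays
      middle = exec (store PA (var 10 ⊹ lit 2) (searchE ÷ NE)) (update σ₀ 10 k) (state k)

      middle-y : ev (searchE %% NE) (update σ₀ 10 k) middle ≡ y
      middle-y = ev-frame PA (searchE %% NE) {update σ₀ 10 k} {state k} {middle} (λ B B≢ → set-other (state k) PA (k + 2) x B≢) tt

      ND-update : state (suc k) ND ≡ update nd (k + 2) y
      ND-update = cong (update nd (k + 2)) middle-y

      older : ∀ {f : ℕ → ℕ} {v} j → j ≤ suc k → update f (k + 2) v j ≡ f j
      older {f} {v} j j≤ = update-other f v (<⇒≢ (≤-trans (s≤s j≤) (≤-reflexive (+-comm 2 k))))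

      newest : ∀ {f : ℕ → ℕ} {v} → update f (k + 2) v (2 + k) ≡ v
      newest {f} {v} = trans (cong (update f (k + 2) v) (+-comm 2 k)) (update-same f (k + 2) v)

      extended : Order (state (suc k) ND) (state (suc k) PA) (2 + k)
      extended = Order-extend (s≤s z≤n) ND-older (λ j j≤ → older {state k PA} j j≤) ordered record
        { node<    = subst (_< N) (sym ND-newest) y<N
        ; parent   = let i , i< , 1≤i , e = lx in i , 1≤i , i< , trans (newest {state k PA}) (trans (sym e) (sym (ND-older i (s≤s⁻¹ i<))))
        ; new      = λ j 1≤j j< e → ¬ly (j , j< , 1≤j , trans (sym (ND-older j (s≤s⁻¹ j<))) (trans e ND-newest))
        ; attached = λ z → xy (trans (cong₂ tadjN (sym (newest {state k PA})) (sym ND-newest)) z) }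
        where
        ND-older : ∀ j → j ≤ suc k → state (suc k) ND j ≡ nd j
        ND-older j j≤ = trans (cong-app ND-update j) (older {nd} j j≤)
        ND-newest : state (suc k) ND (2 + k) ≡ y
        ND-newest = trans (cong-app ND-update (2 + k)) (newest {nd})

      valid-step : ValidC body (update σ₀ 10 k) (state k)
      valid-step = X≤𝔹 (≤-trans (<⇒≤ x<N) (≤-trans (m≤m+n N 8) N+8≤X)) ,
        subst (_≤ 𝔹 (1 , 0)) (sym middle-y) (X≤𝔹 (≤-trans (<⇒≤ y<N) (≤-trans (m≤m+n N 8) N+8≤X)))

    order-state : ∀ k → k ≤ N ∸ 1 → Order (state k ND) (state k PA) (suc k)
    order-state zero    _  = record { root = refl ; first = refl ; top = refl ; steps = λ { (suc (suc i)) _ (s≤s ()) ; (suc zero) (s≤s ()) _ } }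
    order-state (suc k) k< = extended k (order-state k (<⇒≤ k<)) (subst (suc k <_) (m+[n∸m]≡n 0<N) (s≤s k<))

    after-order : Order (after ND) (after PA) N
    after-order = subst (Order (after ND) (after PA)) (m+[n∸m]≡n 0<N) (order-state (N ∸ 1) ≤-refl)

    valid : AdmissibleC order σ₀ 𝓐
    valid = admissible (X≤𝔹 N≤X , z≤n , X≤𝔹 N≤X , λ k k< → valid-step k (order-state k (<⇒≤ k<)) (subst (suc k <_) (m+[n∸m]≡n 0<N) (s≤s k<)))
      where
      N≤X : N ≤ X
      N≤X = ≤-trans (m≤m+n N 8) N+8≤X

sumN-Sum2 : ∀ R f → Sum (2 * R) f ≡ Sum R (λ l → Sum 2 (λ b → f (l * 2 + b)))
sumN-Sum2 R f = trans (cong (λ k → Sum k f) (*-comm 2 R)) (go R)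
  where
  go : ∀ R → Sum (R * 2) f ≡ Sum R (λ l → Sum 2 (λ b → f (l * 2 + b)))
  go zero    = refl
  go (suc R) = trans (+-assoc (Sum (R * 2) f) _ _) (cong₂ _+_ (go R) (cong₂ (λ a b → f a + f b) (sym (+-identityʳ (R * 2))) (+-comm 1 (R * 2))))

combine : ∀ {n} → Vec ℕ n → Vec ℕ n → Vec ℕ n
combine []      []      = []
combine (l ∷ ls) (b ∷ bs) = (l * 2 + b) ∷ combine ls bs

at-combine : ∀ {n} (l b : Vec ℕ n) v → at (combine l b) v ≡ at l v * 2 + at b v
at-combine []       []       v       = refl
at-combine (l ∷ ls) (b ∷ bs) zero    = refl
at-combine (l ∷ ls) (b ∷ bs) (suc v) = at-combine ls bs v

sumN-combine : ∀ R n F → sumN (2 * R) n F ≡ sumN R n (λ l → sumN 2 n (λ b → F (combine l b)))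
sumN-combine R zero    F = refl
sumN-combine R (suc n) F = trans (sumN-Sum2 R _) (Sum-cong R λ l _ →
  trans (Sum-cong 2 λ b _ → sumN-combine R n (λ g → F ((l * 2 + b) ∷ g))) (sumV-Sum R n 2 (λ b ls → sumN 2 n (λ bs → F ((l * 2 + b) ∷ combine ls bs)))))

upto-skip : ∀ (ex : ℕ → Bool) u v → ex v ≡ false → (u <ᵇ v) ∧ ex u ≡ (u <ᵇ suc v) ∧ ex u
upto-skip ex u v no-ex with <-cmp u v
... | tri< u<v _ _ rewrite Equivalence.to T-≡ (<⇒<ᵇ u<v) | Equivalence.to T-≡ (<⇒<ᵇ (m<n⇒m<1+n u<v)) = refl
... | tri≈ _ refl _ rewrite no-ex = trans (∧-zeroʳ (u <ᵇ u)) (sym (∧-zeroʳ (u <ᵇ suc u)))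
... | tri> _ _ v<u with u <ᵇ v in e₁ | u <ᵇ suc v in e₂
...   | false | false = refl
...   | true  | _     = ⊥-elim (<⇒≱ v<u (<⇒≤ (<ᵇ⇒< u v (subst T (sym e₁) tt))))
...   | false | true  = ⊥-elim (<⇒≱ v<u (s≤s⁻¹ (<ᵇ⇒< u (suc v) (subst T (sym e₂) tt))))

exclusive-bits : ∀ a b → a ≤ 1 → ((0 <ᵇ a) ∧ (b <ᵇ 1) ≡ false × a * (1 ∸ b) ≡ 0) ⊎ ((0 <ᵇ a) ∧ (b <ᵇ 1) ≡ true × a * (1 ∸ b) ≡ 1)
exclusive-bits zero          b       _ = inj₁ (refl , refl)
exclusive-bits (suc zero)    zero    _ = inj₂ (refl , refl)
exclusive-bits (suc zero)    (suc b) _ = inj₁ (refl , trans (+-identityʳ _) (0∸n≡0 b))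
exclusive-bits (suc (suc _)) b (s≤s ())

module Solving (X Q : ℕ) (2≤X : 2 ≤ X) (1≤Q : 1 ≤ Q) (input : ℕ → ℕ) (input≤X : ∀ i → input i ≤ X)
  (big : input 0 + input 1 + 8 ≤ X) (σ₀ : Env) (bits : ∀ i → 5 ≤ i → input i ≤ 1) where
  open Preparation X Q 2≤X 1≤Q input input≤X big σ₀
  open Bounds X Q 2≤X 1≤Q
  open Semantics input
  open Frames input

  module Eliminating (Q≡ : Q ≡ q ^ maxBag) (0<E : 0 < σ₀ 0 * σ₀ 0 * (σ₀ 0 * σ₀ 0)) (W nd pa : ℕ → ℕ)
    (nd-0 : nd 0 ≡ N) (nd≤ : ∀ i → i ≤ N → nd i ≤ N) (distinct : ∀ i j → j < i → i ≤ N → nd j ≢ nd i)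
    (parent : ∀ i → 1 ≤ i → i ≤ N → ∃ λ j → j < i × pa i ≡ nd j)
    (intersect : ∀ i → 1 ≤ i → i ≤ N → ∀ j → j < i → ∀ v → v < n → bagN (nd i) v ≢ 0 → bagN (nd j) v ≢ 0 → bagN (pa i) v ≢ 0)
    (bagN-N : ∀ v → v < n → bagN N v ≡ 0) where

    E : ℕ
    E = σ₀ 0 * σ₀ 0 * (σ₀ 0 * σ₀ 0)

    0<q : 0 < q
    0<q = ≤-trans (m≤n+m 1 (input 2)) (m≤n*m (input 2 + 1) 2)

    bagN≤1 : ∀ t v → bagN t v ≤ 1
    bagN≤1 t v = bits _ (m≤m+n 5 _)

    open Encoding n q 0<q bagN bagN≤1

    rank≤maxBag : ∀ t → t ≤ N → rank t n ≤ maxBag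
    rank≤maxBag t t≤N with m≤n⇒m<n∨m≡n t≤N
    ... | inj₂ refl = ≤-trans (≤-reflexive (Sum-0 n bagN-N)) z≤n
    ... | inj₁ t<N  = ≤-trans (≤-reflexive (sym (Sum-below n (rank t n) (≤-trans (Sum-mono n λ v _ → bagN≤1 t v) (≤-reflexive (ones n))))))
        (Sum-mono n λ j _ → counted j)
      where
      Sum-mono : ∀ k {f g} → (∀ i → i < k → f i ≤ g i) → Sum k f ≤ Sum k g
      Sum-mono zero    h = z≤n
      Sum-mono (suc k) h = +-mono-≤ (Sum-mono k λ i i< → h i (m<n⇒m<1+n i<)) (h k ≤-refl)
      ones : ∀ k → Sum k (λ _ → 1) ≡ k
      ones zero    = refl
      ones (suc k) = trans (cong (_+ 1) (ones k)) (+-comm k 1)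
      counted : ∀ j → bit (j <ᵇ rank t n) ≤ bit (0 <ᵇ Sum N (λ t → bit (j <ᵇ Sum n (bagN t))))
      counted j with <-≤-connex j (rank t n)
      ... | inj₂ j≥ = ≤-trans (≤-reflexive (bit-≥ j≥)) z≤n
      ... | inj₁ j< = ≤-trans (bit≤1 (j <ᵇ rank t n)) (≤-reflexive (sym (bit-< (≤-trans (≤-reflexive (sym (bit-< j<)))
              (Sum-term N (λ t → bit (j <ᵇ Sum n (bagN t))) t t<N)))))

    rank-in : ∀ t v → t ≤ N → v < n → rank t v ≤ maxBag
    rank-in t v t≤N v<n = ≤-trans (rank-≤ t (<⇒≤ v<n)) (rank≤maxBag t t≤N)

    enc<Q : ∀ t (g : Vec ℕ n) → Digits q g → t ≤ N → enc t g < Q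
    enc<Q t g hg t≤N = subst (enc t g <_) (sym Q≡) (enc< t g hg (rank≤maxBag t t≤N))

    cellN : ℕ → ℕ → ℕ → ℕ
    cellN a t e = (a * (N + 1) + t) * E + e

    cellN-inj : ∀ {a t e a′ t′ e′} → t ≤ N → e < E → t′ ≤ N → e′ < E → cellN a t e ≡ cellN a′ t′ e′ → a ≡ a′ × t ≡ t′ × e ≡ e′
    cellN-inj {a} {t} {e} {a′} {t′} {e′} t≤ e< t′≤ e′< eq =
      trans (sym (/₀-unique {a} {t} (N + 1) (<N+1 t≤))) (trans (cong (_/₀ (N + 1)) at≡) (/₀-unique {a′} {t′} (N + 1) (<N+1 t′≤))) ,
      trans (sym (%₀-unique {a} {t} (N + 1) (<N+1 t≤))) (trans (cong (_%₀ (N + 1)) at≡) (%₀-unique {a′} {t′} (N + 1) (<N+1 t′≤))) ,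
      trans (sym (%₀-unique {a * (N + 1) + t} E e<)) (trans (cong (_%₀ E) eq) (%₀-unique {a′ * (N + 1) + t′} E e′<))
      where
      <N+1 : ∀ {t} → t ≤ N → t < N + 1
      <N+1 {t} t≤ = subst (t <_) (+-comm 1 N) (s≤s t≤)
      at≡ : a * (N + 1) + t ≡ a′ * (N + 1) + t′
      at≡ = trans (sym (/₀-unique {a * (N + 1) + t} E e<)) (trans (cong (_/₀ E) eq) (/₀-unique {a′ * (N + 1) + t′} E e′<))

    logN : (ℕ → ℕ) → ℕ
    logN P = Sum K (λ i → bit (P i <ᵇ K))

    weightN : (ℕ → ℕ) → (ℕ → ℕ) → ℕ → ℕ
    weightN P R v = 1 + (n + 1) * Sum (logN P) (λ j → R (v * logN P + j) * P j)

    digN : (ℕ → ℕ) → ℕ → ℕ → ℕ → ℕ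
    digN P a t v = (a /₀ P (rank t v)) %₀ q

    labelN sideN coefN : ℕ → ℕ
    labelN s = s /₀ 2
    sideN s  = s %₀ 2
    coefN s  = 1 + 2 * (sideN s * bit (0 <ᵇ labelN s))

    badN : ℕ → ℕ → ℕ
    badN s t = bit (labelN s + 1 <ᵇ labelN t) + (eqN (labelN s + 1) (labelN t) * sideN t +
      bit (labelN s + labelN t <ᵇ 1) * (bit (sideN s <ᵇ sideN t) + bit (sideN t <ᵇ sideN s)))

    shiftN : (ℕ → ℕ) → ℕ → ℕ → ℕ
    shiftN w d v = bit (labelN d <ᵇ 1) * w v

    replaceN : (ℕ → ℕ) → ℕ → ℕ → ℕ → ℕ → ℕ
    replaceN P a t v d = a + d * P (rank t v) ∸ digN P a t v * P (rank t v)

    forgetTerm : (P w τ : ℕ → ℕ) → ℕ → ℕ → ℕ → ℕ → ℕ → ℕ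
    forgetTerm P w τ a t v e d = coefN d * (bit (shiftN w d v <ᵇ e + 1) * τ (cellN (replaceN P a t v d) t (e ∸ shiftN w d v)))

    forgetN : (P w τ : ℕ → ℕ) → ℕ → ℕ → ℕ → ℕ → ℕ
    forgetN P w τ a t v e = Sum q (forgetTerm P w τ a t v e)

    embedN : (ℕ → ℕ) → ℕ → ℕ → ℕ → ℕ
    embedN P a t p = Sum n (λ v → bagN t v * bagN p v * (digN P a p v * P (rank t v)))

    joinN : (P τ : ℕ → ℕ) → ℕ → ℕ → ℕ → ℕ → ℕ
    joinN P τ a t p e = Sum (e + 1) (λ i → τ (cellN a p i) * τ (cellN (embedN P a t p) t (e ∸ i)))

    violN : (ℕ → ℕ) → ℕ → ℕ → ℕ
    violN P a t = Sum n (λ u → Sum n (λ v → bagN t u * bagN t v * (adjN u v * badN (digN P a t u) (digN P a t v))))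

    record Ready (𝓐 : Arrays) : Set where
      field
        pow : ∀ j → j ≤ maxBag → 𝓐 POW j ≡ q ^ j
        wgt : ∀ v → v < n → weightN (𝓐 P2) (𝓐 RND) v ≡ W v
        nds : 𝓐 ND ≡ nd
        pas : 𝓐 PA ≡ pa

    Same : Arrays → Arrays → Set
    Same 𝓐 𝓑 = ∀ B → B < 5 → 𝓑 B ≡ 𝓐 B

    Ready-same : ∀ {𝓐 𝓑} → Same 𝓐 𝓑 → Ready 𝓐 → Ready 𝓑
    Ready-same s r = record
      { pow = λ j j≤ → trans (cong-app (s 0 (s≤s z≤n)) j) (pow j j≤)
      ; wgt = λ v v< → trans (cong₂ (λ P R → weightN P R v) (s 1 (s≤s (s≤s z≤n))) (s 2 (s≤s (s≤s (s≤s z≤n))))) (wgt v v<)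
      ; nds = trans (s 3 (s≤s (s≤s (s≤s (s≤s z≤n))))) nds
      ; pas = trans (s 4 ≤-refl) pas }
      where open Ready r

    module Replace (s e : Expr) (σ : Env) (𝓐 : Arrays)
      (no₁ : T (not (reads TBL (cellE rowE s colE)))) (no₂ : T (not (reads TMP (e %% lit 4)))) (no₃ : T (not (reads TMP (cellE rowE s colE)))) where

      value : ℕ → ℕ
      value j = ev e (update σ 13 j) 𝓐

      module First = Fill 13 TMP (var 13) (e %% lit 4) tt no₂ σ 𝓐

      b : ℕ
      b = ev (QE ⊛ EE) σ 𝓐

      𝓐₁ : Arrays
      𝓐₁ = First.state b

      b₁ : ℕ
      b₁ = ev (QE ⊛ EE) σ 𝓐₁

      b₁≡b : b₁ ≡ b
      b₁≡b = ev-frame TMP (QE ⊛ EE) {σ} {𝓐} {𝓐₁} (First.others b) tt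

      module Second = Fill 13 TBL (cellE rowE s colE) (rd TMP (var 13)) no₁ tt σ 𝓐₁

      after : Arrays
      after = exec (replaceTable s e) σ 𝓐

      same : Same 𝓐 after
      same B B<5 = trans (Second.others b₁ B (<⇒≢ (<-≤-trans B<5 ≤-refl))) (First.others b B (<⇒≢ (<-≤-trans B<5 (n≤1+n 5))))

      temporary : ∀ j → j < b → 𝓐₁ TMP j ≡ value j %₀ 4
      temporary j j<b = First.hit b (λ i k _ _ eq → eq) j j<b

      value≤ : ∀ j → value j %₀ 4 ≤ 𝔹 (1 , 0)
      value≤ j = ≤-trans (%₀-≤ (ev e (update σ 13 j) 𝓐) 4) (X≤𝔹 (≤-trans (m≤n+m 4 (n + 4)) (≤-trans (≤-reflexive (+-assoc n 4 4)) n+8≤X)))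

      valid : ValidC (replaceTable s e) σ 𝓐
      valid = (λ j j< → subst (_≤ 𝔹 (1 , 0)) (sym (First.value-at j)) (value≤ j)) ,
              (λ j j< → subst (_≤ 𝔹 (1 , 0)) (sym (trans (Second.value-at j) (temporary j (subst (j <_) b₁≡b j<)))) (value≤ j))

      module Spec (t : ℕ) (t≤N : t ≤ N) (s≡t : ∀ j → ev s (update σ 13 j) 𝓐 ≡ t) (σ≡ : σ 0 ≡ σ₀ 0) (POW≡ : 𝓐 POW maxBag ≡ Q) where

        b≡ : b ≡ Q * E
        b≡ = cong₂ _*_ POW≡ (cong (λ x → x * x * (x * x)) σ≡)

        place≡ : ∀ j → Second.place j ≡ cellN (j /₀ E) t (j %₀ E)
        place≡ j = trans (ev-frame TMP (cellE rowE s colE) {update σ 13 j} {𝓐} {𝓐₁} (First.others b) no₃)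
          (cong₂ (λ x s → ((j /₀ (x * x * (x * x))) * (N + 1) + s) * (x * x * (x * x)) + j %₀ (x * x * (x * x))) σ≡ (s≡t j))

        hit : ∀ a c → a < Q → c < E → after TBL (cellN a t c) ≡ value (a * E + c) %₀ 4
        hit a c a<Q c<E = trans (cong (after TBL) (sym (trans (place≡ (a * E + c))
            (cong₂ (λ a c → cellN a t c) (/₀-unique {a} E c<E) (%₀-unique {a} E c<E)))))
          (trans (Second.hit b₁ inj (a * E + c) (subst (a * E + c <_) (sym b₁≡b) j<)) (temporary (a * E + c) j<))
          where
          j< : a * E + c < b
          j< = subst (a * E + c <_) (sym b≡) (radix-< E a<Q c<E)
          inj : ∀ i k → i < b₁ → k < b₁ → Second.place i ≡ Second.place k → i ≡ k
          inj i k _ _ eq with cellN-inj {i /₀ E} {t} {i %₀ E} {k /₀ E} {t} {k %₀ E} t≤N (%₀-< i 0<E) t≤N (%₀-< k 0<E) (trans (sym (place≡ i)) (trans eq (place≡ k)))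
          ... | a≡ , _ , c≡ = trans (/₀-%₀ i 0<E) (trans (cong₂ (λ a c → a * E + c) a≡ c≡) (sym (/₀-%₀ k 0<E)))

        miss : ∀ a s′ c → s′ ≤ N → s′ ≢ t → c < E → after TBL (cellN a s′ c) ≡ 𝓐 TBL (cellN a s′ c)
        miss a s′ c s′≤ s′≢t c<E = trans (Second.miss b₁ (cellN a s′ c) λ k _ eq →
            s′≢t (sym (proj₁ (proj₂ (cellN-inj {k /₀ E} {t} {k %₀ E} {a} {s′} {c} t≤N (%₀-< k 0<E) s′≤ c<E (trans (sym (place≡ k)) eq))))))
          (cong-app (First.others b TBL λ ()) (cellN a s′ c))

    open Truncated E using (_≈_; coeffs; coeff; series; exactly)
    open VectorSums series using (δ; module Elimination; sumV; sumV-cong)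
    open CommutativeSemiring series using () renaming (refl to ≈-refl; trans to ≈-trans; *-cong to ⊗-cong; *-congʳ to ⊗-congʳ; reflexive to ≈-reflexive)
    open Elimination q n 0<q enc nd
    module SK = Sums series

    SumK : ∀ k (F : ℕ → Series) e → SK.Sum k F e ≡ Sum k (λ i → F i e)
    SumK zero    F e = refl
    SumK (suc k) F e = cong (_+ F k e) (SumK k F e)

    mod₀ : ∀ x → x %₀ 4 ≡₄ x
    mod₀ x = m%n%n≡m%n x 4

    φ₀ : ℕ → ℕ → Series
    φ₀ v d = mono (coefN d) (shiftN W d v)

    gone : ℕ → ℕ → Bool
    gone k v = Sum (suc k) (λ j → bagN (nd j) v) <ᵇ 1

    φ : ℕ → ℕ → ℕ → Series
    φ k v d = if gone k v then δ d else φ₀ v d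

    exclusive : ℕ → ℕ → Bool
    exclusive k v = (0 <ᵇ bagN (nd k) v) ∧ (bagN (pa k) v <ᵇ 1)

    φ-upto : ℕ → ℕ → ℕ → ℕ → Series
    φ-upto k v u d = if (u <ᵇ v) ∧ exclusive k u then δ d else φ k u d

    τ : Arrays → ℕ → ℕ → Series
    τ 𝓐 s a e = 𝓐 TBL (cellN a s e)

    total-φ : ∀ {φ φ′} τ i → (∀ v d → v < n → φ v d ≡ φ′ v d) → total φ τ i ≈ total φ′ τ i
    total-φ τ i h = sumV-cong q n λ g _ → ⊗-congʳ (SK.Prod-cong n λ v v<n → CommutativeSemiring.reflexive series (h v (at g v) v<n))

    gone-true : ∀ k v → T (gone k v) → ∀ j → j ≤ k → bagN (nd j) v ≡ 0
    gone-true k v h j j≤k = n≤0⇒n≡0 (≤-trans (Sum-term (suc k) (λ j → bagN (nd j) v) j (s≤s j≤k)) (s≤s⁻¹ (<ᵇ⇒< _ 1 h)))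

    gone-intro : ∀ k v → (∀ j → j ≤ k → bagN (nd j) v ≡ 0) → gone k v ≡ true
    gone-intro k v h = cong (_<ᵇ 1) (Sum-0 (suc k) λ j j< → h j (s≤s⁻¹ j<))

    gone-false : ∀ k v j → j ≤ k → bagN (nd j) v ≢ 0 → gone k v ≡ false
    gone-false k v j j≤k nz with gone k v in eq
    ... | false = refl
    ... | true  = ⊥-elim (nz (gone-true k v (subst T (sym eq) tt) j j≤k))

    exclusive-true : ∀ k v → T (exclusive k v) → bagN (nd k) v ≢ 0 × bagN (pa k) v ≡ 0
    exclusive-true k v h with h₁ , h₂ ← ∧-T (0 <ᵇ bagN (nd k) v) h = (λ z → <⇒≢ (<ᵇ⇒< 0 _ h₁) (sym z)) , n<1⇒n≡0 (<ᵇ⇒< _ 1 h₂)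

    exclusive-intro : ∀ k v → bagN (nd k) v ≢ 0 → bagN (pa k) v ≡ 0 → exclusive k v ≡ true
    exclusive-intro k v nz z = cong₂ _∧_ (Equivalence.to T-≡ (<⇒<ᵇ (n≢0⇒n>0 nz))) (cong (_<ᵇ 1) z)

    exclusive-gone : ∀ k → 1 ≤ k → k ≤ N → ∀ v → v < n → T (exclusive k v) → ∀ j → j < k → bagN (nd j) v ≡ 0
    exclusive-gone k 1≤k k≤N v v<n ex j j<k with bagN (nd j) v ≟ 0
    ... | yes z = z
    ... | no nz = ⊥-elim (intersect k 1≤k k≤N j j<k v v<n (proj₁ (exclusive-true k v ex)) nz (proj₂ (exclusive-true k v ex)))

    φ-next : ∀ k → suc k ≤ N → ∀ v d → v < n → φ-upto (suc k) n v d ≡ φ k v d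
    φ-next k k≤N v d v<n rewrite Equivalence.to T-≡ (<⇒<ᵇ v<n) with exclusive (suc k) v in ex
    ... | true  = sym (cong (λ b → if b then δ d else φ₀ v d) (gone-intro k v λ j j≤ →
                    exclusive-gone (suc k) (s≤s z≤n) k≤N v v<n (subst T (sym ex) tt) j (s≤s j≤)))
    ... | false with bagN (nd (suc k)) v ≟ 0
    ...   | yes z = cong (λ x → if x <ᵇ 1 then δ d else φ₀ v d) (trans (cong (Sum (suc k) (λ j → bagN (nd j) v) +_) z) (+-identityʳ _))
    ...   | no nz with parent (suc k) (s≤s z≤n) k≤N
    ...     | j , j< , pa≡ with bagN (pa (suc k)) v ≟ 0
    ...       | yes pz = ⊥-elim (case trans (sym ex) (exclusive-intro (suc k) v nz pz) of λ ())
    ...       | no pnz = trans (cong (λ b → if b then δ d else φ₀ v d) (gone-false (suc k) v (suc k) ≤-refl nz))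
                  (sym (cong (λ b → if b then δ d else φ₀ v d) (gone-false k v j (s≤s⁻¹ j<) (subst (λ p → bagN p v ≢ 0) pa≡ pnz))))

    nd-at : ∀ {𝓐} → Ready 𝓐 → ∀ i → 𝓐 ND i ≡ nd i
    nd-at r = cong-app (Ready.nds r)

    pa-at : ∀ {𝓐} → Ready 𝓐 → ∀ i → 𝓐 PA i ≡ pa i
    pa-at r = cong-app (Ready.pas r)

    POW-Q : ∀ {𝓐} → Ready 𝓐 → 𝓐 POW maxBag ≡ Q
    POW-Q r = trans (Ready.pow r maxBag ≤-refl) (sym Q≡)

    module Round (i : ℕ) (i<N : i < N) where

      σ : Env
      σ = update σ₀ 10 i

      k t p : ℕ
      k = N ∸ i
      t = nd k
      p = pa k

      1≤k : 1 ≤ k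
      1≤k = m<n⇒0<n∸m i<N

      k≤N : k ≤ N
      k≤N = m∸n≤m N i

      t≤N : t ≤ N
      t≤N = nd≤ k k≤N

      p≤N : p ≤ N
      p≤N with parent k 1≤k k≤N
      ... | j , j<k , e = subst (_≤ N) (sym e) (nd≤ j (≤-trans (<⇒≤ j<k) k≤N))

      module Forget (v z : ℕ) (𝓐 : Arrays) where
        σv : Env
        σv = update (update σ 11 v) 12 z

        open Replace childE (forgetE rowE childE (var 11) colE) σv 𝓐 tt tt tt public

        module _ (ready : Ready 𝓐) (v<n : v < n) (ex : T (exclusive k v)) where
          open Ready ready
          open Spec t t≤N (λ j → nd-at ready k) refl (POW-Q ready)

          inside : bagN t v ≢ 0
          inside = proj₁ (exclusive-true k v ex)

          value≡ : ∀ a c → c < E → value (a * E + c) ≡ forgetN (𝓐 POW) (weightN (𝓐 P2) (𝓐 RND)) (𝓐 TBL) a t v c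
          value≡ a c c<E = trans (cong (λ s → forgetN (𝓐 POW) (weightN (𝓐 P2) (𝓐 RND)) (𝓐 TBL) ((a * E + c) /₀ E) s v ((a * E + c) %₀ E)) (nd-at ready k))
            (cong₂ (λ a c → forgetN (𝓐 POW) (weightN (𝓐 P2) (𝓐 RND)) (𝓐 TBL) a t v c) (/₀-unique {a} E c<E) (%₀-unique {a} E c<E))

          digit : ∀ g → Digits q g → digN (𝓐 POW) (enc t g) t v ≡ at g v
          digit g hg = trans (cong (λ P → (enc t g /₀ P) %₀ q) (pow _ (rank-in t v t≤N v<n))) (digit-enc t g hg v v<n inside)

          replace≡ : ∀ g → Digits q g → ∀ d → replaceN (𝓐 POW) (enc t g) t v d ≡ enc t (setAt g v d)
          replace≡ g hg d = trans (cong₂ (λ P δ → enc t g + d * P ∸ δ * P) (pow _ (rank-in t v t≤N v<n)) (digit g hg)) (enc-set t g v d v<n inside)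

          φ-here : ∀ d → φ-upto k v v d ≡ φ₀ v d
          φ-here d = trans (cong (λ b → if b ∧ exclusive k v then δ d else φ k v d) (n≮ᵇn v))
            (cong (λ b → if b then δ d else φ₀ v d) (gone-false k v k ≤-refl inside))
            where
            n≮ᵇn : ∀ n → (n <ᵇ n) ≡ false
            n≮ᵇn zero    = refl
            n≮ᵇn (suc n) = n≮ᵇn n

          eliminated : ∀ g → Digits q g → τ after t (enc t g) ≈ SK.Sum q (λ d → conv (φ-upto k v v d) (τ 𝓐 t (enc t (setAt g v d))))
          eliminated g hg = coeffs λ c c<E → trans (cong (_% 4) (trans (hit (enc t g) c (enc<Q t g hg t≤N) c<E) (cong (_%₀ 4) (value≡ (enc t g) c c<E))))
            (trans (mod₀ (forgetN (𝓐 POW) w (𝓐 TBL) (enc t g) t v c)) (cong (_% 4) (sym (trans (SumK q _ c) (Sum-cong q λ d _ → term c d)))))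
            where
            w : ℕ → ℕ
            w = weightN (𝓐 P2) (𝓐 RND)
            term : ∀ c d → conv (φ-upto k v v d) (τ 𝓐 t (enc t (setAt g v d))) c ≡ forgetTerm (𝓐 POW) w (𝓐 TBL) (enc t g) t v c d
            term c d = trans (cong (λ f → conv f (τ 𝓐 t (enc t (setAt g v d))) c) (φ-here d))
              (trans (conv-mono c (coefN d) (shiftN W d v) (τ 𝓐 t (enc t (setAt g v d))))
              (cong₂ (λ w a → coefN d * (bit (bit (labelN d <ᵇ 1) * w <ᵇ c + 1) * 𝓐 TBL (cellN a t (c ∸ bit (labelN d <ᵇ 1) * w))))
                (sym (wgt v v<n)) (sym (replace≡ g hg d))))

          preserved : total (φ-upto k v) (τ 𝓐) k ≈ total (φ-upto k (suc v)) (τ after) k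
          preserved = forget (φ-upto k v) (φ-upto k (suc v)) (τ 𝓐) (τ after) k v v<n
            (λ j j<k g d → enc-set-outside (nd j) g v d (exclusive-gone k 1≤k k≤N v v<n ex j j<k))
            (λ u d u≢v → cong (λ b → if b ∧ exclusive k u then δ d else φ k u d) (other u u≢v))
            (λ d → cong₂ (λ b c → if b ∧ c then δ d else φ k v d) (Equivalence.to T-≡ (<⇒<ᵇ (n<1+n v))) (Equivalence.to T-≡ ex))
            (λ j j<k g _ → coeffs λ c c<E → cong (_% 4) (miss (enc (nd j) g) (nd j) c (nd≤ j (≤-trans (<⇒≤ j<k) k≤N)) (distinct k j j<k k≤N) c<E))
            eliminated
            where
            other : ∀ u → u ≢ v → (u <ᵇ suc v) ≡ (u <ᵇ v)
            other u u≢v with <-cmp u v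
            ... | tri< u<v _ _ = trans (Equivalence.to T-≡ (<⇒<ᵇ (m<n⇒m<1+n u<v))) (sym (Equivalence.to T-≡ (<⇒<ᵇ u<v)))
            ... | tri≈ _ u≡v _ = ⊥-elim (u≢v u≡v)
            ... | tri> _ _ v<u = trans (false′ (u <ᵇ suc v) λ h → <⇒≱ v<u (s≤s⁻¹ (<ᵇ⇒< u (suc v) h))) (sym (false′ (u <ᵇ v) λ h → <⇒≱ v<u (<⇒≤ (<ᵇ⇒< u v h))))
              where
              false′ : ∀ b → ¬ T b → b ≡ false
              false′ true  h = ⊥-elim (h tt)
              false′ false h = refl

      forget-body : Com
      forget-body = for 12 (bagE childE (var 11) ⊛ (lit 1 ⊖ bagE parentE (var 11))) (replaceTable childE (forgetE rowE childE (var 11) colE))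

      upto : Arrays → ℕ → Arrays
      upto 𝓐 v = iter v (λ v → exec forget-body (update σ 11 v)) 𝓐

      module Step (v : ℕ) (v<n : v < n) (𝓑 : Arrays) (ready : Ready 𝓑) where

        times : ℕ
        times = bagN (𝓑 ND k) v * (1 ∸ bagN (𝓑 PA k) v)

        times≡ : times ≡ bagN t v * (1 ∸ bagN p v)
        times≡ = cong₂ (λ t p → bagN t v * (1 ∸ bagN p v)) (nd-at ready k) (pa-at ready k)

        repeat : ℕ → Arrays
        repeat c = iter c (λ z → exec (replaceTable childE (forgetE rowE childE (var 11) colE)) (update (update σ 11 v) 12 z)) 𝓑

        Done : ℕ → Set
        Done c = Same 𝓑 (repeat c) × total (φ-upto k v) (τ 𝓑) k ≈ total (φ-upto k (suc v)) (τ (repeat c)) k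

        skipped : exclusive k v ≡ false × bagN t v * (1 ∸ bagN p v) ≡ 0 → Done times
        skipped (no-ex , z) = subst Done (sym (trans times≡ z)) ((λ _ _ → refl) , total-φ (τ 𝓑) k λ u d _ →
          cong (λ b → if b then δ d else φ k u d) (upto-skip (exclusive k) u v no-ex))

        forgotten : exclusive k v ≡ true × bagN t v * (1 ∸ bagN p v) ≡ 1 → Done times
        forgotten (ex , o) = subst Done (sym (trans times≡ o)) (Forget.same v 0 𝓑 , Forget.preserved v 0 𝓑 ready v<n (Equivalence.from T-≡ ex))

        step : Done times
        step = [ skipped , forgotten ]′ (exclusive-bits (bagN t v) (bagN p v) (bagN≤1 t v))

      forgets : ∀ 𝓐 → Ready 𝓐 → ∀ v → v ≤ n → Same 𝓐 (upto 𝓐 v) × total (φ k) (τ 𝓐) k ≈ total (φ-upto k v) (τ (upto 𝓐 v)) k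
      forgets 𝓐 ready zero    _   = (λ _ _ → refl) , ≈-refl
      forgets 𝓐 ready (suc v) v<n = extend (upto 𝓐 v) (forgets 𝓐 ready v (<⇒≤ v<n))
        where
        extend : ∀ 𝓑 → Same 𝓐 𝓑 × total (φ k) (τ 𝓐) k ≈ total (φ-upto k v) (τ 𝓑) k →
          Same 𝓐 (exec forget-body (update σ 11 v) 𝓑) × total (φ k) (τ 𝓐) k ≈ total (φ-upto k (suc v)) (τ (exec forget-body (update σ 11 v) 𝓑)) k
        extend 𝓑 (same₁ , eq₁) = (λ B B<5 → trans (proj₁ S.step B B<5) (same₁ B B<5)) , ≈-trans eq₁ (proj₂ S.step)
          where module S = Step v v<n 𝓑 (Ready-same same₁ ready)

      forget-valid : ∀ 𝓐 → ValidC forgetC σ 𝓐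
      forget-valid 𝓐 v v< z z< = Forget.valid v z _

      module Join (𝓐 : Arrays) where
        open Replace parentE (joinE rowE childE parentE colE) σ 𝓐 tt tt tt public

        module _ (k′ : ℕ) (k≡ : k ≡ suc k′) (ready : Ready 𝓐) where
          open Ready ready
          open Spec p p≤N (λ j → pa-at ready k) refl (POW-Q ready)

          value≡ : ∀ a c → c < E → value (a * E + c) ≡ joinN (𝓐 POW) (𝓐 TBL) a t p c
          value≡ a c c<E = trans (cong₂ (λ t p → joinN (𝓐 POW) (𝓐 TBL) ((a * E + c) /₀ E) t p ((a * E + c) %₀ E)) (nd-at ready k) (pa-at ready k))
            (cong₂ (λ a c → joinN (𝓐 POW) (𝓐 TBL) a t p c) (/₀-unique {a} E c<E) (%₀-unique {a} E c<E))

          embed≡ : ∀ g → Digits q g → (∀ v → v < n → bagN t v ≢ 0 → bagN p v ≡ 0 → at g v ≡ 0) → embedN (𝓐 POW) (enc p g) t p ≡ enc t g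
          embed≡ g hg out = trans (Sum-cong n λ v v<n → cong₂ (λ P R → bagN t v * bagN p v * ((enc p g /₀ P) %₀ q * R))
            (pow _ (rank-in p v p≤N v<n)) (pow _ (rank-in t v t≤N v<n))) (enc-embed t p g hg out)

          joined : ∀ g → Digits q g → (∀ v → v < n → bagN t v ≢ 0 → bagN p v ≡ 0 → at g v ≡ 0) →
            τ after p (enc p g) ≈ conv (τ 𝓐 p (enc p g)) (τ 𝓐 t (enc t g))
          joined g hg out = coeffs λ c c<E → trans (cong (_% 4) (trans (hit (enc p g) c (enc<Q p g hg p≤N) c<E) (cong (_%₀ 4) (value≡ (enc p g) c c<E))))
            (trans (mod₀ (joinN (𝓐 POW) (𝓐 TBL) (enc p g) t p c)) (cong (_% 4) (trans (cong (λ a → Sum (c + 1) (λ i → 𝓐 TBL (cellN (enc p g) p i) * 𝓐 TBL (cellN a t (c ∸ i)))) (embed≡ g hg out))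
              (sym (conv-Sum c (τ 𝓐 p (enc p g)) (τ 𝓐 t (enc t g)))))))

          preserved : total (φ k′) (τ 𝓐) (suc k′) ≈ total (φ k′) (τ after) k′
          preserved with parent k 1≤k k≤N
          ... | j₀ , j₀<k , p≡ = merge (φ k′) (τ 𝓐) (τ after) k′ j₀ (subst (j₀ <_) k≡ j₀<k)
            (λ j j< j≢ g _ → coeffs λ c c<E → cong (_% 4) (miss (enc (nd j) g) (nd j) c (nd≤ j (≤-trans (≤-trans (<⇒≤ j<) (≤-reflexive (sym k≡))) k≤N)) (different j j< j≢) c<E))
            (λ g hg → case outside? g of λ where
              (yes (v , v<n , tv , pv , nz)) → inj₁ (v , v<n , vanishing v v<n tv pv (at g v) nz)
              (no none) → inj₂ (subst₂ (λ x y → τ after x (enc x g) ≈ conv (τ 𝓐 x (enc x g)) (τ 𝓐 y (enc y g))) p≡ (cong nd k≡)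
                (joined g hg λ v v<n tv pv → decidable-zero (at g v) λ nz → none (v , v<n , tv , pv , nz))))
            where
            outside? : ∀ g → Dec (∃ λ v → v < n × bagN t v ≢ 0 × bagN p v ≡ 0 × at g v ≢ 0)
            outside? g = anyUpTo? (λ v → ¬? (bagN t v ≟ 0) ×-dec (bagN p v ≟ 0) ×-dec ¬? (at g v ≟ 0)) n
            decidable-zero : ∀ x → ¬ (x ≢ 0) → x ≡ 0
            decidable-zero zero    _ = refl
            decidable-zero (suc x) h = ⊥-elim (h λ ())
            different : ∀ j → j < suc k′ → j ≢ j₀ → nd j ≢ p
            different j j< j≢ e with <-cmp j j₀
            ... | tri< l _ _ = distinct j₀ j l (≤-trans (<⇒≤ j₀<k) k≤N) (trans e p≡)
            ... | tri≈ _ j≡ _ = j≢ j≡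
            ... | tri> _ _ g = distinct j j₀ g (≤-trans (≤-trans (<⇒≤ j<) (≤-reflexive (sym k≡))) k≤N) (sym (trans e p≡))
            vanishing : ∀ v → v < n → bagN t v ≢ 0 → bagN p v ≡ 0 → ∀ d → d ≢ 0 → φ k′ v d ≈ (λ _ → 0)
            vanishing v v<n tv pv zero    nz = ⊥-elim (nz refl)
            vanishing v v<n tv pv (suc d) nz = CommutativeSemiring.reflexive series (cong (λ b → if b then δ (suc d) else φ₀ v (suc d))
              (gone-intro k′ v λ j j≤ → exclusive-gone k 1≤k k≤N v v<n (subst T (sym (exclusive-intro k v tv pv)) tt) j (subst (j <_) (sym k≡) (s≤s j≤))))

    rounds : ℕ → Arrays → Arrays
    rounds i = iter i (λ i → exec (forgetC ⨾ joinC) (update σ₀ 10 i))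

    module _ (𝓐 : Arrays) (ready : Ready 𝓐) where

      advance : ∀ i → (i<N : i < N) → ∀ 𝓑 → Same 𝓐 𝓑 × total (φ N) (τ 𝓐) N ≈ total (φ (N ∸ i)) (τ 𝓑) (N ∸ i) →
        Same 𝓐 (exec (forgetC ⨾ joinC) (update σ₀ 10 i) 𝓑) ×
        total (φ N) (τ 𝓐) N ≈ total (φ (N ∸ suc i)) (τ (exec (forgetC ⨾ joinC) (update σ₀ 10 i) 𝓑)) (N ∸ suc i)
      advance i i<N 𝓑 (same₁ , eq₁) = after-forget 𝓑 same₁ eq₁ (exec forgetC (update σ₀ 10 i) 𝓑) (Round.forgets i i<N 𝓑 (Ready-same same₁ ready) n ≤-refl)
        where
        k≡ : N ∸ i ≡ suc (N ∸ suc i)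
        k≡ = +-∸-assoc 1 i<N
        after-forget : ∀ 𝓑 → Same 𝓐 𝓑 → total (φ N) (τ 𝓐) N ≈ total (φ (N ∸ i)) (τ 𝓑) (N ∸ i) → ∀ 𝓒 →
          Same 𝓑 𝓒 × total (φ (N ∸ i)) (τ 𝓑) (N ∸ i) ≈ total (φ-upto (N ∸ i) n) (τ 𝓒) (N ∸ i) →
          Same 𝓐 (exec joinC (update σ₀ 10 i) 𝓒) ×
          total (φ N) (τ 𝓐) N ≈ total (φ (N ∸ suc i)) (τ (exec joinC (update σ₀ 10 i) 𝓒)) (N ∸ suc i)
        after-forget 𝓑 same₁ eq₁ 𝓒 (same₂ , eq₂) = (λ B B<5 → trans (Round.Join.same i i<N 𝓒 B B<5) (same₁₂ B B<5)) ,
          ≈-trans eq₁ (≈-trans eq₂ (≈-trans switch (subst (λ k → total (φ (N ∸ suc i)) (τ 𝓒) k ≈ total (φ (N ∸ suc i)) (τ (exec joinC (update σ₀ 10 i) 𝓒)) (N ∸ suc i)) (sym k≡)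
            (Round.Join.preserved i i<N 𝓒 (N ∸ suc i) k≡ (Ready-same same₁₂ ready)))))
          where
          same₁₂ : Same 𝓐 𝓒
          same₁₂ B B<5 = trans (same₂ B B<5) (same₁ B B<5)
          switch : total (φ-upto (N ∸ i) n) (τ 𝓒) (N ∸ i) ≈ total (φ (N ∸ suc i)) (τ 𝓒) (N ∸ i)
          switch = total-φ (τ 𝓒) (N ∸ i) λ v d v<n → trans (cong (λ k → φ-upto k n v d) k≡)
            (φ-next (N ∸ suc i) (subst (_≤ N) k≡ (m∸n≤m N i)) v d v<n)

      progress : ∀ i → i ≤ N → Same 𝓐 (rounds i 𝓐) × total (φ N) (τ 𝓐) N ≈ total (φ (N ∸ i)) (τ (rounds i 𝓐)) (N ∸ i)
      progress zero    _   = (λ _ _ → refl) , ≈-refl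
      progress (suc i) i<N = advance i i<N (rounds i 𝓐) (progress i (<⇒≤ i<N))

      solved : ∀ e → e < E → exec solve-all σ₀ 𝓐 TBL (cellN 0 N e) ≡₄ total (φ N) (τ 𝓐) N e
      solved e e<E = sym (trans (coeff (proj₂ (progress N ≤-refl)) e e<E) (trans (coeff (subst (λ k → total (φ k) (τ (rounds N 𝓐)) k ≈ total (φ 0) (τ (rounds N 𝓐)) 0) (sym (n∸n≡0 N)) ≈-refl) e e<E)
        (trans (coeff (total-end (φ 0) (τ (rounds N 𝓐)) (vec n (λ _ → 0)) (at-vec n (λ _ → 0))
          (λ v d v<n → cong (λ b → if b then δ d else φ₀ v d) (gone-intro 0 v λ { zero z≤n → trans (cong (λ t → bagN t v) nd-0) (bagN-N v v<n) }))) e e<E)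
        (cong₂ (λ s a → rounds N 𝓐 TBL (cellN a s e) % 4) nd-0 (Sum-0 n λ v v<n → cong (_* (at (vec n (λ _ → 0)) v * q ^ rank (nd 0) v)) (trans (cong (λ t → bagN t v) nd-0) (bagN-N v v<n)))))))

      solve-valid : AdmissibleC solve-all σ₀ 𝓐
      solve-valid = admissible λ i i<N → Round.forget-valid i i<N (rounds i 𝓐) , Round.Join.valid i i<N _

    module Counting (covered : ∀ v → v < n → ∃ λ j → j ≤ N × bagN (nd j) v ≢ 0)
      (edge-covered : ∀ u v → u < n → v < n → adjN u v ≢ 0 → ∃ λ j → j ≤ N × bagN (nd j) u ≢ 0 × bagN (nd j) v ≢ 0)
      (adjN-sym : ∀ u v → u < n → v < n → adjN u v ≡ adjN v u) where
      open Labelled n adjN adjN-sym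

      bagViolN : ℕ → Vec ℕ n → ℕ
      bagViolN t g = Sum n (λ u → Sum n (λ v → bagN t u * bagN t v * (adjN u v * badN (at g u) (at g v))))

      violation : Vec ℕ n → ℕ
      violation g = Sum n (λ u → Sum n (λ v → adjN u v * badN (at g u) (at g v)))

      module Tables (𝓐 : Arrays) (ready : Ready 𝓐) where
        open Ready ready

        val : Expr
        val = lt (violE (var 10 ÷ EE ÷ (NE ⊹ lit 1)) (var 10 ÷ EE %% (NE ⊹ lit 1))) (lit 1) ⊛ lt (var 10 %% EE) (lit 1)

        open Fill 10 TBL (var 10) val tt tt σ₀ 𝓐

        after : Arrays
        after = exec tables σ₀ 𝓐

        b : ℕ
        b = 𝓐 POW maxBag * ((N + 1) * E)

        same : Same 𝓐 after
        same B B<5 = others b B (<⇒≢ B<5)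

        valid : AdmissibleC tables σ₀ 𝓐
        valid = admissible λ j j< → subst (_≤ 𝔹 (1 , 0)) (sym (value-at j)) (X≤𝔹 (≤-trans (*-mono-≤ (bit≤1 (violN (𝓐 POW) (j /₀ E /₀ (N + 1)) (j /₀ E %₀ (N + 1)) <ᵇ 1)) (bit≤1 (j %₀ E <ᵇ 1))) (≤-trans (n≤1+n 1) 2≤X)))

        after-TBL : ∀ a t c → a < Q → t ≤ N → c < E → after TBL (cellN a t c) ≡ bit (violN (𝓐 POW) a t <ᵇ 1) * bit (c <ᵇ 1)
        after-TBL a t c a<Q t≤N c<E = trans (hit b (λ _ _ _ _ e → e) (cellN a t c) in-range)
          (trans (cong₂ (λ j c → bit (violN (𝓐 POW) (j /₀ (N + 1)) (j %₀ (N + 1)) <ᵇ 1) * bit (c <ᵇ 1)) (/₀-unique {a * (N + 1) + t} E c<E) (%₀-unique {a * (N + 1) + t} E c<E))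
            (cong₂ (λ a t → bit (violN (𝓐 POW) a t <ᵇ 1) * bit (c <ᵇ 1)) (/₀-unique {a} (N + 1) t<) (%₀-unique {a} (N + 1) t<)))
          where
          t< : t < N + 1
          t< = subst (t <_) (+-comm 1 N) (s≤s t≤N)
          in-range : cellN a t c < b
          in-range = subst (cellN a t c <_) (trans (*-assoc Q (N + 1) E) (cong (_* ((N + 1) * E)) (sym (POW-Q ready)))) (radix-< E (radix-< (N + 1) a<Q t<) c<E)

        viol≡ : ∀ t g → t ≤ N → Digits q g → violN (𝓐 POW) (enc t g) t ≡ bagViolN t g
        viol≡ t g t≤N hg = Sum-cong n λ u u<n → Sum-cong n λ v v<n → term u v u<n v<n
          where
          dig≡ : ∀ u → u < n → bagN t u ≢ 0 → digN (𝓐 POW) (enc t g) t u ≡ at g u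
          dig≡ u u<n tu = trans (cong (λ P → (enc t g /₀ P) %₀ q) (pow _ (rank-in t u t≤N u<n))) (digit-enc t g hg u u<n tu)
          term : ∀ u v → u < n → v < n → bagN t u * bagN t v * (adjN u v * badN (digN (𝓐 POW) (enc t g) t u) (digN (𝓐 POW) (enc t g) t v))
                                        ≡ bagN t u * bagN t v * (adjN u v * badN (at g u) (at g v))
          term u v u<n v<n with bagN t u ≟ 0 | bagN t v ≟ 0
          ... | yes z | _     = trans (dead _) (sym (dead _))
            where
            dead : ∀ x → bagN t u * bagN t v * x ≡ 0
            dead x = cong (λ b → b * bagN t v * x) z
          ... | no _  | yes z = trans (dead _) (sym (dead _))
            where
            dead : ∀ x → bagN t u * bagN t v * x ≡ 0
            dead x = cong (_* x) (trans (cong (bagN t u *_) z) (*-zeroʳ (bagN t u)))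
          ... | no tu | no tv = cong₂ (λ x y → bagN t u * bagN t v * (adjN u v * badN x y)) (dig≡ u u<n tu) (dig≡ v v<n tv)

        table≈ : ∀ t g → t ≤ N → Digits q g → τ after t (enc t g) ≈ mono (bit (bagViolN t g <ᵇ 1)) 0
        table≈ t g t≤N hg = coeffs λ c c<E → cong (_% 4) (trans (after-TBL (enc t g) t c (enc<Q t g hg t≤N) t≤N c<E)
          (trans (cong (λ s → bit (s <ᵇ 1) * bit (c <ᵇ 1)) (viol≡ t g t≤N hg)) (unit c)))
          where
          unit : ∀ c → bit (bagViolN t g <ᵇ 1) * bit (c <ᵇ 1) ≡ mono (bit (bagViolN t g <ᵇ 1)) 0 c
          unit zero    = *-identityʳ _
          unit (suc c) = *-zeroʳ (bit (bagViolN t g <ᵇ 1))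

      ProdK-mono : ∀ k c x → SK.Prod k (λ v → mono (c v) (x v)) ≈ mono (Prod k c) (Sum k x)
      ProdK-mono zero    c x = ≈-refl
      ProdK-mono (suc k) c x = ≈-trans (⊗-cong (ProdK-mono k c x) ≈-refl) (exactly λ e → mono-mono e (Prod k c) (Sum k x) (c k) (x k))

      consistent : ∀ g → Prod (suc N) (λ j → bit (bagViolN (nd j) g <ᵇ 1)) ≡ bit (violation g <ᵇ 1)
      consistent g with violation g in viol
      ... | zero = Prod-1 (suc N) λ j _ → cong (λ s → bit (s <ᵇ 1)) (Sum-0 n λ u u<n → Sum-0 n λ v v<n →
          trans (cong (bagN (nd j) u * bagN (nd j) v *_) (n≤0⇒n≡0 (≤-trans (≤-trans (Sum-term n (λ v → adjN u v * badN (at g u) (at g v)) v v<n) (Sum-term n _ u u<n)) (≤-reflexive viol))))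
            (*-zeroʳ (bagN (nd j) u * bagN (nd j) v)))
      ... | suc _ with anyUpTo? (λ u → anyUpTo? (λ v → ¬? (adjN u v * badN (at g u) (at g v) ≟ 0)) n) n
      ...   | no none = ⊥-elim (case trans (sym viol) (Sum-0 n λ u u<n → Sum-0 n λ v v<n → all-zero u v u<n v<n) of λ ())
        where
        all-zero : ∀ u v → u < n → v < n → adjN u v * badN (at g u) (at g v) ≡ 0
        all-zero u v u<n v<n with adjN u v * badN (at g u) (at g v) ≟ 0
        ... | yes z = z
        ... | no nz = ⊥-elim (none (u , u<n , v , v<n , nz))
      ...   | yes (u , u<n , v , v<n , nz) with edge-covered u v u<n v<n (λ z → nz (cong (_* badN (at g u) (at g v)) z))
      ...     | j , j≤N , ju , jv = trans (Prod-extract (suc N) (λ j → bit (bagViolN (nd j) g <ᵇ 1)) j (s≤s j≤N)) (cong (_* Prod (suc N) (without j (λ j → bit (bagViolN (nd j) g <ᵇ 1)))) (bit-≥ pos))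
        where
        pos : 1 ≤ bagViolN (nd j) g
        pos = ≤-trans (≤-trans (n≢0⇒n>0 nz) (≤-reflexive (sym (trans (cong₂ (λ a b → a * b * (adjN u v * badN (at g u) (at g v))) (bagN-1 (nd j) u ju) (bagN-1 (nd j) v jv)) (+-identityʳ _)))))
          (≤-trans (Sum-term n (λ v → bagN (nd j) u * bagN (nd j) v * (adjN u v * badN (at g u) (at g v))) v v<n) (Sum-term n _ u u<n))

      sumV-at : ∀ q n (F : Vec ℕ n → Series) e → sumV q n F e ≡ sumN q n (λ g → F g e)
      sumV-at q zero    F e = refl
      sumV-at q (suc n) F e = trans (SumK q _ e) (Sum-cong q λ d _ → sumV-at q n (λ g → F (d ∷ g)) e)

      labelExponent : Vec ℕ n → ℕ
      labelExponent l = Sum n (λ v → bit (at l v <ᵇ 1) * W v)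

      R : ℕ
      R = input 2 + 1

      labellings : ℕ → ℕ
      labellings e = sumN R n (λ l → bit (e ≡ᵇ labelExponent l) * A (at l))

      total-count : ∀ 𝓐 → (ready : Ready 𝓐) → ∀ e → e < E → total (φ N) (τ (exec tables σ₀ 𝓐)) N e ≡₄ labellings e
      total-count 𝓐 ready e e<E = trans (coeff (sumV-cong q n pointwise) e e<E) (cong (_% 4) (trans (sumV-at q n _ e)
        (trans (sumN-combine R n _) (sumN-cong R n λ l hl → split l))))
        where
        open Tables 𝓐 ready
        coefs exps : Vec ℕ n → ℕ
        coefs g = Prod n (λ v → coefN (at g v))
        exps g = Sum n (λ v → shiftN W (at g v) v)
        pointwise : ∀ g → Digits q g → _ ≈ mono (coefs g * bit (violation g <ᵇ 1)) (exps g + 0)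
        pointwise g hg = ≈-trans (⊗-cong vertices′ tables′) (exactly λ e → mono-mono e (coefs g) (exps g) _ 0)
          where
          vertices′ : SK.Prod n (λ v → φ N v (at g v)) ≈ mono (coefs g) (exps g)
          vertices′ = ≈-trans (SK.Prod-cong n λ v v<n → ≈-reflexive (cong (λ b → if b then δ (at g v) else φ₀ v (at g v))
              (let j , j≤N , nz = covered v v<n in gone-false N v j j≤N nz))) (ProdK-mono n _ _)
          tables′ : SK.Prod (suc N) (λ j → τ after (nd j) (enc (nd j) g)) ≈ mono (bit (violation g <ᵇ 1)) 0
          tables′ = ≈-trans (SK.Prod-cong (suc N) λ j j< → table≈ (nd j) g (nd≤ j (s≤s⁻¹ j<)) hg)
            (≈-trans (ProdK-mono (suc N) _ _) (≈-reflexive (cong₂ mono (consistent g) (Sum-0 (suc N) λ _ _ → refl))))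
        label≡ : ∀ (l b : Vec ℕ n) → Digits 2 b → ∀ v → v < n → labelN (at (combine l b) v) ≡ at l v
        label≡ l b hb v v<n = trans (cong (_/₀ 2) (at-combine l b v)) (/₀-unique {at l v} 2 (hb v v<n))
        side≡ : ∀ (l b : Vec ℕ n) → Digits 2 b → ∀ v → v < n → sideN (at (combine l b) v) ≡ at b v
        side≡ l b hb v v<n = trans (cong (_%₀ 2) (at-combine l b v)) (%₀-unique {at l v} 2 (hb v v<n))
        one : ∀ l b → Digits 2 b → mono (coefs (combine l b) * bit (violation (combine l b) <ᵇ 1)) (exps (combine l b) + 0) e
                                  ≡ bit (e ≡ᵇ labelExponent l) * F (at l) (at b)
        one l b hb = trans (cong₂ (λ c x → mono c x e)
            (cong₂ _*_ (Prod-cong n λ v v<n → cong₂ (λ x y → 1 + 2 * (y * bit (0 <ᵇ x))) (label≡ l b hb v v<n) (side≡ l b hb v v<n))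
              (cong (λ s → bit (s <ᵇ 1)) (Sum-cong n λ u u<n → Sum-cong n λ v v<n → cong (adjN u v *_)
                (trans (cong₂ (λ lu lv → bit (lu + 1 <ᵇ lv) + (eqN (lu + 1) lv * sideN (at (combine l b) v) +
                    bit (lu + lv <ᵇ 1) * (bit (sideN (at (combine l b) u) <ᵇ sideN (at (combine l b) v)) + bit (sideN (at (combine l b) v) <ᵇ sideN (at (combine l b) u)))))
                  (label≡ l b hb u u<n) (label≡ l b hb v v<n))
                 (cong₂ (λ bu bv → badL (at l u) bu (at l v) bv) (side≡ l b hb u u<n) (side≡ l b hb v v<n))))))
            (trans (+-identityʳ _) (Sum-cong n λ v v<n → cong (λ x → bit (x <ᵇ 1) * W v) (label≡ l b hb v v<n))))
          (pick (e ≡ᵇ labelExponent l))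
          where
          pick : ∀ c → (if c then F (at l) (at b) else 0) ≡ bit c * F (at l) (at b)
          pick true  = sym (+-identityʳ _)
          pick false = refl
        split : ∀ l → sumN 2 n (λ b → mono (coefs (combine l b) * bit (violation (combine l b) <ᵇ 1)) (exps (combine l b) + 0) e)
                    ≡ bit (e ≡ᵇ labelExponent l) * A (at l)
        split l = trans (sumN-cong 2 n λ b hb → one l b hb) (sumN-*ˡ 2 n (bit (e ≡ᵇ labelExponent l)) _)

-- From counts to connected dominating sets

binary-bound : ∀ m f → (∀ j → j < m → f j ≤ 1) → binary m f < 2 ^ m
binary-bound zero    f h = s≤s z≤n
binary-bound (suc m) f h = ≤-trans (s≤s (≤-reflexive (binary-suc m f)))
  (≤-trans (s≤s (+-monoˡ-≤ _ (h 0 z<s))) (≤-trans (≤-reflexive (sym (*-suc 2 (binary m (f ∘ suc)))))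
    (*-monoʳ-≤ 2 (binary-bound m (f ∘ suc) λ j j< → h (suc j) (s<s j<)))))

bitAt≤1 : ∀ {t} (β : Vec Bool t) i → bitAt β i ≤ 1
bitAt≤1 []      i       = z≤n
bitAt≤1 (b ∷ β) zero    = bit≤1 b
bitAt≤1 (b ∷ β) (suc i) = bitAt≤1 β i

exponent-Sum : ∀ r n W (l : Vec ℕ n) → Polynomials.exponent r (vec n W) l ≡ Sum n (λ v → bit (at l v <ᵇ 1) * W v)
exponent-Sum r zero    W []      = refl
exponent-Sum r (suc n) W (c ∷ l) = trans (cong (bit (c <ᵇ 1) * W 0 +_) (exponent-Sum r n (W ∘ suc) l))
  (sym (Sum-shift n (λ v → bit (at (c ∷ l) v <ᵇ 1) * W v)))

matches⇒ : ∀ r {n} (S : Vec Bool n) l → T (Polynomials.matches r S l) → ∀ v → Vec.lookup S v ≡ (at l (toℕ v) <ᵇ 1)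
matches⇒ r (true  ∷ S) (c ∷ l) h Fin.zero    = sym (Equivalence.to T-≡ (proj₁ (∧-T (c <ᵇ 1) h)))
matches⇒ r (true  ∷ S) (c ∷ l) h (Fin.suc v) = matches⇒ r S l (proj₂ (∧-T (c <ᵇ 1) h)) v
matches⇒ r (false ∷ S) (suc c ∷ l) h Fin.zero    = refl
matches⇒ r (false ∷ S) (suc c ∷ l) h (Fin.suc v) = matches⇒ r S l h v

⇒matches : ∀ r {n} (S : Vec Bool n) l → (∀ v → Vec.lookup S v ≡ (at l (toℕ v) <ᵇ 1)) → T (Polynomials.matches r S l)
⇒matches r []          []      h = tt
⇒matches r (true  ∷ S) (c ∷ l) h = subst (λ b → T (b ∧ Polynomials.matches r S l)) (h Fin.zero) (⇒matches r S l (h ∘ Fin.suc))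
⇒matches r (false ∷ S) (zero  ∷ l) h = case h Fin.zero of λ ()
⇒matches r (false ∷ S) (suc c ∷ l) h = ⇒matches r S l (h ∘ Fin.suc)

module Analysis {n : ℕ} (G : Graph n) (adjN : ℕ → ℕ → ℕ)
  (adjN-adj : ∀ u v → adjN (toℕ u) (toℕ v) ≡ bit (adj G u v)) (r r′ : ℕ) (r′≤r : r′ ≤ r)
  (enough : ∀ d → d ≤ r → d < n → d ≤ r′) where
  open Domination G adjN adjN-adj
  open Polynomials r′

  size : Vec ℕ n → ℕ
  size l = Sum n (λ v → bit (at l v <ᵇ 1))

  size-≤ : ∀ l → size l ≤ n
  size-≤ l = go n
    where
    go : ∀ k → Sum k (λ v → bit (at l v <ᵇ 1)) ≤ k
    go zero    = z≤n
    go (suc k) = ≤-trans (+-mono-≤ (go k) (bit≤1 (at l k <ᵇ 1))) (≤-reflexive (+-comm k 1))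

  exp : (ℕ → ℕ) → Vec ℕ n → ℕ
  exp W l = Sum n (λ v → bit (at l v <ᵇ 1) * W v)

  labellingsOf : (ℕ → ℕ) → ℕ → ℕ
  labellingsOf W e = sumN (suc r′) n (λ l → bit (e ≡ᵇ exp W l) * A (at l))

  exp-size : ∀ (x : ℕ → ℕ) l → exp (λ v → 1 + suc n * x v) l % suc n ≡ size l
  exp-size x l = trans (cong (_% suc n) split) (trans ([m+kn]%n≡m%n (size l) (Sum n (λ v → bit (at l v <ᵇ 1) * x v)) (suc n)) (m<n⇒m%n≡m (s≤s (size-≤ l))))
    where
    split : exp (λ v → 1 + suc n * x v) l ≡ size l + Sum n (λ v → bit (at l v <ᵇ 1) * x v) * suc n
    split = trans (Sum-cong n λ v _ → solve 3 (λ b x n → b :* (con 1 :+ n :* x) := b :+ n :* (b :* x)) refl (bit (at l v <ᵇ 1)) (x v) (suc n))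
      (trans (Sum-+ n _ _) (cong (size l +_) (trans (Sum-*ˡ n (suc n) _) (*-comm (suc n) _))))

  label-vector : ∀ l → Digits (suc r′) l → ¬ (A (at l) ≡₄ 0) → ¬ ¬ ConnectedDominating G r (zeroSet (at l))
  label-vector l hl A≢0 = labels-sound (at l) r (A≢0⇒Lipschitz (at l) A≢0) (A≢0⇒Lowered (at l) A≢0) (A≢0⇒Linked (at l) A≢0)
    λ v v<n → ≤-trans (s≤s⁻¹ (hl v v<n)) r′≤r

  sound : ∀ (x : ℕ → ℕ) e → ¬ (labellingsOf (λ v → 1 + suc n * x v) e ≡₄ 0) → ¬ ¬ HasConnectedDominatingSet G r (ℤ.+ (e % suc n))
  sound x e nz none = nz (trans (sumN₄ (suc r′) n {G = λ _ → 0} vanish) (cong (_% 4) (sumN-0 (suc r′) n λ _ _ → refl)))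
    where
    vanish : ∀ l → Digits (suc r′) l → bit (e ≡ᵇ exp (λ v → 1 + suc n * x v) l) * A (at l) ≡₄ 0
    vanish l hl with e ≡ᵇ exp (λ v → 1 + suc n * x v) l in eq
    ... | false = refl
    ... | true with A (at l) % 4 ≟ 0
    ...   | yes z = trans (cong (_% 4) (+-identityʳ (A (at l)))) z
    ...   | no A≢0 = ⊥-elim (label-vector l hl A≢0 λ cd → none (zeroSet (at l) , cd ,
              cong ℤ.+_ (trans (∣zeroSet∣ (at l)) (trans (sym (exp-size x l)) (cong (_% suc n) (sym (≡ᵇ⇒≡ e _ (subst T (sym eq) tt))))))))

  module Complete (D : Subset n) (cd : ConnectedDominating G r D) (m E : ℕ) (E-big : n * (suc n * 2 ^ m) < E) where
    open Isolation r′ m n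
    open Distances D

    l* : Vec ℕ n
    l* = vec n (label r r′ enough cd)

    at-l* : ∀ v → v < n → at l* v ≡ label r r′ enough cd v
    at-l* = at-vec n _

    F* : ℕ → Vec ℕ n → ℕ
    F* k l = bit (size l ≡ᵇ k) * A (at l)

    l*-Digits : Digits (suc r′) l*
    l*-Digits v v<n = s≤s (subst (_≤ r′) (sym (at-l* v v<n)) (label≤ r r′ enough cd v))

    Lipschitz-cong : ∀ {f g} → (∀ v → v < n → f v ≡ g v) → Lipschitz f → Lipschitz g
    Lipschitz-cong h lip u v uv@(u< , v< , _) = subst₂ (λ a b → b ≤ a + 1) (h u u<) (h v v<) (lip u v uv)

    Lowered-cong : ∀ {f g} → (∀ v → v < n → f v ≡ g v) → Lowered f → Lowered g
    Lowered-cong h low v v< nz with u , uv@(u< , _) , e ← low v v< (λ z → nz (trans (sym (h v v<)) z)) =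
      u , uv , trans (cong (_+ 1) (sym (h u u<))) (trans e (h v v<))

    Linked-cong : ∀ {f g} → (∀ v → v < n → f v ≡ g v) → Linked f → Linked g
    Linked-cong {f} {g} h link x y x< y< zx zy = convert (link x y x< y< (trans (h x x<) zx) (trans (h y y<) zy))
      where
      convert : ∀ {x y} → Star (Link f) x y → Star (Link g) x y
      convert ε = ε
      convert ((zx , zy , uv@(u< , v< , _)) ◅ s) = (trans (sym (h _ u<)) zx , trans (sym (h _ v<)) zy , uv) ◅ convert s

    A*≢0 : ¬ (A (at l*) ≡₄ 0)
    A*≢0 = A-good (at l*) (Lipschitz-cong (λ v v<n → sym (at-l* v v<n)) (label-Lipschitz r r′ enough cd))
                          (Lowered-cong (λ v v<n → sym (at-l* v v<n)) (label-Lowered r r′ enough cd))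
                          (Linked-cong (λ v v<n → sym (at-l* v v<n)) (label-Linked r r′ enough cd))

    lookup-D : ∀ v → Vec.lookup D v ≡ (at l* (toℕ v) <ᵇ 1)
    lookup-D v with Vec.lookup D v in eq
    ... | true  = sym (cong (_<ᵇ 1) (trans (at-l* (toℕ v) (Fin.toℕ<n v)) (zero-label r r′ enough cd (toℕ v) (inD-∈ v (VecP.lookup⇒[]= v D eq)))))
    ... | false = sym (false′ λ h → case trans (sym eq) (VecP.[]=⇒lookup (∈-inD v (label-zero r r′ enough cd (toℕ v) (Fin.toℕ<n v)
                     (trans (sym (at-l* (toℕ v) (Fin.toℕ<n v))) (n<1⇒n≡0 (<ᵇ⇒< _ 1 h)))))) of λ ())
      where
      false′ : ∀ {b} → ¬ T b → b ≡ false
      false′ {true}  h = ⊥-elim (h tt)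
      false′ {false} h = refl

    size-D : size l* ≡ ∣ D ∣
    size-D = trans (sym (∣zeroSet∣ (at l*))) (cong ∣_∣ (trans (VecP.tabulate-cong (sym ∘ lookup-D)) (VecP.tabulate∘lookup D)))

    coefficient≢0 : ¬ (coefficient n (F* ∣ D ∣) D ≡₄ 0)
    coefficient≢0 z = A*≢0 (trans (sym F*≡A) (trans (sym (coefficient-single n (F* ∣ D ∣) D l* l*-Digits (⇒matches r′ D l* lookup-D) other)) z))
      where
      F*≡A : F* ∣ D ∣ l* ≡₄ A (at l*)
      F*≡A = cong (_% 4) (trans (cong (λ s → bit (s ≡ᵇ ∣ D ∣) * A (at l*)) size-D)
        (trans (cong (λ b → bit b * A (at l*)) (≡ᵇ-refl ∣ D ∣)) (+-identityʳ (A (at l*)))))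
      other : ∀ l → Digits (suc r′) l → T (matches D l) → l ≢ l* → F* ∣ D ∣ l ≡₄ 0
      other l hl ml ne with A (at l) % 4 ≟ 0
      ... | yes z = trans (*₄ {bit (size l ≡ᵇ ∣ D ∣)} {bit (size l ≡ᵇ ∣ D ∣)} {A (at l)} {0} refl z) (cong (_% 4) (*-zeroʳ (bit (size l ≡ᵇ ∣ D ∣))))
      ... | no A≢0 = ⊥-elim (ne (at-ext l l* λ v v<n → trans (labels-unique (at l) (label r r′ enough cd)
              (A≢0⇒Lipschitz (at l) A≢0) (label-Lipschitz r r′ enough cd) (A≢0⇒Lowered (at l) A≢0) (label-Lowered r r′ enough cd)
              (λ v v<n z → trans (sym (at-l* v v<n)) (zero⇐ v v<n (trans (sym (same v v<n)) (cong (_<ᵇ 1) z))))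
              (λ v v<n z → zero⇐′ v (trans (same v v<n) (cong (_<ᵇ 1) (trans (at-l* v v<n) z)))) v v<n) (sym (at-l* v v<n))))
        where
        same : ∀ v → v < n → (at l v <ᵇ 1) ≡ (at l* v <ᵇ 1)
        same v v<n = subst (λ v → (at l v <ᵇ 1) ≡ (at l* v <ᵇ 1)) (Fin.toℕ-fromℕ< v<n) (trans (sym (matches⇒ r′ D l ml _)) (lookup-D _))
        zero⇐ : ∀ v → v < n → (at l* v <ᵇ 1) ≡ true → at l* v ≡ 0
        zero⇐ v _ e = n<1⇒n≡0 (<ᵇ⇒< _ 1 (Equivalence.from T-≡ e))
        zero⇐′ : ∀ v → (at l v <ᵇ 1) ≡ true → at l v ≡ 0
        zero⇐′ v e = n<1⇒n≡0 (<ᵇ⇒< _ 1 (Equivalence.from T-≡ e))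

    W : (ℕ → ℕ) → ℕ → ℕ
    W f v = 1 + suc n * binary m (λ j → f (v * m + j))

    exp< : ∀ f → (∀ i → f i ≤ 1) → ∀ l → exp (W f) l < E
    exp< f f≤1 l = ≤-<-trans (go n) E-big
      where
      W≤ : ∀ v → W f v ≤ suc n * 2 ^ m
      W≤ v = ≤-trans (+-monoˡ-≤ (suc n * x) (s≤s (z≤n {n}))) (≤-trans (≤-reflexive (sym (*-suc (suc n) x)))
        (*-monoʳ-≤ (suc n) (binary-bound m (λ j → f (v * m + j)) λ j _ → f≤1 (v * m + j))))
        where
        x = binary m (λ j → f (v * m + j))
      go : ∀ k → Sum k (λ v → bit (at l v <ᵇ 1) * W f v) ≤ k * (suc n * 2 ^ m)
      go zero    = z≤n
      go (suc k) = ≤-trans (+-mono-≤ (go k) (≤-trans (*-mono-≤ (bit≤1 (at l k <ᵇ 1)) (W≤ k)) (≤-reflexive (+-identityʳ _)))) (≤-reflexive (+-comm (k * (suc n * 2 ^ m)) _))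

    complete : n * 2 ≤ 2 ^ m → ∀ (p : Vec Bool (n * m) → Bool) →
      (∀ β → T (p β) → ∀ e → e < E → e % suc n ≡ ∣ D ∣ → labellingsOf (W (bitAt β)) e ≡₄ 0) →
      2 * count (n * m) p ≤ 2 ^ (n * m)
    complete 2n≤ p h = isolation-half n (F* ∣ D ∣) D coefficient≢0 2n≤ p λ β pβ e → trans (cong (_% 4) (poly-sum n (F* ∣ D ∣) (weights n (bitAt β)) e)) (restricted β pβ e)
      where
      restricted : ∀ β → T (p β) → ∀ e → sumN (suc r′) n (λ l → bit (e ≡ᵇ exponent (weights n (bitAt β)) l) * F* ∣ D ∣ l) ≡₄ 0
      restricted β pβ e with e <? E | e % suc n ≟ ∣ D ∣
      ... | yes e<E | yes e≡ = trans (cong (_% 4) (sumN-cong (suc r′) n λ l _ → term l)) (h β pβ e e<E e≡)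
        where
        term : ∀ l → bit (e ≡ᵇ exponent (weights n (bitAt β)) l) * F* ∣ D ∣ l ≡ bit (e ≡ᵇ exp (W (bitAt β)) l) * A (at l)
        term l rewrite exponent-Sum r′ n (W (bitAt β)) l with e ≡ᵇ exp (W (bitAt β)) l in eq
        ... | false = refl
        ... | true  = cong (1 *_) (trans (cong (λ b → bit b * A (at l)) (trans (cong (_≡ᵇ ∣ D ∣)
                (trans (sym (exp-size _ l)) (trans (cong (_% suc n) (sym (≡ᵇ⇒≡ e _ (subst T (sym eq) tt)))) e≡))) (≡ᵇ-refl ∣ D ∣))) (+-identityʳ (A (at l))))
      ... | no e≮E | _ = cong (_% 4) (sumN-0 (suc r′) n λ l _ → term l)
        where
        term : ∀ l → bit (e ≡ᵇ exponent (weights n (bitAt β)) l) * F* ∣ D ∣ l ≡ 0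
        term l rewrite exponent-Sum r′ n (W (bitAt β)) l with e ≡ᵇ exp (W (bitAt β)) l in eq
        ... | false = refl
        ... | true  = ⊥-elim (e≮E (subst (_< E) (sym (≡ᵇ⇒≡ e _ (subst T (sym eq) tt))) (exp< (bitAt β) (bitAt≤1 β) l)))
      ... | yes _ | no e≢ = cong (_% 4) (sumN-0 (suc r′) n λ l _ → term l)
        where
        term : ∀ l → bit (e ≡ᵇ exponent (weights n (bitAt β)) l) * F* ∣ D ∣ l ≡ 0
        term l rewrite exponent-Sum r′ n (W (bitAt β)) l with e ≡ᵇ exp (W (bitAt β)) l in eq
        ... | false = refl
        ... | true  = cong (1 *_) (cong (λ b → bit b * A (at l)) (≢⇒≡ᵇ λ s≡ → e≢ (trans (cong (_% suc n) (≡ᵇ⇒≡ e _ (subst T (sym eq) tt))) (trans (exp-size _ l) s≡))))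

entry : List ℕ → ℕ → ℕ
entry xs i = fromMaybe 0 (head (drop i xs))

entry-++ˡ : ∀ xs ys i → i < length xs → entry (xs ++ ys) i ≡ entry xs i
entry-++ˡ (x ∷ xs) ys zero    _       = refl
entry-++ˡ (x ∷ xs) ys (suc i) (s≤s h) = entry-++ˡ xs ys i h

entry-++ʳ : ∀ xs ys i → entry (xs ++ ys) (length xs + i) ≡ entry ys i
entry-++ʳ []       ys i = refl
entry-++ʳ (x ∷ xs) ys i = entry-++ʳ xs ys i

entry-out : ∀ xs i → length xs ≤ i → entry xs i ≡ 0
entry-out []       zero    _       = refl
entry-out []       (suc i) _       = refl
entry-out (x ∷ xs) (suc i) (s≤s h) = entry-out xs i h

entry-All : ∀ {xs} → All (_≤ 1) xs → ∀ i → entry xs i ≤ 1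
entry-All []       zero    = z≤n
entry-All []       (suc i) = z≤n
entry-All (p ∷ ps) zero    = p
entry-All (p ∷ ps) (suc i) = entry-All ps i

All-++ : ∀ {xs ys : List ℕ} → All (_≤ 1) xs → All (_≤ 1) ys → All (_≤ 1) (xs ++ ys)
All-++ []       qs = qs
All-++ (p ∷ ps) qs = p ∷ All-++ ps qs

module _ {m n : ℕ} (f : Fin m → Fin n → Bool) where

  row : Fin m → List ℕ
  row i = map (λ j → bit (f i j)) (allFin n)

  length-row : ∀ i → length (row i) ≡ n
  length-row i = trans (List.length-map _ (allFin n)) (List.length-tabulate id)

  length-rows : ∀ is → length (concatMap row is) ≡ length is * n
  length-rows []       = refl
  length-rows (i ∷ is) = trans (List.length-++ (row i)) (cong₂ _+_ (length-row i) (length-rows is))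

  length-matrix : length (matrix f) ≡ m * n
  length-matrix = trans (length-rows (allFin m)) (cong (_* n) (List.length-tabulate {n = m} id))

  entry-row : ∀ i j → entry (row i) (toℕ j) ≡ bit (f i j)
  entry-row i j = go id j
    where
    go : ∀ {k} (h : Fin k → Fin n) j → entry (map (λ j → bit (f i j)) (tabulate h)) (toℕ j) ≡ bit (f i (h j))
    go h Fin.zero    = refl
    go h (Fin.suc j) = go (h ∘ Fin.suc) j

  entry-matrix : ∀ i j → entry (matrix f) (toℕ i * n + toℕ j) ≡ bit (f i j)
  entry-matrix i j = trans (go id i) (entry-row i j)
    where
    go : ∀ {k} (h : Fin k → Fin m) i → entry (concatMap row (tabulate h)) (toℕ i * n + toℕ j) ≡ entry (row (h i)) (toℕ j)
    go h Fin.zero    = entry-++ˡ (row (h Fin.zero)) _ (toℕ j) (subst (toℕ j <_) (sym (length-row (h Fin.zero))) (Fin.toℕ<n j))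
    go h (Fin.suc i) = trans (cong (entry (concatMap row (tabulate h))) (trans (+-assoc n (toℕ i * n) (toℕ j)) (cong (_+ (toℕ i * n + toℕ j)) (sym (length-row (h Fin.zero))))))
      (trans (entry-++ʳ (row (h Fin.zero)) _ (toℕ i * n + toℕ j)) (go (h ∘ Fin.suc) i))

  matrix-bits : All (_≤ 1) (matrix f)
  matrix-bits = go (allFin m)
    where
    row-bits : ∀ i js → All (_≤ 1) (map (λ j → bit (f i j)) js)
    row-bits i []       = []
    row-bits i (j ∷ js) = bit≤1 (f i j) ∷ row-bits i js
    go : ∀ is → All (_≤ 1) (concatMap row is)
    go []       = []
    go (i ∷ is) = All-++ (row-bits i (allFin n)) (go is)

signBit : ℤ → ℕ
signBit (ℤ.+ _)  = 0
signBit -[1+ _ ] = 1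

module Encoded {n : ℕ} (G : Graph n) (𝒯 : TreeDecomposition G) (r : ℕ) (k : ℤ) where

  N : ℕ
  N = nodes 𝒯

  body : List ℕ
  body = matrix (adj G) ++ matrix (adj (tree 𝒯)) ++ matrix (λ t v → Vec.lookup (bag 𝒯 t) v)

  I : ℕ → ℕ
  I = entry (encode G 𝒯 r k)

  encode≡ : encode G 𝒯 r k ≡ n ∷ N ∷ r ∷ signBit k ∷ ℤ.∣ k ∣ ∷ body
  encode≡ = go k
    where
    go : ∀ k → encode G 𝒯 r k ≡ n ∷ N ∷ r ∷ signBit k ∷ ℤ.∣ k ∣ ∷ body
    go (ℤ.+ _)  = refl
    go -[1+ _ ] = refl

  I≡ : ∀ i → I i ≡ entry (n ∷ N ∷ r ∷ signBit k ∷ ℤ.∣ k ∣ ∷ body) i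
  I≡ i = cong (λ xs → entry xs i) encode≡

  inputLength : ℕ
  inputLength = 5 + (n * n + (N * N + N * n))

  length-body : length body ≡ n * n + (N * N + N * n)
  length-body = trans (List.length-++ (matrix (adj G))) (cong₂ _+_ (length-matrix (adj G))
    (trans (List.length-++ (matrix (adj (tree 𝒯)))) (cong₂ _+_ (length-matrix (adj (tree 𝒯))) (length-matrix (λ t v → Vec.lookup (bag 𝒯 t) v)))))

  I-out : ∀ i → inputLength ≤ i → I i ≡ 0
  I-out i h = trans (I≡ i) (entry-out (n ∷ N ∷ r ∷ signBit k ∷ ℤ.∣ k ∣ ∷ body) i (subst (λ l → 5 + l ≤ i) (sym length-body) h))

  I-bits : ∀ i → 5 ≤ i → I i ≤ 1
  I-bits (suc (suc (suc (suc (suc i))))) _ = ≤-trans (≤-reflexive (I≡ (5 + i)))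
    (entry-All (All-++ (matrix-bits (adj G)) (All-++ (matrix-bits (adj (tree 𝒯))) (matrix-bits (λ t v → Vec.lookup (bag 𝒯 t) v)))) i)
  I-bits 1 (s≤s ())
  I-bits 2 (s≤s (s≤s ()))
  I-bits 3 (s≤s (s≤s (s≤s ())))
  I-bits 4 (s≤s (s≤s (s≤s (s≤s ()))))

  position< : ∀ {a b} (i : Fin a) (j : Fin b) → toℕ i * b + toℕ j < a * b
  position< {a} {b} i j = radix-< b (Fin.toℕ<n i) (Fin.toℕ<n j)

  I-adj : ∀ u v → I (5 + (toℕ u * n + toℕ v)) ≡ bit (adj G u v)
  I-adj u v = trans (I≡ (5 + (toℕ u * n + toℕ v))) (trans (entry-++ˡ (matrix (adj G)) _ _ (subst (toℕ u * n + toℕ v <_) (sym (length-matrix (adj G))) (position< u v))) (entry-matrix (adj G) u v))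

  I-tadj : ∀ s t → I (5 + (n * n + (toℕ s * N + toℕ t))) ≡ bit (adj (tree 𝒯) s t)
  I-tadj s t = trans (I≡ (5 + (n * n + (toℕ s * N + toℕ t)))) (trans (cong (λ l → entry body (l + (toℕ s * N + toℕ t))) (sym (length-matrix (adj G))))
    (trans (entry-++ʳ (matrix (adj G)) _ _) (trans (entry-++ˡ (matrix (adj (tree 𝒯))) _ _ (subst (toℕ s * N + toℕ t <_) (sym (length-matrix (adj (tree 𝒯)))) (position< s t)))
      (entry-matrix (adj (tree 𝒯)) s t))))

  I-bag : ∀ t v → I (5 + (n * n + (N * N + (toℕ t * n + toℕ v)))) ≡ bit (Vec.lookup (bag 𝒯 t) v)
  I-bag t v = trans (I≡ (5 + (n * n + (N * N + (toℕ t * n + toℕ v))))) (trans (cong₂ (λ l l′ → entry body (l + (l′ + (toℕ t * n + toℕ v)))) (sym (length-matrix (adj G))) (sym (length-matrix (adj (tree 𝒯)))))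
    (trans (entry-++ʳ (matrix (adj G)) _ _) (trans (entry-++ʳ (matrix (adj (tree 𝒯))) _ _) (entry-matrix (λ t v → Vec.lookup (bag 𝒯 t) v) t v))))

module Outcomes (w : ℕ) where
  open Machine w using (step; steps; answer)
  open Runs w

  -- From σ the machine halts within s steps, having used j random bits on
  -- which its answer is f.
  record Outcome (σ : Config) (j : ℕ) (f : Vec Bool j → Bool) (s : ℕ) : Set where
    field
      halts  : ∀ t → s ≤ t → (ω : Vec Bool t) → ∃ λ β → answer (steps ω σ) ≡ just (f β)
      counts : ∀ t → s ≤ t → count t (λ ω → saysNo (answer (steps ω σ))) * 2 ^ j ≡ 2 ^ t * count j (not ∘ f)

  count-cong : ∀ t {p q : Vec Bool t → Bool} → (∀ ω → p ω ≡ q ω) → count t p ≡ count t q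
  count-cong zero    h = cong bit (h [])
  count-cong (suc t) h = cong₂ _+_ (count-cong t λ ω → h _) (count-cong t λ ω → h _)

  stopped : ∀ {t} (ω : Vec Bool t) {ρ m} → steps ω ⟨ [] , ρ , m ⟩ ≡ ⟨ [] , ρ , m ⟩
  stopped []      = refl
  stopped (b ∷ ω) = stopped ω

  halted : ∀ {ρ m a} → (0 <ᵇ ρ 0) ≡ a → Outcome ⟨ [] , ρ , m ⟩ 0 (λ _ → a) 0
  halted {ρ} {m} {a} eq = record { halts = λ t _ ω → [] , here′ ω ; counts = λ t _ → trans (*-identityʳ _) (trans (count-cong t λ ω → cong saysNo (here′ ω)) (constant t a)) }
    where
    here′ : ∀ {t} (ω : Vec Bool t) → answer (steps ω ⟨ [] , ρ , m ⟩) ≡ just a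
    here′ ω = trans (cong answer (stopped ω)) (cong just eq)
    constant : ∀ t a → count t (λ _ → saysNo (just a)) ≡ 2 ^ t * bit (not a)
    constant zero    true  = refl
    constant zero    false = refl
    constant (suc t) a     = trans (cong₂ _+_ (constant t a) (constant t a))
      (solve 2 (λ p b → p :* b :+ p :* b := con 2 :* p :* b) refl (2 ^ t) (bit (not a)))

  weaken : ∀ {σ j f s s′} → s ≤ s′ → Outcome σ j f s → Outcome σ j f s′
  weaken s≤ o = record { halts = λ t h → halts t (≤-trans s≤ h) ; counts = λ t h → counts t (≤-trans s≤ h) }
    where open Outcome o

  running : ∀ {σ σ′ j f a s} → σ ⟶[ a ] σ′ → Outcome σ′ j f s → Outcome σ j f (a + s)
  running done o = o
  running {σ} {j = j} {f} (_then_ {σ₁ = σ₁} {s = a} e r) o = record { halts = halts′ ; counts = counts′ }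
    where
    o₁ = running r o
    halts′ : ∀ t → suc a + _ ≤ t → (ω : Vec Bool t) → ∃ λ β → answer (steps ω σ) ≡ just (f β)
    halts′ (suc t) (s≤s h) (b ∷ ω) with β , eq ← Outcome.halts o₁ t h ω = β , trans (cong (λ τ → answer (steps ω τ)) (e b)) eq
    counts′ : ∀ t → suc a + _ ≤ t → count t (λ ω → saysNo (answer (steps ω σ))) * 2 ^ j ≡ 2 ^ t * count j (not ∘ f)
    counts′ (suc t) (s≤s h) = trans (cong₂ (λ x y → (count t (λ ω → saysNo (answer (steps ω x))) + count t (λ ω → saysNo (answer (steps ω y)))) * 2 ^ j) (e false) (e true))
      (trans (*-distribʳ-+ (2 ^ j) (count t (λ ω → saysNo (answer (steps ω σ₁)))) _)
      (trans (cong₂ _+_ (Outcome.counts o₁ t h) (Outcome.counts o₁ t h)) (solve 2 (λ p c → p :* c :+ p :* c := con 2 :* p :* c) refl (2 ^ t) (count j (not ∘ f)))))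

  tossing : ∀ {σ j f s} → (∀ b → Outcome (step b σ) j (λ β → f (b ∷ β)) s) → Outcome σ (suc j) f (suc s)
  tossing {σ} {j} {f} {s} o = record { halts = halts′ ; counts = counts′ }
    where
    halts′ : ∀ t → suc s ≤ t → (ω : Vec Bool t) → ∃ λ β → answer (steps ω σ) ≡ just (f β)
    halts′ (suc t) (s≤s h) (b ∷ ω) with β , eq ← Outcome.halts (o b) t h ω = b ∷ β , eq
    counts′ : ∀ t → suc s ≤ t → count t (λ ω → saysNo (answer (steps ω σ))) * 2 ^ suc j ≡ 2 ^ t * count (suc j) (not ∘ f)
    counts′ (suc t) (s≤s h) = trans (solve 3 (λ x y p → (x :+ y) :* (con 2 :* p) := con 2 :* (x :* p :+ y :* p)) refl (c false) (c true) (2 ^ j))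
      (trans (cong (2 *_) (cong₂ _+_ (Outcome.counts (o false) t h) (Outcome.counts (o true) t h)))
        (solve 3 (λ p x y → con 2 :* (p :* x :+ p :* y) := con 2 :* p :* (x :+ y)) refl (2 ^ t) _ _))
      where
      c : Bool → ℕ
      c b = count t (λ ω → saysNo (answer (steps ω (step b σ))))

fillFrom : ∀ {j} → ℕ → Vec Bool j → Arrays → Arrays
fillFrom i []      𝓐 = 𝓐
fillFrom i (b ∷ β) 𝓐 = fillFrom (suc i) β (set 𝓐 RND i (bit b))

fillFrom-other : ∀ {j} i (β : Vec Bool j) 𝓐 B → B ≢ RND → fillFrom i β 𝓐 B ≡ 𝓐 B
fillFrom-other i []      𝓐 B B≢ = refl
fillFrom-other i (b ∷ β) 𝓐 B B≢ = trans (fillFrom-other (suc i) β _ B B≢) (set-other 𝓐 RND i (bit b) B≢)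

fillFrom-before : ∀ {j} i (β : Vec Bool j) 𝓐 x → x < i → fillFrom i β 𝓐 RND x ≡ 𝓐 RND x
fillFrom-before i []      𝓐 x x<i = refl
fillFrom-before i (b ∷ β) 𝓐 x x<i = trans (fillFrom-before (suc i) β _ x (m<n⇒m<1+n x<i)) (update-other (𝓐 RND) (bit b) (<⇒≢ x<i))

fillFrom-at : ∀ {j} i (β : Vec Bool j) 𝓐 x → x < j → fillFrom i β 𝓐 RND (i + x) ≡ bitAt β x
fillFrom-at i (b ∷ β) 𝓐 zero    _       = trans (cong (fillFrom (suc i) β (set 𝓐 RND i (bit b)) RND) (+-identityʳ i))
  (trans (fillFrom-before (suc i) β (set 𝓐 RND i (bit b)) i ≤-refl) (update-same (𝓐 RND) i (bit b)))
fillFrom-at i (b ∷ β) 𝓐 (suc x) (s≤s h) = trans (cong (fillFrom (suc i) β (set 𝓐 RND i (bit b)) RND) (+-suc i x)) (fillFrom-at (suc i) β (set 𝓐 RND i (bit b)) x h)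

codeDraw : List Cmd
codeDraw =
  arith (rV 10) add (rV 2) (rV 2) ∷
  while (rV 10 <ʳ rT 0)
    (codeCell RND (codeVar 10) 1 ++ flip (rT 2) ∷ store (rT 1) (rT 2) ∷ arith (rV 10) add (rV 10) (rV 3) ∷ []) ∷
  arith (rV 10) add (rV 2) (rV 2) ∷ []

codeStart : List Cmd
codeStart =
  const (rV 3) 1 ∷ load (rT 0) (rV 2) ∷ load (rT 1) (rV 3) ∷
  const (rV 0) 8 ∷ arith (rV 0) add (rV 0) (rT 0) ∷ arith (rV 0) add (rV 0) (rT 1) ∷
  arith (rT 2) mul (rT 0) (rT 0) ∷ arith (rT 3) mul (rT 1) (rT 1) ∷ arith (rT 4) mul (rT 1) (rT 0) ∷
  const (rV 1) 5 ∷ arith (rV 1) add (rV 1) (rT 2) ∷ arith (rV 1) add (rV 1) (rT 3) ∷ arith (rV 1) add (rV 1) (rT 4) ∷ []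

program : Program
program = codeStart ++ codeC powersOf2 0 ++ code (nE ⊛ mE) 0 ++ codeDraw ++ codeC main 0 ++ code answerE 0

module Start (w : ℕ) (I : ℕ → ℕ) where
  open Machine w using (wrap; ⟦_⟧)
  open Runs w

  r₁ r₂ r₃ r₄ r₅ r₆ r₇ r₈ r₉ r₁₀ r₁₁ r₁₂ r₁₃ : ℕ → ℕ
  r₁  = update (λ _ → 0) (rV 3) (wrap 1)
  r₂  = update r₁ (rT 0) (I (r₁ (rV 2)))
  r₃  = update r₂ (rT 1) (I (r₂ (rV 3)))
  r₄  = update r₃ (rV 0) (wrap 8)
  r₅  = update r₄ (rV 0) (⟦ add ⟧ (r₄ (rV 0)) (r₄ (rT 0)))
  r₆  = update r₅ (rV 0) (⟦ add ⟧ (r₅ (rV 0)) (r₅ (rT 1)))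
  r₇  = update r₆ (rT 2) (⟦ mul ⟧ (r₆ (rT 0)) (r₆ (rT 0)))
  r₈  = update r₇ (rT 3) (⟦ mul ⟧ (r₇ (rT 1)) (r₇ (rT 1)))
  r₉  = update r₈ (rT 4) (⟦ mul ⟧ (r₈ (rT 1)) (r₈ (rT 0)))
  r₁₀ = update r₉ (rV 1) (wrap 5)
  r₁₁ = update r₁₀ (rV 1) (⟦ add ⟧ (r₁₀ (rV 1)) (r₁₀ (rT 2)))
  r₁₂ = update r₁₁ (rV 1) (⟦ add ⟧ (r₁₁ (rV 1)) (r₁₁ (rT 3)))
  r₁₃ = update r₁₂ (rV 1) (⟦ add ⟧ (r₁₂ (rV 1)) (r₁₂ (rT 4)))

  start-run : ∀ κ → ⟨ codeStart ++ κ , (λ _ → 0) , I ⟩ ⟶[ 13 ] ⟨ κ , r₁₃ , I ⟩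
  start-run κ =
    by-const (rV 3) 1 (λ _ → 0) ++ʳ
    by-load (rT 0) (rV 2) r₁ ++ʳ
    by-load (rT 1) (rV 3) r₂ ++ʳ
    by-const (rV 0) 8 r₃ ++ʳ
    by-arith (rV 0) add (rV 0) (rT 0) r₄ ++ʳ
    by-arith (rV 0) add (rV 0) (rT 1) r₅ ++ʳ
    by-arith (rT 2) mul (rT 0) (rT 0) r₆ ++ʳ
    by-arith (rT 3) mul (rT 1) (rT 1) r₇ ++ʳ
    by-arith (rT 4) mul (rT 1) (rT 0) r₈ ++ʳ
    by-const (rV 1) 5 r₉ ++ʳ
    by-arith (rV 1) add (rV 1) (rT 2) r₁₀ ++ʳ
    by-arith (rV 1) add (rV 1) (rT 3) r₁₁ ++ʳ
    by-arith (rV 1) add (rV 1) (rT 4) r₁₂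
    where
    by-const : ∀ x a ρ {κ} → ⟨ const x a ∷ κ , ρ , I ⟩ ⟶[ 1 ] ⟨ κ , update ρ x (wrap a) , I ⟩
    by-const x a ρ = (λ _ → refl) then done
    by-load : ∀ x y ρ {κ} → ⟨ load x y ∷ κ , ρ , I ⟩ ⟶[ 1 ] ⟨ κ , update ρ x (I (ρ y)) , I ⟩
    by-load x y ρ = (λ _ → refl) then done
    by-arith : ∀ x o y z ρ {κ} → ⟨ arith x o y z ∷ κ , ρ , I ⟩ ⟶[ 1 ] ⟨ κ , update ρ x (⟦ o ⟧ (ρ y) (ρ z)) , I ⟩
    by-arith x o y z ρ = (λ _ → refl) then done

  σ₀ : Env
  σ₀ x = r₁₃ (rV x)

  σ₀-rest : ∀ x → σ₀ (4 + x) ≡ 0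
  σ₀-rest x = trans (v r₁₂ 1 (s≤s (s≤s z≤n))) (trans (v r₁₁ 1 (s≤s (s≤s z≤n))) (trans (v r₁₀ 1 (s≤s (s≤s z≤n))) (trans (v r₉ 1 (s≤s (s≤s z≤n)))
    (trans (t r₈ 4) (trans (t r₇ 3) (trans (t r₆ 2) (trans (v r₅ 0 (s≤s z≤n)) (trans (v r₄ 0 (s≤s z≤n)) (trans (v r₃ 0 (s≤s z≤n))
    (trans (t r₂ 1) (trans (t r₁ 0) (v (λ _ → 0) 3 ≤-refl))))))))))))
    where
    v : ∀ f y {a} → y < 4 → update f (rV y) a (rV (4 + x)) ≡ f (rV (4 + x))
    v f y {a} y<4 = update-other f a (λ e → <⇒≢ (<-≤-trans y<4 (m≤m+n 4 x)) (sym (rV-inj e)))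
    t : ∀ f k {a} → update f (rT k) a (rV (4 + x)) ≡ f (rV (4 + x))
    t f k {a} = update-other f a (rT≢rV k (4 + x) ∘ sym)

  opaque
    unfolding rT rV

    σ₀-0 : σ₀ 0 ≡ wrap (wrap (wrap 8 + I 0) + I (wrap 1))
    σ₀-0 = refl

    σ₀-1 : σ₀ 1 ≡ wrap (wrap (wrap (wrap 5 + wrap (I 0 * I 0)) + wrap (I (wrap 1) * I (wrap 1))) + wrap (I (wrap 1) * I 0))
    σ₀-1 = refl

    σ₀-2 : σ₀ 2 ≡ 0
    σ₀-2 = refl

    σ₀-3 : σ₀ 3 ≡ wrap 1
    σ₀-3 = refl

  module _ (1<W : 1 < 2 ^ w) (X<W : I 0 + I 1 + 8 < 2 ^ w) (L<W : 5 + (I 0 * I 0 + (I 1 * I 1 + I 1 * I 0)) < 2 ^ w) where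

    σ₀-X : σ₀ 0 ≡ I 0 + I 1 + 8
    σ₀-X = begin
      σ₀ 0                                    ≡⟨ σ₀-0 ⟩
      wrap (wrap (wrap 8 + I 0) + I (wrap 1)) ≡⟨ cong₂ (λ a b → wrap (wrap (a + I 0) + I b)) (wrap-small (≤-<-trans (m≤n+m 8 (I 0 + I 1)) X<W)) (wrap-small 1<W) ⟩
      wrap (wrap (8 + I 0) + I 1)             ≡⟨ cong (λ a → wrap (a + I 1)) (wrap-small (≤-<-trans (≤-trans (m≤m+n (8 + I 0) (I 1)) (≤-reflexive sum≡)) X<W)) ⟩
      wrap (8 + I 0 + I 1)                    ≡⟨ cong wrap sum≡ ⟩
      wrap (I 0 + I 1 + 8)                    ≡⟨ wrap-small X<W ⟩
      I 0 + I 1 + 8                           ∎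
      where
      open ≡-Reasoning
      sum≡ : 8 + I 0 + I 1 ≡ I 0 + I 1 + 8
      sum≡ = +-comm 8 (I 0 + I 1)

    σ₀-L : σ₀ 1 ≡ 5 + (I 0 * I 0 + (I 1 * I 1 + I 1 * I 0))
    σ₀-L = begin
      σ₀ 1 ≡⟨ σ₀-1 ⟩
      wrap (wrap (wrap (wrap 5 + wrap (I 0 * I 0)) + wrap (I (wrap 1) * I (wrap 1))) + wrap (I (wrap 1) * I 0))
        ≡⟨ cong (λ o → wrap (wrap (wrap (wrap 5 + wrap (I 0 * I 0)) + wrap (I o * I o)) + wrap (I o * I 0))) (wrap-small 1<W) ⟩
      wrap (wrap (wrap (wrap 5 + wrap a) + wrap b) + wrap c)
        ≡⟨ cong₂ (λ x y → wrap (wrap (wrap (x + y) + wrap b) + wrap c)) (wrap-small (below′ (m≤m+n 5 _))) (wrap-small (below′ (≤-trans (m≤m+n a _) (m≤n+m _ 5)))) ⟩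
      wrap (wrap (wrap (5 + a) + wrap b) + wrap c)
        ≡⟨ cong₂ (λ x y → wrap (wrap (x + y) + wrap c)) (wrap-small (below′ (+-monoʳ-≤ 5 (m≤m+n a _)))) (wrap-small (below′ (≤-trans (m≤m+n b c) (≤-trans (m≤n+m _ a) (m≤n+m _ 5))))) ⟩
      wrap (wrap (5 + a + b) + wrap c)
        ≡⟨ cong₂ (λ x y → wrap (x + y)) (wrap-small (below′ (≤-trans (m≤m+n (5 + a + b) c) (≤-reflexive sum≡)))) (wrap-small (below′ (≤-trans (m≤n+m c b) (≤-trans (m≤n+m _ a) (m≤n+m _ 5))))) ⟩
      wrap (5 + a + b + c)   ≡⟨ cong wrap sum≡ ⟩
      wrap (5 + (a + (b + c))) ≡⟨ wrap-small L<W ⟩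
      5 + (a + (b + c)) ∎
      where
      open ≡-Reasoning
      a = I 0 * I 0
      b = I 1 * I 1
      c = I 1 * I 0
      below′ : ∀ {x} → x ≤ 5 + (a + (b + c)) → x < 2 ^ w
      below′ h = ≤-<-trans h L<W
      sum≡ : 5 + a + b + c ≡ 5 + (a + (b + c))
      sum≡ = trans (+-assoc (5 + a) b c) (+-assoc 5 a (b + c))

    σ₀-one : σ₀ 3 ≡ 1
    σ₀-one = trans σ₀-3 (wrap-small 1<W)

module Drawing (w X Q L : ℕ) (I : ℕ → ℕ) (2≤X : 2 ≤ X) (1≤Q : 1 ≤ Q) (arrays<W : arrays < 2 ^ w) where
  open Machine w using (wrap; ⟦_⟧; step)
  open Runs w
  open Outcomes w
  open Compiler w X Q L I 2≤X 1≤Q arrays<W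

  recast : ∀ {σ j s} {f g : Vec Bool j → Bool} → (∀ β → f β ≡ g β) → Outcome σ j f s → Outcome σ j g s
  recast {j = j} h o = record
    { halts  = λ t t≥ ω → let β , eq = Outcome.halts o t t≥ ω in β , trans eq (cong just (h β))
    ; counts = λ t t≥ → trans (Outcome.counts o t t≥) (cong (2 ^ t *_) (count-cong j λ β → cong not (h β))) }

  Vars-V : ∀ ρ {σ v u} y → Vars ρ σ → v ≡ u → Vars (update ρ (rV y) v) (update σ y u)
  Vars-V ρ {σ} {v} y vs refl x with x ≟ y
  ... | yes refl = trans (update-same ρ (rV x) v) (sym (update-same σ x v))
  ... | no x≢y   = trans (update-other ρ v (x≢y ∘ rV-inj)) (trans (vs x) (sym (update-other σ v x≢y)))

  Vars-cong : ∀ ρ {σ σ′ : Env} → (∀ x → σ x ≡ σ′ x) → Vars ρ σ → Vars ρ σ′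
  Vars-cong ρ h vs x = trans (vs x) (h x)

  module _ (b : ℕ) (σ : Env) (good : Good σ) (σ-10 : σ 10 ≡ 0) (ans : Arrays → Bool) (S : ℕ) (κ : List Cmd)
    (b<W : b < W) (fits : ∀ i → i < b → cell L RND i < W) where
    open Good good

    toss loopBody : List Cmd
    toss = flip (rT 2) ∷ store (rT 1) (rT 2) ∷ arith (rV 10) add (rV 10) (rV 3) ∷ []
    loopBody = codeCell RND (codeVar 10) 1 ++ toss

    loopCmd : Cmd
    loopCmd = while (rV 10 <ʳ rT 0) loopBody

    reset : Cmd
    reset = arith (rV 10) add (rV 2) (rV 2)

    zero-sum : ∀ (ρ : ℕ → ℕ) → ρ (rV 2) ≡ 0 → ⟦ add ⟧ (ρ (rV 2)) (ρ (rV 2)) ≡ 0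
    zero-sum ρ e = trans (cong₂ (λ x y → wrap (x + y)) e e) (wrap-small (≤-<-trans z≤n b<W))

    Continue : ∀ {j} → ℕ → Arrays → Set
    Continue {j} i 𝓑 = ∀ (β : Vec Bool j) ρ m → Vars ρ σ → Rep m (fillFrom i β 𝓑) → Outcome ⟨ κ , ρ , m ⟩ 0 (λ _ → ans (fillFrom i β 𝓑)) S

    draws : ∀ j i → j + i ≡ b → ∀ 𝓑 ρ m → Vars ρ (update σ 10 i) → ρ (rT 0) ≡ b → Rep m 𝓑 → Continue {j} i 𝓑 →
      Outcome ⟨ loopCmd ∷ reset ∷ κ , ρ , m ⟩ j (λ β → ans (fillFrom i β 𝓑)) (j * 11 + (2 + S))
    draws zero i refl 𝓑 ρ m vs eb rep continue = recast (λ { [] → refl })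
      (running (leave then (λ _ → refl) then done) (continue [] (update ρ (rV 10) (⟦ add ⟧ (ρ (rV 2)) (ρ (rV 2)))) m
        (Vars-cong (update ρ (rV 10) (⟦ add ⟧ (ρ (rV 2)) (ρ (rV 2)))) restore (Vars-V ρ 10 vs (zero-sum ρ (trans (vs 2) is0)))) rep))
      where
      n≮ᵇn : ∀ n → (n <ᵇ n) ≡ false
      n≮ᵇn zero    = refl
      n≮ᵇn (suc n) = n≮ᵇn n
      leave : (bt : Bool) → step bt ⟨ loopCmd ∷ reset ∷ κ , ρ , m ⟩ ≡ ⟨ reset ∷ κ , ρ , m ⟩
      leave _ = cong (λ c → ⟨ (if c then loopBody ++ loopCmd ∷ reset ∷ κ else reset ∷ κ) , ρ , m ⟩)
        (trans (cong₂ _<ᵇ_ (trans (vs 10) (update-same σ 10 i)) eb) (n≮ᵇn i))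
      restore : ∀ x → update (update σ 10 i) 10 0 x ≡ σ x
      restore x with x ≟ 10
      ... | yes refl = trans (update-same (update σ 10 i) 10 0) (sym σ-10)
      ... | no x≢    = trans (update-other (update σ 10 i) 0 x≢) (update-other σ i x≢)
    draws (suc j) i j+i 𝓑 ρ m vs eb rep continue = finish (computesCell goodᵢ RND (computesVar goodᵢ 10)
        (subst (λ x → cell L RND x < W) (sym (update-same σ 10 i)) (fits i i<b)) 1 ρ (toss ++ loopCmd ∷ reset ∷ κ) vs)
      where
      i<b : i < b
      i<b = subst (i <_) j+i (s≤s (m≤n+m i j))
      goodᵢ : Good (update σ 10 i)
      goodᵢ = Good-update good (s≤s (s≤s (s≤s (s≤s z≤n)))) (<-trans i<b b<W)
      enter : (bt : Bool) → step bt ⟨ loopCmd ∷ reset ∷ κ , ρ , m ⟩ ≡ ⟨ loopBody ++ loopCmd ∷ reset ∷ κ , ρ , m ⟩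
      enter _ = cong (λ c → ⟨ (if c then loopBody ++ loopCmd ∷ reset ∷ κ else reset ∷ κ) , ρ , m ⟩)
        (trans (cong₂ _<ᵇ_ (trans (vs 10) (update-same σ 10 i)) eb) (Equivalence.to T-≡ (<⇒<ᵇ i<b)))
      finish : Result (codeCell RND (codeVar 10) 1) (toss ++ loopCmd ∷ reset ∷ κ) ρ m 1 (update σ 10 i)
          (λ ρ′ m′ → ρ′ (rT 1) ≡ cell L RND (update σ 10 i 10) × m′ ≡ m) 7 →
        Outcome ⟨ loopCmd ∷ reset ∷ κ , ρ , m ⟩ (suc j) (λ β → ans (fillFrom i β 𝓑)) (suc j * 11 + (2 + S))
      finish (result {ρ₁} {m₁} {time} t≤ r vs₁ ks (e₁ , refl)) = weaken time≤
        (running (enter then reassoc (codeCell RND (codeVar 10) 1) toss r) (tossing branch′))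
        where
        time≤ : suc time + suc (2 + (j * 11 + (2 + S))) ≤ suc j * 11 + (2 + S)
        time≤ = s≤s (+-monoˡ-≤ _ t≤)
        wrap-bit : ∀ x → wrap (bit x) ≡ bit x
        wrap-bit x = wrap-small (≤-<-trans (bit≤1 x) (<-trans (s≤s (s≤s z≤n)) arrays<W))
        branch′ : ∀ x → Outcome ⟨ store (rT 1) (rT 2) ∷ arith (rV 10) add (rV 10) (rV 3) ∷ loopCmd ∷ reset ∷ κ , update ρ₁ (rT 2) (wrap (bit x)) , m ⟩
          j (λ β → ans (fillFrom i (x ∷ β) 𝓑)) (2 + (j * 11 + (2 + S)))
        branch′ x = running ((λ _ → refl) then (λ _ → refl) then done)
          (draws j (suc i) (trans (+-suc j i) j+i) (set 𝓑 RND i (bit x)) ρ₃ _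
            (Vars-cong ρ₃ next (Vars-V ρ₂ 10 (Vars-T ρ₁ vs₁) increment))
            (trans (keepV ρ₂ 0) (trans (keepT ρ₁ 1 {0} {1} (s≤s z≤n)) (trans (ks 0 (s≤s z≤n)) eb)))
            (subst₂ (λ a v → Rep (update m a v) (set 𝓑 RND i (bit x))) (sym address) (sym value) (Rep-store RND i (bit x) (s≤s (s≤s (s≤s z≤n))) rep))
            (λ β → continue (x ∷ β)))
          where
          ρ₂ : ℕ → ℕ
          ρ₂ = update ρ₁ (rT 2) (wrap (bit x))
          ρ₃ : ℕ → ℕ
          ρ₃ = update ρ₂ (rV 10) (⟦ add ⟧ (ρ₂ (rV 10)) (ρ₂ (rV 3)))
          address : ρ₂ (rT 1) ≡ cell L RND i
          address = trans (update-other ρ₁ (wrap (bit x)) (apart 1 2 {0} λ ())) (trans e₁ (cong (cell L RND) (update-same σ 10 i)))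
          value : ρ₂ (rT 2) ≡ bit x
          value = trans (update-same ρ₁ (rT 2) _) (wrap-bit x)
          increment : ⟦ add ⟧ (ρ₂ (rV 10)) (ρ₂ (rV 3)) ≡ suc i
          increment = trans (cong₂ (λ a o → wrap (a + o)) (trans (Vars-T ρ₁ vs₁ 10) (update-same σ 10 i)) (trans (Vars-T ρ₁ vs₁ 3) is1))
            (trans (cong wrap (+-comm i 1)) (wrap-small (≤-<-trans i<b b<W)))
          next : ∀ y → update (update σ 10 i) 10 (suc i) y ≡ update σ 10 (suc i) y
          next y with y ≟ 10
          ... | yes refl = trans (update-same (update σ 10 i) 10 (suc i)) (sym (update-same σ 10 (suc i)))
          ... | no y≢    = trans (update-other (update σ 10 i) (suc i) y≢) (trans (update-other σ i y≢) (sym (update-other σ (suc i) y≢)))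

    drawing : ∀ 𝓐 ρ m → Vars ρ σ → ρ (rT 0) ≡ b → Rep m 𝓐 → Continue {b} 0 𝓐 →
      Outcome ⟨ codeDraw ++ κ , ρ , m ⟩ b (λ β → ans (fillFrom 0 β 𝓐)) (1 + (b * 11 + (2 + S)))
    drawing 𝓐 ρ m vs eb rep continue = running ((λ _ → refl) then done)
      (draws b 0 (+-identityʳ b) 𝓐 (update ρ (rV 10) (⟦ add ⟧ (ρ (rV 2)) (ρ (rV 2)))) m (Vars-V ρ 10 vs (zero-sum ρ (trans (vs 2) is0))) (trans (keepV ρ 0) eb) rep continue)

eqN-≡ : ∀ a b → eqN a b ≢ 0 → a ≡ b
eqN-≡ a b nz with a ≟ b
... | yes e = e
... | no ne = ⊥-elim (nz (eqN-≢ ne))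

Sum-nonzero : ∀ E f → Sum E f ≢ 0 → ∃ λ e → e < E × f e ≢ 0
Sum-nonzero zero    f h = ⊥-elim (h refl)
Sum-nonzero (suc E) f h with f E ≟ 0
... | no nz = E , ≤-refl , nz
... | yes z with e , e<E , nz ← Sum-nonzero E f (λ z′ → h (cong₂ _+_ z′ z)) = e , m<n⇒m<1+n e<E , nz

sign-magnitude : ∀ k {s d} → s ≡ signBit k → 1 ∸ s ≢ 0 → ℤ.∣ k ∣ ≡ d → ℤ.+ d ≡ k
sign-magnitude (ℤ.+ a)  _    _  refl = refl
sign-magnitude -[1+ a ] refl nz _    = ⊥-elim (nz refl)

%₀-suc : ∀ e n → e %₀ (n + 1) ≡ e % suc n
%₀-suc e n = cong (e %₀_) (+-comm n 1)

maxBagOf : (ℕ → ℕ) → ℕ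
maxBagOf input = Sum (input 0) (λ j → bit (0 <ᵇ Sum (input 1) (λ t → bit (j <ᵇ
  Sum (input 0) (λ v → input (5 + (input 0 * input 0 + (input 1 * input 1 + (t * input 0 + v)))))))))

tableSize : (ℕ → ℕ) → ℕ
tableSize input = (2 * (input 2 + 1)) ^ maxBagOf input

record Setting (w X L : ℕ) (I : ℕ → ℕ) (n N : ℕ) (G : Graph n) (r : ℕ) (k : ℤ) : Set where
  input : ℕ → ℕ
  input = capped X L I

  field
    Tr           : Graph N
    isTree       : IsTree Tr
    bagT         : Fin N → Subset n
    coversVertex : ∀ v → ∃ λ t → v ∈ bagT t
    coversEdge   : ∀ u v → Edge G u v → ∃ λ t → u ∈ bagT t × v ∈ bagT t
    connected    : ∀ v → InducedConnected Tr (λ t → v ∈ bagT t)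
    adj≡    : ∀ u v → input (5 + (toℕ u * n + toℕ v)) ≡ bit (adj G u v)
    tadj≡   : ∀ s t → input (5 + (n * n + (toℕ s * N + toℕ t))) ≡ bit (adj Tr s t)
    bag≡    : ∀ t v → input (5 + (n * n + (N * N + (toℕ t * n + toℕ v)))) ≡ bit (Vec.lookup (bagT t) v)
    outside : ∀ v → v < n → input (5 + (n * n + (N * N + (N * n + v)))) ≡ 0
    bits    : ∀ i → 5 ≤ i → input i ≤ 1
    r′≤r    : input 2 ≤ r
    enough  : ∀ d → d ≤ r → d < n → d ≤ input 2
    sign≡   : input 3 ≡ signBit k
    k⇒      : ∀ d → d ≤ n → input 4 ≡ d → ℤ.∣ k ∣ ≡ d
    k⇐      : ∀ d → d ≤ n → ℤ.∣ k ∣ ≡ d → input 4 ≡ d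
    I0      : I 0 ≡ n
    I1      : I 1 ≡ N
    X≡      : X ≡ I 0 + I 1 + 8
    L≡      : L ≡ 5 + (I 0 * I 0 + (I 1 * I 1 + I 1 * I 0))
    I-out   : ∀ i → L ≤ i → I i ≡ 0
    D-fits  : X ^ degreeBound * tableSize input < 2 ^ w

module Core (w X L : ℕ) (I : ℕ → ℕ) (G : Graph (capped X L I 0)) (r : ℕ) (k : ℤ)
  (setting : Setting w X L I (capped X L I 0) (capped X L I 1) G r k) where
  open Setting setting

  Q : ℕ
  Q = tableSize input

  8≤X : 8 ≤ X
  8≤X = subst (8 ≤_) (sym X≡) (m≤n+m 8 (I 0 + I 1))

  2≤X : 2 ≤ X
  2≤X = ≤-trans (s≤s (s≤s z≤n)) 8≤X

  1≤Q : 1 ≤ Q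
  1≤Q = m^n>0 (2 * (input 2 + 1)) {{>-nonZero (≤-trans (m≤n+m 1 (input 2)) (m≤n*m (input 2 + 1) 2))}} (maxBagOf input)

  open Bounds X Q 2≤X 1≤Q

  X<W : X < 2 ^ w
  X<W = ≤-<-trans (≤-trans (≤-reflexive (sym (trans (*-identityʳ _) (*-identityʳ X)))) (𝔹-mono {1} {degreeBound} {0} {1} (≤ᵇ⇒≤ 1 degreeBound tt) z≤n))
    (subst (λ q → X ^ degreeBound * q < 2 ^ w) (sym (*-identityʳ Q)) D-fits)

  arrays<W : arrays < 2 ^ w
  arrays<W = ≤-<-trans 8≤X X<W

  open Compiler w X Q L I 2≤X 1≤Q arrays<W hiding (input; W)
  open Correct Γ degreeBound D-fits
  open Degrees Γ degreeBound
  open Semantics input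
  open Frames input
  open Runs w
  open Outcomes w
  open Drawing w X Q L I 2≤X 1≤Q arrays<W
  open Start w I

  L≤ : L ≤ 𝔹 (3 , 0)
  L≤ = ≤-trans (≤-reflexive L≡) (≤-trans (≤-trans (m≤m+n _ (I 0 * I 1 + 16 * I 0 + 16 * I 1 + 59))
      (≤-reflexive (trans (solve 2 (λ a b → con 5 :+ (a :* a :+ (b :* b :+ b :* a)) :+ (a :* b :+ con 16 :* a :+ con 16 :* b :+ con 59) := (a :+ b :+ con 8) :* (a :+ b :+ con 8)) refl (I 0) (I 1))
        (cong₂ _*_ (sym X≡) (sym X≡)))))
    (≤-trans (*-monoʳ-≤ X (≤-trans (≤-reflexive (sym (*-identityʳ X))) (*-monoʳ-≤ X (≤-trans (s≤s z≤n) 8≤X))))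
      (≤-reflexive (sym (trans (*-identityʳ _) (cong (λ y → X * (X * y)) (*-identityʳ X)))))))

  L<W : L < 2 ^ w
  L<W = fits-< (3 , 0) tt L≤

  1<W : 1 < 2 ^ w
  1<W = <-trans (s≤s (s≤s z≤n)) arrays<W

  σ₀≡X : σ₀ 0 ≡ X
  σ₀≡X = trans (σ₀-X 1<W (subst (_< 2 ^ w) X≡ X<W) (subst (_< 2 ^ w) L≡ L<W)) (sym X≡)

  σ₀≡L : σ₀ 1 ≡ L
  σ₀≡L = trans (σ₀-L 1<W (subst (_< 2 ^ w) X≡ X<W) (subst (_< 2 ^ w) L≡ L<W)) (sym L≡)

  σ₀≡1 : σ₀ 3 ≡ 1
  σ₀≡1 = σ₀-one 1<W (subst (_< 2 ^ w) X≡ X<W) (subst (_< 2 ^ w) L≡ L<W)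

  good : Good σ₀
  good = record { isX = σ₀≡X ; isL = σ₀≡L ; is0 = σ₀-2 ; is1 = σ₀≡1 ; small = small }
    where
    small : ∀ x → σ₀ x < 2 ^ w
    small 0 = subst (_< 2 ^ w) (sym σ₀≡X) X<W
    small 1 = subst (_< 2 ^ w) (sym σ₀≡L) L<W
    small 2 = subst (_< 2 ^ w) (sym σ₀-2) (≤-<-trans z≤n 1<W)
    small 3 = subst (_< 2 ^ w) (sym σ₀≡1) 1<W
    small (suc (suc (suc (suc x)))) = subst (_< 2 ^ w) (sym (σ₀-rest x)) (≤-<-trans z≤n 1<W)

  fit : Fit Δ₀ σ₀
  fit = record { good = good ; bnd = bnd ; L≤ = subst (_≤ 𝔹 (3 , 0)) (sym σ₀≡L) L≤ }
    where
    bnd : Bounded Δ₀ σ₀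
    bnd 0 = ≤-trans (≤-reflexive σ₀≡X) (≤-reflexive (sym (trans (*-identityʳ _) (*-identityʳ X))))
    bnd 1 = subst (_≤ 𝔹 (3 , 0)) (sym σ₀≡L) L≤
    bnd 2 = subst (_≤ 1) (sym σ₀-2) z≤n
    bnd 3 = ≤-reflexive σ₀≡1
    bnd (suc (suc (suc (suc x)))) = subst (_≤ 1) (sym (σ₀-rest x)) z≤n

  big : input 0 + input 1 + 8 ≤ X
  big = ≤-reflexive (trans (cong₂ (λ a b → a + b + 8) (sym I0) (sym I1)) (sym X≡))

  open Preparation X Q 2≤X 1≤Q input (capped≤ X L I) big σ₀

  BoundedA′ : Arrays → Set
  BoundedA′ = BoundedA Γ degreeBound input (capped≤ X L I)

  𝓐₀ 𝓐₁ : Arrays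
  𝓐₀ A i = I (cell L A i)
  𝓐₁ = exec powersOf2 σ₀ 𝓐₀

  bounded₀ : BoundedA′ 𝓐₀
  bounded₀ A i = subst (_≤ 𝔹 (Γ A)) (sym (I-out _ (m≤m+n L _))) z≤n

  rep₀ : Rep I 𝓐₀
  rep₀ = record { cells = λ _ _ _ → refl ; inputs = λ _ _ → refl }

  bounded₁ : BoundedA′ 𝓐₁
  bounded₁ = exec-bound Γ degreeBound input (capped≤ X L I) powersOf2 {σ₀} {𝓐₀} (Powers2.valid 𝓐₀) bounded₀

  bounded-exec : ∀ c {𝓐} → AdmissibleC c σ₀ 𝓐 → BoundedA′ 𝓐 → BoundedA′ (exec c σ₀ 𝓐)
  bounded-exec c (admissible v) = exec-bound Γ degreeBound input (capped≤ X L I) c v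

  admissible-⨾′ : ∀ {c d 𝓐} → AdmissibleC c σ₀ 𝓐 → AdmissibleC d σ₀ (exec c σ₀ 𝓐) → AdmissibleC (c ⨾ d) σ₀ 𝓐
  admissible-⨾′ = admissible-⨾ Γ degreeBound input (capped≤ X L I)

  correct : ∀ c {𝓐 mem} → T (okC Δ₀ c) → BoundedA′ 𝓐 → AdmissibleC c σ₀ 𝓐 → ∀ ρ κ → Rep mem 𝓐 → Vars ρ σ₀ →
    Result (codeC c 0) κ ρ mem 0 σ₀ (λ _ m′ → Rep m′ (exec c σ₀ 𝓐)) (𝔹 (costC Δ₀ c))
  correct c ok bounded (admissible v) = codeC-correct c ok fit bounded v 0

  bounded-fill : ∀ {j} i (β : Vec Bool j) 𝓐 → BoundedA′ 𝓐 → BoundedA′ (fillFrom i β 𝓐)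
  bounded-fill i []      𝓐 h = h
  bounded-fill i (b ∷ β) 𝓐 h = bounded-fill (suc i) β (set 𝓐 RND i (bit b)) (set-bound Γ degreeBound input (capped≤ X L I) {𝓐} RND i (bit b) h (bit≤1 b))

  m : ℕ
  m = log K

  m≡ : Sum K (λ i → bit (𝓐₁ P2 i <ᵇ K)) ≡ m
  m≡ = trans (Sum-cong K λ i i<K → cong (λ d → bit (d <ᵇ K)) (Powers2.after-P2 𝓐₀ i (<⇒≤ i<K))) (log-Sum K)

  bitsE : Expr
  bitsE = nE ⊛ mE

  bits≡ : ev bitsE σ₀ 𝓐₁ ≡ n * m
  bits≡ = cong (n *_) m≡

  W : ∀ {t} → Vec Bool t → ℕ → ℕ
  W β v = 1 + suc n * binary m (λ j → bitAt β (v * m + j))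

  E : ℕ
  E = σ₀ 0 * σ₀ 0 * (σ₀ 0 * σ₀ 0)

  E≡ : E ≡ X * X * (X * X)
  E≡ = cong (λ x → x * x * (x * x)) σ₀≡X

  1≤X : 1 ≤ X
  1≤X = <⇒≤ 2≤X

  0<E : 0 < E
  0<E = subst (0 <_) (sym E≡) (*-mono-≤ (*-mono-≤ 1≤X 1≤X) (*-mono-≤ 1≤X 1≤X))

  E-big : n * (suc n * 2 ^ m) < E
  E-big = subst (n * (suc n * 2 ^ m) <_) (trans (solve 1 (λ x → x :* (x :* (x :* x)) := x :* x :* (x :* x)) refl X) (sym E≡))
    (≤-<-trans (*-monoʳ-≤ n (*-mono-≤ n<X (≤-trans (≤-trans (≤-reflexive (sym (doubling-2^ K m ≤-refl))) (doubling-≤ K m)) bound)))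
      (*-monoˡ-< (X * (X * X)) {{>-nonZero (*-mono-≤ 1≤X (*-mono-≤ 1≤X 1≤X))}} n<X))
    where
    n<X : suc n ≤ X
    n<X = ≤-trans (≤-trans (≤-reflexive (+-comm 1 n)) (+-monoʳ-≤ n (s≤s z≤n))) n+8≤X
    bound : 1 + 2 * K ≤ X * X
    bound = ≤-trans (≤-trans (m≤m+n (1 + 2 * K) (4 * n + 63)) (≤-reflexive
              (solve 1 (λ n → con 1 :+ con 2 :* (con 2 :* n) :+ (con 4 :* n :+ con 63) := con 8 :* (n :+ con 8)) refl n)))
            (*-mono-≤ 8≤X n+8≤X)

  open Domination G adjN adj≡ using (adjN-sym; Adj⇒edge; A)
  open Analysis G adjN adj≡ r (input 2) r′≤r enough

  root-cell : ℕ → ℕ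
  root-cell e = (0 * (N + 1) + N) * E + e

  module Decision (W : ℕ → ℕ) (𝓐₅ : Arrays) (result≡ : ∀ e → e < E → 𝓐₅ TBL (root-cell e) ≡₄ labellingsOf W e) where

    candidate : ℕ → ℕ
    candidate e = eqN (e %₀ (n + 1)) (input 4) * (𝓐₅ TBL (root-cell e) %₀ 4)

    positive : T (0 <ᵇ ev answerE σ₀ 𝓐₅) → 1 ∸ input 3 ≢ 0 × Sum E candidate ≢ 0
    positive h = (λ z → <⇒≢ (<ᵇ⇒< 0 _ h) (sym (cong (_* bit (0 <ᵇ Sum E candidate)) z))) ,
      λ z → <⇒≢ (<ᵇ⇒< 0 _ h) (sym (trans (cong (λ s → (1 ∸ input 3) * bit (0 <ᵇ s)) z) (*-zeroʳ (1 ∸ input 3))))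

    found : ∀ x → (∀ v → W v ≡ 1 + suc n * x v) → 1 ∸ input 3 ≢ 0 → (∃ λ e → e < E × candidate e ≢ 0) → ¬ ¬ HasConnectedDominatingSet G r k
    found x W≡ s≢0 (e , e<E , nz) c = sound x e (λ z → nz (trans (cong (eqN (e %₀ (n + 1)) (input 4) *_) (trans (result≡ e e<E) (trans (cong (_% 4) weights≡) z)))
          (*-zeroʳ (eqN (e %₀ (n + 1)) (input 4)))))
        λ cds → c (subst (HasConnectedDominatingSet G r) (sign-magnitude k sign≡ s≢0 abs≡) cds)
      where
      weights≡ : labellingsOf W e ≡ labellingsOf (λ v → 1 + suc n * x v) e
      weights≡ = sumN-cong (suc (input 2)) n λ l _ → cong (λ s → bit (e ≡ᵇ s) * A (at l)) (Sum-cong n λ v _ → cong (bit (at l v <ᵇ 1) *_) (W≡ v))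
      size≡ : input 4 ≡ e % suc n
      size≡ = trans (sym (eqN-≡ (e %₀ (n + 1)) (input 4) λ z → nz (cong (_* (𝓐₅ TBL (root-cell e) %₀ 4)) z))) (%₀-suc e n)
      abs≡ : ℤ.∣ k ∣ ≡ e % suc n
      abs≡ = k⇒ _ (s≤s⁻¹ (m%n<n e (suc n))) size≡

    no-false-positive : ∀ x → (∀ v → W v ≡ 1 + suc n * x v) → T (0 <ᵇ ev answerE σ₀ 𝓐₅) → ¬ ¬ HasConnectedDominatingSet G r k
    no-false-positive x W≡ h = found x W≡ (proj₁ (positive h)) (Sum-nonzero E candidate (proj₂ (positive h)))

    rejected : ∀ D → ConnectedDominating G r D → ℤ.+ ∣ D ∣ ≡ k → T (not (0 <ᵇ ev answerE σ₀ 𝓐₅)) →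
      ∀ e → e < E → e % suc n ≡ ∣ D ∣ → labellingsOf W e ≡₄ 0
    rejected D cd k≡ h e e<E e≡ = trans (sym (result≡ e e<E)) (zero-entry (𝓐₅ TBL (root-cell e) % 4 ≟ 0))
      where
      sign0 : input 3 ≡ 0
      sign0 = trans sign≡ (cong signBit (sym k≡))
      size4 : input 4 ≡ ∣ D ∣
      size4 = k⇐ _ (subst (_≤ n) e≡ (s≤s⁻¹ (m%n<n e (suc n)))) (cong ℤ.∣_∣ (sym k≡))
      zero-entry : Dec (𝓐₅ TBL (root-cell e) % 4 ≡ 0) → 𝓐₅ TBL (root-cell e) % 4 ≡ 0
      zero-entry (yes z) = z
      zero-entry (no nz) = ⊥-elim (subst (T ∘ not) (Equivalence.to T-≡ (<⇒<ᵇ {0} {ev answerE σ₀ 𝓐₅} some)) h)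
        where
        one : candidate e ≢ 0
        one z = nz (trans (sym (+-identityʳ _)) (trans (cong (_* (𝓐₅ TBL (root-cell e) % 4)) (sym (trans (cong₂ eqN (trans (%₀-suc e n) e≡) size4) (eqN-refl ∣ D ∣)))) z))
        some : 0 < (1 ∸ input 3) * bit (0 <ᵇ Sum E candidate)
        some = subst (0 <_) (sym (cong₂ (λ s b → (1 ∸ s) * b) sign0 (bit-< (≤-trans (n≢0⇒n>0 one) (Sum-term E candidate e e<E))))) (s≤s z≤n)

  0<q : 0 < q
  0<q = ≤-trans (m≤n+m 1 (input 2)) (m≤n*m (input 2 + 1) 2)

  open TreeOrder G Tr isTree bagT coversVertex coversEdge connected tadjN bagN tadj≡ bag≡ outside using (Order; module Order; module Step; module Ordered)

  module Decide (W nd pa : ℕ → ℕ) (ordered : Order nd pa N) where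
    open Order ordered
    open Ordered ordered

    nd≤ : ∀ i → i ≤ N → nd i ≤ N
    nd≤ zero    _   = ≤-reflexive root
    nd≤ (suc i) i≤N = <⇒≤ (nd< (suc i) (s≤s z≤n) i≤N)

    distinct : ∀ i j → j < i → i ≤ N → nd j ≢ nd i
    distinct (suc i) zero    _   i≤N e = <⇒≢ (nd< (suc i) (s≤s z≤n) i≤N) (trans (sym e) root)
    distinct i       (suc j) j<i i≤N   = nd-distinct i (suc j) (s≤s z≤n) j<i i≤N

    parent : ∀ i → 1 ≤ i → i ≤ N → ∃ λ j → j < i × pa i ≡ nd j
    parent (suc zero)    _ _   = 0 , s≤s z≤n , trans top (sym root)
    parent (suc (suc i)) _ i≤N = let j , _ , j<i , e = Step.parent (steps (2 + i) (s≤s (s≤s z≤n)) i≤N) in j , j<i , e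

    open Solving.Eliminating X Q 2≤X 1≤Q input (capped≤ X L I) big σ₀ bits refl 0<E W nd pa root nd≤ distinct parent running-intersection outside
      hiding (E; 0<q) public

    edge-covered′ : ∀ u v → u < n → v < n → adjN u v ≢ 0 → ∃ λ j → j ≤ N × bagN (nd j) u ≢ 0 × bagN (nd j) v ≢ 0
    edge-covered′ u v u<n v<n a =
      let j , _ , j≤N , ju , jv = edge-covered ≤-refl {fromℕ< u<n} {fromℕ< v<n}
            (Adj⇒edge (Fin.toℕ<n (fromℕ< u<n) , Fin.toℕ<n (fromℕ< v<n) , λ z → a (trans (cong₂ adjN (sym (Fin.toℕ-fromℕ< u<n)) (sym (Fin.toℕ-fromℕ< v<n))) z)))
      in j , j≤N , subst (λ x → bagN (nd j) x ≢ 0) (Fin.toℕ-fromℕ< u<n) ju , subst (λ x → bagN (nd j) x ≢ 0) (Fin.toℕ-fromℕ< v<n) jv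

    covered′ : ∀ v → v < n → ∃ λ j → j ≤ N × bagN (nd j) v ≢ 0
    covered′ v v<n = let j , _ , j≤N , nz = covered ≤-refl v v<n in j , j≤N , nz

    module C = Counting covered′ edge-covered′ adjN-sym

    module Final (𝓐₃ : Arrays) (ready₃ : Ready 𝓐₃) where

      𝓐₄ 𝓐₅ : Arrays
      𝓐₄ = exec tables σ₀ 𝓐₃
      𝓐₅ = exec solve-all σ₀ 𝓐₄

      ready₄ : Ready 𝓐₄
      ready₄ = Ready-same (C.Tables.same 𝓐₃ ready₃) ready₃

      valid : AdmissibleC (tables ⨾ solve-all) σ₀ 𝓐₃
      valid = admissible-⨾′ (C.Tables.valid 𝓐₃ ready₃) (solve-valid 𝓐₄ ready₄)

      result≡ : ∀ e → e < E → 𝓐₅ TBL (cellN 0 N e) ≡₄ labellingsOf W e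
      result≡ e e<E = trans (solved 𝓐₄ ready₄ e e<E)
        (trans (C.total-count 𝓐₃ ready₃ e e<E) (cong (λ R → sumN R n (λ l → bit (e ≡ᵇ exp W l) * A (at l)) % 4) (+-comm (input 2) 1)))

  module Run (β : Vec Bool (n * m)) where

    𝓑 𝓐₂ 𝓐₃ : Arrays
    𝓑  = fillFrom 0 β 𝓐₁
    𝓐₂ = exec powers σ₀ 𝓑
    𝓐₃ = exec order σ₀ 𝓐₂

    module T = Traversal G Tr isTree bagT coversVertex coversEdge connected tadj≡ bag≡ outside 𝓐₂

    open Decide (W β) (𝓐₃ ND) (𝓐₃ PA) T.after-order using (Ready; weightN; module Final)

    𝓑-P2 : 𝓑 P2 ≡ 𝓐₁ P2
    𝓑-P2 = fillFrom-other 0 β 𝓐₁ P2 λ ()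

    ready₃ : Ready 𝓐₃
    ready₃ = record
      { pow = λ j j≤ → trans (cong-app (frame POW order {σ₀} {𝓐₂} tt) j) (Powers.after-POW 𝓑 refl 0<q j j≤)
      ; wgt = λ v v<n → trans (cong₂ (λ P R → weightN P R v) (earlier P2 tt tt) (earlier RND tt tt)) (weight≡ v v<n)
      ; nds = refl ; pas = refl }
      where
      earlier : ∀ B → T (not (writes B order)) → T (not (writes B powers)) → 𝓐₃ B ≡ 𝓑 B
      earlier B h h′ = trans (frame B order {σ₀} {𝓐₂} h) (frame B powers {σ₀} {𝓑} h′)
      weight≡ : ∀ v → v < n → weightN (𝓑 P2) (𝓑 RND) v ≡ W β v
      weight≡ v v<n = trans (cong (λ P → weightN P (𝓑 RND) v) 𝓑-P2)
        (trans (cong (λ l → 1 + (n + 1) * Sum l (λ j → 𝓑 RND (v * l + j) * 𝓐₁ P2 j)) m≡)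
        (cong₂ (λ a s → 1 + a * s) (+-comm n 1) (Sum-cong m λ j j<m → cong₂ _*_
          (fillFrom-at 0 β 𝓐₁ (v * m + j) (radix-< m v<n j<m))
          (trans (Powers2.after-P2 𝓐₀ j (≤-trans (<⇒≤ j<m) (leastB-≤ _ K))) (doubling-2^ K j (<⇒≤ j<m))))))

    open Final 𝓐₃ ready₃ using (𝓐₅; valid; result≡)
    open Decision (W β) 𝓐₅ result≡ public

    main-valid : AdmissibleC main σ₀ 𝓑
    main-valid = admissible-⨾′ (Powers.valid 𝓑 refl 0<q) (admissible-⨾′ T.valid valid)

  S : ℕ
  S = 𝔹 (costC Δ₀ main) + (𝔹 (cost Δ₀ answerE) + 0)

  solution : Arrays → Arrays
  solution 𝓑 = exec solve-all σ₀ (exec tables σ₀ (exec order σ₀ (exec powers σ₀ 𝓑)))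

  verdict : Arrays → Bool
  verdict 𝓑 = 0 <ᵇ ev answerE σ₀ (solution 𝓑)

  decision : Vec Bool (n * m) → Bool
  decision β = verdict (fillFrom 0 β 𝓐₁)

  finishing : ∀ (β : Vec Bool (n * m)) ρ mem → Vars ρ σ₀ → Rep mem (fillFrom 0 β 𝓐₁) →
    Outcome ⟨ codeC main 0 ++ code answerE 0 , ρ , mem ⟩ 0 (λ _ → decision β) S
  finishing β ρ mem vs rep = after-main (correct main ok-main bounded (Run.main-valid β) ρ (code answerE 0) rep vs)
    where
    𝓑 : Arrays
    𝓑 = fillFrom 0 β 𝓐₁
    bounded : BoundedA′ 𝓑
    bounded = bounded-fill 0 β 𝓐₁ bounded₁
    after-answer : ∀ {ρ₁ m₁} → Result (code answerE 0) [] ρ₁ m₁ 0 σ₀ (λ ρ′ m′ → ρ′ (rT 0) ≡ ev answerE σ₀ (solution 𝓑) × m′ ≡ m₁) (𝔹 (cost Δ₀ answerE)) →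
      Outcome ⟨ code answerE 0 , ρ₁ , m₁ ⟩ 0 (λ _ → decision β) (𝔹 (cost Δ₀ answerE) + 0)
    after-answer {ρ₁} {m₁} (result {ρ₂} {m₂} {t} t≤ run _ _ (e , _)) = weaken (+-monoˡ-≤ 0 t≤)
      (running (subst (λ c → ⟨ c , ρ₁ , m₁ ⟩ ⟶[ t ] ⟨ [] , ρ₂ , m₂ ⟩) (List.++-identityʳ (code answerE 0)) run)
        (halted (cong (0 <ᵇ_) (trans (cong ρ₂ (sym rT0)) e))))
    after-main : Result (codeC main 0) (code answerE 0) ρ mem 0 σ₀ (λ _ m′ → Rep m′ (solution 𝓑)) (𝔹 (costC Δ₀ main)) →
      Outcome ⟨ codeC main 0 ++ code answerE 0 , ρ , mem ⟩ 0 (λ _ → decision β) S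
    after-main (result {ρ₁} t≤ run vs₁ _ rep₁) = weaken (+-monoˡ-≤ _ t≤) (running run (after-answer
      (code-correct answerE ok-answer fit (bounded-exec main (Run.main-valid β) bounded) rep₁ 0 ρ₁ [] vs₁)))

  bits≤ : n * m ≤ 𝔹 (deg Δ₀ bitsE)
  bits≤ = subst (_≤ 𝔹 (deg Δ₀ bitsE)) bits≡ (ev-bound Γ degreeBound input (capped≤ X L I) bitsE {Δ₀} {σ₀} {𝓐₁} (Fit.bnd fit) bounded₁)

  drawn : ∀ ρ mem → Vars ρ σ₀ → ρ (rT 0) ≡ n * m → Rep mem 𝓐₁ →
    Outcome ⟨ codeDraw ++ codeC main 0 ++ code answerE 0 , ρ , mem ⟩ (n * m) decision (1 + (n * m * 11 + (2 + S)))
  drawn ρ mem vs e rep = drawing (n * m) σ₀ good (σ₀-rest 6) verdict S (codeC main 0 ++ code answerE 0)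
    (fits-< (deg Δ₀ bitsE) fits-bits bits≤)
    (λ i i< → cell-fits RND (deg Δ₀ bitsE) good (Fit.L≤ fit) fits-RND (≤-trans (<⇒≤ i<) bits≤))
    𝓐₁ ρ mem vs e rep finishing

  d₁ d₂ d₃ d₄ d₅ timeD : Deg
  d₁ = litD 2 ⊞ (costC Δ₀ main ⊞ cost Δ₀ answerE)
  d₂ = deg Δ₀ bitsE ⊠ litD 11 ⊞ d₁
  d₃ = litD 1 ⊞ d₂
  d₄ = cost Δ₀ bitsE ⊞ d₃
  d₅ = costC Δ₀ powersOf2 ⊞ d₄
  timeD = litD 13 ⊞ d₅

  time : ℕ
  time = 13 + (𝔹 (costC Δ₀ powersOf2) + (𝔹 (cost Δ₀ bitsE) + (1 + (n * m * 11 + (2 + S)))))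

  outcome : Outcome ⟨ program , (λ _ → 0) , I ⟩ (n * m) decision time
  outcome = running (start-run _) (after-powers (codeC-correct powersOf2 ok-powersOf2 fit bounded₀ (Powers2.valid 𝓐₀) 0 r₁₃ κ₁ rep₀ (λ _ → refl)))
    where
    κ₁ κ₂ : List Cmd
    κ₂ = codeDraw ++ codeC main 0 ++ code answerE 0
    κ₁ = code bitsE 0 ++ κ₂
    after-bits : ∀ {ρ₁ m₁} → Rep m₁ 𝓐₁ → Result (code bitsE 0) κ₂ ρ₁ m₁ 0 σ₀ (λ ρ′ m′ → ρ′ (rT 0) ≡ ev bitsE σ₀ 𝓐₁ × m′ ≡ m₁) (𝔹 (cost Δ₀ bitsE)) →
      Outcome ⟨ κ₁ , ρ₁ , m₁ ⟩ (n * m) decision (𝔹 (cost Δ₀ bitsE) + (1 + (n * m * 11 + (2 + S))))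
    after-bits rep (result {ρ₂} t≤ run vs _ (e , refl)) = weaken (+-monoˡ-≤ _ t≤) (running run (drawn ρ₂ _ vs (trans e bits≡) rep))
    after-powers : Result (codeC powersOf2 0) κ₁ r₁₃ I 0 σ₀ (λ _ m′ → Rep m′ 𝓐₁) (𝔹 (costC Δ₀ powersOf2)) →
      Outcome ⟨ codeC powersOf2 0 ++ κ₁ , r₁₃ , I ⟩ (n * m) decision (𝔹 (costC Δ₀ powersOf2) + (𝔹 (cost Δ₀ bitsE) + (1 + (n * m * 11 + (2 + S)))))
    after-powers (result {ρ₁} t≤ run vs _ rep) = weaken (+-monoˡ-≤ _ t≤) (running run (after-bits rep
      (code-correct bitsE ok-bits fit bounded₁ rep 0 ρ₁ κ₂ vs)))

  time≤ : time ≤ X ^ degreeBound * Q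
  time≤ = ≤-trans bound (≤-trans (𝔹-mono {proj₁ timeD} {degreeBound} {proj₂ timeD} {1} (≤ᵇ⇒≤ (proj₁ timeD) degreeBound tt) (≤ᵇ⇒≤ (proj₂ timeD) 1 tt))
    (≤-reflexive (cong (X ^ degreeBound *_) (*-identityʳ Q))))
    where
    bound : time ≤ 𝔹 timeD
    bound = 𝔹-⊞ (litD 13) d₅ (𝔹-lit 13) (𝔹-⊞ (costC Δ₀ powersOf2) d₄ ≤-refl (𝔹-⊞ (cost Δ₀ bitsE) d₃ ≤-refl (𝔹-⊞ (litD 1) d₂ (𝔹-lit 1)
      (𝔹-⊞ (deg Δ₀ bitsE ⊠ litD 11) d₁ (𝔹-⊠ (deg Δ₀ bitsE) (litD 11) bits≤ (𝔹-lit 11)) (𝔹-⊞ (litD 2) (costC Δ₀ main ⊞ cost Δ₀ answerE) (𝔹-lit 2)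
        (𝔹-⊞ (costC Δ₀ main) (cost Δ₀ answerE) ≤-refl (≤-reflexive (+-identityʳ _))))))))

  decision-sound : ∀ β → T (decision β) → ¬ ¬ HasConnectedDominatingSet G r k
  decision-sound β = Run.no-false-positive β (λ v → binary m (λ j → bitAt β (v * m + j))) (λ _ → refl)

  decision-complete : HasConnectedDominatingSet G r k → 2 * count (n * m) (not ∘ decision) ≤ 2 ^ (n * m)
  decision-complete (D , cd , k≡) = Complete.complete D cd m E E-big (≤-trans (≤-reflexive (*-comm n 2)) (log-upper K)) (not ∘ decision)
    λ β h e e<E e≡ → Run.rejected β D cd k≡ h e e<E e≡

Conclusion : ∀ (w X L : ℕ) (I : ℕ → ℕ) {n : ℕ} (G : Graph n) (r : ℕ) (k : ℤ) → Set
Conclusion w X L I G r k = ∃ λ b → Σ[ f ∈ (Vec Bool b → Bool) ]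
  Outcomes.Outcome w ⟨ program , (λ _ → 0) , I ⟩ b f (X ^ degreeBound * tableSize (capped X L I)) ×
  (∀ β → T (f β) → ¬ ¬ HasConnectedDominatingSet G r k) ×
  (HasConnectedDominatingSet G r k → 2 * count b (not ∘ f) ≤ 2 ^ b)

core : ∀ {w X L I n N r k} (G : Graph n) → n ≡ capped X L I 0 → N ≡ capped X L I 1 →
  Setting w X L I n N G r k → Conclusion w X L I G r k
core {w} {X} {L} {I} {r = r} {k} G refl refl s = _ , C.decision , Outcomes.weaken w C.time≤ C.outcome , C.decision-sound , C.decision-complete
  where module C = Core w X L I G r k s

∣∣-Sum : ∀ {n} (D : Subset n) f → (∀ v → f (toℕ v) ≡ bit (Vec.lookup D v)) → Sum n f ≡ ∣ D ∣
∣∣-Sum []          f h = refl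
∣∣-Sum {suc n} (true  ∷ D) f h = trans (Sum-shift n f) (cong₂ _+_ (h Fin.zero) (∣∣-Sum D (f ∘ suc) (h ∘ Fin.suc)))
∣∣-Sum {suc n} (false ∷ D) f h = trans (Sum-shift n f) (cong₂ _+_ (h Fin.zero) (∣∣-Sum D (f ∘ suc) (h ∘ Fin.suc)))

≤-foldr : ∀ {n} (f : Fin n → ℕ) i → f i ≤ Vector.foldr _⊔_ 0 f
≤-foldr f Fin.zero    = m≤m⊔n _ _
≤-foldr f (Fin.suc i) = ≤-trans (≤-foldr (f ∘ Fin.suc) i) (m≤n⊔m (f Fin.zero) _)

Sum-bit≤ : ∀ n M (p : ℕ → Bool) → (∀ j → M ≤ j → ¬ T (p j)) → Sum n (bit ∘ p) ≤ M
Sum-bit≤ zero    M p h = z≤n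
Sum-bit≤ (suc n) M p h with <-≤-connex n M
... | inj₁ n<M = ≤-trans (Bounds.Sum-bound 2 1 ≤-refl ≤-refl (suc n) λ i _ → bit≤1 (p i)) (≤-trans (≤-reflexive (*-identityʳ (suc n))) n<M)
... | inj₂ M≤n with p n in pn
...   | true  = ⊥-elim (h n M≤n (subst T (sym pn) tt))
...   | false = ≤-trans (≤-reflexive (+-identityʳ _)) (Sum-bit≤ n M p h)

^-distribʳ-* : ∀ o a b → (a * b) ^ o ≡ a ^ o * b ^ o
^-distribʳ-* zero    a b = refl
^-distribʳ-* (suc o) a b = trans (cong (a * b *_) (^-distribʳ-* o a b)) ([m*n]*[o*p]≡[m*o]*[n*p] a b (a ^ o) (b ^ o))

opaque
  exponentC : ℕ
  exponentC = 9 ^ degreeBound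

  9^≤C : 9 ^ degreeBound ≤ exponentC
  9^≤C = ≤-refl

  degreeBound≤C : degreeBound ≤ exponentC
  degreeBound≤C = ≤ᵇ⇒≤ degreeBound (9 ^ degreeBound) tt

module Final {n : ℕ} (G : Graph n) (𝒯 : TreeDecomposition G) (r : ℕ) (k : ℤ) where
  open Encoded G 𝒯 r k hiding (N)

  N X L : ℕ
  N = nodes 𝒯
  X = n + N + 8
  L = inputLength

  input : ℕ → ℕ
  input = capped X L I

  n≤X : n ≤ X
  n≤X = ≤-trans (m≤m+n n N) (m≤m+n (n + N) 8)

  N≤X : N ≤ X
  N≤X = ≤-trans (m≤n+m N n) (m≤m+n (n + N) 8)

  1≤X : 1 ≤ X
  1≤X = ≤-trans (s≤s z≤n) (m≤n+m 8 (n + N))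

  early : ∀ i {_ : T (i <ᵇ 5)} → i < L
  early i {h} = <-≤-trans (<ᵇ⇒< i 5 h) (m≤m+n 5 (n * n + (N * N + N * n)))

  input-0 : input 0 ≡ n
  input-0 = capped-small X L I 0 (early 0) n≤X

  input-1 : input 1 ≡ N
  input-1 = capped-small X L I 1 (early 1) N≤X

  input-bit : ∀ i → i < L → 5 ≤ i → input i ≡ I i
  input-bit i i<L 5≤i = capped-small X L I i i<L (≤-trans (I-bits i 5≤i) 1≤X)

  adj≡ : ∀ u v → input (5 + (toℕ u * n + toℕ v)) ≡ bit (adj G u v)
  adj≡ u v = trans (input-bit _ (s≤s (s≤s (s≤s (s≤s (s≤s (<-≤-trans (position< u v) (m≤m+n (n * n) (N * N + N * n)))))))) (m≤m+n 5 (toℕ u * n + toℕ v))) (I-adj u v)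

  tadj≡ : ∀ s t → input (5 + (n * n + (toℕ s * N + toℕ t))) ≡ bit (adj (tree 𝒯) s t)
  tadj≡ s t = trans (input-bit _ (s≤s (s≤s (s≤s (s≤s (s≤s (+-monoʳ-< (n * n) (<-≤-trans (position< s t) (m≤m+n (N * N) (N * n))))))))) (m≤m+n 5 _)) (I-tadj s t)

  bag≡ : ∀ t v → input (5 + (n * n + (N * N + (toℕ t * n + toℕ v)))) ≡ bit (Vec.lookup (bag 𝒯 t) v)
  bag≡ t v = trans (input-bit _ (s≤s (s≤s (s≤s (s≤s (s≤s (+-monoʳ-< (n * n) (+-monoʳ-< (N * N) (position< t v)))))))) (m≤m+n 5 _)) (I-bag t v)

  I-2 : I 2 ≡ r
  I-2 = I≡ 2

  I-3 : I 3 ≡ signBit k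
  I-3 = I≡ 3

  I-4 : I 4 ≡ ℤ.∣ k ∣
  I-4 = I≡ 4

  sign≤1 : ∀ k → signBit k ≤ 1
  sign≤1 (ℤ.+ _)  = z≤n
  sign≤1 -[1+ _ ] = ≤-refl

  sign≡ : input 3 ≡ signBit k
  sign≡ = trans (capped-small X L I 3 (early 3) (≤-trans (≤-reflexive I-3) (≤-trans (sign≤1 k) 1≤X))) I-3

  k⇐ : ∀ d → d ≤ n → ℤ.∣ k ∣ ≡ d → input 4 ≡ d
  k⇐ d d≤n e = trans (capped-small X L I 4 (early 4) (≤-trans (≤-reflexive (trans I-4 e)) (≤-trans d≤n n≤X))) (trans I-4 e)

  k⇒ : ∀ d → d ≤ n → input 4 ≡ d → ℤ.∣ k ∣ ≡ d
  k⇒ d d≤n e with ≤-total (I 4) X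
  ... | inj₁ h = trans (sym I-4) (trans (sym (capped-small X L I 4 (early 4) h)) e)
  ... | inj₂ h = ⊥-elim (<⇒≱ (≤-trans (s≤s (m≤m+n n N)) (≤-trans (≤-reflexive (+-comm 1 (n + N))) (+-monoʳ-≤ (n + N) (s≤s z≤n))))
      (≤-trans (capped-≥ X L I 4 (early 4) ≤-refl h) (≤-trans (≤-reflexive e) d≤n)))

  enough : ∀ d → d ≤ r → d < n → d ≤ input 2
  enough d d≤r d<n = capped-≥ X L I 2 (early 2) (≤-trans (<⇒≤ d<n) n≤X) (≤-trans d≤r (≤-reflexive (sym I-2)))

  r′≤r : input 2 ≤ r
  r′≤r = ≤-trans (capped≤I X L I 2) (≤-reflexive I-2)

  bag-size : ∀ t → Sum n (λ v → input (5 + (n * n + (N * N + (toℕ t * n + v))))) ≤ width 𝒯 + 1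
  bag-size t = ≤-trans (≤-reflexive (∣∣-Sum (bag 𝒯 t) _ (bag≡ t))) (≤-trans (≤-foldr (λ t → ∣ bag 𝒯 t ∣) t) (∸1+1 _))
    where
    ∸1+1 : ∀ x → x ≤ x ∸ 1 + 1
    ∸1+1 zero    = z≤n
    ∸1+1 (suc x) = ≤-reflexive (+-comm 1 x)

  maxBag≤ : maxBagOf input ≤ width 𝒯 + 1
  maxBag≤ = subst₂ (λ a b → Sum a (λ j → bit (0 <ᵇ Sum b (λ t → bit (j <ᵇ Sum a (λ v → input (5 + (a * a + (b * b + (t * a + v))))))))) ≤ width 𝒯 + 1)
    (sym input-0) (sym input-1) (Sum-bit≤ n (width 𝒯 + 1) _ λ j j≥ h → <⇒≢ (<ᵇ⇒< 0 _ h) (sym (Sum-0 N λ t t<N → bit-≥ (≤-trans (small t t<N) j≥))))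
    where
    small : ∀ t → t < N → Sum n (λ v → input (5 + (n * n + (N * N + (t * n + v))))) ≤ width 𝒯 + 1
    small t t<N = subst (λ t → Sum n (λ v → input (5 + (n * n + (N * N + (t * n + v))))) ≤ width 𝒯 + 1) (Fin.toℕ-fromℕ< t<N) (bag-size (fromℕ< t<N))

  tableSize≤ : tableSize input ≤ (2 * r + 2) ^ (width 𝒯 + 1)
  tableSize≤ = ≤-trans (^-monoˡ-≤ (maxBagOf input) (≤-trans (*-monoʳ-≤ 2 (+-monoˡ-≤ 1 r′≤r)) (≤-reflexive (*-distribˡ-+ 2 r 1))))
    (^-monoʳ-≤ (2 * r + 2) {{>-nonZero (≤-trans (s≤s z≤n) (m≤n+m 2 (2 * r)))}} maxBag≤)

  time≤ : X ^ degreeBound * tableSize input ≤ timeBound exponentC n N r (width 𝒯)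
  time≤ = *-mono-≤ (begin
    X ^ degreeBound                                  ≤⟨ ^-monoˡ-≤ degreeBound X≤ ⟩
    (9 * (n + N)) ^ degreeBound                      ≡⟨ ^-distribʳ-* degreeBound 9 (n + N) ⟩
    9 ^ degreeBound * (n + N) ^ degreeBound          ≤⟨ *-mono-≤ 9^≤C (^-monoʳ-≤ (n + N) {{>-nonZero 1≤n+N}} degreeBound≤C) ⟩
    exponentC * (n + N) ^ exponentC                  ∎) tableSize≤
    where
    open ≤-Reasoning
    1≤n+N : 1 ≤ n + N
    1≤n+N = ≤-trans (proj₁ (TreeDecomposition.isTree 𝒯)) (m≤n+m N n)
    X≤ : X ≤ 9 * (n + N)
    X≤ = +-monoʳ-≤ (n + N) (*-monoʳ-≤ 8 1≤n+N)

  setting : ∀ w → X ^ degreeBound * tableSize input < 2 ^ w → Setting w X L I n N G r k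
  setting w fits = record
    { Tr = tree 𝒯 ; isTree = TreeDecomposition.isTree 𝒯 ; bagT = bag 𝒯
    ; coversVertex = TreeDecomposition.coversVertex 𝒯 ; coversEdge = TreeDecomposition.coversEdge 𝒯 ; connected = TreeDecomposition.connected 𝒯
    ; adj≡ = adj≡ ; tadj≡ = tadj≡ ; bag≡ = bag≡
    ; outside = λ v _ → capped-out X L I _ (+-monoʳ-≤ 5 (+-monoʳ-≤ (n * n) (+-monoʳ-≤ (N * N) (m≤m+n (N * n) v))))
    ; bits = λ i 5≤i → ≤-trans (capped≤I X L I i) (I-bits i 5≤i)
    ; r′≤r = r′≤r ; enough = enough ; sign≡ = sign≡ ; k⇒ = k⇒ ; k⇐ = k⇐
    ; I0 = refl ; I1 = refl ; X≡ = refl ; L≡ = refl ; I-out = I-out ; D-fits = fits }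

  module Machines (w : ℕ) (enough-bits : timeBound exponentC n N r (width 𝒯) < 2 ^ w) where
    open Machine w using (run)

    t : ℕ
    t = timeBound exponentC n N r (width 𝒯)

    conclusion : Conclusion w X L I G r k
    conclusion = core G (sym input-0) (sym input-1) (setting w (≤-<-trans time≤ enough-bits))

    biased : ∀ (c : Conclusion w X L I G r k) → TrueBiasedMonteCarlo program w (encode G 𝒯 r k) t (HasConnectedDominatingSet G r k)
    biased (b , f , outcome , sound , complete) = record
      { halts           = λ ω → let β , eq = O.halts t time≤ ω in f β , eq
      ; noFalsePositive = λ ¬Q ω yes≡ → let β , eq = O.halts t time≤ ω in
          sound β (Equivalence.from T-≡ (just-injective (trans (sym eq) yes≡))) ¬Q
      ; falseNegative   = λ q → *-cancelʳ-≤ _ _ (2 ^ b) {{m^n≢0 2 b}} (begin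
          2 * count t no-answer * 2 ^ b        ≡⟨ *-assoc 2 (count t no-answer) (2 ^ b) ⟩
          2 * (count t no-answer * 2 ^ b)      ≡⟨ cong (2 *_) (O.counts t time≤) ⟩
          2 * (2 ^ t * count b (not ∘ f))      ≡⟨ solve 2 (λ p c → con 2 :* (p :* c) := p :* (con 2 :* c)) refl (2 ^ t) (count b (not ∘ f)) ⟩
          2 ^ t * (2 * count b (not ∘ f))      ≤⟨ *-monoʳ-≤ (2 ^ t) (complete q) ⟩
          2 ^ t * 2 ^ b                        ∎) }
      where
      open ≤-Reasoning
      module O = Outcomes.Outcome outcome
      no-answer : Vec Bool t → Bool
      no-answer ω = saysNo (run program (encode G 𝒯 r k) ω)

theorem3 : ∃ λ (P : Program) → ∃ λ (C : ℕ) →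
    ∀ (r : ℕ) (k : ℤ) (n : ℕ) (G : Graph n) (tw : ℕ) (𝒯 : TreeDecomposition G) →
    1 ≤ r → IsTreewidth G tw → width 𝒯 ≡ tw →
    let t = timeBound C n (nodes 𝒯) r tw in
    ∀ (w : ℕ) → WordsSuffice w t k →
    TrueBiasedMonteCarlo P w (encode G 𝒯 r k) t (HasConnectedDominatingSet G r k)
theorem3 = program , exponentC , λ { r k n G _ 𝒯 _ _ refl w (t<2^w , _) →
  Final.Machines.biased G 𝒯 r k w t<2^w (Final.Machines.conclusion G 𝒯 r k w t<2^w) }
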